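{- Let $G$ be a finite simple graph that is claw-free (it has no induced subgraph isomorphic to $K_{1,3}$) and subcubic (every vertex has degree at most $3$). If no connected component of $G$ is isomorphic to the triangular prism, then $\chi'_s(G)\le 7$.
   Context: Two distinct edges $e,e'$ of a graph are at distance $1$ if they share an end vertex, and at distance $2$ if they are not adjacent but both are adjacent to a common edge. For a positive integer $k$, a strong $k$-edge-coloring of $G$ is a map $\phi:E(G)\to\{1,\dots,k\}$ such that $\phi(e)\ne\phi(e')$ whenever $e,e'$ are at distance $1$ or $2$. The strong chromatic index $\chi'_s(G)$ is the least $k$ for which $G$ has a strong $k$-edge-coloring. The triangular prism ($3$-prism) is the cubic graph on $6$ vertices consisting of two disjoint triangles $a_1a_2a_3$ and $b_1b_2b_3$ together with the edges $a_1b_1,a_2b_2,a_3b_3$. -}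

module Defs where

open import Data.Nat using (ℕ; zero; suc; _+_; _≤_; _<_)
open import Data.Nat.DivMod using (_%_)
open import Data.Fin using (Fin; toℕ)
import Data.Fin as F
open import Data.Bool using (Bool; true; false; if_then_else_; _∧_; _∨_; not)
open import Data.Product using (Σ; ∃; _×_; _,_; proj₁; proj₂)
open import Data.Sum using (_⊎_)
open import Relation.Binary.PropositionalEquality using (_≡_; _≢_)
open import Relation.Nullary using (¬_; does)
import Data.Nat as N

record SimpleGraph (n : ℕ) : Set where
  field
    adj    : Fin n → Fin n → Bool
    sym    : ∀ u v → adj u v ≡ adj v u
    irrefl : ∀ v → adj v v ≡ false
open SimpleGraph public

Adj : ∀ {n} → SimpleGraph n → Fin n → Fin n → Set
Adj G u v = adj G u v ≡ true

sumFin : ∀ n → (Fin n → ℕ) → ℕ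
sumFin zero    f = 0
sumFin (suc n) f = f F.zero + sumFin n (λ i → f (F.suc i))

degree : ∀ {n} → SimpleGraph n → Fin n → ℕ
degree {n} G v = sumFin n (λ w → if adj G v w then 1 else 0)

Subcubic : ∀ {n} → SimpleGraph n → Set
Subcubic {n} G = ∀ v → degree G v ≤ 3

InducedClaw : ∀ {n} → SimpleGraph n → Fin n → Fin n → Fin n → Fin n → Set
InducedClaw G c x y z =
  Adj G c x × Adj G c y × Adj G c z ×
  x ≢ y × x ≢ z × y ≢ z ×
  ¬ Adj G x y × ¬ Adj G x z × ¬ Adj G y z

ClawFree : ∀ {n} → SimpleGraph n → Set
ClawFree {n} G = ∀ (c x y z : Fin n) → ¬ InducedClaw G c x y z

record Edge {n : ℕ} (G : SimpleGraph n) : Set where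
  constructor edge
  field
    u   : Fin n
    v   : Fin n
    u<v : toℕ u < toℕ v
    uv  : Adj G u v
open Edge public

Incident : ∀ {n} {G : SimpleGraph n} → Fin n → Edge G → Set
Incident w e = (w ≡ u e) ⊎ (w ≡ v e)

DistinctEdges : ∀ {n} {G : SimpleGraph n} → Edge G → Edge G → Set
DistinctEdges e e' = ¬ ((u e ≡ u e') × (v e ≡ v e'))

SharesEnd : ∀ {n} {G : SimpleGraph n} → Edge G → Edge G → Set
SharesEnd e e' = ∃ λ w → Incident w e × Incident w e'

Dist1 : ∀ {n} {G : SimpleGraph n} → Edge G → Edge G → Set
Dist1 e e' = DistinctEdges e e' × SharesEnd e e'

Dist2 : ∀ {n} {G : SimpleGraph n} → Edge G → Edge G → Set
Dist2 {G = G} e e' =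
  DistinctEdges e e' × ¬ SharesEnd e e' ×
  Σ (Edge G) λ f → Dist1 e f × Dist1 e' f

StrongEdgeColoring : ∀ {n} (G : SimpleGraph n) (k : ℕ) → (Edge G → Fin k) → Set
StrongEdgeColoring G k φ =
  ∀ (e e' : Edge G) → (Dist1 e e' ⊎ Dist2 e e') → φ e ≢ φ e'

StrongChromaticIndexAtMost : ∀ {n} → SimpleGraph n → ℕ → Set
StrongChromaticIndexAtMost G k = Σ (Edge G → Fin k) λ φ → StrongEdgeColoring G k φ

data Reach {n} (G : SimpleGraph n) (v : Fin n) : Fin n → Set where
  here : Reach G v v
  step : ∀ {w x} → Reach G v w → Adj G w x → Reach G v x

-- The triangular prism on Fin 6: a_i = i, b_i = i + 3 (i = 0,1,2).
prismAdj : Fin 6 → Fin 6 → Bool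
prismAdj i j =
  let si = does (toℕ i N.<? 3)
      sj = does (toℕ j N.<? 3)
      sameSide = (si ∧ sj) ∨ (not si ∧ not sj)
  in (sameSide ∧ not (does (toℕ i N.≟ toℕ j)))
     ∨ (not sameSide ∧ does ((toℕ i % 3) N.≟ (toℕ j % 3)))

ComponentIsPrism : ∀ {n} → SimpleGraph n → Fin n → Set
ComponentIsPrism {n} G v =
  Σ (Fin 6 → Fin n) λ f →
    (∀ i j → f i ≡ f j → i ≡ j) ×
    (∀ w → Reach G v w → ∃ λ i → f i ≡ w) ×
    (∀ i → Reach G v (f i)) ×
    (∀ i j → adj G (f i) (f j) ≡ prismAdj i j)

{-# OPTIONS --safe #-}
module Submission where

-- Induction on the number of non-isolated vertices, over claw-free subcubic graphs that contain no
-- triangular prism.  A vertex of degree at most 2, a diamond, two triangles linked by two edges, or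
-- three pairwise linked triangles are removed, and the colouring of the smaller graph (possibly with
-- two outer neighbours joined by a new edge) is extended.  Otherwise every vertex lies in exactly one
-- triangle, and an edge leaves each corner.  Take a triangle abc with links from b and c to triangles
-- u₁u₂u₃ and w₁w₂w₃.  Delete these three triangles, except a, and join the outer neighbours of u₁ and
-- u₂, and those of w₁ and w₂.  In a strong colouring of the result the colours at the two ends of a
-- joining edge are disjoint; giving that edge's colour to one of the two links it replaces leaves
-- enough freedom in each outer triangle, and what remains is a finite problem on seven colours,
-- solved by search.

open import Defs
open import Data.Nat using (ℕ; zero; suc; _≤_; _<_; s≤s)
import Data.Nat as ℕ
import Data.Nat.Properties as ℕ
open import Data.Nat.Induction using (<-wellFounded)
open import Induction.WellFounded using (Acc; acc)
open import Data.Bool using (Bool; true; false; _∧_; if_then_else_)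
import Data.Bool as Bool
open import Data.Bool.Properties using (¬-not)
open import Data.Fin using (Fin; zero; suc; toℕ; _≟_; #_)
import Data.Fin.Properties as Fin
open import Data.Fin.Permutation.Components using (transpose; transpose-inverse)
open import Data.List using (List; []; _∷_; length; lookup; filter; allFin; map)
open import Data.List.Properties using (filter-notAll; length-map)
open import Data.List.Membership.Propositional using (_∈_)
open import Data.List.Membership.Propositional.Properties using (∈-allFin; ∈-filter⁺; ∈-map⁺; ∈-lookup)
open import Data.List.Relation.Unary.All using (All; []; _∷_; all?)
import Data.List.Relation.Unary.All as All
open import Data.List.Relation.Unary.All.Properties using (¬All⇒Any¬)
open import Data.List.Relation.Unary.Any using (Any; here; there; index)
import Data.List.Relation.Unary.Any as Any
open import Data.List.Relation.Unary.Any.Properties using (lookup-index)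
open import Data.List.Relation.Unary.AllPairs using (AllPairs; []; _∷_)
open import Data.Maybe using (Maybe; just; nothing)
open import Data.Product using (∃; _×_; _,_; proj₁; proj₂)
open import Data.Sum using (_⊎_; inj₁; inj₂; [_,_]′; swap)
open import Data.Empty using (⊥; ⊥-elim)
open import Function using (_∘_; id)
open import Relation.Nullary using (¬_; Dec; yes; no; does; _because_; contradiction)
open import Relation.Nullary.Reflects using (Reflects; ofʸ; ofⁿ)
open import Relation.Nullary.Decidable using (¬?; True; toWitness; decidable-stable; _×-dec_; _⊎-dec_; _→-dec_; map′)
open import Relation.Binary.PropositionalEquality using (_≡_; _≢_; refl; trans; cong; cong₂; subst; subst₂; ≢-sym) renaming (sym to ≡-sym)

-- When no reduction applies, a triangle edge sees nine other edges and a link sees ten, so seven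
-- colours can be enough only if many of the colours seen coincide or can be steered. The two
-- joining edges serve this purpose: they tell which colours around an outer triangle differ from
-- each other, and so leave a real choice inside it.
--
-- The price is that an added edge may complete a prism. The nine edges of a prism are pairwise
-- within distance 2, so it needs nine colours and the induction would break down. A prism without
-- one of its links is a pair of triangles linked by two edges; hence joining two vertices is safe
-- where no such pair exists. The second joining edge needs the same after the first has been added,
-- and the first could create such a pair only out of three pairwise linked triangles. This is why
-- both configurations are removed beforehand.

Color : Set
Color = Fin 7

Distinct : List Color → Set
Distinct = AllPairs _≢_

pick-fresh : (xs : List Color) → length xs < 7 → ∃ λ k → All (k ≢_) xs
pick-fresh xs short with Fin.any? (λ k → all? (λ x → ¬? (k ≟ x)) xs)
... | yes found = found
... | no none = contradiction (trans (lookup-index (at i)) (trans (cong (lookup xs) same) (≡-sym (lookup-index (at j))))) (Fin.<⇒≢ i<j)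
  where
    at : ∀ k → Any (k ≡_) xs
    at k = Any.map (λ {x} → decidable-stable (k ≟ x)) (¬All⇒Any¬ (λ x → ¬? (k ≟ x)) xs (λ all → none (k , all)))
    clash = Fin.pigeonhole short (λ k → index (at k))
    i = proj₁ clash
    j = proj₁ (proj₂ clash)
    i<j = proj₁ (proj₂ (proj₂ clash))
    same = proj₂ (proj₂ (proj₂ clash))

fresh : (xs : List Color) {short : True (length xs ℕ.<? 7)} → ∃ λ k → All (k ≢_) xs
fresh xs {short} = pick-fresh xs (toWitness short)

-- Graphs and strong colourings

-- All graphs of the induction live on the same `Fin n`: deleting a vertex only isolates it, so
-- nothing is renumbered and colourings of the smaller and the larger graph have the same type.
-- Adjacency is a decidable proposition because deletions, joins and cuts are described by
-- conjunctions, disjunctions and negations.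
record Graph (n : ℕ) : Set₁ where
  field
    _∼_   : Fin n → Fin n → Set
    ∼-sym : ∀ {u v} → u ∼ v → v ∼ u
    ∼-irr : ∀ {v} → ¬ v ∼ v
    _∼?_  : ∀ u v → Dec (u ∼ v)

open Graph

_∋_∼_ : ∀ {n} → Graph n → Fin n → Fin n → Set
G ∋ u ∼ v = Graph._∼_ G u v

∼⇒≢ : ∀ {n} (G : Graph n) {u v} → G ∋ u ∼ v → u ≢ v
∼⇒≢ G u∼v refl = ∼-irr G u∼v

-- A record instead of a bare function type, so that both graphs can be inferred from a proof of
-- inclusion.
record _⊑_ {n} (H G : Graph n) : Set where
  constructor incl
  field
    sub : ∀ {u v} → H ∋ u ∼ v → G ∋ u ∼ v

open _⊑_ public

module Coloring {n : ℕ} where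

  private
    V = Fin n

  del : Graph n → V → Graph n
  del G x = record
    { _∼_   = λ u v → G ∋ u ∼ v × u ≢ x × v ≢ x
    ; ∼-sym = λ (uv , u≢x , v≢x) → ∼-sym G uv , v≢x , u≢x
    ; ∼-irr = λ (vv , _) → ∼-irr G vv
    ; _∼?_  = λ u v → _∼?_ G u v ×-dec ¬? (u ≟ x) ×-dec ¬? (v ≟ x)
    }

  join : Graph n → (p q : V) → p ≢ q → Graph n
  join G p q p≢q = record
    { _∼_   = λ u v → G ∋ u ∼ v ⊎ (u ≡ p × v ≡ q) ⊎ (u ≡ q × v ≡ p)
    ; ∼-sym = λ where
        (inj₁ uv) → inj₁ (∼-sym G uv)
        (inj₂ (inj₁ (a , b))) → inj₂ (inj₂ (b , a))
        (inj₂ (inj₂ (a , b))) → inj₂ (inj₁ (b , a))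
    ; ∼-irr = λ where
        (inj₁ vv) → ∼-irr G vv
        (inj₂ (inj₁ (refl , q≡))) → p≢q q≡
        (inj₂ (inj₂ (refl , p≡))) → p≢q (≡-sym p≡)
    ; _∼?_  = λ u v → _∼?_ G u v ⊎-dec ((u ≟ p) ×-dec (v ≟ q)) ⊎-dec ((u ≟ q) ×-dec (v ≟ p))
    }

  -- Every ordered pair of vertices has a colour, arbitrary at non-edges; thus `c` needs no proofs
  -- of adjacency as arguments. `joined` treats two edges at the two ends of a third one; if `a ≡ b`
  -- they also share an end, and up to symmetry it repeats `incident`.
  record Strong (G : Graph n) (c : V → V → Color) : Set where
    field
      symm     : ∀ u v → c u v ≡ c v u
      incident : ∀ {u a b} → G ∋ u ∼ a → G ∋ u ∼ b → a ≢ b → c u a ≢ c u b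
      joined   : ∀ {u v a b} → G ∋ u ∼ v → G ∋ u ∼ a → G ∋ v ∼ b → a ≢ v → b ≢ u → c u a ≢ c v b

  open Strong public

  Colorable : Graph n → Set
  Colorable G = ∃ (Strong G)

  Strong-⊑ : ∀ {H G c} → H ⊑ G → Strong G c → Strong H c
  Strong-⊑ h s = record
    { symm = symm s
    ; incident = λ ua ub → incident s (sub h ua) (sub h ub)
    ; joined = λ uv ua vb → joined s (sub h uv) (sub h ua) (sub h vb) }

  Unused : Graph n → (V → V → Color) → V → Color → Set
  Unused G c w k = ∀ {b} → G ∋ w ∼ b → c w b ≢ k

  -- An edge at `y` is also an edge at a neighbour of `y`, so this covers everything that a new
  -- pendant edge at `y` would see.
  Free : Graph n → (V → V → Color) → V → Color → Set
  Free G c y k = ∀ {w} → G ∋ y ∼ w → Unused G c w k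

  abstract

    -- Opaque and used only through the equations below; otherwise nested extensions would unfold
    -- into large case distinctions.
    extend : V → (V → Color) → (V → V → Color) → V → V → Color
    extend x l c u v with u ≟ x | v ≟ x
    ... | yes _ | _     = l v
    ... | no _  | yes _ = l u
    ... | no _  | no _  = c u v

    extend-new : ∀ x l c v → extend x l c x v ≡ l v
    extend-new x l c v with x ≟ x
    ... | yes _  = refl
    ... | no x≢x = contradiction refl x≢x

    extend-old : ∀ x l c {u v} → u ≢ x → v ≢ x → extend x l c u v ≡ c u v
    extend-old x l c {u} {v} u≢x v≢x with u ≟ x | v ≟ x
    ... | yes u≡x | _       = contradiction u≡x u≢x
    ... | no _    | yes v≡x = contradiction v≡x v≢x
    ... | no _    | no _    = refl

    extend-sym : ∀ x l c → (∀ u v → c u v ≡ c v u) → ∀ u v → extend x l c u v ≡ extend x l c v u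
    extend-sym x l c s u v with u ≟ x | v ≟ x
    ... | yes refl | yes refl = refl
    ... | yes _ | no _  = refl
    ... | no _  | yes _ = refl
    ... | no _  | no _  = s u v

    extend-new′ : ∀ x l c {v} → v ≢ x → extend x l c v x ≡ l v
    extend-new′ x l c {v} v≢x with v ≟ x | x ≟ x
    ... | yes v≡x | _      = contradiction v≡x v≢x
    ... | no _    | yes _  = refl
    ... | no _    | no x≢x = contradiction refl x≢x

  module _ (G : Graph n) (x : V) {l : V → Color} {c : V → V → Color} where

    unused-new : ∀ {k} → (∀ {y} → G ∋ x ∼ y → l y ≢ k) → Unused G (extend x l c) x k
    unused-new h xb e = h xb (trans (≡-sym (extend-new x l c _)) e)

    unused-old : ∀ {w k} → w ≢ x → Unused (del G x) c w k → (G ∋ x ∼ w → l w ≢ k) → Unused G (extend x l c) w k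
    unused-old {w} w≢x un h {b} wb e with b ≟ x
    ... | yes refl = h (∼-sym G wb) (trans (≡-sym (extend-new′ x l c w≢x)) e)
    ... | no b≢x   = un (wb , w≢x , b≢x) (trans (≡-sym (extend-old x l c w≢x b≢x)) e)

    -- The three conditions sort what a new edge `x y` sees: the other new edges, the old edges at
    -- neighbours of `y`, and the old edges at another neighbour `z` of `x`.
    addVertex : Strong (del G x) c →
      (∀ {y z} → G ∋ x ∼ y → G ∋ x ∼ z → y ≢ z → l y ≢ l z) →
      (∀ {y} → G ∋ x ∼ y → Free (del G x) c y (l y)) →
      (∀ {y z} → G ∋ x ∼ y → G ∋ x ∼ z → y ≢ z → Unused (del G x) c z (l y)) →
      Strong G (extend x l c)
    addVertex s distinct free unused = record { symm = sy ; incident = inc ; joined = jn }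
      where
        c′ = extend x l c
        sy = extend-sym x l c (symm s)
        new = extend-new x l c
        new′ : ∀ {v} → v ≢ x → c′ v x ≡ l v
        new′ = extend-new′ x l c
        old : ∀ {u v} → u ≢ x → v ≢ x → c′ u v ≡ c u v
        old = extend-old x l c
        via : ∀ {p q p′ q′ : Color} → p ≡ p′ → q ≡ q′ → p′ ≢ q′ → p ≢ q
        via refl refl ne = ne

        inc : ∀ {u a b} → G ∋ u ∼ a → G ∋ u ∼ b → a ≢ b → c′ u a ≢ c′ u b
        inc {u} {a} {b} ua ub a≢b with u ≟ x
        ... | yes refl = via (new a) (new b) (distinct ua ub a≢b)
        ... | no u≢x with a ≟ x | b ≟ x
        ... | yes refl | yes refl = contradiction refl a≢b
        ... | yes refl | no b≢x = λ e → free (∼-sym G ua) (ub , u≢x , b≢x) (∼-sym G ub , b≢x , u≢x) (trans (symm s _ _) (trans (≡-sym (old u≢x b≢x)) (trans (≡-sym e) (new′ u≢x))))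
        ... | no a≢x | yes refl = λ e → free (∼-sym G ub) (ua , u≢x , a≢x) (∼-sym G ua , a≢x , u≢x) (trans (symm s _ _) (trans (≡-sym (old u≢x a≢x)) (trans e (new′ u≢x))))
        ... | no a≢x | no b≢x = via (old u≢x a≢x) (old u≢x b≢x) (incident s (ua , u≢x , a≢x) (ub , u≢x , b≢x) a≢b)

        -- In `half` the middle edge is new, so one of the two outer edges is new as well. In `far`
        -- the middle edge is old and one or both of the outer edges are new.
        half : ∀ {v a b} → G ∋ x ∼ v → G ∋ x ∼ a → G ∋ v ∼ b → a ≢ v → b ≢ x → c′ x a ≢ c′ v b
        half {v} {a} {b} xv xa vb a≢v b≢x e =
          unused xa xv a≢v (vb , v≢x , b≢x) (trans (≡-sym (old v≢x b≢x)) (trans (≡-sym e) (new a)))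
          where v≢x = λ v≡x → ∼⇒≢ G xv (≡-sym v≡x)

        far : ∀ {u v b} → u ≢ x → v ≢ x → G ∋ u ∼ v → G ∋ u ∼ x → G ∋ v ∼ b → b ≢ u → c′ u x ≢ c′ v b
        far {u} {v} {b} u≢x v≢x uv ux vb b≢u e with b ≟ x
        ... | yes refl = distinct (∼-sym G ux) (∼-sym G vb) (∼⇒≢ G uv) (trans (≡-sym (new′ u≢x)) (trans e (new′ v≢x)))
        ... | no b≢x = free (∼-sym G ux) (uv , u≢x , v≢x) (vb , v≢x , b≢x) (trans (≡-sym (old v≢x b≢x)) (trans (≡-sym e) (new′ u≢x)))

        jn : ∀ {u v a b} → G ∋ u ∼ v → G ∋ u ∼ a → G ∋ v ∼ b → a ≢ v → b ≢ u → c′ u a ≢ c′ v b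
        jn {u} {v} {a} {b} uv ua vb a≢v b≢u = go (u ≟ x) (v ≟ x) (a ≟ x) (b ≟ x)
          where
            go : Dec (u ≡ x) → Dec (v ≡ x) → Dec (a ≡ x) → Dec (b ≡ x) → c′ u a ≢ c′ v b
            go (yes refl) _ _ _ = half uv ua vb a≢v b≢u
            go (no _) (yes refl) _ _ = half (∼-sym G uv) vb ua b≢u a≢v ∘ ≡-sym
            go (no u≢x) (no v≢x) (yes refl) _ = far u≢x v≢x uv ua vb b≢u
            go (no u≢x) (no v≢x) (no _) (yes refl) = far v≢x u≢x (∼-sym G uv) vb ua a≢v ∘ ≡-sym
            go (no u≢x) (no v≢x) (no a≢x) (no b≢x) =
              via (old u≢x a≢x) (old v≢x b≢x) (joined s (uv , u≢x , v≢x) (ua , u≢x , a≢x) (vb , v≢x , b≢x) a≢v b≢u)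

open Coloring

-- Inserting a triangle at a pendant edge

module Insertion {n : ℕ} where

  private
    V = Fin n

  del² : Graph n → V → V → Graph n
  del² G x y = del (del G x) y

  -- What is asked of the outer neighbour `w` of a corner: `leg` is the colour meant for the edge
  -- from `w` to the corner, and `s`, `t` are meant for the two triangle edges at that corner, which
  -- the edges at `w` will see.
  record Addable (K : Graph n) (c : V → V → Color) (w : V) (leg s t : Color) : Set where
    constructor addable
    field
      leg-free : Free K c w leg
      unused₁  : Unused K c w s
      unused₂  : Unused K c w t

  -- In the intended situation the triangle a b d is a new one; its corner a is already present
  -- with its pendant edge of colour la, while lb and ld colour the third edges at b and d.
  -- When such an edge is missing its colour is a placeholder for an edge to be added later.
  record AddPair (G : Graph n) (a b d : V) (c : V → V → Color) (x y z la lb ld : Color) : Set where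
    field
      coloring : V → V → Color
      strong   : Strong G coloring
      at-a     : ∀ {k} → k ≢ la → k ≢ x → k ≢ y → Unused G coloring a k
      at-b     : ∀ {k} → k ≢ lb → k ≢ x → k ≢ z → Unused G coloring b k
      at-d     : ∀ {k} → k ≢ ld → k ≢ y → k ≢ z → Unused G coloring d k
      at-old   : ∀ {w k} → w ≢ a → w ≢ b → w ≢ d → Unused (del² G d b) c w k →
                 (G ∋ b ∼ w → k ≢ lb) → (G ∋ d ∼ w → k ≢ ld) → Unused G coloring w k
      keeps    : ∀ {u v} → u ≢ b → u ≢ d → v ≢ b → v ≢ d → coloring u v ≡ c u v

  module _ (G : Graph n) {a b d : V} {c : V → V → Color} {x y z la lb ld : Color} where

    -- Three triangle edges and three edges leaving the corners are pairwise within distance 2,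
    -- hence six distinct colours. The vertices `b′` and `d′` only ensure that `b` and `d` have at
    -- most one outer neighbour each; where there is none, the third alternative never arises and
    -- any vertex will do.
    PairRule : Set
    PairRule = G ∋ a ∼ b → G ∋ a ∼ d → G ∋ b ∼ d → Strong (del² G d b) c →
      ∀ b′ d′ → Distinct (x ∷ y ∷ z ∷ la ∷ lb ∷ ld ∷ []) →
      (∀ {w} → del² G d b ∋ a ∼ w → c a w ≡ la × Unused (del² G d b) c w x × Unused (del² G d b) c w y) →
      (∀ {w} → G ∋ b ∼ w → w ≡ a ⊎ w ≡ d ⊎ (w ≡ b′ × Addable (del² G d b) c w lb x z)) →
      (∀ {w} → G ∋ d ∼ w → w ≡ a ⊎ w ≡ b ⊎ (w ≡ d′ × Addable (del² G d b) c w ld y z)) →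
      AddPair G a b d c x y z la lb ld

    private
     buildPair : PairRule
     buildPair ab ad bd s b′ d′
       ((x≢y ∷ x≢z ∷ x≢la ∷ x≢lb ∷ x≢ld ∷ []) ∷ (y≢z ∷ y≢la ∷ y≢lb ∷ y≢ld ∷ []) ∷ (z≢la ∷ z≢lb ∷ z≢ld ∷ []) ∷ (la≢lb ∷ la≢ld ∷ []) ∷ (lb≢ld ∷ []) ∷ [] ∷ [])
       nbA nbB nbD = record
         { coloring = c₂
         ; strong = strong₂
         ; at-a = λ ka kx ky → unused-old G d a≢d (atA₁ ka kx) λ _ e → ky (≡-sym (trans (≡-sym ly) e))
         ; at-b = λ kb kx kz → unused-old G d b≢d (atB₁ kb kx) λ _ e → kz (≡-sym (trans (≡-sym lz) e))
         ; at-d = λ kd ky kz → unused-new G d λ dw → l₂≢ dw (≢-sym ky) (≢-sym kz) (≢-sym kd)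
         ; at-old = λ w≢a w≢b w≢d un hb hd →
             unused-old G d w≢d (unused-old G₁ b w≢b un λ (bw , _) → λ e → hb bw (≡-sym (trans (≡-sym (l₁-leg w≢a)) e)))
               λ dw e → hd dw (≡-sym (trans (≡-sym (l₂-leg w≢a w≢b)) e))
         ; keeps = λ u≢b u≢d v≢b v≢d → trans (extend-old d l₂ c₁ u≢d v≢d) (extend-old b l₁ c u≢b v≢b)
         }
       where
         G₁ = del G d
         K = del² G d b
         a≢b = ∼⇒≢ G ab
         a≢d = ∼⇒≢ G ad
         b≢d = ∼⇒≢ G bd

         l₁ l₂ : V → Color
         l₁ w with w ≟ a
         ... | yes _ = x
         ... | no _  = lb
         l₂ w with w ≟ a | w ≟ b
         ... | yes _ | _     = y
         ... | no _  | yes _ = z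
         ... | no _  | no _  = ld
         c₁ = extend b l₁ c
         c₂ = extend d l₂ c₁

         lx : l₁ a ≡ x
         lx with a ≟ a
         ... | yes _ = refl
         ... | no a≢a = contradiction refl a≢a
         l₁-leg : ∀ {w} → w ≢ a → l₁ w ≡ lb
         l₁-leg {w} w≢a with w ≟ a
         ... | yes w≡a = contradiction w≡a w≢a
         ... | no _ = refl
         ly : l₂ a ≡ y
         ly with a ≟ a
         ... | yes _ = refl
         ... | no a≢a = contradiction refl a≢a
         lz : l₂ b ≡ z
         lz with b ≟ a | b ≟ b
         ... | yes b≡a | _ = contradiction (≡-sym b≡a) a≢b
         ... | no _ | yes _ = refl
         ... | no _ | no b≢b = contradiction refl b≢b
         l₂-leg : ∀ {w} → w ≢ a → w ≢ b → l₂ w ≡ ld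
         l₂-leg {w} w≢a w≢b with w ≟ a | w ≟ b
         ... | yes w≡a | _ = contradiction w≡a w≢a
         ... | no _ | yes w≡b = contradiction w≡b w≢b
         ... | no _ | no _ = refl

         data NbB : V → Set where
           isA : NbB a
           leg : ∀ {w} → w ≢ a → w ≢ d → w ≡ b′ → Addable K c w lb x z → NbB w
         data NbD : V → Set where
           isA : NbD a
           isB : NbD b
           leg : ∀ {w} → w ≢ a → w ≢ b → w ≡ d′ → Addable K c w ld y z → NbD w

         viewB : ∀ {w} → G₁ ∋ b ∼ w → NbB w
         viewB {w} (bw , _ , w≢d) with w ≟ a | nbB bw
         ... | yes refl | _ = isA
         ... | no w≢a | inj₁ w≡a = contradiction w≡a w≢a
         ... | no w≢a | inj₂ (inj₁ w≡d) = contradiction w≡d w≢d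
         ... | no w≢a | inj₂ (inj₂ (w≡b′ , add)) = leg w≢a w≢d w≡b′ add
         viewD : ∀ {w} → G ∋ d ∼ w → NbD w
         viewD {w} dw with w ≟ a | w ≟ b | nbD dw
         ... | yes refl | _ | _ = isA
         ... | no _ | yes refl | _ = isB
         ... | no w≢a | no _ | inj₁ w≡a = contradiction w≡a w≢a
         ... | no _ | no w≢b | inj₂ (inj₁ w≡b) = contradiction w≡b w≢b
         ... | no w≢a | no w≢b | inj₂ (inj₂ (w≡d′ , add)) = leg w≢a w≢b w≡d′ add

         l₁≢ : ∀ {w k} → G₁ ∋ b ∼ w → x ≢ k → lb ≢ k → l₁ w ≢ k
         l₁≢ bw xk lk with viewB bw
         ... | isA = λ e → xk (trans (≡-sym lx) e)
         ... | leg w≢a _ _ _ = λ e → lk (trans (≡-sym (l₁-leg w≢a)) e)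
         l₂≢ : ∀ {w k} → G ∋ d ∼ w → y ≢ k → z ≢ k → ld ≢ k → l₂ w ≢ k
         l₂≢ dw yk zk lk with viewD dw
         ... | isA = λ e → yk (trans (≡-sym ly) e)
         ... | isB = λ e → zk (trans (≡-sym lz) e)
         ... | leg w≢a w≢b _ _ = λ e → lk (trans (≡-sym (l₂-leg w≢a w≢b)) e)

         unusedK-a : ∀ {k} → k ≢ la → Unused K c a k
         unusedK-a k≢la aw e = k≢la (trans (≡-sym e) (proj₁ (nbA aw)))

         -- The vertex `b` is put back while `d` is still isolated; `strong₂` then puts back `d` and
         -- with it the other two sides of the triangle.
         strong₁ : Strong G₁ c₁
         strong₁ = addVertex G₁ b s dis fr un
           where
             dis : ∀ {v w} → G₁ ∋ b ∼ v → G₁ ∋ b ∼ w → v ≢ w → l₁ v ≢ l₁ w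
             dis bv bw v≢w with viewB bv | viewB bw
             ... | isA | isA = contradiction refl v≢w
             ... | isA | leg w≢a _ _ _ = λ e → x≢lb (trans (≡-sym lx) (trans e (l₁-leg w≢a)))
             ... | leg v≢a _ _ _ | isA = λ e → x≢lb (≡-sym (trans (≡-sym (l₁-leg v≢a)) (trans e lx)))
             ... | leg _ _ refl _ | leg _ _ refl _ = contradiction refl v≢w
             fr : ∀ {v} → G₁ ∋ b ∼ v → Free K c v (l₁ v)
             fr bv with viewB bv
             ... | isA = subst (Free K c a) (≡-sym lx) (λ aw → proj₁ (proj₂ (nbA aw)))
             ... | leg v≢a _ _ add = subst (Free K c _) (≡-sym (l₁-leg v≢a)) (Addable.leg-free add)
             un : ∀ {v w} → G₁ ∋ b ∼ v → G₁ ∋ b ∼ w → v ≢ w → Unused K c w (l₁ v)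
             un bv bw v≢w with viewB bv | viewB bw
             ... | isA | isA = contradiction refl v≢w
             ... | isA | leg _ _ _ add = subst (Unused K c _) (≡-sym lx) (Addable.unused₁ add)
             ... | leg v≢a _ _ _ | isA = subst (Unused K c _) (≡-sym (l₁-leg v≢a)) (unusedK-a (≢-sym la≢lb))
             ... | leg _ _ refl _ | leg _ _ refl _ = contradiction refl v≢w

         atA₁ : ∀ {k} → k ≢ la → k ≢ x → Unused G₁ c₁ a k
         atA₁ ka kx = unused-old G₁ b a≢b (unusedK-a ka) λ _ e → kx (≡-sym (trans (≡-sym lx) e))
         atB₁ : ∀ {k} → k ≢ lb → k ≢ x → Unused G₁ c₁ b k
         atB₁ kb kx = unused-new G₁ b λ bw → l₁≢ bw (≢-sym kx) (≢-sym kb)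
         atLeg₁ : ∀ {w k} → w ≢ b → Unused K c w k → x ≢ k → lb ≢ k → Unused G₁ c₁ w k
         atLeg₁ w≢b un xk lk = unused-old G₁ b w≢b un λ bw → l₁≢ bw xk lk

         strong₂ : Strong G c₂
         strong₂ = addVertex G d strong₁ dis fr un
           where
             dis : ∀ {v w} → G ∋ d ∼ v → G ∋ d ∼ w → v ≢ w → l₂ v ≢ l₂ w
             dis dv dw v≢w with viewD dv | viewD dw
             ... | isA | isA = contradiction refl v≢w
             ... | isA | isB = λ e → y≢z (trans (≡-sym ly) (trans e lz))
             ... | isA | leg wa wb _ _ = λ e → y≢ld (trans (≡-sym ly) (trans e (l₂-leg wa wb)))
             ... | isB | isA = λ e → y≢z (≡-sym (trans (≡-sym lz) (trans e ly)))
             ... | isB | isB = contradiction refl v≢w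
             ... | isB | leg wa wb _ _ = λ e → z≢ld (trans (≡-sym lz) (trans e (l₂-leg wa wb)))
             ... | leg wa wb _ _ | isA = λ e → y≢ld (≡-sym (trans (≡-sym (l₂-leg wa wb)) (trans e ly)))
             ... | leg wa wb _ _ | isB = λ e → z≢ld (≡-sym (trans (≡-sym (l₂-leg wa wb)) (trans e lz)))
             ... | leg _ _ refl _ | leg _ _ refl _ = contradiction refl v≢w
             fr : ∀ {v} → G ∋ d ∼ v → Free G₁ c₁ v (l₂ v)
             fr dv with viewD dv
             ... | isA = subst (Free G₁ c₁ a) (≡-sym ly) freeA
               where
                 freeA : Free G₁ c₁ a y
                 freeA {w} aw@(_ , _ , w≢d) with w ≟ b
                 ... | yes refl = atB₁ y≢lb (≢-sym x≢y)
                 ... | no w≢b = atLeg₁ w≢b (proj₂ (proj₂ (nbA (aw , a≢b , w≢b)))) x≢y (≢-sym y≢lb)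
             ... | isB = subst (Free G₁ c₁ b) (≡-sym lz) freeB
               where
                 freeB : Free G₁ c₁ b z
                 freeB bw with viewB bw
                 ... | isA = atA₁ z≢la (≢-sym x≢z)
                 ... | leg _ _ _ add = atLeg₁ (≢-sym (∼⇒≢ G₁ bw)) (Addable.unused₂ add) x≢z (≢-sym z≢lb)
             ... | leg {v} wa wb _ add = subst (Free G₁ c₁ _) (≡-sym (l₂-leg wa wb)) freeL
               where
                 freeL : Free G₁ c₁ v ld
                 freeL {w} vw with w ≟ b
                 ... | yes refl = atB₁ (≢-sym lb≢ld) (≢-sym x≢ld)
                 ... | no w≢b = atLeg₁ w≢b (Addable.leg-free add (vw , wb , w≢b)) x≢ld lb≢ld
             un : ∀ {v w} → G ∋ d ∼ v → G ∋ d ∼ w → v ≢ w → Unused G₁ c₁ w (l₂ v)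
             un dv dw v≢w with viewD dv | viewD dw
             ... | isA | isA = contradiction refl v≢w
             ... | isA | isB = subst (Unused G₁ c₁ _) (≡-sym ly) (atB₁ y≢lb (≢-sym x≢y))
             ... | isA | leg wa wb _ add = subst (Unused G₁ c₁ _) (≡-sym ly) (atLeg₁ wb (Addable.unused₁ add) x≢y (≢-sym y≢lb))
             ... | isB | isA = subst (Unused G₁ c₁ _) (≡-sym lz) (atA₁ z≢la (≢-sym x≢z))
             ... | isB | isB = contradiction refl v≢w
             ... | isB | leg wa wb _ add = subst (Unused G₁ c₁ _) (≡-sym lz) (atLeg₁ wb (Addable.unused₂ add) x≢z (≢-sym z≢lb))
             ... | leg wa wb _ _ | isA = subst (Unused G₁ c₁ _) (≡-sym (l₂-leg wa wb)) (atA₁ (≢-sym la≢ld) (≢-sym x≢ld))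
             ... | leg wa wb _ _ | isB = subst (Unused G₁ c₁ _) (≡-sym (l₂-leg wa wb)) (atB₁ (≢-sym lb≢ld) (≢-sym x≢ld))
             ... | leg _ _ refl _ | leg _ _ refl _ = contradiction refl v≢w

    abstract
      addPair : PairRule
      addPair = buildPair

open Insertion

-- Good graphs, their neighbourhoods, and joining two vertices

module _ {n : ℕ} where

  private
    V = Fin n

  addPendant : ∀ (G : Graph n) {x y c k} → (∀ {w} → G ∋ x ∼ w → w ≡ y) →
    Strong (del G x) c → Free (del G x) c y k → Strong G (extend x (λ _ → k) c)
  addPendant G {x} {y} {c} {k} nb s free = addVertex G x s
    (λ xv xw v≢w → contradiction (trans (nb xv) (≡-sym (nb xw))) v≢w)
    (λ {v} xv → subst (λ w → Free (del G x) c w k) (≡-sym (nb xv)) free)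
    (λ xv xw v≢w → contradiction (trans (nb xv) (≡-sym (nb xw))) v≢w)

  Triangle : Graph n → V → V → V → Set
  Triangle G a b c = G ∋ a ∼ b × G ∋ a ∼ c × G ∋ b ∼ c

  Disjoint : List V → List V → Set
  Disjoint xs ys = All (λ x → All (x ≢_) ys) xs

  -- A prism in which the link `a₁ a₂` is left open: it may or may not be an edge.
  DoubleLink : Graph n → V → V → V → V → V → V → Set
  DoubleLink G a₁ b₁ c₁ a₂ b₂ c₂ =
    Triangle G a₁ b₁ c₁ × Triangle G a₂ b₂ c₂ × G ∋ b₁ ∼ b₂ × G ∋ c₁ ∼ c₂ ×
    Disjoint (a₁ ∷ b₁ ∷ c₁ ∷ []) (a₂ ∷ b₂ ∷ c₂ ∷ [])

  NoDoubleLink : Graph n → Set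
  NoDoubleLink G = ∀ {a₁ b₁ c₁ a₂ b₂ c₂} → ¬ DoubleLink G a₁ b₁ c₁ a₂ b₂ c₂

  DoubleLink-⊑ : ∀ {H G a₁ b₁ c₁ a₂ b₂ c₂} → H ⊑ G → DoubleLink H a₁ b₁ c₁ a₂ b₂ c₂ → DoubleLink G a₁ b₁ c₁ a₂ b₂ c₂
  DoubleLink-⊑ (incl h) ((ab , ac , bc) , (ab′ , ac′ , bc′) , bb , cc , dis) =
    (h ab , h ac , h bc) , (h ab′ , h ac′ , h bc′) , h bb , h cc , dis

  NoDoubleLink-⊑ : ∀ {H G} → H ⊑ G → NoDoubleLink G → NoDoubleLink H
  NoDoubleLink-⊑ {H} {G} h none dl = none (DoubleLink-⊑ {H} {G} h dl)

  del-⊑ : ∀ (G : Graph n) x → del G x ⊑ G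
  del-⊑ G x = incl proj₁

  ⊑-trans : ∀ {F G H : Graph n} → F ⊑ G → G ⊑ H → F ⊑ H
  ⊑-trans (incl f) (incl g) = incl (g ∘ f)

  -- The three vertices may repeat or fail to be neighbours. In this form the bound passes to
  -- subgraphs without any counting.
  record Subcubic′ (G : Graph n) : Set where
    constructor cover-by
    field
      cover : ∀ v → ∃ λ x → ∃ λ y → ∃ λ z → ∀ {w} → G ∋ v ∼ w → w ≡ x ⊎ w ≡ y ⊎ w ≡ z

  open Subcubic′ public

  -- Prisms are excluded as subgraphs instead of as components. In a subcubic graph a prism has no
  -- edge to spare and fills its component, so this amounts to the same, and it passes to subgraphs
  -- at once.
  record Good (G : Graph n) : Set where
    field
      clawFree : ∀ {c x y z} → G ∋ c ∼ x → G ∋ c ∼ y → G ∋ c ∼ z → x ≢ y → x ≢ z → y ≢ z →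
                 G ∋ x ∼ y ⊎ G ∋ x ∼ z ⊎ G ∋ y ∼ z
      subcubic : Subcubic′ G
      noPrism  : ∀ {a₁ b₁ c₁ a₂ b₂ c₂} → DoubleLink G a₁ b₁ c₁ a₂ b₂ c₂ → ¬ G ∋ a₁ ∼ a₂

  open Good public

  Good-del : ∀ {G} → Good G → ∀ x → Good (del G x)
  Good-del {G} g x = record
    { clawFree = λ { (cx , _ , x≢) (cy , _ , y≢) (cz , _ , z≢) xy xz yz → [ (λ e → inj₁ (e , x≢ , y≢)) , (λ r → inj₂ ([ (λ e → inj₁ (e , x≢ , z≢)) , (λ e → inj₂ (e , y≢ , z≢)) ]′ r)) ]′ (clawFree g cx cy cz xy xz yz) }
    ; subcubic = cover-by λ v → let (a , b , c , h) = cover (subcubic g) v in a , b , c , λ (vw , _) → h vw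
    ; noPrism = λ dl (aa , _) → noPrism g (DoubleLink-⊑ (del-⊑ G x) dl) aa
    }

  module _ {G : Graph n} (cv : Subcubic′ G) where

    nbrs₁ : ∀ {v a} → G ∋ v ∼ a → ∃ λ e → ∃ λ f → ∀ {w} → G ∋ v ∼ w → w ≡ a ⊎ w ≡ e ⊎ w ≡ f
    nbrs₁ {v} va with cover cv v
    ... | x , y , z , h with h va
    ... | inj₁ refl = y , z , h
    ... | inj₂ (inj₁ refl) = x , z , λ vw → [ inj₂ ∘ inj₁ , [ inj₁ , inj₂ ∘ inj₂ ]′ ]′ (h vw)
    ... | inj₂ (inj₂ refl) = x , y , λ vw → [ inj₂ ∘ inj₁ , [ inj₂ ∘ inj₂ , inj₁ ]′ ]′ (h vw)

    nbrs₂ : ∀ {v a b} → G ∋ v ∼ a → G ∋ v ∼ b → a ≢ b → ∃ λ e → ∀ {w} → G ∋ v ∼ w → w ≡ a ⊎ w ≡ b ⊎ w ≡ e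
    nbrs₂ va vb a≢b with nbrs₁ va
    ... | e , f , h with h vb
    ... | inj₁ refl = contradiction refl a≢b
    ... | inj₂ (inj₁ refl) = f , h
    ... | inj₂ (inj₂ refl) = e , λ vw → [ inj₁ , [ inj₂ ∘ inj₂ , inj₂ ∘ inj₁ ]′ ]′ (h vw)

    nbrs₃ : ∀ {v a b e} → G ∋ v ∼ a → G ∋ v ∼ b → G ∋ v ∼ e → a ≢ b → a ≢ e → b ≢ e →
      ∀ {w} → G ∋ v ∼ w → w ≡ a ⊎ w ≡ b ⊎ w ≡ e
    nbrs₃ va vb ve a≢b a≢e b≢e with nbrs₂ va vb a≢b
    ... | e , h with h ve
    ... | inj₁ refl = contradiction refl a≢e
    ... | inj₂ (inj₁ refl) = contradiction refl b≢e
    ... | inj₂ (inj₂ refl) = h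

    noFour : ∀ {v a b e f} → G ∋ v ∼ a → G ∋ v ∼ b → G ∋ v ∼ e → G ∋ v ∼ f →
      a ≢ b → a ≢ e → a ≢ f → b ≢ e → b ≢ f → e ≢ f → ⊥
    noFour va vb ve vf ab ae af be bf ef with nbrs₃ va vb ve ab ae be vf
    ... | inj₁ refl = af refl
    ... | inj₂ (inj₁ refl) = bf refl
    ... | inj₂ (inj₂ refl) = ef refl

  module _ {G : Graph n} (g : Good G) where

    others-adjacent : ∀ {v p s t} → G ∋ v ∼ p → G ∋ v ∼ s → G ∋ v ∼ t → p ≢ s → p ≢ t → s ≢ t →
      ¬ G ∋ p ∼ s → ¬ G ∋ p ∼ t → G ∋ s ∼ t
    others-adjacent vp vs vt ps pt st ¬ps ¬pt with clawFree g vp vs vt ps pt st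
    ... | inj₁ e = contradiction e ¬ps
    ... | inj₂ (inj₁ e) = contradiction e ¬pt
    ... | inj₂ (inj₂ e) = e

    -- In `one` the vertex `r` need not be a neighbour, so that a vertex without edges in `K` falls
    -- under it too.
    data Rest (K : Graph n) (p v : V) : Set where
      one : ∀ r → (∀ {w} → K ∋ v ∼ w → w ≡ r) → Rest K p v
      two : ∀ {s t} → G ∋ v ∼ s → G ∋ v ∼ t → s ≢ p → t ≢ p → s ≢ t →
        (∀ {w} → K ∋ v ∼ w → w ≡ s ⊎ w ≡ t) → Rest K p v

    rest : ∀ {K p v} → K ⊑ G → G ∋ v ∼ p → ¬ K ∋ v ∼ p → Rest K p v
    rest {K} {p} {v} K⊑G vp ¬vp with nbrs₁ (subcubic g) vp
    ... | s , t , hv = decide (_∼?_ G v s) (_∼?_ G v t) (s ≟ t) (s ≟ p) (t ≟ p)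
      where
        hK : ∀ {w} → K ∋ v ∼ w → w ≡ s ⊎ w ≡ t
        hK vw with hv (sub K⊑G vw)
        ... | inj₁ refl = contradiction vw ¬vp
        ... | inj₂ r = r
        drop-s : (∀ {w} → K ∋ v ∼ w → w ≡ s → w ≡ t) → Rest K p v
        drop-s f = one t λ vw → [ f vw , id ]′ (hK vw)
        drop-t : (∀ {w} → K ∋ v ∼ w → w ≡ t → w ≡ s) → Rest K p v
        drop-t f = one s λ vw → [ id , f vw ]′ (hK vw)
        decide : Dec (G ∋ v ∼ s) → Dec (G ∋ v ∼ t) → Dec (s ≡ t) → Dec (s ≡ p) → Dec (t ≡ p) → Rest K p v
        decide (no ¬vs) _ _ _ _ = drop-s λ where vw refl → contradiction (sub K⊑G vw) ¬vs
        decide _ (no ¬vt) _ _ _ = drop-t λ where vw refl → contradiction (sub K⊑G vw) ¬vt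
        decide _ _ (yes refl) _ _ = drop-s λ _ → id
        decide _ _ _ (yes refl) _ = drop-s λ where vw refl → contradiction vw ¬vp
        decide _ _ _ _ (yes refl) = drop-t λ where vw refl → contradiction vw ¬vp
        decide (yes vs) (yes vt) (no s≢t) (no s≢p) (no t≢p) = two vs vt s≢p t≢p s≢t hK

    -- Beyond v, an edge p v lying in no triangle sees at most five edges at distance at most 2.
    legColors : ∀ {K p v c} → K ⊑ G → (∀ u w → c u w ≡ c w u) → G ∋ v ∼ p → ¬ K ∋ v ∼ p →
      (∀ {s} → G ∋ v ∼ s → ¬ G ∋ p ∼ s) →
      ∃ λ k₁ → ∃ λ k₂ → ∃ λ k₃ → ∃ λ k₄ → ∃ λ k₅ →
        ∀ {k} → All (k ≢_) (k₁ ∷ k₂ ∷ k₃ ∷ k₄ ∷ k₅ ∷ []) → Free K c v k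
    legColors {K} {p} {v} {c} K⊑G csym vp ¬vp away with rest K⊑G vp ¬vp
    ... | two {s} {t} vs vt s≢p t≢p s≢t hv = c v s , c v t , c s t , c s s⁺ , c t t⁺ , free
      where
        -- Claw-freeness closes the triangle `v s t`; then only `s⁺` and `t⁺` lie outside it, and
        -- the edges seen are five.
        st = others-adjacent vp vs vt (≢-sym s≢p) (≢-sym t≢p) s≢t (away vs) (away vt)
        S = nbrs₂ (subcubic g) (∼-sym G vs) st (∼⇒≢ G vt)
        T = nbrs₂ (subcubic g) (∼-sym G vt) (∼-sym G st) (∼⇒≢ G vs)
        s⁺ = proj₁ S
        t⁺ = proj₁ T
        free : ∀ {k} → All (k ≢_) (c v s ∷ c v t ∷ c s t ∷ c s s⁺ ∷ c t t⁺ ∷ []) → Free K c v k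
        free (k₁ ∷ k₂ ∷ k₃ ∷ k₄ ∷ k₅ ∷ []) vw wb e with hv vw
        ... | inj₁ refl with proj₂ S (sub K⊑G wb)
        ...   | inj₁ refl = k₁ (trans (≡-sym e) (csym _ _))
        ...   | inj₂ (inj₁ refl) = k₃ (≡-sym e)
        ...   | inj₂ (inj₂ refl) = k₄ (≡-sym e)
        free (k₁ ∷ k₂ ∷ k₃ ∷ k₄ ∷ k₅ ∷ []) vw wb e | inj₂ refl with proj₂ T (sub K⊑G wb)
        ...   | inj₁ refl = k₂ (trans (≡-sym e) (csym _ _))
        ...   | inj₂ (inj₁ refl) = k₃ (trans (≡-sym e) (csym _ _))
        ...   | inj₂ (inj₂ refl) = k₅ (≡-sym e)
    ... | one r hv with _∼?_ K v r
    -- Here `v` has no edge in `K`, every colour is free, and the five entries are padding.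
    ... | no ¬vr = k , k , k , k , k , λ _ vw → contradiction (subst (λ z → K ∋ v ∼ z) (hv vw) vw) ¬vr
      where k = c v r
    ... | yes vr = c v r , c r e , c r f , c v r , c v r , free
      where
        R = nbrs₁ (subcubic g) (sub K⊑G (∼-sym K vr))
        e = proj₁ R
        f = proj₁ (proj₂ R)
        free : ∀ {k} → All (k ≢_) (c v r ∷ c r e ∷ c r f ∷ c v r ∷ c v r ∷ []) → Free K c v k
        free (k₁ ∷ k₂ ∷ k₃ ∷ _) vw wb eq with hv vw
        ... | refl with proj₂ (proj₂ R) (sub K⊑G wb)
        ...   | inj₁ refl = k₁ (trans (≡-sym eq) (csym _ _))
        ...   | inj₂ (inj₁ refl) = k₂ (≡-sym eq)
        ...   | inj₂ (inj₂ refl) = k₃ (≡-sym eq)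

  Clique : Graph n → V → Set
  Clique G v = ∀ {s t} → G ∋ v ∼ s → G ∋ v ∼ t → s ≢ t → G ∋ s ∼ t

  AtMostTwo : Graph n → V → Set
  AtMostTwo G v = ∃ λ s → ∃ λ t → ∀ {w} → G ∋ v ∼ w → w ≡ s ⊎ w ≡ t

  module _ {L : Graph n} {p q : V} (p≢q : p ≢ q) where

    private
      J = join L p q p≢q
      Joined : V → V → Set
      Joined u v = (u ≡ p × v ≡ q) ⊎ (u ≡ q × v ≡ p)

    -- A new claw would be centred at `p` or `q` and would need two non-adjacent old neighbours
    -- there, which the cliques rule out. In a new prism the edge `p q` cannot be the side of a
    -- triangle (see `inner`), so it is one of the three links, and the two triangles with the other
    -- two links form a double link of `L`.
    Good-join : Good L → NoDoubleLink L → Clique L p → Clique L q → AtMostTwo L p → AtMostTwo L q → Good J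
    Good-join g noDL cliqueP cliqueQ (s , t , hp) (s′ , t′ , hq) = record
      { clawFree = claw ; subcubic = cover-by cov ; noPrism = prism }
      where
        clique : ∀ {v a b} → v ≡ p ⊎ v ≡ q → L ∋ v ∼ a → L ∋ v ∼ b → a ≢ b → L ∋ a ∼ b
        clique (inj₁ refl) = cliqueP
        clique (inj₂ refl) = cliqueQ

        end : ∀ {u v} → Joined u v → u ≡ p ⊎ u ≡ q
        end (inj₁ (e , _)) = inj₁ e
        end (inj₂ (e , _)) = inj₂ e

        same : ∀ {u v w} → Joined u v → Joined u w → v ≡ w
        same (inj₁ (refl , refl)) (inj₁ (_ , refl)) = refl
        same (inj₁ (refl , refl)) (inj₂ (e , _)) = contradiction e p≢q
        same (inj₂ (refl , refl)) (inj₁ (e , _)) = contradiction (≡-sym e) p≢q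
        same (inj₂ (refl , refl)) (inj₂ (_ , refl)) = refl

        claw : ∀ {c x y z} → J ∋ c ∼ x → J ∋ c ∼ y → J ∋ c ∼ z → x ≢ y → x ≢ z → y ≢ z →
               J ∋ x ∼ y ⊎ J ∋ x ∼ z ⊎ J ∋ y ∼ z
        claw (inj₁ cx) (inj₁ cy) (inj₁ cz) xy xz yz with clawFree g cx cy cz xy xz yz
        ... | inj₁ e = inj₁ (inj₁ e)
        ... | inj₂ (inj₁ e) = inj₂ (inj₁ (inj₁ e))
        ... | inj₂ (inj₂ e) = inj₂ (inj₂ (inj₁ e))
        claw (inj₁ cx) (inj₁ cy) (inj₂ cz) xy xz yz = inj₁ (inj₁ (clique (end cz) cx cy xy))
        claw (inj₁ cx) (inj₂ cy) (inj₁ cz) xy xz yz = inj₂ (inj₁ (inj₁ (clique (end cy) cx cz xz)))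
        claw (inj₂ cx) (inj₁ cy) (inj₁ cz) xy xz yz = inj₂ (inj₂ (inj₁ (clique (end cx) cy cz yz)))
        claw (inj₂ cx) (inj₂ cy) _ xy xz yz = contradiction (same cx cy) xy
        claw (inj₂ cx) (inj₁ _) (inj₂ cz) xy xz yz = contradiction (same cx cz) xz
        claw (inj₁ _) (inj₂ cy) (inj₂ cz) xy xz yz = contradiction (same cy cz) yz

        cov : ∀ v → ∃ λ x → ∃ λ y → ∃ λ z → ∀ {w} → J ∋ v ∼ w → w ≡ x ⊎ w ≡ y ⊎ w ≡ z
        cov v with v ≟ p | v ≟ q
        ... | yes refl | _ = s , t , q , λ where
              (inj₁ vw) → [ inj₁ , inj₂ ∘ inj₁ ]′ (hp vw)
              (inj₂ (inj₁ (_ , e))) → inj₂ (inj₂ e)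
              (inj₂ (inj₂ (e , _))) → contradiction e p≢q
        ... | no _ | yes refl = s′ , t′ , p , λ where
              (inj₁ vw) → [ inj₁ , inj₂ ∘ inj₁ ]′ (hq vw)
              (inj₂ (inj₁ (e , _))) → contradiction (≡-sym e) p≢q
              (inj₂ (inj₂ (_ , e))) → inj₂ (inj₂ e)
        ... | no v≢p | no v≢q = let (x , y , z , h) = cover (subcubic g) v in x , y , z , λ where
              (inj₁ vw) → h vw
              (inj₂ (inj₁ (e , _))) → contradiction e v≢p
              (inj₂ (inj₂ (e , _))) → contradiction e v≢q

        distinct-ends : ∀ {u v w} → Joined u v → w ≢ u → w ≢ v → ∀ {x} → J ∋ w ∼ x → L ∋ w ∼ x
        distinct-ends j w≢u w≢v (inj₁ wx) = wx
        distinct-ends (inj₁ (refl , refl)) w≢u w≢v (inj₂ (inj₁ (e , _))) = contradiction e w≢u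
        distinct-ends (inj₁ (refl , refl)) w≢u w≢v (inj₂ (inj₂ (e , _))) = contradiction e w≢v
        distinct-ends (inj₂ (refl , refl)) w≢u w≢v (inj₂ (inj₁ (e , _))) = contradiction e w≢v
        distinct-ends (inj₂ (refl , refl)) w≢u w≢v (inj₂ (inj₂ (e , _))) = contradiction e w≢u

        inner : ∀ {u v w u′ w′} → J ∋ u ∼ v → J ∋ u ∼ w → J ∋ v ∼ w → J ∋ u ∼ u′ → J ∋ w ∼ w′ →
          v ≢ u′ → u ≢ w′ → v ≢ w′ → u′ ≢ w′ → w ≢ u′ → L ∋ u ∼ v
        inner (inj₁ uv) _ _ _ _ _ _ _ _ _ = uv
        inner (inj₂ uv) (inj₂ uw) vw _ _ _ _ _ _ _ = contradiction (same uv uw) (∼⇒≢ J vw)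
        inner (inj₂ uv) _ _ (inj₂ uu′) _ v≢u′ _ _ _ _ = contradiction (same uv uu′) v≢u′
        -- If the new edge `u v` were a side, `w` and `u′` would both be old neighbours of `u`,
        -- hence adjacent, and `w` would have the four neighbours `u`, `v`, `w′`, `u′`.
        inner (inj₂ uv) (inj₁ uw) vw (inj₁ uu′) ww′ v≢u′ u≢w′ v≢w′ u′≢w′ w≢u′ =
          ⊥-elim (noFour {J} (cover-by cov) (inj₁ (∼-sym L uw)) (∼-sym J vw) ww′ (inj₁ (clique (end uv) uw uu′ w≢u′))
            (∼⇒≢ J (inj₂ uv)) u≢w′ (∼⇒≢ L uu′) v≢w′ v≢u′ (≢-sym u′≢w′))

        flip : ∀ {a₁ b₁ c₁ a₂ b₂ c₂ : V} → Disjoint (a₁ ∷ b₁ ∷ c₁ ∷ []) (a₂ ∷ b₂ ∷ c₂ ∷ []) → Disjoint (b₁ ∷ c₁ ∷ a₁ ∷ []) (b₂ ∷ c₂ ∷ a₂ ∷ [])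
        flip ((a ∷ b ∷ c ∷ []) ∷ (d ∷ e ∷ f ∷ []) ∷ (g ∷ h ∷ i ∷ []) ∷ []) =
          (e ∷ f ∷ d ∷ []) ∷ (h ∷ i ∷ g ∷ []) ∷ (b ∷ c ∷ a ∷ []) ∷ []

        prism : ∀ {a₁ b₁ c₁ a₂ b₂ c₂} → DoubleLink J a₁ b₁ c₁ a₂ b₂ c₂ → ¬ J ∋ a₁ ∼ a₂
        prism {a₁} {b₁} {c₁} {a₂} {b₂} {c₂} ((ab , ac , bc) , (ab′ , ac′ , bc′) , bb , cc ,
          dis@((aa′ ∷ a-b′ ∷ a-c′ ∷ []) ∷ (b-a′ ∷ bb′ ∷ b-c′ ∷ []) ∷ (c-a′ ∷ c-b′ ∷ cc′ ∷ []) ∷ [])) aa = links bb cc aa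
          where
            tri₁ : Triangle L a₁ b₁ c₁
            tri₁ = inner ab ac bc aa cc b-a′ a-c′ b-c′ (∼⇒≢ J ac′) c-a′ ,
                   inner ac ab (∼-sym J bc) aa bb c-a′ a-b′ c-b′ (∼⇒≢ J ab′) b-a′ ,
                   inner bc (∼-sym J ab) (∼-sym J ac) bb aa c-b′ b-a′ c-a′ (≢-sym (∼⇒≢ J ab′)) a-b′
            tri₂ : Triangle L a₂ b₂ c₂
            tri₂ = inner ab′ ac′ bc′ (∼-sym J aa) (∼-sym J cc) (≢-sym a-b′) (≢-sym c-a′) (≢-sym c-b′) (∼⇒≢ J ac) (≢-sym a-c′) ,
                   inner ac′ ab′ (∼-sym J bc′) (∼-sym J aa) (∼-sym J bb) (≢-sym a-c′) (≢-sym b-a′) (≢-sym b-c′) (∼⇒≢ J ab) (≢-sym a-b′) ,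
                   inner bc′ (∼-sym J ab′) (∼-sym J ac′) (∼-sym J bb) (∼-sym J aa) (≢-sym b-c′) (≢-sym a-b′) (≢-sym a-c′) (≢-sym (∼⇒≢ J ab)) (≢-sym b-a′)
            rotate : ∀ {u v w} → Triangle L u v w → Triangle L v w u
            rotate (uv , uw , vw) = vw , ∼-sym L uv , ∼-sym L uw
            links : J ∋ b₁ ∼ b₂ → J ∋ c₁ ∼ c₂ → J ∋ a₁ ∼ a₂ → ⊥
            links (inj₁ bb) (inj₁ cc) _ = noDL (tri₁ , tri₂ , bb , cc , dis)
            links (inj₂ bb) cc aa = noDL (rotate tri₁ , rotate tri₂ ,
              distinct-ends bb (≢-sym (∼⇒≢ J bc)) c-b′ cc , distinct-ends bb (∼⇒≢ J ab) a-b′ aa , flip dis)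
            links bb (inj₂ cc) aa = noDL (rotate (rotate tri₁) , rotate (rotate tri₂) ,
              distinct-ends cc (∼⇒≢ J ac) a-c′ aa , distinct-ends cc (∼⇒≢ J bc) b-c′ bb , flip (flip dis))

-- Induction and vertices of small degree

module _ {n : ℕ} where

  private
    V = Fin n

  record _⊏_ (H G : Graph n) : Set where
    field
      alive   : ∀ {u v} → H ∋ u ∼ v → ∃ λ w → G ∋ u ∼ w
      {x y}   : V
      edge-of : G ∋ x ∼ y
      dead    : ∀ {v} → ¬ H ∋ x ∼ v

  Below : Graph n → Set₁
  Below G = ∀ {H} → Good H → H ⊏ G → Colorable H

  -- The recursion is on the length of a list that contains every non-isolated vertex. The vertex
  -- that becomes isolated is filtered out of it, so the non-isolated vertices are never counted.
  colorable : (∀ {G} → Good G → Below G → Colorable G) → ∀ {G} → Good G → Colorable G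
  colorable reduce g = go (allFin n) (<-wellFounded _) g (λ _ → ∈-allFin _)
    where
      go : ∀ xs → Acc _<_ (length xs) → ∀ {G} → Good G → (∀ {u v} → G ∋ u ∼ v → u ∈ xs) → Colorable G
      go xs (acc rec) {G} g supp = reduce g below
        where
          below : Below G
          below h h⊏g = go (filter (λ u → ¬? (u ≟ x)) xs) (rec shorter) h λ uv → ∈-filter⁺ _ (supp (proj₂ (alive uv))) λ where refl → dead uv
            where
              open _⊏_ h⊏g
              shorter : length (filter (λ u → ¬? (u ≟ x)) xs) < length xs
              shorter = filter-notAll _ xs (Any.map (λ e ne → ne (≡-sym e)) (supp edge-of))

  ⊑⇒⊏ : ∀ {H G x y} → H ⊑ G → G ∋ x ∼ y → (∀ {v} → ¬ H ∋ x ∼ v) → H ⊏ G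
  ⊑⇒⊏ h xy d = record { alive = λ uv → _ , sub h uv ; edge-of = xy ; dead = d }

  join-⊏ : ∀ {L G p q p′ q′ x y} (p≢q : p ≢ q) → L ⊑ G → G ∋ p ∼ p′ → G ∋ q ∼ q′ →
    G ∋ x ∼ y → (∀ {v} → ¬ L ∋ x ∼ v) → x ≢ p → x ≢ q → join L p q p≢q ⊏ G
  join-⊏ p≢q h pp′ qq′ xy d x≢p x≢q = record
    { alive = λ where
        (inj₁ uv) → _ , sub h uv
        (inj₂ (inj₁ (refl , _))) → _ , pp′
        (inj₂ (inj₂ (refl , _))) → _ , qq′
    ; edge-of = xy
    ; dead = λ where
        (inj₁ xv) → d xv
        (inj₂ (inj₁ (e , _))) → x≢p e
        (inj₂ (inj₂ (e , _))) → x≢q e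
    }

  Only₁ : Graph n → V → V → Set
  Only₁ G v x = G ∋ v ∼ x × (∀ w → G ∋ v ∼ w → w ≡ x)

  Only₂ : Graph n → V → V → V → Set
  Only₂ G v x y = G ∋ v ∼ x × G ∋ v ∼ y × x ≢ y × (∀ w → G ∋ v ∼ w → w ≡ x ⊎ w ≡ y)

  addTwo : ∀ (G : Graph n) {v x y c k l} → x ≢ y → (∀ w → G ∋ v ∼ w → w ≡ x ⊎ w ≡ y) → Strong (del G v) c → k ≢ l →
    Free (del G v) c x k → Free (del G v) c y l → Unused (del G v) c y k → Unused (del G v) c x l → Colorable G
  addTwo G {v} {x} {y} {c} {k} {l} x≢y only s k≢l freeX freeY unY unX = extend v f c , addVertex G v s dis fr un
    where
      f : V → Color
      f w with w ≟ x
      ... | yes _ = k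
      ... | no _  = l
      fx : f x ≡ k
      fx with x ≟ x
      ... | yes _ = refl
      ... | no x≢x = contradiction refl x≢x
      fy : f y ≡ l
      fy with y ≟ x
      ... | yes y≡x = contradiction (≡-sym y≡x) x≢y
      ... | no _ = refl
      dis : ∀ {w w′} → G ∋ v ∼ w → G ∋ v ∼ w′ → w ≢ w′ → f w ≢ f w′
      dis vw vw′ w≢w′ with only _ vw | only _ vw′
      ... | inj₁ refl | inj₁ refl = contradiction refl w≢w′
      ... | inj₁ refl | inj₂ refl = λ e → k≢l (trans (≡-sym fx) (trans e fy))
      ... | inj₂ refl | inj₁ refl = λ e → k≢l (trans (≡-sym fx) (trans (≡-sym e) fy))
      ... | inj₂ refl | inj₂ refl = contradiction refl w≢w′
      fr : ∀ {w} → G ∋ v ∼ w → Free (del G v) c w (f w)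
      fr vw with only _ vw
      ... | inj₁ refl = subst (Free (del G v) c x) (≡-sym fx) freeX
      ... | inj₂ refl = subst (Free (del G v) c y) (≡-sym fy) freeY
      un : ∀ {w w′} → G ∋ v ∼ w → G ∋ v ∼ w′ → w ≢ w′ → Unused (del G v) c w′ (f w)
      un vw vw′ w≢w′ with only _ vw | only _ vw′
      ... | inj₁ refl | inj₁ refl = contradiction refl w≢w′
      ... | inj₁ refl | inj₂ refl = subst (Unused (del G v) c y) (≡-sym fx) unY
      ... | inj₂ refl | inj₁ refl = subst (Unused (del G v) c x) (≡-sym fy) unX
      ... | inj₂ refl | inj₂ refl = contradiction refl w≢w′

  module _ {G : Graph n} (g : Good G) (below : Below G) where

    below-del : ∀ {x y} → G ∋ x ∼ y → Colorable (del G x)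
    below-del {x} xy = below (Good-del g x) (⊑⇒⊏ (del-⊑ G x) xy λ (_ , x≢x , _) → x≢x refl)

    leaf : ∀ {v x} → Only₁ G v x → Colorable G
    leaf {v} {x} (vx , only) with below-del vx
    ... | c , s with legColors g (del-⊑ G v) (symm s) (∼-sym G vx) (λ (_ , _ , v≢v) → v≢v refl)
                       (λ {r} xr vr → ∼-irr G (subst (λ z → G ∋ x ∼ z) (only r vr) xr))
    ... | k₁ , k₂ , k₃ , k₄ , k₅ , free with fresh (k₁ ∷ k₂ ∷ k₃ ∷ k₄ ∷ k₅ ∷ [])
    ... | k , avoids = _ , addPendant G (only _) s (free avoids)

    -- Because `v x y` is a triangle, `v x` sees only `x y`, `y y⁺` and at most three edges at `x⁺`.
    -- Likewise `v y` sees at most five old edges, and the colour just given to `v x` is the sixth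
    -- one forbidden.
    flatPath : ∀ {v x y} → Only₂ G v x y → G ∋ x ∼ y → Colorable G
    flatPath {v} {x} {y} (vx , vy , x≢y , only) xy
      with below-del vx | nbrs₂ (subcubic g) (∼-sym G vx) xy (∼⇒≢ G vy) | nbrs₂ (subcubic g) (∼-sym G vy) (∼-sym G xy) (∼⇒≢ G vx)
    ... | c , s | x⁺ , hx | y⁺ , hy with cover (subcubic g) x⁺ | cover (subcubic g) y⁺
    ... | a₁ , a₂ , a₃ , ha | b₁ , b₂ , b₃ , hb
      with fresh (c x y ∷ c y y⁺ ∷ c x⁺ a₁ ∷ c x⁺ a₂ ∷ c x⁺ a₃ ∷ [])
    ... | k , kxy ∷ ky⁺ ∷ ka₁ ∷ ka₂ ∷ ka₃ ∷ []
      with fresh (k ∷ c x y ∷ c x x⁺ ∷ c y⁺ b₁ ∷ c y⁺ b₂ ∷ c y⁺ b₃ ∷ [])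
    ... | l , lk ∷ lxy ∷ lx⁺ ∷ lb₁ ∷ lb₂ ∷ lb₃ ∷ [] =
      addTwo G x≢y only s (≢-sym lk) (free hx unY (at ha ka₁ ka₂ ka₃)) (free hy unX (at hb lb₁ lb₂ lb₃)) unY unX
      where
        K = del G v
        at : ∀ {r a b d m} → (∀ {w} → G ∋ r ∼ w → w ≡ a ⊎ w ≡ b ⊎ w ≡ d) → m ≢ c r a → m ≢ c r b → m ≢ c r d → Unused K c r m
        at h ma mb md (rw , _) e with h rw
        ... | inj₁ refl = ma (≡-sym e)
        ... | inj₂ (inj₁ refl) = mb (≡-sym e)
        ... | inj₂ (inj₂ refl) = md (≡-sym e)
        un : ∀ {p q q⁺ m} → (∀ {w} → G ∋ p ∼ w → w ≡ v ⊎ w ≡ q ⊎ w ≡ q⁺) → m ≢ c p q → m ≢ c p q⁺ → Unused K c p m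
        un h mq mq⁺ (pb , _ , b≢v) e with h pb
        ... | inj₁ b≡v = b≢v b≡v
        ... | inj₂ (inj₁ refl) = mq (≡-sym e)
        ... | inj₂ (inj₂ refl) = mq⁺ (≡-sym e)
        unY : Unused K c y k
        unY = un hy (λ e → kxy (trans e (symm s y x))) ky⁺
        unX : Unused K c x l
        unX = un hx lxy lx⁺
        free : ∀ {p q p⁺ m} → (∀ {w} → G ∋ p ∼ w → w ≡ v ⊎ w ≡ q ⊎ w ≡ p⁺) → Unused K c q m → Unused K c p⁺ m → Free K c p m
        free h uq up (pw , _ , w≢v) wb with h pw
        ... | inj₁ w≡v = contradiction w≡v w≢v
        ... | inj₂ (inj₁ refl) = uq wb
        ... | inj₂ (inj₂ refl) = up wb

    -- Both `v` and `x` are removed. The outer edges `x z` and `v y` are coloured before the middle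
    -- one, since each sees at most five edges beyond it; `v x` then has to avoid only these two
    -- colours and two more at each of `z` and `y`.
    adjacentPaths : ∀ {v x y z} → Only₂ G v x y → Only₂ G x v z → Colorable G
    adjacentPaths {v} {x} {y} {z} o@(vx , vy , x≢y , onlyV) (xv , xz , v≢z , onlyX) with _∼?_ G x y
    ... | yes xy = flatPath o xy
    ... | no ¬xy with below (Good-del (Good-del g v) x) (⊑⇒⊏ K₀⊑G vx λ ((_ , v≢v , _) , _) → v≢v refl)
      where K₀⊑G = ⊑-trans (del-⊑ (del G v) x) (del-⊑ G v)
    ... | c , s
      with legColors g (⊑-trans (del-⊑ (del G v) x) (del-⊑ G v)) (symm s) (∼-sym G xz) (λ (_ , _ , x≢x) → x≢x refl) awayZ
      where
        awayZ : ∀ {r} → G ∋ z ∼ r → ¬ G ∋ x ∼ r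
        awayZ zr xr with onlyX _ xr
        ... | inj₁ refl = [ (λ { refl → ∼-irr G xz }) , (λ { refl → ¬xy xz }) ]′ (onlyV _ (∼-sym G zr))
        ... | inj₂ refl = ∼-irr G zr
    ... | p₁ , p₂ , p₃ , p₄ , p₅ , freeZ with fresh (p₁ ∷ p₂ ∷ p₃ ∷ p₄ ∷ p₅ ∷ [])
    ... | k₁ , avoid₁
      with legColors g {K = del G v} {c = extend x (λ _ → k₁) c} (del-⊑ G v) (extend-sym _ _ _ (symm s)) (∼-sym G vy) (λ (_ , _ , v≢v) → v≢v refl) awayY
         | nbrs₁ (subcubic g) (∼-sym G vy) | nbrs₁ (subcubic g) (∼-sym G xz)
      where
        awayY : ∀ {r} → G ∋ y ∼ r → ¬ G ∋ v ∼ r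
        awayY yr vr with onlyV _ vr
        ... | inj₁ refl = ¬xy (∼-sym G yr)
        ... | inj₂ refl = ∼-irr G yr
    ... | q₁ , q₂ , q₃ , q₄ , q₅ , freeY | y₁ , y₂ , hy | z₁ , z₂ , hz = finish
      where
        K = del G v
        c₁ = extend x (λ _ → k₁) c
        s₁ : Strong K c₁
        s₁ = addPendant K (λ (xw , _ , w≢v) → [ (λ w≡v → contradiction w≡v w≢v) , id ]′ (onlyX _ xw)) s (freeZ avoid₁)
        unX : ∀ {m} → m ≢ k₁ → Unused K c₁ x m
        unX m≢k₁ = unused-new K x λ _ e → m≢k₁ (≡-sym e)
        at : ∀ {r a b d m} → (∀ {w} → G ∋ r ∼ w → w ≡ a ⊎ w ≡ b ⊎ w ≡ d) → (K ∋ r ∼ a → m ≢ c₁ r a) → m ≢ c₁ r b → m ≢ c₁ r d → Unused K c₁ r m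
        at h ma mb md rw@(rw′ , _) e with h rw′
        ... | inj₁ refl = ma rw (≡-sym e)
        ... | inj₂ (inj₁ refl) = mb (≡-sym e)
        ... | inj₂ (inj₂ refl) = md (≡-sym e)
        finish : Colorable G
        finish with fresh (k₁ ∷ q₁ ∷ q₂ ∷ q₃ ∷ q₄ ∷ q₅ ∷ [])
        ... | k₃ , k₃≢k₁ ∷ avoid₃ with fresh (k₃ ∷ c₁ z x ∷ c₁ z z₁ ∷ c₁ z z₂ ∷ c₁ y y₁ ∷ c₁ y y₂ ∷ [])
        ... | k₂ , k₂≢k₃ ∷ zx ∷ zz₁ ∷ zz₂ ∷ yy₁ ∷ yy₂ ∷ [] =
          addTwo G x≢y onlyV s₁ k₂≢k₃ freeX (freeY avoid₃)
            (at hy (λ (_ , _ , v≢v) → contradiction refl v≢v) yy₁ yy₂) (unX k₃≢k₁)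
          where
            freeX : Free K c₁ x k₂
            freeX (xw , _ , w≢v) wb with onlyX _ xw
            ... | inj₁ w≡v = contradiction w≡v w≢v
            ... | inj₂ refl = at hz (λ _ → zx) zz₁ zz₂ wb

-- Colour choices for diamonds

diamondColors : ∀ f x₁ x₂ y₁ y₂ → ∃ λ x → ∃ λ y → ∃ λ z → ∃ λ l → ∃ λ m →
  Distinct (x ∷ y ∷ z ∷ f ∷ l ∷ m ∷ []) ×
  All (x ≢_) (x₁ ∷ x₂ ∷ []) × All (y ≢_) (x₁ ∷ x₂ ∷ []) × All (l ≢_) (y₁ ∷ y₂ ∷ []) × All (m ≢_) (y₁ ∷ y₂ ∷ [])
diamondColors f x₁ x₂ y₁ y₂ with fresh (f ∷ x₁ ∷ x₂ ∷ [])
... | x , xf ∷ xs with fresh (x ∷ f ∷ x₁ ∷ x₂ ∷ [])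
... | y , yx ∷ yf ∷ ys with fresh (y ∷ x ∷ f ∷ y₁ ∷ y₂ ∷ [])
... | l , ly ∷ lx ∷ lf ∷ ls with fresh (l ∷ y ∷ x ∷ f ∷ y₁ ∷ y₂ ∷ [])
... | m , ml ∷ my ∷ mx ∷ mf ∷ ms with fresh (m ∷ l ∷ y ∷ x ∷ f ∷ [])
... | z , zm ∷ zl ∷ zy ∷ zx ∷ zf ∷ [] = x , y , z , l , m ,
  (≢-sym yx ∷ ≢-sym zx ∷ xf ∷ ≢-sym lx ∷ ≢-sym mx ∷ []) ∷ (≢-sym zy ∷ yf ∷ ≢-sym ly ∷ ≢-sym my ∷ []) ∷
  (zf ∷ zl ∷ zm ∷ []) ∷ (≢-sym lf ∷ ≢-sym mf ∷ []) ∷ (≢-sym ml ∷ []) ∷ [] ∷ [] , xs , ys , ls , ms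

-- The choice is nearly forced. With adjacent tips the seven edges at the diamond need seven
-- different colours, so `k₁`, `k₂`, `k₃`, the colours of `a′ b′`, `a′ u`, `b′ u` in `adjacentTips`,
-- all occur among them. As `k₁` is forbidden at `a` and at `b`, it must go to the central edge;
-- `k₂` is forbidden at `a` and goes to `b`, and `k₃` is forbidden at `b` and goes to `a`.
adjacentTipColors : ∀ k₁ k₂ k₃ k₄ → k₃ ≢ k₂ → ∃ λ f → ∃ λ h → ∃ λ y → ∃ λ z → ∃ λ m →
  All (f ≢_) (k₁ ∷ k₂ ∷ k₃ ∷ k₄ ∷ []) × All (h ≢_) (f ∷ k₁ ∷ k₂ ∷ k₃ ∷ k₄ ∷ []) ×
  Distinct (k₃ ∷ y ∷ z ∷ f ∷ k₂ ∷ m ∷ []) × All (h ≢_) (k₃ ∷ y ∷ z ∷ k₂ ∷ m ∷ []) ×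
  All (y ≢_) (k₁ ∷ k₂ ∷ []) × All (m ≢_) (k₁ ∷ k₃ ∷ [])
adjacentTipColors k₁ k₂ k₃ k₄ k₃≢k₂ with fresh (k₁ ∷ k₂ ∷ k₃ ∷ k₄ ∷ [])
... | f , fs@(_ ∷ f₂ ∷ f₃ ∷ _) with fresh (f ∷ k₁ ∷ k₂ ∷ k₃ ∷ k₄ ∷ [])
... | h , hs@(_ ∷ _ ∷ h₂ ∷ h₃ ∷ _) with fresh (f ∷ h ∷ k₁ ∷ k₂ ∷ k₃ ∷ [])
... | y , yf ∷ yh ∷ y₁ ∷ y₂ ∷ y₃ ∷ [] with fresh (y ∷ f ∷ h ∷ k₁ ∷ k₂ ∷ k₃ ∷ [])
... | m , my ∷ mf ∷ mh ∷ m₁ ∷ m₂ ∷ m₃ ∷ [] with fresh (k₃ ∷ y ∷ f ∷ h ∷ k₂ ∷ m ∷ [])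
... | z , z₃ ∷ zy ∷ zf ∷ zh ∷ z₂ ∷ zm ∷ [] = f , h , y , z , m , fs , hs ,
  (≢-sym y₃ ∷ ≢-sym z₃ ∷ ≢-sym f₃ ∷ k₃≢k₂ ∷ ≢-sym m₃ ∷ []) ∷ (≢-sym zy ∷ yf ∷ y₂ ∷ ≢-sym my ∷ []) ∷
  (zf ∷ z₂ ∷ zm ∷ []) ∷ (f₂ ∷ ≢-sym mf ∷ []) ∷ (≢-sym m₂ ∷ []) ∷ [] ∷ [] ,
  h₃ ∷ ≢-sym yh ∷ ≢-sym zh ∷ h₂ ∷ ≢-sym mh ∷ [] , y₁ ∷ y₂ ∷ [] , m₁ ∷ m₃ ∷ []

others : ∀ {x y z f l m : Color} → Distinct (x ∷ y ∷ z ∷ f ∷ l ∷ m ∷ []) → All (f ≢_) (x ∷ y ∷ z ∷ l ∷ m ∷ [])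
others ((_ ∷ _ ∷ xf ∷ _) ∷ (_ ∷ yf ∷ _) ∷ (zf ∷ _) ∷ (fl ∷ fm ∷ []) ∷ _) = ≢-sym xf ∷ ≢-sym yf ∷ ≢-sym zf ∷ fl ∷ fm ∷ []

sevenColors : ∃ λ f → ∃ λ h → ∃ λ x → ∃ λ y → ∃ λ z → ∃ λ l → ∃ λ m →
  h ≢ f × Distinct (x ∷ y ∷ z ∷ f ∷ l ∷ m ∷ []) × All (h ≢_) (x ∷ y ∷ z ∷ l ∷ m ∷ [])
sevenColors = # 0 , # 1 , # 2 , # 3 , # 4 , # 5 , # 6 , (λ ()) ,
  ((λ ()) ∷ (λ ()) ∷ (λ ()) ∷ (λ ()) ∷ (λ ()) ∷ []) ∷ ((λ ()) ∷ (λ ()) ∷ (λ ()) ∷ (λ ()) ∷ []) ∷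
  ((λ ()) ∷ (λ ()) ∷ (λ ()) ∷ []) ∷ ((λ ()) ∷ (λ ()) ∷ []) ∷ ((λ ()) ∷ []) ∷ [] ∷ [] ,
  (λ ()) ∷ (λ ()) ∷ (λ ()) ∷ (λ ()) ∷ (λ ()) ∷ []

-- Diamonds

module _ {n : ℕ} where

  private
    V = Fin n

  -- In `J` the edge `p q` sees everything that a pendant edge at `p` sees in `L`, so such an edge
  -- can inherit its colour.
  edge-free : ∀ {L J : Graph n} {c p q} → L ⊑ J → Strong J c → J ∋ p ∼ q → ¬ L ∋ p ∼ q → Free L c p (c p q)
  edge-free {L} {J} {c} {p} {q} h s pq ¬pq {w} pw {b} wb e with b ≟ p
  ... | yes refl = incident s (sub h pw) pq (λ where refl → ¬pq pw) (trans (symm s _ _) e)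
  ... | no b≢p   = joined s (sub h pw) pq (sub h wb) (λ where refl → ¬pq pw) b≢p (≡-sym e)

  edge-separates : ∀ {L J : Graph n} {c p q s t} → L ⊑ J → Strong J c → J ∋ p ∼ q → ¬ L ∋ p ∼ q →
    L ∋ p ∼ s → L ∋ q ∼ t → c p s ≢ c q t
  edge-separates {L} h st pq ¬pq ps qt = joined st pq (sub h ps) (sub h qt) (λ where refl → ¬pq ps) (λ where refl → ¬pq (∼-sym L qt))

  NoFlatPath : Graph n → Set
  NoFlatPath G = ∀ {v x y} → Only₂ G v x y → ¬ G ∋ x ∼ y

  Diamond : Graph n → V → V → V → V → Set
  Diamond G a b p q = (G ∋ p ∼ q × G ∋ a ∼ p × G ∋ a ∼ q) × G ∋ b ∼ p × G ∋ b ∼ q × a ≢ b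

  module _ {G : Graph n} (g : Good G) where

    -- The neighbour `p` of `v` is adjacent to none of the others, so claw-freeness at `v` makes
    -- these adjacent to each other. This supplies the clique hypotheses of `Good-join`.
    clique-beyond : ∀ {K p v} → K ⊑ G → G ∋ v ∼ p → (∀ {w} → K ∋ v ∼ w → w ≢ p × ¬ G ∋ p ∼ w) →
      (∀ {s t} → K ∋ v ∼ s → K ∋ v ∼ t → G ∋ s ∼ t → K ∋ s ∼ t) → Clique K v
    clique-beyond h vp away induced vs vt s≢t = induced vs vt
      (others-adjacent g vp (sub h vs) (sub h vt) (≢-sym (proj₁ (away vs))) (≢-sym (proj₁ (away vt))) s≢t (proj₂ (away vs)) (proj₂ (away vt)))

    two-beyond : ∀ {K p v} → K ⊑ G → G ∋ v ∼ p → ¬ K ∋ v ∼ p → AtMostTwo K v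
    two-beyond h vp ¬vp with nbrs₁ (subcubic g) vp
    ... | e , f , hv = e , f , λ vw → [ (λ where refl → contradiction vw ¬vp) , id ]′ (hv (sub h vw))

    third : NoFlatPath G → ∀ {v a b} → G ∋ v ∼ a → G ∋ v ∼ b → G ∋ a ∼ b →
      ∃ λ e → G ∋ v ∼ e × e ≢ a × e ≢ b × (∀ {w} → G ∋ v ∼ w → w ≡ a ⊎ w ≡ b ⊎ w ≡ e)
    third noFlat {v} {a} {b} va vb ab with nbrs₂ (subcubic g) va vb (∼⇒≢ G ab)
    ... | e , h with _∼?_ G v e | e ≟ a | e ≟ b
    ... | yes ve | no e≢a | no e≢b = e , ve , e≢a , e≢b , h
    ... | no ¬ve | _ | _ = contradiction ab (noFlat (va , vb , ∼⇒≢ G ab , λ w vw → [ inj₁ , [ inj₂ , (λ where refl → contradiction vw ¬ve) ]′ ]′ (h vw)))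
    ... | _ | yes refl | _ = contradiction ab (noFlat (va , vb , ∼⇒≢ G ab , λ w vw → [ inj₁ , [ inj₂ , inj₁ ]′ ]′ (h vw)))
    ... | _ | _ | yes refl = contradiction ab (noFlat (va , vb , ∼⇒≢ G ab , λ w vw → [ inj₁ , [ inj₂ , inj₂ ]′ ]′ (h vw)))

  module _ {G : Graph n} (g : Good G) (below : Below G) (noFlat : NoFlatPath G)
    (noAdjacentPaths : ∀ {v x y z} → Only₂ G v x y → ¬ Only₂ G x v z) (noDL : NoDoubleLink G)
    {a b p q : V} (D : Diamond G a b p q) where

    private
      pq = proj₁ (proj₁ D)
      ap = proj₁ (proj₂ (proj₁ D))
      aq = proj₂ (proj₂ (proj₁ D))
      bp = proj₁ (proj₂ D)
      bq = proj₁ (proj₂ (proj₂ D))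
      a≢b = proj₂ (proj₂ (proj₂ D))
      p≢q = ∼⇒≢ G pq
      K = del² G q p
      Kb = del K b
      L = del² K b a
      a≢p = ∼⇒≢ G ap
      a≢q = ∼⇒≢ G aq
      b≢p = ∼⇒≢ G bp
      b≢q = ∼⇒≢ G bq

      nbP : ∀ {w} → G ∋ p ∼ w → w ≡ a ⊎ w ≡ q ⊎ w ≡ b
      nbP = nbrs₃ (subcubic g) (∼-sym G ap) pq (∼-sym G bp) a≢q a≢b (≢-sym b≢q)
      nbQ : ∀ {w} → G ∋ q ∼ w → w ≡ a ⊎ w ≡ p ⊎ w ≡ b
      nbQ = nbrs₃ (subcubic g) (∼-sym G aq) (∼-sym G pq) (∼-sym G bq) a≢p a≢b (≢-sym b≢p)

      K⊑G : K ⊑ G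
      K⊑G = ⊑-trans (del-⊑ (del G q) p) (del-⊑ G q)
      L⊑G : L ⊑ G
      L⊑G = ⊑-trans (⊑-trans (del-⊑ Kb a) (del-⊑ K b)) K⊑G
      Good-L : Good L
      Good-L = Good-del (Good-del (Good-del (Good-del g q) p) b) a

      -- The triangle `a p q` is inserted at the pendant edge `a a′` of colour `f`, and both of its
      -- legs end at `b`. The colour `h` of `b b′` has to avoid the five edges of the diamond but
      -- may equal `f`.
      fill : ∀ {c a′ b′ f h x y z l m} → Strong K c →
        (∀ {w} → K ∋ a ∼ w → w ≡ a′) → (∀ {w} → K ∋ b ∼ w → w ≡ b′) → c a a′ ≡ f → c b b′ ≡ h →
        Distinct (x ∷ y ∷ z ∷ f ∷ l ∷ m ∷ []) → All (h ≢_) (x ∷ y ∷ z ∷ l ∷ m ∷ []) →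
        Unused K c a′ x → Unused K c a′ y → Unused K c b′ l → Unused K c b′ m → Colorable G
      fill {c} {a′} {b′} {f} {h} {x} {y} {z} {l} {m} s nbA nbB cf ch dis (hx ∷ hy ∷ hz ∷ hl ∷ hm ∷ []) ux uy ul um =
        _ , AddPair.strong (addPair G ap aq pq s b b dis
          (λ aw → atA (nbA aw))
          (λ pw → [ inj₁ , inj₂ ∘ [ inj₁ , (λ where refl → inj₂ (refl , addable (atB ul) (unB hx) (unB hz))) ]′ ]′ (nbP pw))
          (λ qw → [ inj₁ , inj₂ ∘ [ inj₁ , (λ where refl → inj₂ (refl , addable (atB um) (unB hy) (unB hz))) ]′ ]′ (nbQ qw)))
        where
          atA : ∀ {w} → w ≡ a′ → c a w ≡ f × Unused K c w x × Unused K c w y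
          atA refl = cf , ux , uy
          unB : ∀ {k} → h ≢ k → Unused K c b k
          unB h≢k bw e with nbB bw
          ... | refl = h≢k (trans (≡-sym ch) e)
          atB : ∀ {k} → Unused K c b′ k → Free K c b k
          atB u bw with nbB bw
          ... | refl = u

    complete₄ : G ∋ a ∼ b → Colorable G
    complete₄ ab with below (Good-del (Good-del g q) p) (⊑⇒⊏ K⊑G (∼-sym G aq) λ ((_ , q≢q , _) , _) → q≢q refl)
    -- In a complete graph on four vertices `a` and `b` are each other's tips, so the edge `a b`
    -- imposes the only condition.
    ... | c , s with diamondColors (c a b) (c a b) (c a b) (c a b) (c a b)
    ... | x , y , z , l , m , dis , xf ∷ _ , yf ∷ _ , lf ∷ _ , mf ∷ _ =
      fill s (only (nbrs₃ (subcubic g) ap aq ab p≢q (≢-sym b≢p) (≢-sym b≢q)))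
             (only (nbrs₃ (subcubic g) bp bq (∼-sym G ab) p≢q (≢-sym a≢p) (≢-sym a≢q))) refl (symm s b a)
        dis (others dis) (unB xf) (unB yf) (unA lf) (unA mf)
      where
        only : ∀ {u w} → (∀ {v} → G ∋ u ∼ v → v ≡ p ⊎ v ≡ q ⊎ v ≡ w) → ∀ {v} → K ∋ u ∼ v → v ≡ w
        only h ((uv , _ , v≢q) , _ , v≢p) = [ (λ e → contradiction e v≢p) , [ (λ e → contradiction e v≢q) , id ]′ ]′ (h uv)
        unA : ∀ {k} → k ≢ c a b → Unused K c a k
        unA k≢ aw e with only (nbrs₃ (subcubic g) ap aq ab p≢q (≢-sym b≢p) (≢-sym b≢q)) aw
        ... | refl = k≢ (≡-sym e)
        unB : ∀ {k} → k ≢ c a b → Unused K c b k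
        unB k≢ bw e with only (nbrs₃ (subcubic g) bp bq (∼-sym G ab) p≢q (≢-sym a≢p) (≢-sym a≢q)) bw
        ... | refl = k≢ (trans (≡-sym e) (symm s b a))

    module _ (¬ab : ¬ G ∋ a ∼ b) {a′ b′ : V}
      (aa′ : G ∋ a ∼ a′) (a′≢p : a′ ≢ p) (a′≢q : a′ ≢ q) (nbrsA : ∀ {w} → G ∋ a ∼ w → w ≡ p ⊎ w ≡ q ⊎ w ≡ a′)
      (bb′ : G ∋ b ∼ b′) (b′≢p : b′ ≢ p) (b′≢q : b′ ≢ q) (nbrsB : ∀ {w} → G ∋ b ∼ w → w ≡ p ⊎ w ≡ q ⊎ w ≡ b′) where

      private
        a′≢b : a′ ≢ b
        a′≢b e = ¬ab (subst (λ z → G ∋ a ∼ z) e aa′)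
        b′≢a : b′ ≢ a
        b′≢a e = ¬ab (∼-sym G (subst (λ z → G ∋ b ∼ z) e bb′))
        a′≢a = ≢-sym (∼⇒≢ G aa′)
        b′≢b = ≢-sym (∼⇒≢ G bb′)

        nbA : ∀ {w} → K ∋ a ∼ w → w ≡ a′
        nbA ((aw , _ , w≢q) , _ , w≢p) = [ (λ e → contradiction e w≢p) , [ (λ e → contradiction e w≢q) , id ]′ ]′ (nbrsA aw)
        nbB : ∀ {w} → K ∋ b ∼ w → w ≡ b′
        nbB ((bw , _ , w≢q) , _ , w≢p) = [ (λ e → contradiction e w≢p) , [ (λ e → contradiction e w≢q) , id ]′ ]′ (nbrsB bw)

        tipA : ∀ {w} → G ∋ a ∼ w → w ≢ p → w ≢ q → w ≡ a′
        tipA aw w≢p w≢q = nbA ((aw , a≢q , w≢q) , a≢p , w≢p)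

        fill′ : ∀ {c f h x y z l m} → Strong L c → Free L c a′ f →
          (∀ {w} → Kb ∋ b′ ∼ w → Unused Kb (extend a (λ _ → f) c) w h) →
          Distinct (x ∷ y ∷ z ∷ f ∷ l ∷ m ∷ []) → All (h ≢_) (x ∷ y ∷ z ∷ l ∷ m ∷ []) →
          Unused L c a′ x → Unused L c a′ y → Unused L c b′ l → Unused L c b′ m → Colorable G
        fill′ {c} {f} {h} s freeA freeB dis@((_ ∷ _ ∷ xf ∷ _) ∷ (_ ∷ yf ∷ _) ∷ _ ∷ (fl ∷ fm ∷ []) ∷ _) hs@(hx ∷ hy ∷ _ ∷ hl ∷ hm ∷ []) ux uy ul um =
          fill (addPendant K nbB (addPendant Kb (λ (aw , _) → nbA aw) s freeA) freeB) nbA nbB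
            (trans (extend-old b _ _ a≢b a′≢b) (extend-new a _ _ _)) (extend-new b _ _ _) dis hs
            (up a′≢a a′≢b ux (≢-sym xf) hx) (up a′≢a a′≢b uy (≢-sym yf) hy)
            (up b′≢a b′≢b ul fl hl) (up b′≢a b′≢b um fm hm)
          where
            up : ∀ {w k} → w ≢ a → w ≢ b → Unused L c w k → f ≢ k → h ≢ k → Unused K (extend b (λ _ → h) (extend a (λ _ → f) c)) w k
            up w≢a w≢b u fk hk = unused-old K b w≢b (unused-old Kb a w≢a u λ _ → fk) λ _ → hk

        below-L : Colorable L
        below-L = below Good-L (⊑⇒⊏ L⊑G (∼-sym G aq) λ ((((_ , q≢q , _) , _) , _) , _) → q≢q refl)

      -- Claw-freeness leaves the common tip without further neighbours. The component has seven
      -- edges, which can all get different colours.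
      sharedTip : a′ ≡ b′ → Colorable G
      sharedTip a′≡b′ with below-L | sevenColors
      ... | c , s | f , h , x , y , z , l , m , hf , dis , hs =
        fill′ s (λ w → ⊥-elim (isolated w)) freeB dis hs
          (λ w → ⊥-elim (isolated w)) (λ w → ⊥-elim (isolated w)) (λ w → ⊥-elim (isolated′ w)) (λ w → ⊥-elim (isolated′ w))
        where
          ba′ : G ∋ b ∼ a′
          ba′ = subst (λ v → G ∋ b ∼ v) (≡-sym a′≡b′) bb′
          isolated : ∀ {w} → ¬ L ∋ a′ ∼ w
          isolated {w} ((((a′w , _ , w≢q) , _ , w≢p) , _ , w≢b) , _ , w≢a)
            with clawFree g (∼-sym G aa′) (∼-sym G ba′) a′w a≢b (≢-sym w≢a) (≢-sym w≢b)
          ... | inj₁ ab = ¬ab ab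
          ... | inj₂ (inj₁ aw) = ∼⇒≢ G a′w (≡-sym (tipA aw w≢p w≢q))
          ... | inj₂ (inj₂ bw) = ∼⇒≢ G a′w (trans a′≡b′ (≡-sym (nbB ((bw , b≢q , w≢q) , b≢p , w≢p))))
          isolated′ : ∀ {w} → ¬ L ∋ b′ ∼ w
          isolated′ = subst (λ v → ∀ {w} → ¬ L ∋ v ∼ w) a′≡b′ isolated
          freeB : ∀ {w} → Kb ∋ b′ ∼ w → Unused Kb (extend a (λ _ → f) c) w h
          freeB {w} b′w with w ≟ a
          ... | yes refl = unused-new Kb a λ _ e → hf (≡-sym e)
          ... | no w≢a = ⊥-elim (isolated′ (b′w , b′≢a , w≢a))

      private
        toB : ∀ {c f h} → Free L c b′ h → (∀ {w} → Kb ∋ b′ ∼ w → w ≢ a) → (∀ {w} → Kb ∋ b′ ∼ w → w ≡ a′ → f ≢ h) →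
          ∀ {w} → Kb ∋ b′ ∼ w → Unused Kb (extend a (λ _ → f) c) w h
        toB free w≢a sep b′w = unused-old Kb a (w≢a b′w) (free (b′w , b′≢a , w≢a b′w)) λ (aw , _) → sep b′w (nbA aw)

        not-a : a′ ≢ b′ → ∀ {w} → Kb ∋ b′ ∼ w → w ≢ a
        not-a a′≢b′ (((b′a , _) , _) , _) refl = a′≢b′ (≡-sym (tipA (∼-sym G b′a) b′≢p b′≢q))

      -- Claw-freeness gives the tips a common neighbour `u`, so the triangle `a′ b′ u` with its
      -- third edge `u u⁺` is all that the edges `a a′` and `b b′` see beyond the tips.
      adjacentTips : a′ ≢ b′ → G ∋ a′ ∼ b′ → Colorable G
      adjacentTips a′≢b′ a′b′ = go u-exists below-L
        where
          a≁ : ∀ {w} → w ≢ p → w ≢ q → w ≢ a′ → ¬ G ∋ a ∼ w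
          a≁ w≢p w≢q w≢a′ aw = w≢a′ (tipA aw w≢p w≢q)
          b≁ : ∀ {w} → w ≢ p → w ≢ q → w ≢ b′ → ¬ G ∋ b ∼ w
          b≁ w≢p w≢q w≢b′ bw = w≢b′ (nbB ((bw , b≢q , w≢q) , b≢p , w≢p))
          not-centre : ∀ {u w} → G ∋ u ∼ w → u ≢ a → u ≢ b → u ≢ p → u ≢ q → w ≢ p × w ≢ q
          not-centre uw u≢a u≢b u≢p u≢q =
            (λ where refl → [ u≢a , [ u≢q , u≢b ]′ ]′ (nbP (∼-sym G uw))) , (λ where refl → [ u≢a , [ u≢p , u≢b ]′ ]′ (nbQ (∼-sym G uw)))

          -- If `a′` had degree 2, claw-freeness at `b′` would give `b′` degree 2 as well, and
          -- adjacent vertices of degree 2 are excluded.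
          not-path : ¬ Only₂ G a′ b′ a
          not-path o@(_ , _ , _ , onlyA) with nbrs₂ (subcubic g) (∼-sym G bb′) (∼-sym G a′b′) (≢-sym a′≢b)
          ... | y , hy = decide (_∼?_ G b′ y) (y ≟ b) (y ≟ a′)
            where
              decide : Dec (G ∋ b′ ∼ y) → Dec (y ≡ b) → Dec (y ≡ a′) → ⊥
              decide (no ¬b′y) _ _ = noAdjacentPaths o (∼-sym G a′b′ , ∼-sym G bb′ , a′≢b , λ w b′w → [ inj₂ , [ inj₁ , (λ where refl → contradiction b′w ¬b′y) ]′ ]′ (hy b′w))
              decide _ (yes refl) _ = noAdjacentPaths o (∼-sym G a′b′ , ∼-sym G bb′ , a′≢b , λ w b′w → [ inj₂ , [ inj₁ , inj₂ ]′ ]′ (hy b′w))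
              decide _ _ (yes refl) = noAdjacentPaths o (∼-sym G a′b′ , ∼-sym G bb′ , a′≢b , λ w b′w → [ inj₂ , [ inj₁ , inj₁ ]′ ]′ (hy b′w))
              decide (yes b′y) (no y≢b) (no y≢a′) =
                let (y≢p , y≢q) = not-centre b′y b′≢a b′≢b b′≢p b′≢q
                    a′y = others-adjacent g (∼-sym G bb′) (∼-sym G a′b′) b′y (≢-sym a′≢b) (≢-sym y≢b) (≢-sym y≢a′)
                            (b≁ a′≢p a′≢q a′≢b′) (b≁ y≢p y≢q (≢-sym (∼⇒≢ G b′y)))
                in [ (λ e → ∼⇒≢ G b′y (≡-sym e)) , (λ where refl → b′≢b (≡-sym (b-only b′y))) ]′ (onlyA y a′y)
                where
                  b-only : G ∋ b′ ∼ a → b ≡ b′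
                  b-only b′a = ⊥-elim (a≁ b′≢p b′≢q (≢-sym a′≢b′) (∼-sym G b′a))

          u-exists : ∃ λ u → G ∋ a′ ∼ u × u ≢ a × u ≢ b′ × (∀ {w} → G ∋ a′ ∼ w → w ≡ a ⊎ w ≡ b′ ⊎ w ≡ u)
          u-exists with nbrs₂ (subcubic g) (∼-sym G aa′) a′b′ (≢-sym b′≢a)
          ... | u , hu with _∼?_ G a′ u | u ≟ a | u ≟ b′
          ... | yes a′u | no u≢a | no u≢b′ = u , a′u , u≢a , u≢b′ , hu
          ... | no ¬a′u | _ | _ = ⊥-elim (not-path (a′b′ , ∼-sym G aa′ , b′≢a , λ w a′w → [ inj₂ , [ inj₁ , (λ where refl → contradiction a′w ¬a′u) ]′ ]′ (hu a′w)))
          ... | _ | yes refl | _ = ⊥-elim (not-path (a′b′ , ∼-sym G aa′ , b′≢a , λ w a′w → [ inj₂ , [ inj₁ , inj₂ ]′ ]′ (hu a′w)))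
          ... | _ | _ | yes refl = ⊥-elim (not-path (a′b′ , ∼-sym G aa′ , b′≢a , λ w a′w → [ inj₂ , [ inj₁ , inj₁ ]′ ]′ (hu a′w)))

          go : (∃ λ u → G ∋ a′ ∼ u × u ≢ a × u ≢ b′ × (∀ {w} → G ∋ a′ ∼ w → w ≡ a ⊎ w ≡ b′ ⊎ w ≡ u)) → Colorable L → Colorable G
          go (u , a′u , u≢a , u≢b′ , nbA′) (c , s) = finish
            where
              u≢pq = not-centre a′u a′≢a a′≢b a′≢p a′≢q
              b′u : G ∋ b′ ∼ u
              b′u = others-adjacent g (∼-sym G aa′) a′b′ a′u (≢-sym b′≢a) (≢-sym u≢a) (≢-sym u≢b′)
                      (a≁ b′≢p b′≢q (≢-sym a′≢b′)) (a≁ (proj₁ u≢pq) (proj₂ u≢pq) (≢-sym (∼⇒≢ G a′u)))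
              u≢b : u ≢ b
              u≢b refl = a′≢b′ (nbB ((∼-sym G a′u , b≢q , a′≢q) , b≢p , a′≢p))
              nbB′ = nbrs₃ (subcubic g) (∼-sym G bb′) (∼-sym G a′b′) b′u (≢-sym a′≢b) (≢-sym u≢b) (∼⇒≢ G a′u)
              U = nbrs₂ (subcubic g) (∼-sym G a′u) (∼-sym G b′u) a′≢b′
              u⁺ = proj₁ U
              inL : ∀ {v w} → G ∋ v ∼ w → v ≢ a → v ≢ b → v ≢ p → v ≢ q → w ≢ a → w ≢ b → L ∋ v ∼ w
              inL vw v≢a v≢b v≢p v≢q w≢a w≢b = let (w≢p , w≢q) = not-centre vw v≢a v≢b v≢p v≢q in
                (((vw , v≢q , w≢q) , v≢p , w≢p) , v≢b , w≢b) , v≢a , w≢a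
              k₁ = c a′ b′
              k₂ = c a′ u
              k₃ = c b′ u
              k₄ = c u u⁺
              k₃≢k₂ : k₃ ≢ k₂
              k₃≢k₂ e = incident s (inL (∼-sym G b′u) u≢a u≢b (proj₁ u≢pq) (proj₂ u≢pq) b′≢a b′≢b)
                                   (inL (∼-sym G a′u) u≢a u≢b (proj₁ u≢pq) (proj₂ u≢pq) a′≢a a′≢b) (≢-sym a′≢b′)
                                   (trans (symm s u b′) (trans e (symm s a′ u)))
              unA′ : ∀ {k} → k ≢ k₁ → k ≢ k₂ → Unused L c a′ k
              unA′ n₁ n₂ (v@(((a′w , _) , _) , _) , _ , w≢a) e with nbA′ a′w
              ... | inj₁ w≡a = w≢a w≡a
              ... | inj₂ (inj₁ refl) = n₁ (≡-sym e)
              ... | inj₂ (inj₂ refl) = n₂ (≡-sym e)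
              unB′ : ∀ {k} → k ≢ k₁ → k ≢ k₃ → Unused L c b′ k
              unB′ n₁ n₃ (((((b′w , _) , _) , _ , w≢b)) , _) e with nbB′ b′w
              ... | inj₁ w≡b = w≢b w≡b
              ... | inj₂ (inj₁ refl) = n₁ (trans (≡-sym e) (symm s b′ a′))
              ... | inj₂ (inj₂ refl) = n₃ (≡-sym e)
              unU : ∀ {k} → k ≢ k₂ → k ≢ k₃ → k ≢ k₄ → Unused L c u k
              unU n₂ n₃ n₄ ((((uw , _) , _) , _) , _) e with proj₂ U uw
              ... | inj₁ refl = n₂ (trans (≡-sym e) (symm s u a′))
              ... | inj₂ (inj₁ refl) = n₃ (trans (≡-sym e) (symm s u b′))
              ... | inj₂ (inj₂ refl) = n₄ (≡-sym e)
              freeA′ : ∀ {k} → All (k ≢_) (k₁ ∷ k₂ ∷ k₃ ∷ k₄ ∷ []) → Free L c a′ k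
              freeA′ (n₁ ∷ n₂ ∷ n₃ ∷ n₄ ∷ []) ((((a′w , _) , _) , _) , _ , w≢a) with nbA′ a′w
              ... | inj₁ w≡a = contradiction w≡a w≢a
              ... | inj₂ (inj₁ refl) = unB′ n₁ n₃
              ... | inj₂ (inj₂ refl) = unU n₂ n₃ n₄
              freeB′ : ∀ {k} → All (k ≢_) (k₁ ∷ k₂ ∷ k₃ ∷ k₄ ∷ []) → Free L c b′ k
              freeB′ (n₁ ∷ n₂ ∷ n₃ ∷ n₄ ∷ []) ((((b′w , _) , _) , _ , w≢b) , _) with nbB′ b′w
              ... | inj₁ w≡b = contradiction w≡b w≢b
              ... | inj₂ (inj₁ refl) = unA′ n₁ n₂
              ... | inj₂ (inj₂ refl) = unU n₂ n₃ n₄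

              a′L : ∀ {w} → G ∋ a′ ∼ w → w ≢ a → w ≢ b → L ∋ a′ ∼ w
              a′L a′w = inL a′w a′≢a a′≢b a′≢p a′≢q
              b′L : ∀ {w} → G ∋ b′ ∼ w → w ≢ a → w ≢ b → L ∋ b′ ∼ w
              b′L b′w = inL b′w b′≢a b′≢b b′≢p b′≢q
              k₂≢k₁ : k₂ ≢ k₁
              k₂≢k₁ = incident s (a′L a′u u≢a u≢b) (a′L a′b′ b′≢a b′≢b) u≢b′
              k₃≢k₁ : k₃ ≢ k₁
              k₃≢k₁ e = incident s (b′L b′u u≢a u≢b) (b′L (∼-sym G a′b′) a′≢a a′≢b) (≢-sym (∼⇒≢ G a′u)) (trans e (symm s a′ b′))

              finish : Colorable G
              finish with adjacentTipColors k₁ k₂ k₃ k₄ k₃≢k₂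
              ... | f , h , y , z , m , fs , hf ∷ hs , dis , hs′ , y₁ ∷ y₂ ∷ [] , m₁ ∷ m₃ ∷ [] =
                fill′ s (freeA′ fs) (toB (freeB′ hs) (not-a a′≢b′) (λ _ _ → ≢-sym hf)) dis hs′
                  (unA′ k₃≢k₁ k₃≢k₂) (unA′ y₁ y₂) (unB′ k₂≢k₁ (≢-sym k₃≢k₂)) (unB′ m₁ m₃)

      -- Here `a a′` and `b b′` do not see each other, so both can inherit the colour of the edge
      -- joining the tips. That leaves six colours for the diamond itself, enough for the greedy
      -- choice of `diamondColors`.
      separateTips : a′ ≢ b′ → ¬ G ∋ a′ ∼ b′ → Colorable G
      separateTips a′≢b′ ¬a′b′ = finish colored
        where
          J = join L a′ b′ a′≢b′
          awayA : ∀ {w} → L ∋ a′ ∼ w → w ≢ a × ¬ G ∋ a ∼ w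
          awayA ((((a′w , _ , w≢q) , _ , w≢p) , _) , _ , w≢a) = w≢a , λ aw → ∼⇒≢ G a′w (≡-sym (tipA aw w≢p w≢q))
          awayB : ∀ {w} → L ∋ b′ ∼ w → w ≢ b × ¬ G ∋ b ∼ w
          awayB ((((b′w , _ , w≢q) , _ , w≢p) , _ , w≢b) , _) = w≢b , λ bw → ∼⇒≢ G b′w (≡-sym (nbB ((bw , b≢q , w≢q) , b≢p , w≢p)))
          induced : ∀ {v s t} → L ∋ v ∼ s → L ∋ v ∼ t → G ∋ s ∼ t → L ∋ s ∼ t
          induced ((((_ , _ , s≢q) , _ , s≢p) , _ , s≢b) , _ , s≢a) ((((_ , _ , t≢q) , _ , t≢p) , _ , t≢b) , _ , t≢a) st =
            (((st , s≢q , t≢q) , s≢p , t≢p) , s≢b , t≢b) , s≢a , t≢a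
          twoA = two-beyond g L⊑G (∼-sym G aa′) (λ a′a → proj₁ (awayA a′a) refl)
          twoB = two-beyond g L⊑G (∼-sym G bb′) (λ b′b → proj₁ (awayB b′b) refl)
          Good-J : Good J
          Good-J = Good-join a′≢b′ Good-L (NoDoubleLink-⊑ L⊑G noDL) (clique-beyond g L⊑G (∼-sym G aa′) awayA induced)
            (clique-beyond g L⊑G (∼-sym G bb′) awayB induced) twoA twoB
          colored : Colorable J
          colored = below Good-J (join-⊏ a′≢b′ L⊑G (∼-sym G aa′) (∼-sym G bb′) (∼-sym G aq)
            (λ ((((_ , q≢q , _) , _) , _) , _) → q≢q refl) (≢-sym a′≢q) (≢-sym b′≢q))
          L⊑J : L ⊑ J
          L⊑J = incl inj₁
          ¬L : ¬ L ∋ a′ ∼ b′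
          ¬L e = ¬a′b′ (sub L⊑G e)

          finish : Colorable J → Colorable G
          finish (c , sJ) with diamondColors (c a′ b′) (c a′ (proj₁ twoA)) (c a′ (proj₁ (proj₂ twoA))) (c b′ (proj₁ twoB)) (c b′ (proj₁ (proj₂ twoB)))
          ... | x , y , z , l , m , dis , xs , ys , ls , ms =
            fill′ (Strong-⊑ L⊑J sJ) freeA (toB freeB (not-a a′≢b′) (λ { (((b′a′ , _) , _) , _) refl → contradiction (∼-sym G b′a′) ¬a′b′ }))
              dis (others dis) (un twoA xs) (un twoA ys) (un twoB ls) (un twoB ms)
            where
              freeA : Free L c a′ (c a′ b′)
              freeA = edge-free L⊑J sJ (inj₂ (inj₁ (refl , refl))) ¬L
              freeB : Free L c b′ (c a′ b′)
              freeB = subst (Free L c b′) (symm sJ b′ a′) (edge-free L⊑J sJ (inj₂ (inj₂ (refl , refl))) (λ e → ¬L (∼-sym L e)))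
              un : ∀ {v k} (t : AtMostTwo L v) → All (k ≢_) (c v (proj₁ t) ∷ c v (proj₁ (proj₂ t)) ∷ []) → Unused L c v k
              un (_ , _ , h) (n₁ ∷ n₂ ∷ []) vw e with h vw
              ... | inj₁ refl = n₁ (≡-sym e)
              ... | inj₂ refl = n₂ (≡-sym e)

    diamond : Colorable G
    diamond with _∼?_ G a b
    ... | yes ab = complete₄ ab
    ... | no ¬ab with third g noFlat ap aq pq | third g noFlat bp bq pq
    ... | a′ , aa′ , a′≢p , a′≢q , nbrsA | b′ , bb′ , b′≢p , b′≢q , nbrsB with a′ ≟ b′ | _∼?_ G a′ b′
    ... | yes e | _ = sharedTip ¬ab aa′ a′≢p a′≢q nbrsA bb′ b′≢p b′≢q nbrsB e
    ... | no ne | yes e = adjacentTips ¬ab aa′ a′≢p a′≢q nbrsA bb′ b′≢p b′≢q nbrsB ne e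
    ... | no ne | no ¬e = separateTips ¬ab aa′ a′≢p a′≢q nbrsA bb′ b′≢p b′≢q nbrsB ne ¬e

-- The colours `t₃`, `t₁`, `t₂` are meant for the edges `p₁ p₂`, `p p₂`, `p p₁` of the triangle next
-- to a vertex of degree 2. Besides `e₁`, `e₂`, `f`, the first avoids one more colour at `v₁` and
-- two at `v₂`; a second extra colour at `v₁` would leave nothing.
pathColors : ∀ e₁ e₂ f y a b → e₁ ≢ e₂ → f ≢ e₁ → f ≢ e₂ → ∃ λ t₃ → ∃ λ t₁ → ∃ λ t₂ →
  Distinct (t₃ ∷ t₁ ∷ t₂ ∷ e₂ ∷ e₁ ∷ f ∷ []) × All (t₃ ≢_) (y ∷ a ∷ b ∷ []) × All (t₁ ≢_) (a ∷ b ∷ []) × t₂ ≢ y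
pathColors e₁ e₂ f y a b e₁≢e₂ f≢e₁ f≢e₂ with fresh (e₁ ∷ e₂ ∷ f ∷ y ∷ a ∷ b ∷ [])
... | t₃ , t₃e₁ ∷ t₃e₂ ∷ t₃f ∷ t₃s with fresh (t₃ ∷ e₁ ∷ e₂ ∷ f ∷ a ∷ b ∷ [])
... | t₁ , t₁t₃ ∷ t₁e₁ ∷ t₁e₂ ∷ t₁f ∷ t₁s with fresh (t₁ ∷ t₃ ∷ e₁ ∷ e₂ ∷ f ∷ y ∷ [])
... | t₂ , t₂t₁ ∷ t₂t₃ ∷ t₂e₁ ∷ t₂e₂ ∷ t₂f ∷ t₂y ∷ [] = t₃ , t₁ , t₂ ,
  (≢-sym t₁t₃ ∷ ≢-sym t₂t₃ ∷ t₃e₂ ∷ t₃e₁ ∷ t₃f ∷ []) ∷ (≢-sym t₂t₁ ∷ t₁e₂ ∷ t₁e₁ ∷ t₁f ∷ []) ∷ (t₂e₂ ∷ t₂e₁ ∷ t₂f ∷ []) ∷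
  (≢-sym e₁≢e₂ ∷ ≢-sym f≢e₂ ∷ []) ∷ (≢-sym f≢e₁ ∷ []) ∷ [] ∷ [] , t₃s , t₁s , t₂y

-- Vertices of degree 2

module _ {n : ℕ} where

  private
    V = Fin n

  NoLeaf NoAdjacentPaths NoDiamond : Graph n → Set
  NoLeaf G = ∀ {v x} → ¬ Only₁ G v x
  NoAdjacentPaths G = ∀ {v x y z} → Only₂ G v x y → ¬ Only₂ G x v z
  NoDiamond G = ∀ {a b p q} → ¬ Diamond G a b p q

  swap₂ : ∀ {G : Graph n} {v x y} → Only₂ G v x y → Only₂ G v y x
  swap₂ (vx , vy , x≢y , h) = vy , vx , ≢-sym x≢y , λ w vw → [ inj₂ , inj₁ ]′ (h w vw)

  -- The colour `f` is meant for `w p` and must not occur at `q`. A colour found at `v` never does,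
  -- because the joining edge separates the colours at its two ends; and since the triangle edges
  -- avoid `f` in any case, only one further colour `y` at `v` constrains them. If `v` has at most
  -- one edge left, a fresh `f` will do.
  split-color : ∀ {L J : Graph n} {c v q e₁} e₂ → L ⊑ J → Strong J c → J ∋ v ∼ q → ¬ L ∋ v ∼ q → Free L c v e₁ → AtMostTwo L q →
    (∃ λ r → ∀ {w} → L ∋ v ∼ w → w ≡ r) ⊎ (∃ λ a → ∃ λ b → L ∋ v ∼ a × L ∋ v ∼ b × a ≢ b × (∀ {w} → L ∋ v ∼ w → w ≡ a ⊎ w ≡ b)) →
    ∃ λ f → ∃ λ y → f ≢ e₁ × f ≢ e₂ × Unused L c q f × (∀ {k} → k ≢ e₂ → k ≢ f → k ≢ y → Unused L c v k)
  split-color {c = c} {v} {q} {e₁} e₂ _ _ _ _ _ (q₁ , q₂ , hq) (inj₁ (r , h)) with fresh (e₁ ∷ e₂ ∷ c q q₁ ∷ c q q₂ ∷ [])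
  ... | f , fe₁ ∷ fe₂ ∷ f₁ ∷ f₂ ∷ [] = f , c v r , fe₁ , fe₂ ,
    (λ qx e → [ (λ where refl → f₁ (≡-sym e)) , (λ where refl → f₂ (≡-sym e)) ]′ (hq qx)) ,
    λ _ _ k≢ vx e → k≢ (trans (≡-sym e) (cong (c v) (h vx)))
  split-color {L} {J} {c} {v} {q} {e₁} e₂ L⊑J sJ vq ¬L free _ (inj₂ (a , b , va , vb , a≢b , h)) = decide (c v a ≟ e₂)
    where
      used : ∀ {x} → L ∋ v ∼ x → c v x ≢ e₁
      used vx e = free vx (∼-sym L vx) (trans (symm sJ _ _) e)
      decide : Dec (c v a ≡ e₂) → ∃ λ f → ∃ λ y → f ≢ e₁ × f ≢ e₂ × Unused L c q f × (∀ {k} → k ≢ e₂ → k ≢ f → k ≢ y → Unused L c v k)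
      decide (no a≢) = c v a , c v b , used va , a≢ , (λ qx e → edge-separates L⊑J sJ vq ¬L va qx (≡-sym e)) ,
        λ _ ka kb vx e → [ (λ where refl → ka (≡-sym e)) , (λ where refl → kb (≡-sym e)) ]′ (h vx)
      -- One of the two colours at `v` is `e₂`, which is avoided anyway, so `f` is the other and `y`
      -- merely repeats it.
      decide (yes a≡) = c v b , c v b , used vb , (λ e → incident sJ (sub L⊑J va) (sub L⊑J vb) a≢b (trans a≡ (≡-sym e))) ,
        (λ qx e → edge-separates L⊑J sJ vq ¬L vb qx (≡-sym e)) ,
        λ k₂ kb _ vx e → [ (λ where refl → k₂ (trans (≡-sym e) a≡)) , (λ where refl → kb (≡-sym e)) ]′ (h vx)

  -- The edge `p₁ v₁` inherits the colour `c₀` of the joining edge unless `p₂ v₂` already has it.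
  -- Either way `c₀` is one of `e₁`, `e₂`, hence different from every colour at `p`, and can be used
  -- for `w q` as well.
  first-color : ∀ {L : Graph n} {c v} c₀ e₂ → Free L c v c₀ →
    (∃ λ k₁ → ∃ λ k₂ → ∃ λ k₃ → ∃ λ k₄ → ∃ λ k₅ → ∀ {k} → All (k ≢_) (k₁ ∷ k₂ ∷ k₃ ∷ k₄ ∷ k₅ ∷ []) → Free L c v k) →
    ∃ λ e₁ → e₁ ≢ e₂ × (c₀ ≡ e₁ ⊎ c₀ ≡ e₂) × Free L c v e₁
  first-color c₀ e₂ free₀ (k₁ , k₂ , k₃ , k₄ , k₅ , free) with c₀ ≟ e₂
  ... | no c₀≢e₂ = c₀ , c₀≢e₂ , inj₁ refl , free₀
  ... | yes c₀≡e₂ with fresh (e₂ ∷ k₁ ∷ k₂ ∷ k₃ ∷ k₄ ∷ k₅ ∷ [])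
  ... | e₁ , e₁≢e₂ ∷ avoids = e₁ , e₁≢e₂ , inj₂ c₀≡e₂ , free avoids

  module _ {G : Graph n} (g : Good G) (below : Below G) (noLeaf : NoLeaf G) (noFlat : NoFlatPath G)
    (noAdj : NoAdjacentPaths G) (noDL : NoDoubleLink G) (noDiamond : NoDiamond G) where

    private
      three : ∀ {v w u} → Only₂ G w v u → ∃ λ s → ∃ λ t → G ∋ v ∼ s × G ∋ v ∼ t × s ≢ w × t ≢ w × s ≢ t
      three {v} {w} o@(wv , _) with rest g (del-⊑ G w) (∼-sym G wv) (λ (_ , _ , w≢w) → w≢w refl)
      ... | two vs vt s≢w t≢w s≢t _ = _ , _ , vs , vt , s≢w , t≢w , s≢t
      ... | one r h with _∼?_ G v r | r ≟ w
      ... | yes vr | no r≢w = ⊥-elim (noAdj o (∼-sym G wv , vr , ≢-sym r≢w , nb))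
        where
          nb : ∀ x → G ∋ v ∼ x → x ≡ w ⊎ x ≡ r
          nb x vx with x ≟ w
          ... | yes x≡w = inj₁ x≡w
          ... | no x≢w = inj₂ (h (vx , ∼⇒≢ G (∼-sym G wv) , x≢w))
      ... | no ¬vr | _ = ⊥-elim (noLeaf (∼-sym G wv , nb))
        where
          nb : ∀ x → G ∋ v ∼ x → x ≡ w
          nb x vx with x ≟ w
          ... | yes x≡w = x≡w
          ... | no x≢w = contradiction (subst (λ z → G ∋ v ∼ z) (h (vx , ∼⇒≢ G (∼-sym G wv) , x≢w)) vx) ¬vr
      ... | yes _ | yes refl = ⊥-elim (noLeaf (∼-sym G wv , nb))
        where
          nb : ∀ x → G ∋ v ∼ x → x ≡ w
          nb x vx with x ≟ w
          ... | yes x≡w = x≡w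
          ... | no x≢w = h (vx , ∼⇒≢ G (∼-sym G wv) , x≢w)

    module _ {w p q : V} (o : Only₂ G w p q) where

      private
        wp = proj₁ o
        wq = proj₁ (proj₂ o)
        p≢q = proj₁ (proj₂ (proj₂ o))
        onlyW = proj₂ (proj₂ (proj₂ o))
        ¬pq : ¬ G ∋ p ∼ q
        ¬pq = noFlat o
        w≁ : ∀ {x} → x ≢ p → x ≢ q → ¬ G ∋ w ∼ x
        w≁ x≢p x≢q wx = [ x≢p , x≢q ]′ (onlyW _ wx)

      -- The triangle p p₁ p₂ loses p₁ and p; the outer neighbour v₁ of p₁ gets joined to q.
      module _ {p₁ p₂ v₁ v₂ : V} (pp₁ : G ∋ p ∼ p₁) (pp₂ : G ∋ p ∼ p₂) (p₁≢w : p₁ ≢ w) (p₂≢w : p₂ ≢ w) (p₁p₂ : G ∋ p₁ ∼ p₂)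
        (p₁v₁ : G ∋ p₁ ∼ v₁) (v₁≢p : v₁ ≢ p) (v₁≢p₂ : v₁ ≢ p₂) (nbP₁ : ∀ {x} → G ∋ p₁ ∼ x → x ≡ p ⊎ x ≡ p₂ ⊎ x ≡ v₁)
        (p₂v₂ : G ∋ p₂ ∼ v₂) (v₂≢p : v₂ ≢ p) (v₂≢p₁ : v₂ ≢ p₁) (nbP₂ : ∀ {x} → G ∋ p₂ ∼ x → x ≡ p ⊎ x ≡ p₁ ⊎ x ≡ v₂) where

        private
          p₁≢p₂ = ∼⇒≢ G p₁p₂
          p₁≢q : p₁ ≢ q
          p₁≢q refl = ¬pq pp₁
          p₂≢q : p₂ ≢ q
          p₂≢q refl = ¬pq pp₂
          p₁≢p = ≢-sym (∼⇒≢ G pp₁)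
          p₂≢p = ≢-sym (∼⇒≢ G pp₂)
          nbP : ∀ {x} → G ∋ p ∼ x → x ≡ w ⊎ x ≡ p₁ ⊎ x ≡ p₂
          nbP = nbrs₃ (subcubic g) (∼-sym G wp) pp₁ pp₂ (≢-sym p₁≢w) (≢-sym p₂≢w) p₁≢p₂
          v₁≢w : v₁ ≢ w
          v₁≢w refl = w≁ p₁≢p p₁≢q (∼-sym G p₁v₁)
          v₂≢w : v₂ ≢ w
          v₂≢w refl = w≁ p₂≢p p₂≢q (∼-sym G p₂v₂)
          v₁≢v₂ : v₁ ≢ v₂
          v₁≢v₂ e = noDiamond ((p₁p₂ , pp₁ , pp₂) , ∼-sym G p₁v₁ , subst (λ z → G ∋ z ∼ p₂) (≡-sym e) (∼-sym G p₂v₂) , ≢-sym v₁≢p)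

        -- Otherwise `q` is the outer neighbour `v₁`. Claw-freeness at `q`, applied to `w`, `p₁` and
        -- a third neighbour `r`, makes `r` adjacent to `p₁`; then `r` can only be `p₂`, which gives
        -- a diamond.
        q≁p₁ : ¬ G ∋ q ∼ p₁
        q≁p₁ qp₁ with three (swap₂ {G} o)
        ... | s , t , qs , qt , s≢w , t≢w , s≢t = cases (nbrs₃ (subcubic g) qs (∼-sym G wq) qt s≢w s≢t (≢-sym t≢w) qp₁)
          where
            q≡v₁ : q ≡ v₁
            q≡v₁ with nbP₁ (∼-sym G qp₁)
            ... | inj₁ q≡p = contradiction (≡-sym q≡p) p≢q
            ... | inj₂ (inj₁ q≡p₂) = contradiction (≡-sym q≡p₂) p₂≢q
            ... | inj₂ (inj₂ e) = e
            use : ∀ {r} → G ∋ q ∼ r → r ≢ w → r ≢ p₁ → ⊥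
            use {r} qr r≢w r≢p₁ = last (nbP₁ p₁r)
              where
                r≢p : r ≢ p
                r≢p refl = ¬pq (∼-sym G qr)
                p₁r : G ∋ p₁ ∼ r
                p₁r = others-adjacent g (∼-sym G wq) qp₁ qr (≢-sym p₁≢w) (≢-sym r≢w) (≢-sym r≢p₁)
                        (w≁ p₁≢p p₁≢q) (w≁ r≢p (≢-sym (∼⇒≢ G qr)))
                last : r ≡ p ⊎ r ≡ p₂ ⊎ r ≡ v₁ → ⊥
                last (inj₁ e) = r≢p e
                last (inj₂ (inj₁ refl)) = noDiamond ((p₁p₂ , pp₁ , pp₂) , qp₁ , qr , p≢q)
                last (inj₂ (inj₂ e)) = ∼⇒≢ G qr (trans q≡v₁ (≡-sym e))
            cases : p₁ ≡ s ⊎ p₁ ≡ w ⊎ p₁ ≡ t → ⊥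
            cases (inj₁ refl) = use qt t≢w (≢-sym s≢t)
            cases (inj₂ (inj₁ e)) = p₁≢w e
            cases (inj₂ (inj₂ refl)) = use qs s≢w s≢t

        v₁≢q : v₁ ≢ q
        v₁≢q e = q≁p₁ (∼-sym G (subst (λ z → G ∋ p₁ ∼ z) e p₁v₁))

        -- Guarantees that at least one of `v₁`, `v₂` can be joined to `q`: otherwise claw-freeness
        -- at `q` makes `q v₁ v₂` a triangle linked twice to `p p₁ p₂`.
        doubly-linked : G ∋ q ∼ v₁ → G ∋ q ∼ v₂ → ⊥
        doubly-linked qv₁ qv₂ = noDL ((pp₁ , pp₂ , p₁p₂) , (qv₁ , qv₂ , v₁v₂) , p₁v₁ , p₂v₂ ,
          (p≢q ∷ ≢-sym v₁≢p ∷ ≢-sym v₂≢p ∷ []) ∷ (p₁≢q ∷ ∼⇒≢ G p₁v₁ ∷ ≢-sym v₂≢p₁ ∷ []) ∷ (p₂≢q ∷ ≢-sym v₁≢p₂ ∷ ∼⇒≢ G p₂v₂ ∷ []) ∷ [])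
          where
            v₁v₂ = others-adjacent g (∼-sym G wq) qv₁ qv₂ (≢-sym v₁≢w) (≢-sym v₂≢w) v₁≢v₂
                     (w≁ v₁≢p (≢-sym (∼⇒≢ G qv₁))) (w≁ v₂≢p (≢-sym (∼⇒≢ G qv₂)))

        module _ (q≁p₂ : ¬ G ∋ q ∼ p₂) (q≁v₁ : ¬ G ∋ q ∼ v₁) where

          private
            G₁ = del G w
            L = del² G₁ p p₁
            J = join L v₁ q v₁≢q
            L⊑G : L ⊑ G
            L⊑G = ⊑-trans (⊑-trans (del-⊑ (del G₁ p) p₁) (del-⊑ G₁ p)) (del-⊑ G w)
            L⊑J : L ⊑ J
            L⊑J = incl inj₁
            Good-L : Good L
            Good-L = Good-del (Good-del (Good-del g w) p) p₁
            awayV₁ : ∀ {x} → L ∋ v₁ ∼ x → x ≢ p₁ × ¬ G ∋ p₁ ∼ x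
            awayV₁ {x} (((v₁x , _) , _ , x≢p) , _ , x≢p₁) = x≢p₁ , λ p₁x → far (nbP₁ p₁x)
              where
                far : x ≡ p ⊎ x ≡ p₂ ⊎ x ≡ v₁ → ⊥
                far (inj₁ e) = x≢p e
                far (inj₂ (inj₁ refl)) = noDiamond ((p₁p₂ , pp₁ , pp₂) , ∼-sym G p₁v₁ , v₁x , ≢-sym v₁≢p)
                far (inj₂ (inj₂ e)) = ∼⇒≢ G v₁x (≡-sym e)
            awayQ : ∀ {x} → L ∋ q ∼ x → x ≢ w × ¬ G ∋ w ∼ x
            awayQ (((qx , _ , x≢w) , _ , x≢p) , _) = x≢w , w≁ x≢p (≢-sym (∼⇒≢ G qx))
            induced : ∀ {v s t} → L ∋ v ∼ s → L ∋ v ∼ t → G ∋ s ∼ t → L ∋ s ∼ t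
            induced (((_ , _ , s≢w) , _ , s≢p) , _ , s≢p₁) (((_ , _ , t≢w) , _ , t≢p) , _ , t≢p₁) st =
              ((st , s≢w , t≢w) , s≢p , t≢p) , s≢p₁ , t≢p₁
            inL : ∀ {u v} → G ∋ u ∼ v → u ≢ w → u ≢ p → u ≢ p₁ → v ≢ w → v ≢ p → v ≢ p₁ → L ∋ u ∼ v
            inL uv u≢w u≢p u≢p₁ v≢w v≢p v≢p₁ = ((uv , u≢w , v≢w) , u≢p , v≢p) , u≢p₁ , v≢p₁
            colored : Colorable J
            colored = below
              (Good-join v₁≢q Good-L (NoDoubleLink-⊑ L⊑G noDL) (clique-beyond g L⊑G (∼-sym G p₁v₁) awayV₁ induced)
                (clique-beyond g L⊑G (∼-sym G wq) awayQ induced)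
                (two-beyond g L⊑G (∼-sym G p₁v₁) (λ e → proj₁ (awayV₁ e) refl)) (two-beyond g L⊑G (∼-sym G wq) (λ e → proj₁ (awayQ e) refl)))
              (join-⊏ v₁≢q L⊑G (∼-sym G p₁v₁) (∼-sym G wq) wp (λ (((_ , w≢w , _) , _) , _) → w≢w refl) (≢-sym v₁≢w) (∼⇒≢ G wq))

          private
           module _ {c : V → V → Color} (sJ : Strong J c) where

              s : Strong L c
              s = Strong-⊑ L⊑J sJ
              c₀ = c v₁ q
              e₂ = c p₂ v₂
              ¬L : ¬ L ∋ v₁ ∼ q
              ¬L e = q≁v₁ (∼-sym G (sub L⊑G e))
              jn : J ∋ v₁ ∼ q
              jn = inj₂ (inj₁ (refl , refl))
              free₁ : Free L c v₁ c₀
              free₁ = edge-free L⊑J sJ jn ¬L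
              freeQ : Free L c q c₀
              freeQ = subst (Free L c q) (symm sJ q v₁) (edge-free L⊑J sJ (inj₂ (inj₂ (refl , refl))) (λ e → ¬L (∼-sym L e)))

              First : Set
              First = ∃ λ e₁ → e₁ ≢ e₂ × (c₀ ≡ e₁ ⊎ c₀ ≡ e₂) × Free L c v₁ e₁
              away-G : ∀ {x} → G ∋ v₁ ∼ x → ¬ G ∋ p₁ ∼ x
              away-G v₁x p₁x with nbP₁ p₁x
              ... | inj₁ refl = [ v₁≢w , [ (λ e → ∼⇒≢ G p₁v₁ (≡-sym e)) , v₁≢p₂ ]′ ]′ (nbP (∼-sym G v₁x))
              ... | inj₂ (inj₁ refl) = noDiamond ((p₁p₂ , pp₁ , pp₂) , ∼-sym G p₁v₁ , v₁x , ≢-sym v₁≢p)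
              ... | inj₂ (inj₂ refl) = ∼-irr G v₁x
              first : First
              first = first-color {L} c₀ e₂ free₁ (legColors g {K = L} L⊑G (symm s) (∼-sym G p₁v₁) (λ e → proj₁ (awayV₁ e) refl) away-G)

              Second : Color → Set
              Second e₁ = ∃ λ f → ∃ λ y → f ≢ e₁ × f ≢ e₂ × Unused L c q f × (∀ {k} → k ≢ e₂ → k ≢ f → k ≢ y → Unused L c v₁ k)
              inner : ∀ {x} → G ∋ v₁ ∼ x → x ≢ p₁ → L ∋ v₁ ∼ x
              inner v₁x x≢p₁ = inL v₁x v₁≢w v₁≢p (≢-sym (∼⇒≢ G p₁v₁)) (λ where refl → w≁ v₁≢p v₁≢q (∼-sym G v₁x))
                (λ where refl → [ v₁≢w , [ (λ e → ∼⇒≢ G p₁v₁ (≡-sym e)) , v₁≢p₂ ]′ ]′ (nbP (∼-sym G v₁x))) x≢p₁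
              shape : Rest g L p₁ v₁ → (∃ λ r → ∀ {x} → L ∋ v₁ ∼ x → x ≡ r) ⊎ (∃ λ a → ∃ λ b → L ∋ v₁ ∼ a × L ∋ v₁ ∼ b × a ≢ b × (∀ {x} → L ∋ v₁ ∼ x → x ≡ a ⊎ x ≡ b))
              shape (one r h) = inj₁ (r , h)
              shape (two v₁a v₁b a≢p₁ b≢p₁ a≢b h) = inj₂ (_ , _ , inner v₁a a≢p₁ , inner v₁b b≢p₁ , a≢b , h)
              second : ((e₁ , _) : First) → Second e₁
              second (e₁ , _ , _ , freeE₁) = split-color e₂ L⊑J sJ jn ¬L freeE₁
                (two-beyond g L⊑G (∼-sym G wq) (λ e → proj₁ (awayQ e) refl)) (shape (rest g L⊑G (∼-sym G p₁v₁) (λ e → proj₁ (awayV₁ e) refl)))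

              finish : Colorable G
              finish = go first (second first) (nbrs₁ (subcubic g) (∼-sym G p₂v₂))
                where
                  go : ((e₁ , _) : First) → Second e₁ → (∃ λ a → ∃ λ b → ∀ {x} → G ∋ v₂ ∼ x → x ≡ p₂ ⊎ x ≡ a ⊎ x ≡ b) → Colorable G
                  go (e₁ , e₁≢e₂ , c₀∈ , freeE₁) (f , y , f≢e₁ , f≢e₂ , unQ , un₁) (a , b , hv₂)
                    with pathColors e₁ e₂ f y (c v₂ a) (c v₂ b) e₁≢e₂ f≢e₁ f≢e₂
                  ... | t₃ , t₁ , t₂ , dis@((_ ∷ _ ∷ t₃e₂ ∷ _ ∷ t₃f ∷ []) ∷ (_ ∷ t₁e₂ ∷ t₁e₁ ∷ t₁f ∷ []) ∷ (t₂e₂ ∷ t₂e₁ ∷ t₂f ∷ []) ∷ _) , t₃y ∷ t₃a ∷ t₃b ∷ [] , t₁a ∷ t₁b ∷ [] , t₂y =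
                    -- The edge `w p` gets the colour `f` reserved at `p`, and `w q` gets the colour
                    -- of the joining edge.
                    addTwo G p≢q onlyW (AddPair.strong R) f≢c₀ freeP freeQ′ unQ′ unP
                    where
                      un₂ : ∀ {k} → k ≢ e₂ → k ≢ c v₂ a → k ≢ c v₂ b → Unused L c v₂ k
                      un₂ k₂ ka kb v₂x e with hv₂ (sub L⊑G v₂x)
                      ... | inj₁ refl = k₂ (trans (≡-sym e) (symm s _ _))
                      ... | inj₂ (inj₁ refl) = ka (≡-sym e)
                      ... | inj₂ (inj₂ refl) = kb (≡-sym e)
                      nb-p₂ : ∀ {x} → L ∋ p₂ ∼ x → c p₂ x ≡ e₂ × Unused L c x t₃ × Unused L c x t₁
                      nb-p₂ (((p₂x , _) , _ , x≢p) , _ , x≢p₁) with nbP₂ p₂x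
                      ... | inj₁ e = contradiction e x≢p
                      ... | inj₂ (inj₁ e) = contradiction e x≢p₁
                      ... | inj₂ (inj₂ refl) = refl , un₂ t₃e₂ t₃a t₃b , un₂ t₁e₂ t₁a t₁b
                      nb-p₁ : ∀ {x} → G₁ ∋ p₁ ∼ x → x ≡ p₂ ⊎ x ≡ p ⊎ (x ≡ v₁ × Addable L c x e₁ t₃ t₂)
                      nb-p₁ (p₁x , _) with nbP₁ p₁x
                      ... | inj₁ e = inj₂ (inj₁ e)
                      ... | inj₂ (inj₁ e) = inj₁ e
                      ... | inj₂ (inj₂ refl) = inj₂ (inj₂ (refl , addable freeE₁ (un₁ t₃e₂ t₃f t₃y) (un₁ t₂e₂ t₂f t₂y)))
                      nb-p : ∀ {x} → G₁ ∋ p ∼ x → x ≡ p₂ ⊎ x ≡ p₁ ⊎ (x ≡ w × Addable L c x f t₁ t₂)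
                      nb-p (px , _ , x≢w) with nbP px
                      ... | inj₁ e = contradiction e x≢w
                      ... | inj₂ (inj₁ e) = inj₂ (inj₁ e)
                      ... | inj₂ (inj₂ e) = inj₁ e
                      p≢w = ≢-sym (∼⇒≢ G wp)
                      R : AddPair G₁ p₂ p₁ p c t₃ t₁ t₂ e₂ e₁ f
                      R = addPair G₁ (∼-sym G p₁p₂ , p₂≢w , p₁≢w) (∼-sym G pp₂ , p₂≢w , p≢w) (∼-sym G pp₁ , p₁≢w , p≢w) s v₁ w
                        dis nb-p₂ nb-p₁ nb-p
                      c′ = AddPair.coloring R
                      c₀≢ : ∀ {k} → k ≢ e₁ → k ≢ e₂ → k ≢ c₀
                      c₀≢ k₁ k₂ e = [ (λ e′ → k₁ (trans e e′)) , (λ e′ → k₂ (trans e e′)) ]′ c₀∈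
                      f≢c₀ = c₀≢ f≢e₁ f≢e₂
                      freeP : Free G₁ c′ p f
                      freeP (px , _ , x≢w) with nbP px
                      ... | inj₁ e = contradiction e x≢w
                      ... | inj₂ (inj₁ refl) = AddPair.at-b R f≢e₁ (≢-sym t₃f) (≢-sym t₂f)
                      ... | inj₂ (inj₂ refl) = AddPair.at-a R f≢e₂ (≢-sym t₃f) (≢-sym t₁f)
                      q≢w = ≢-sym (∼⇒≢ G wq)
                      freeQ′ : Free G₁ c′ q c₀
                      freeQ′ {x} (qx , _ , x≢w) = AddPair.at-old R (λ where refl → q≁p₂ qx) x≢p₁ x≢p
                          (freeQ (inL qx q≢w (≢-sym p≢q) (≢-sym p₁≢q) x≢w x≢p x≢p₁)) (λ (p₁x , _) → ⊥-elim (far (nbP₁ p₁x))) (λ _ → ≢-sym f≢c₀)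
                        where
                          x≢p : x ≢ p
                          x≢p refl = ¬pq (∼-sym G qx)
                          x≢p₁ : x ≢ p₁
                          x≢p₁ refl = q≁p₁ qx
                          far : x ≡ p ⊎ x ≡ p₂ ⊎ x ≡ v₁ → ⊥
                          far (inj₁ e) = x≢p e
                          far (inj₂ (inj₁ refl)) = q≁p₂ qx
                          far (inj₂ (inj₂ refl)) = q≁v₁ qx
                      unQ′ : Unused G₁ c′ q f
                      unQ′ = AddPair.at-old R (≢-sym p₂≢q) (≢-sym p₁≢q) (≢-sym p≢q) unQ (λ (p₁q , _) → ⊥-elim (q≁p₁ (∼-sym G p₁q))) (λ (pq , _) → ⊥-elim (¬pq pq))
                      unP : Unused G₁ c′ p c₀
                      unP = AddPair.at-d R (≢-sym f≢c₀) (≢-sym (c₀≢ t₁e₁ t₁e₂)) (≢-sym (c₀≢ t₂e₁ t₂e₂))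

          splitPath : Colorable G
          splitPath = finish (proj₂ colored)

      pathVertex : Colorable G
      pathVertex with three o
      ... | p₁ , p₂ , pp₁ , pp₂ , p₁≢w , p₂≢w , p₁≢p₂
        with others-adjacent g (∼-sym G wp) pp₁ pp₂ (≢-sym p₁≢w) (≢-sym p₂≢w) p₁≢p₂
               (w≁ (≢-sym (∼⇒≢ G pp₁)) (λ where refl → ¬pq pp₁)) (w≁ (≢-sym (∼⇒≢ G pp₂)) (λ where refl → ¬pq pp₂))
      ... | p₁p₂ with third g noFlat (∼-sym G pp₁) p₁p₂ pp₂ | third g noFlat (∼-sym G pp₂) (∼-sym G p₁p₂) pp₁
      ... | v₁ , p₁v₁ , v₁≢p , v₁≢p₂ , nbP₁ | v₂ , p₂v₂ , v₂≢p , v₂≢p₁ , nbP₂ with _∼?_ G q v₁ | _∼?_ G q v₂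
      ... | no q≁v₁ | _ = splitPath pp₁ pp₂ p₁≢w p₂≢w p₁p₂ p₁v₁ v₁≢p v₁≢p₂ nbP₁ p₂v₂ v₂≢p v₂≢p₁ nbP₂
            (q≁p₁ pp₂ pp₁ p₂≢w p₁≢w (∼-sym G p₁p₂) p₂v₂ v₂≢p v₂≢p₁ nbP₂ p₁v₁ v₁≢p v₁≢p₂ nbP₁) q≁v₁
      ... | yes _ | no q≁v₂ = splitPath pp₂ pp₁ p₂≢w p₁≢w (∼-sym G p₁p₂) p₂v₂ v₂≢p v₂≢p₁ nbP₂ p₁v₁ v₁≢p v₁≢p₂ nbP₁
            (q≁p₁ pp₁ pp₂ p₁≢w p₂≢w p₁p₂ p₁v₁ v₁≢p v₁≢p₂ nbP₁ p₂v₂ v₂≢p v₂≢p₁ nbP₂) q≁v₂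
      ... | yes qv₁ | yes qv₂ = ⊥-elim (doubly-linked pp₁ pp₂ p₁≢w p₂≢w p₁p₂ p₁v₁ v₁≢p v₁≢p₂ nbP₁ p₂v₂ v₂≢p v₂≢p₁ nbP₂ qv₁ qv₂)

-- Exhaustive search

allᵇ : ∀ {n} → (Fin n → Bool) → Bool
allᵇ {zero}  p = true
allᵇ {suc n} p = p zero ∧ allᵇ (p ∘ suc)

allᵇ-sound : ∀ {n} (p : Fin n → Bool) → allᵇ p ≡ true → ∀ i → p i ≡ true
allᵇ-sound {suc n} p e i with p zero in eq
allᵇ-sound {suc n} p e zero    | true = eq
allᵇ-sound {suc n} p e (suc i) | true = allᵇ-sound (p ∘ suc) e i

infix 4 _≠ᵇ_ _<ᵇ_

_≠ᵇ_ _<ᵇ_ : ∀ {n} → Fin n → Fin n → Bool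
zero  ≠ᵇ zero  = false
zero  ≠ᵇ suc j = true
suc i ≠ᵇ zero  = true
suc i ≠ᵇ suc j = i ≠ᵇ j
i     <ᵇ zero  = false
zero  <ᵇ suc j = true
suc i <ᵇ suc j = i <ᵇ j

≠ᵇ-complete : ∀ {n} {i j : Fin n} → i ≢ j → (i ≠ᵇ j) ≡ true
≠ᵇ-complete {i = zero}  {zero}  i≢j = contradiction refl i≢j
≠ᵇ-complete {i = zero}  {suc j} i≢j = refl
≠ᵇ-complete {i = suc i} {zero}  i≢j = refl
≠ᵇ-complete {i = suc i} {suc j} i≢j = ≠ᵇ-complete (i≢j ∘ cong suc)

≠ᵇ-sound : ∀ {n} {i j : Fin n} → (i ≠ᵇ j) ≡ true → i ≢ j
≠ᵇ-sound {i = suc i} e refl = ≠ᵇ-sound {i = i} e refl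

<ᵇ-total : ∀ {n} {i j : Fin n} → i ≢ j → (i <ᵇ j) ≡ true ⊎ (j <ᵇ i) ≡ true
<ᵇ-total {i = zero}  {zero}  i≢j = contradiction refl i≢j
<ᵇ-total {i = zero}  {suc j} i≢j = inj₁ refl
<ᵇ-total {i = suc i} {zero}  i≢j = inj₂ refl
<ᵇ-total {i = suc i} {suc j} i≢j = <ᵇ-total (i≢j ∘ cong suc)

guard : Bool → Bool → Bool
guard b x = if b then x else true

guard-sound : ∀ {b x} → guard b x ≡ true → b ≡ true → x ≡ true
guard-sound e refl = e

avoids : Color → List Color → Bool
avoids k []       = true
avoids k (x ∷ xs) = if k ≠ᵇ x then avoids k xs else false

_orElse_ : ∀ {A : Set} → Maybe A → Maybe A → Maybe A
just x  orElse m = just x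
nothing orElse m = m

firstFin : ∀ {A : Set} {n} → (Fin n → Maybe A) → Maybe A
firstFin {n = zero}  f = nothing
firstFin {n = suc n} f = f zero orElse firstFin (f ∘ suc)

-- The continuation `f` may fail, and then the next colour is tried; nested picks therefore
-- backtrack.
pick : ∀ {A : Set} → List Color → (Color → Maybe A) → Maybe A
pick xs f = firstFin λ k → if avoids k xs then f k else nothing

-- The searches need no correctness proof: whatever they return is tested, and only this test
-- provides evidence.
verify : ∀ {A : Set} {P : A → Set} → (∀ a → Dec (P a)) → Maybe A → Bool
verify P? nothing  = false
verify P? (just a) = does (P? a)

verify-sound : ∀ {A : Set} {P : A → Set} (P? : ∀ a → Dec (P a)) m → verify P? m ≡ true → ∃ P
verify-sound P? (just a) e with P? a
... | yes p = a , p

avoids-reflects : ∀ k xs → Reflects (All (k ≢_) xs) (avoids k xs)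
avoids-reflects k []       = ofʸ []
avoids-reflects k (x ∷ xs) with k ≠ᵇ x in eq
... | false = ofⁿ λ { (k≢ ∷ _) → contradiction (trans (≡-sym (≠ᵇ-complete k≢)) eq) λ () }
... | true with avoids k xs | avoids-reflects k xs
...   | true  | ofʸ h = ofʸ (≠ᵇ-sound eq ∷ h)
...   | false | ofⁿ h = ofⁿ λ { (_ ∷ ks) → h ks }

-- Unlike a test assembled from _≟_, this one computes its Boolean without touching proofs.
avoids? : ∀ (k : Color) xs → Dec (All (k ≢_) xs)
avoids? k xs = avoids k xs because avoids-reflects k xs

distinct? : ∀ xs → Dec (Distinct xs)
distinct? []       = yes []
distinct? (x ∷ xs) = map′ (λ (h , d) → h ∷ d) (λ { (h ∷ d) → h , d }) (avoids? x xs ×-dec distinct? xs)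

-- Describes what is known about a pendant edge: its colour `o` and the two further colours `p`, `q`
-- at its outer end. The order of these two is immaterial and is fixed by `p <ᵇ q`.
sidesᵇ : (Color → Color → Color → Bool) → Bool
sidesᵇ P = allᵇ λ o → allᵇ λ p → guard (o ≠ᵇ p) (allᵇ λ q → guard (p <ᵇ q) (guard (o ≠ᵇ q) (P o p q)))

sidesᵇ-sound : ∀ P → sidesᵇ P ≡ true → ∀ o p q → o ≢ p → o ≢ q → (p <ᵇ q) ≡ true → P o p q ≡ true
sidesᵇ-sound P e o p q o≢p o≢q p<q = guard-sound {o ≠ᵇ q} (guard-sound {p <ᵇ q} (allᵇ-sound (at-q o p) at-p q) p<q) (≠ᵇ-complete o≢q)
  where
    at-q : Color → Color → Color → Bool
    at-q o p q = guard (p <ᵇ q) (guard (o ≠ᵇ q) (P o p q))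
    at-p : allᵇ (at-q o p) ≡ true
    at-p = guard-sound {o ≠ᵇ p} (allᵇ-sound (λ p → guard (o ≠ᵇ p) (allᵇ (at-q o p)))
      (allᵇ-sound (λ o → allᵇ λ p → guard (o ≠ᵇ p) (allᵇ (at-q o p))) e o) p) (≠ᵇ-complete o≢p)

-- Relabelling colours

-- The conditions to be met speak only of equality and inequality of colours, so a permutation
-- preserves them. Moving known colours to the first few values cuts down the enumeration: four
-- colours for chains, three for linked triangles.
record Relabelling (a b c d : Color) : Set where
  field
    to        : Color → Color
    injective : ∀ {i j} → to i ≡ to j → i ≡ j
    onto      : ∀ k → ∃ λ i → to i ≡ k
    to-0      : to (# 0) ≡ a
    to-1      : to (# 1) ≡ b
    to-2      : to (# 2) ≡ c
    to-3      : to (# 3) ≡ d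

transpose-fixes : ∀ {i j k : Color} → k ≢ i → k ≢ j → transpose i j k ≡ k
transpose-fixes {i} {j} {k} k≢i k≢j with k ≟ i
... | yes k≡i = contradiction k≡i k≢i
... | no _ with k ≟ j
...   | yes k≡j = contradiction k≡j k≢j
...   | no _ = refl

transpose-moves : ∀ (i j : Color) → transpose i j i ≡ j
transpose-moves i j with i ≟ i
... | yes _ = refl
... | no i≢i = contradiction refl i≢i

record Bijection : Set where
  field
    fun inv : Color → Color
    fun-inv : ∀ k → fun (inv k) ≡ k
    inv-fun : ∀ k → inv (fun k) ≡ k

open Bijection

-- Precomposing with the transposition of `i` and the preimage of `a` repairs the value at `i` and
-- disturbs only the point that was sent to `a`.
send : Bijection → Color → Color → Bijection
send π i a = record
  { fun = fun π ∘ transpose i j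
  ; inv = transpose j i ∘ inv π
  ; fun-inv = λ k → trans (cong (fun π) (transpose-inverse i j)) (fun-inv π k)
  ; inv-fun = λ k → trans (cong (transpose j i) (inv-fun π _)) (transpose-inverse j i) }
  where j = inv π a

send-at : ∀ π i a → fun (send π i a) i ≡ a
send-at π i a = trans (cong (fun π) (transpose-moves i _)) (fun-inv π a)

send-else : ∀ π {i a k b} → k ≢ i → fun π k ≡ b → b ≢ a → fun (send π i a) k ≡ b
send-else π {i} {a} k≢i e b≢a = trans (cong (fun π) (transpose-fixes k≢i λ k≡ → b≢a (trans (≡-sym e) (trans (cong (fun π) k≡) (fun-inv π a))))) e

relabel : ∀ {a b c d} → Distinct (a ∷ b ∷ c ∷ d ∷ []) → Relabelling a b c d
relabel {a} {b} {c} {d} ((ab ∷ ac ∷ ad ∷ []) ∷ (bc ∷ bd ∷ []) ∷ (cd ∷ []) ∷ [] ∷ []) = record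
  { to = fun π₃
  ; injective = λ e → trans (≡-sym (inv-fun π₃ _)) (trans (cong (inv π₃) e) (inv-fun π₃ _))
  ; onto = λ k → inv π₃ k , fun-inv π₃ k
  ; to-0 = else₃ (# 0) (λ ()) (else₂ (# 0) (λ ()) (else₁ (# 0) (λ ()) (send-at id′ (# 0) a) ab) ac) ad
  ; to-1 = else₃ (# 1) (λ ()) (else₂ (# 1) (λ ()) (send-at π₀ (# 1) b) bc) bd
  ; to-2 = else₃ (# 2) (λ ()) (send-at π₁ (# 2) c) cd
  ; to-3 = send-at π₂ (# 3) d
  }
  where
    id′ : Bijection
    id′ = record { fun = id ; inv = id ; fun-inv = λ _ → refl ; inv-fun = λ _ → refl }
    π₀ = send id′ (# 0) a
    π₁ = send π₀ (# 1) b
    π₂ = send π₁ (# 2) c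
    π₃ = send π₂ (# 3) d
    else₁ : ∀ k {e} → k ≢ # 1 → fun π₀ k ≡ e → e ≢ b → fun π₁ k ≡ e
    else₁ k = send-else π₀
    else₂ : ∀ k {e} → k ≢ # 2 → fun π₁ k ≡ e → e ≢ c → fun π₂ k ≡ e
    else₂ k = send-else π₁
    else₃ : ∀ k {e} → k ≢ # 3 → fun π₂ k ≡ e → e ≢ d → fun π₃ k ≡ e
    else₃ k = send-else π₂

module _ {f : Color → Color} (inj : ∀ {i j} → f i ≡ f j → i ≡ j) where

  avoids-map : ∀ {k xs} → All (k ≢_) xs → All (f k ≢_) (map f xs)
  avoids-map []         = []
  avoids-map (k≢ ∷ k≢s) = (k≢ ∘ inj) ∷ avoids-map k≢s

  distinct-map : ∀ {xs} → Distinct xs → Distinct (map f xs)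
  distinct-map []       = []
  distinct-map (h ∷ hs) = avoids-map h ∷ distinct-map hs

-- The two triangles of a double link

Colors₈ : Set
Colors₈ = Color × Color × Color × Color × Color × Color × Color × Color

-- In the application `x`, `y`, `z` colour `a₁ b₁`, `a₁ c₁`, `b₁ c₁`, their primed versions the
-- second triangle, and `f`, `g` the links `b₁ b₂`, `c₁ c₂`; `o` is the colour of the pendant edge
-- at `a₁`, and `p`, `q` bound the colours beyond it. Between `x` and `y′`, or `y` and `x′`, nothing
-- is asked, as these edges are too far apart.
DoubleLinkColors : (o p q o′ p′ q′ : Color) → Colors₈ → Set
DoubleLinkColors o p q o′ p′ q′ (x , y , z , x′ , y′ , z′ , f , g) =
  Distinct (x ∷ y ∷ z ∷ o ∷ f ∷ g ∷ []) × Distinct (x′ ∷ y′ ∷ z′ ∷ o′ ∷ f ∷ g ∷ []) ×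
  All (x ≢_) (p ∷ q ∷ x′ ∷ z′ ∷ []) × All (y ≢_) (p ∷ q ∷ y′ ∷ z′ ∷ []) × All (z ≢_) (x′ ∷ y′ ∷ z′ ∷ []) ×
  All (x′ ≢_) (p′ ∷ q′ ∷ []) × All (y′ ≢_) (p′ ∷ q′ ∷ [])

doubleLinkColors? : ∀ o p q o′ p′ q′ s → Dec (DoubleLinkColors o p q o′ p′ q′ s)
doubleLinkColors? o p q o′ p′ q′ (x , y , z , x′ , y′ , z′ , f , g) =
  distinct? _ ×-dec distinct? _ ×-dec avoids? _ _ ×-dec avoids? _ _ ×-dec avoids? _ _ ×-dec avoids? _ _ ×-dec avoids? _ _

doubleLinkSearch : (o p q o′ p′ q′ : Color) → Maybe Colors₈
doubleLinkSearch o p q o′ p′ q′ =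
  pick (o ∷ p ∷ q ∷ []) λ x → pick (o ∷ p ∷ q ∷ x ∷ []) λ y →
  pick (o′ ∷ p′ ∷ q′ ∷ x ∷ []) λ x′ → pick (o′ ∷ p′ ∷ q′ ∷ x′ ∷ y ∷ []) λ y′ →
  pick (o ∷ x ∷ y ∷ x′ ∷ y′ ∷ []) λ z → pick (o′ ∷ x′ ∷ y′ ∷ x ∷ y ∷ z ∷ []) λ z′ →
  pick (o ∷ o′ ∷ x ∷ y ∷ z ∷ x′ ∷ y′ ∷ z′ ∷ []) λ f → pick (o ∷ o′ ∷ x ∷ y ∷ z ∷ x′ ∷ y′ ∷ z′ ∷ f ∷ []) λ g →
  just (x , y , z , x′ , y′ , z′ , f , g)

doubleLinkTest : (o p q : Color) → Bool
doubleLinkTest o p q = verify (doubleLinkColors? (# 0) (# 1) (# 2) o p q) (doubleLinkSearch (# 0) (# 1) (# 2) o p q)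

abstract
  -- The first side is normalised to the colours 0, 1, 2. The `refl` below runs the search for every
  -- second side, and `abstract` keeps this computation from being repeated.
  doubleLinkNormal : ∀ o p q → o ≢ p → o ≢ q → (p <ᵇ q) ≡ true → ∃ (DoubleLinkColors (# 0) (# 1) (# 2) o p q)
  doubleLinkNormal o p q o≢p o≢q p<q = verify-sound (doubleLinkColors? (# 0) (# 1) (# 2) o p q) (doubleLinkSearch (# 0) (# 1) (# 2) o p q)
    (sidesᵇ-sound doubleLinkTest refl o p q o≢p o≢q p<q)

doubleLinkColors : ∀ {o p q o′ p′ q′} → Distinct (o ∷ p ∷ q ∷ []) → Distinct (o′ ∷ p′ ∷ q′ ∷ []) → ∃ (DoubleLinkColors o p q o′ p′ q′)
doubleLinkColors {o} {p} {q} ((op ∷ oq ∷ []) ∷ (pq ∷ []) ∷ [] ∷ []) ((op′ ∷ oq′ ∷ []) ∷ (pq′ ∷ []) ∷ [] ∷ []) with fresh (o ∷ p ∷ q ∷ [])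
-- `relabel` wants four colours and only three are given, so `r` is a filler.
... | r , ro ∷ rp ∷ rq ∷ [] with relabel ((op ∷ oq ∷ ≢-sym ro ∷ []) ∷ (pq ∷ ≢-sym rp ∷ []) ∷ (≢-sym rq ∷ []) ∷ [] ∷ [])
... | record { to = σ ; injective = inj ; onto = onto ; to-0 = refl ; to-1 = refl ; to-2 = refl } =
  go (onto _) (onto _) (onto _) op′ oq′ pq′
  where
    Goal = λ o′ p′ q′ → ∃ (DoubleLinkColors (σ (# 0)) (σ (# 1)) (σ (# 2)) o′ p′ q′)
    go : ∀ {o′ p′ q′} → (∃ λ i → σ i ≡ o′) → (∃ λ i → σ i ≡ p′) → (∃ λ i → σ i ≡ q′) → o′ ≢ p′ → o′ ≢ q′ → p′ ≢ q′ → Goal o′ p′ q′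
    go (o , refl) (p , refl) (q , refl) op oq pq = [ sorted p q op oq , swapped ∘ sorted q p oq op ]′ (<ᵇ-total (pq ∘ cong σ))
      where
        swapped : Goal (σ o) (σ q) (σ p) → Goal (σ o) (σ p) (σ q)
        swapped (s , d , d′ , X , Y , Z , (xp ∷ xq ∷ []) , (yp ∷ yq ∷ [])) = s , d , d′ , X , Y , Z , (xq ∷ xp ∷ []) , (yq ∷ yp ∷ [])
        sorted : ∀ p q → σ o ≢ σ p → σ o ≢ σ q → (p <ᵇ q) ≡ true → Goal (σ o) (σ p) (σ q)
        sorted p q op oq p<q with doubleLinkNormal o p q (op ∘ cong σ) (oq ∘ cong σ) p<q
        ... | (x , y , z , x′ , y′ , z′ , f , g) , d , d′ , X , Y , Z , X′ , Y′ =
          (σ x , σ y , σ z , σ x′ , σ y′ , σ z′ , σ f , σ g) ,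
          distinct-map {σ} inj d , distinct-map {σ} inj d′ , avoids-map {σ} inj X , avoids-map {σ} inj Y , avoids-map {σ} inj Z , avoids-map {σ} inj X′ , avoids-map {σ} inj Y′

-- Three pairwise linked triangles

Colors₁₂ : Set
Colors₁₂ = Color × Color × Color × Color × Color × Color × Color × Color × Color × Color × Color × Color

-- The first index names a triangle: `e₁₂` colours its side from `a₁` to the corner that is linked
-- to triangle 2, `z₁` the side opposite `a₁`, and `f₁₂` the link between triangles 1 and 2. The
-- colours `o`, `p`, `q` belong to the pendant edges, as for double links.
TripleLinkColors : (o₁ p₁ q₁ o₂ p₂ q₂ o₃ p₃ q₃ : Color) → Colors₁₂ → Set
TripleLinkColors o₁ p₁ q₁ o₂ p₂ q₂ o₃ p₃ q₃ (e₁₂ , e₁₃ , z₁ , e₂₁ , e₂₃ , z₂ , e₃₁ , e₃₂ , z₃ , f₁₂ , f₁₃ , f₂₃) =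
  Distinct (e₁₂ ∷ e₁₃ ∷ z₁ ∷ o₁ ∷ f₁₂ ∷ f₁₃ ∷ []) ×
  Distinct (e₂₁ ∷ e₂₃ ∷ z₂ ∷ o₂ ∷ f₁₂ ∷ f₂₃ ∷ []) ×
  Distinct (e₃₁ ∷ e₃₂ ∷ z₃ ∷ o₃ ∷ f₁₃ ∷ f₂₃ ∷ []) ×
  (All (e₁₂ ≢_) (e₂₁ ∷ z₂ ∷ []) × All (e₁₃ ≢_) (e₃₁ ∷ z₃ ∷ []) × All (e₂₃ ≢_) (e₃₂ ∷ z₃ ∷ []) ×
   All (z₁ ≢_) (e₂₁ ∷ z₂ ∷ e₃₁ ∷ z₃ ∷ []) × All (z₂ ≢_) (e₃₂ ∷ z₃ ∷ [])) ×
  (All (e₁₂ ≢_) (p₁ ∷ q₁ ∷ []) × All (e₁₃ ≢_) (p₁ ∷ q₁ ∷ [])) ×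
  (All (e₂₁ ≢_) (p₂ ∷ q₂ ∷ []) × All (e₂₃ ≢_) (p₂ ∷ q₂ ∷ [])) ×
  (All (e₃₁ ≢_) (p₃ ∷ q₃ ∷ []) × All (e₃₂ ≢_) (p₃ ∷ q₃ ∷ []))

tripleLinkColors? : ∀ o₁ p₁ q₁ o₂ p₂ q₂ o₃ p₃ q₃ s → Dec (TripleLinkColors o₁ p₁ q₁ o₂ p₂ q₂ o₃ p₃ q₃ s)
tripleLinkColors? o₁ p₁ q₁ o₂ p₂ q₂ o₃ p₃ q₃ (e₁₂ , e₁₃ , z₁ , e₂₁ , e₂₃ , z₂ , e₃₁ , e₃₂ , z₃ , f₁₂ , f₁₃ , f₂₃) =
  distinct? _ ×-dec distinct? _ ×-dec distinct? _ ×-dec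
  (avoids? _ _ ×-dec avoids? _ _ ×-dec avoids? _ _ ×-dec avoids? _ _ ×-dec avoids? _ _) ×-dec
  (avoids? _ _ ×-dec avoids? _ _) ×-dec (avoids? _ _ ×-dec avoids? _ _) ×-dec (avoids? _ _ ×-dec avoids? _ _)

-- A greedy choice in this order, with backtracking, finds a solution after few steps.
tripleLinkSearch : (o₁ p₁ q₁ o₂ p₂ q₂ o₃ p₃ q₃ : Color) → Maybe Colors₁₂
tripleLinkSearch o₁ p₁ q₁ o₂ p₂ q₂ o₃ p₃ q₃ =
  pick (o₁ ∷ o₃ ∷ []) λ f₁₃ →
  pick (f₁₃ ∷ o₁ ∷ []) λ z₁ →
  pick (f₁₃ ∷ o₃ ∷ p₃ ∷ q₃ ∷ z₁ ∷ []) λ e₃₁ →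
  pick (e₃₁ ∷ f₁₃ ∷ o₃ ∷ p₃ ∷ q₃ ∷ []) λ e₃₂ →
  pick (e₃₁ ∷ e₃₂ ∷ f₁₃ ∷ o₂ ∷ o₃ ∷ []) λ f₂₃ →
  pick (e₃₂ ∷ f₂₃ ∷ o₂ ∷ p₂ ∷ q₂ ∷ []) λ e₂₃ →
  pick (e₂₃ ∷ e₃₁ ∷ e₃₂ ∷ f₁₃ ∷ f₂₃ ∷ o₃ ∷ z₁ ∷ []) λ z₃ →
  pick (e₂₃ ∷ f₂₃ ∷ o₂ ∷ p₂ ∷ q₂ ∷ z₁ ∷ []) λ e₂₁ →
  pick (e₂₁ ∷ e₂₃ ∷ e₃₂ ∷ f₂₃ ∷ o₂ ∷ z₁ ∷ z₃ ∷ []) λ z₂ →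
  pick (e₂₁ ∷ e₂₃ ∷ f₁₃ ∷ f₂₃ ∷ o₁ ∷ o₂ ∷ z₁ ∷ z₂ ∷ []) λ f₁₂ →
  pick (e₂₁ ∷ f₁₂ ∷ f₁₃ ∷ o₁ ∷ p₁ ∷ q₁ ∷ z₁ ∷ z₂ ∷ []) λ e₁₂ →
  pick (e₁₂ ∷ e₃₁ ∷ f₁₂ ∷ f₁₃ ∷ o₁ ∷ p₁ ∷ q₁ ∷ z₁ ∷ z₃ ∷ []) λ e₁₃ →
  just (e₁₂ , e₁₃ , z₁ , e₂₁ , e₂₃ , z₂ , e₃₁ , e₃₂ , z₃ , f₁₂ , f₁₃ , f₂₃)

tripleLinkTest : (o₂ p₂ q₂ o₃ p₃ q₃ : Color) → Bool
tripleLinkTest o₂ p₂ q₂ o₃ p₃ q₃ =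
  verify (tripleLinkColors? (# 0) (# 1) (# 2) o₂ p₂ q₂ o₃ p₃ q₃) (tripleLinkSearch (# 0) (# 1) (# 2) o₂ p₂ q₂ o₃ p₃ q₃)

abstract
  tripleLinkNormal : ∀ o₂ p₂ q₂ o₃ p₃ q₃ → o₂ ≢ p₂ → o₂ ≢ q₂ → (p₂ <ᵇ q₂) ≡ true → o₃ ≢ p₃ → o₃ ≢ q₃ → (p₃ <ᵇ q₃) ≡ true →
    ∃ (TripleLinkColors (# 0) (# 1) (# 2) o₂ p₂ q₂ o₃ p₃ q₃)
  tripleLinkNormal o₂ p₂ q₂ o₃ p₃ q₃ op₂ oq₂ <₂ op₃ oq₃ <₃ =
    verify-sound (tripleLinkColors? (# 0) (# 1) (# 2) o₂ p₂ q₂ o₃ p₃ q₃) (tripleLinkSearch (# 0) (# 1) (# 2) o₂ p₂ q₂ o₃ p₃ q₃)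
      (sidesᵇ-sound (tripleLinkTest o₂ p₂ q₂) (sidesᵇ-sound (λ o p q → sidesᵇ (tripleLinkTest o p q)) refl o₂ p₂ q₂ op₂ oq₂ <₂) o₃ p₃ q₃ op₃ oq₃ <₃)

swap-pair : ∀ {k p q : Color} → All (k ≢_) (p ∷ q ∷ []) → All (k ≢_) (q ∷ p ∷ [])
swap-pair (kp ∷ kq ∷ []) = kq ∷ kp ∷ []

tripleLinkColors : ∀ {o₁ p₁ q₁ o₂ p₂ q₂ o₃ p₃ q₃} → Distinct (o₁ ∷ p₁ ∷ q₁ ∷ []) → Distinct (o₂ ∷ p₂ ∷ q₂ ∷ []) → Distinct (o₃ ∷ p₃ ∷ q₃ ∷ []) →
  ∃ (TripleLinkColors o₁ p₁ q₁ o₂ p₂ q₂ o₃ p₃ q₃)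
tripleLinkColors {o} {p} {q} ((op ∷ oq ∷ []) ∷ (pq ∷ []) ∷ [] ∷ []) d₂ d₃ with fresh (o ∷ p ∷ q ∷ [])
... | r , ro ∷ rp ∷ rq ∷ [] with relabel ((op ∷ oq ∷ ≢-sym ro ∷ []) ∷ (pq ∷ ≢-sym rp ∷ []) ∷ (≢-sym rq ∷ []) ∷ [] ∷ [])
... | record { to = σ ; injective = inj ; onto = onto ; to-0 = refl ; to-1 = refl ; to-2 = refl } =
  go (onto _) (onto _) (onto _) (onto _) (onto _) (onto _) d₂ d₃
  where
    Goal = λ o₂ p₂ q₂ o₃ p₃ q₃ → ∃ (TripleLinkColors (σ (# 0)) (σ (# 1)) (σ (# 2)) o₂ p₂ q₂ o₃ p₃ q₃)
    swap-second : ∀ {o₂ p₂ q₂ o₃ p₃ q₃} → Goal o₂ p₂ q₂ o₃ p₃ q₃ → Goal o₂ q₂ p₂ o₃ p₃ q₃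
    swap-second (s , d₁ , d₂ , d₃ , links , s₁ , (a , b) , s₃) = s , d₁ , d₂ , d₃ , links , s₁ , (swap-pair a , swap-pair b) , s₃
    swap₃ : ∀ {o₂ p₂ q₂ o₃ p₃ q₃} → Goal o₂ p₂ q₂ o₃ p₃ q₃ → Goal o₂ p₂ q₂ o₃ q₃ p₃
    swap₃ (s , d₁ , d₂ , d₃ , links , s₁ , s₂ , (a , b)) = s , d₁ , d₂ , d₃ , links , s₁ , s₂ , (swap-pair a , swap-pair b)
    sorted : ∀ {o₂ p₂ q₂ o₃ p₃ q₃} → o₂ ≢ p₂ → o₂ ≢ q₂ → o₃ ≢ p₃ → o₃ ≢ q₃ → (p₂ <ᵇ q₂) ≡ true → (p₃ <ᵇ q₃) ≡ true →
      Goal (σ o₂) (σ p₂) (σ q₂) (σ o₃) (σ p₃) (σ q₃)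
    sorted op₂ oq₂ op₃ oq₃ <₂ <₃ with tripleLinkNormal _ _ _ _ _ _ op₂ oq₂ <₂ op₃ oq₃ <₃
    ... | (e₁₂ , e₁₃ , z₁ , e₂₁ , e₂₃ , z₂ , e₃₁ , e₃₂ , z₃ , f₁₂ , f₁₃ , f₂₃) , d₁ , d₂ , d₃ , (l₁ , l₂ , l₃ , l₄ , l₅) , (a₁ , b₁) , (a₂ , b₂) , (a₃ , b₃) =
      (σ e₁₂ , σ e₁₃ , σ z₁ , σ e₂₁ , σ e₂₃ , σ z₂ , σ e₃₁ , σ e₃₂ , σ z₃ , σ f₁₂ , σ f₁₃ , σ f₂₃) ,
      distinct-map {σ} inj d₁ , distinct-map {σ} inj d₂ , distinct-map {σ} inj d₃ ,
      (avoids-map {σ} inj l₁ , avoids-map {σ} inj l₂ , avoids-map {σ} inj l₃ , avoids-map {σ} inj l₄ , avoids-map {σ} inj l₅) ,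
      (avoids-map {σ} inj a₁ , avoids-map {σ} inj b₁) , (avoids-map {σ} inj a₂ , avoids-map {σ} inj b₂) , (avoids-map {σ} inj a₃ , avoids-map {σ} inj b₃)
    go : ∀ {o₂ p₂ q₂ o₃ p₃ q₃} → (∃ λ i → σ i ≡ o₂) → (∃ λ i → σ i ≡ p₂) → (∃ λ i → σ i ≡ q₂) → (∃ λ i → σ i ≡ o₃) → (∃ λ i → σ i ≡ p₃) → (∃ λ i → σ i ≡ q₃) →
      Distinct (o₂ ∷ p₂ ∷ q₂ ∷ []) → Distinct (o₃ ∷ p₃ ∷ q₃ ∷ []) → Goal o₂ p₂ q₂ o₃ p₃ q₃
    go (o₂ , refl) (p₂ , refl) (q₂ , refl) (o₃ , refl) (p₃ , refl) (q₃ , refl)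
      ((op₂ ∷ oq₂ ∷ []) ∷ (pq₂ ∷ []) ∷ _) ((op₃ ∷ oq₃ ∷ []) ∷ (pq₃ ∷ []) ∷ _)
      with <ᵇ-total (pq₂ ∘ cong σ) | <ᵇ-total (pq₃ ∘ cong σ)
    ... | inj₁ <₂ | inj₁ <₃ = sorted (op₂ ∘ cong σ) (oq₂ ∘ cong σ) (op₃ ∘ cong σ) (oq₃ ∘ cong σ) <₂ <₃
    ... | inj₁ <₂ | inj₂ <₃ = swap₃ (sorted (op₂ ∘ cong σ) (oq₂ ∘ cong σ) (oq₃ ∘ cong σ) (op₃ ∘ cong σ) <₂ <₃)
    ... | inj₂ <₂ | inj₁ <₃ = swap-second (sorted (oq₂ ∘ cong σ) (op₂ ∘ cong σ) (op₃ ∘ cong σ) (oq₃ ∘ cong σ) <₂ <₃)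
    ... | inj₂ <₂ | inj₂ <₃ = swap-second (swap₃ (sorted (oq₂ ∘ cong σ) (op₂ ∘ cong σ) (oq₃ ∘ cong σ) (op₃ ∘ cong σ) <₂ <₃))

-- The middle triangle of a chain of three

-- An inserted triangle offers these colours: t₁ and t₂ at its third corner, and f for the link leaving it.
record Offer (p₁ p₂ r₁ r₂ t₁ t₂ f : Color) : Set where
  constructor offer
  field
    t₁∈ : t₁ ∈ (p₁ ∷ p₂ ∷ [])
    t₂∈ : t₂ ∈ (r₁ ∷ r₂ ∷ [])
    f∈  : f ∈ (p₁ ∷ p₂ ∷ []) ⊎ f ∈ (r₁ ∷ r₂ ∷ [])
    f≢  : All (f ≢_) (t₁ ∷ t₂ ∷ [])

Colors₉ : Set
Colors₉ = Color × Color × Color × Color × Color × Color × Color × Color × Color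

-- The middle triangle `b c a` gets `x`, `y`, `z` on `a b`, `a c`, `b c`, and `f`, `f′` on its links
-- to the outer triangles. The side `b c` sees both outer triangles, so `z` has to avoid all four
-- colours offered there; the sides at `a` each see only one, but also the colours `p`, `q` beyond
-- the third link.
ChainColors : (p₁ p₂ r₁ r₂ p₁′ p₂′ r₁′ r₂′ o p q : Color) → Colors₉ → Set
ChainColors p₁ p₂ r₁ r₂ p₁′ p₂′ r₁′ r₂′ o p q (t₁ , t₂ , f , t₁′ , t₂′ , f′ , x , y , z) =
  Offer p₁ p₂ r₁ r₂ t₁ t₂ f × Offer p₁′ p₂′ r₁′ r₂′ t₁′ t₂′ f′ ×
  Distinct (x ∷ y ∷ z ∷ o ∷ f ∷ f′ ∷ []) ×
  All (x ≢_) (t₁ ∷ t₂ ∷ []) × All (y ≢_) (t₁′ ∷ t₂′ ∷ []) × All (z ≢_) (t₁ ∷ t₂ ∷ t₁′ ∷ t₂′ ∷ []) ×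
  All (x ≢_) (p ∷ q ∷ []) × All (y ≢_) (p ∷ q ∷ [])

member? : ∀ (k : Color) xs → Dec (k ∈ xs)
member? k = Any.any? (k ≟_)

offer? : ∀ p₁ p₂ r₁ r₂ t₁ t₂ f → Dec (Offer p₁ p₂ r₁ r₂ t₁ t₂ f)
offer? p₁ p₂ r₁ r₂ t₁ t₂ f = map′ (λ (a , b , c , d) → offer a b c d) (λ (offer a b c d) → a , b , c , d)
  (member? _ _ ×-dec member? _ _ ×-dec (member? _ _ ⊎-dec member? _ _) ×-dec avoids? _ _)

chainColors? : ∀ p₁ p₂ r₁ r₂ p₁′ p₂′ r₁′ r₂′ o p q s → Dec (ChainColors p₁ p₂ r₁ r₂ p₁′ p₂′ r₁′ r₂′ o p q s)
chainColors? p₁ p₂ r₁ r₂ p₁′ p₂′ r₁′ r₂′ o p q (t₁ , t₂ , f , t₁′ , t₂′ , f′ , x , y , z) =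
  offer? _ _ _ _ _ _ _ ×-dec offer? _ _ _ _ _ _ _ ×-dec distinct? _ ×-dec
  avoids? _ _ ×-dec avoids? _ _ ×-dec avoids? _ _ ×-dec avoids? _ _ ×-dec avoids? _ _

select : ∀ {A : Set} → List Color → List Color → (Color → Maybe A) → Maybe A
select []       xs f = nothing
select (y ∷ ys) xs f = (if avoids y xs then f y else nothing) orElse select ys xs f

chainSearch : (p₁ p₂ r₁ r₂ p₁′ p₂′ r₁′ r₂′ o p q : Color) → Maybe Colors₉
chainSearch p₁ p₂ r₁ r₂ p₁′ p₂′ r₁′ r₂′ o p q =
  select (p₁ ∷ p₂ ∷ []) [] λ t₁ → select (r₁ ∷ r₂ ∷ []) [] λ t₂ → select (p₁ ∷ p₂ ∷ r₁ ∷ r₂ ∷ []) (t₁ ∷ t₂ ∷ o ∷ []) λ f →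
  select (p₁′ ∷ p₂′ ∷ []) [] λ t₁′ → select (r₁′ ∷ r₂′ ∷ []) [] λ t₂′ → select (p₁′ ∷ p₂′ ∷ r₁′ ∷ r₂′ ∷ []) (t₁′ ∷ t₂′ ∷ o ∷ f ∷ []) λ f′ →
  pick (p ∷ q ∷ t₁ ∷ t₂ ∷ o ∷ f ∷ f′ ∷ []) λ x → pick (p ∷ q ∷ t₁′ ∷ t₂′ ∷ o ∷ f ∷ f′ ∷ x ∷ []) λ y →
  pick (t₁ ∷ t₂ ∷ t₁′ ∷ t₂′ ∷ o ∷ f ∷ f′ ∷ x ∷ y ∷ []) λ z →
  just (t₁ , t₂ , f , t₁′ , t₂′ , f′ , x , y , z)

chainTest : (p₁′ p₂′ r₁′ r₂′ o p q : Color) → Bool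
chainTest p₁′ p₂′ r₁′ r₂′ o p q =
  verify (chainColors? (# 0) (# 1) (# 2) (# 3) p₁′ p₂′ r₁′ r₂′ o p q) (chainSearch (# 0) (# 1) (# 2) (# 3) p₁′ p₂′ r₁′ r₂′ o p q)

pairsᵇ : (Color → Color → Bool) → Bool
pairsᵇ P = allᵇ λ p → allᵇ λ q → guard (p <ᵇ q) (P p q)

pairsᵇ-sound : ∀ P → pairsᵇ P ≡ true → ∀ p q → (p <ᵇ q) ≡ true → P p q ≡ true
pairsᵇ-sound P e p q = guard-sound {p <ᵇ q} (allᵇ-sound (λ q → guard (p <ᵇ q) (P p q)) (allᵇ-sound (λ p → allᵇ λ q → guard (p <ᵇ q) (P p q)) e p) q)

-- Exchanging the two pairs of an offer only exchanges its colours `t₁` and `t₂`, so it is enough to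
-- test `p₁′` below `r₁′`.
chainTests : (p₁′ p₂′ r₁′ r₂′ : Color) → Bool
chainTests p₁′ p₂′ r₁′ r₂′ =
  guard (p₁′ <ᵇ r₁′) (guard (avoids p₁′ (r₁′ ∷ r₂′ ∷ [])) (guard (avoids p₂′ (r₁′ ∷ r₂′ ∷ [])) (sidesᵇ (chainTest p₁′ p₂′ r₁′ r₂′))))

avoids-complete : ∀ {k xs} → All (k ≢_) xs → avoids k xs ≡ true
avoids-complete [] = refl
avoids-complete (k≢ ∷ h) rewrite ≠ᵇ-complete k≢ = avoids-complete h

abstract
  chainNormal : ∀ p₁′ p₂′ r₁′ r₂′ o p q → (p₁′ <ᵇ p₂′) ≡ true → (r₁′ <ᵇ r₂′) ≡ true → (p₁′ <ᵇ r₁′) ≡ true →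
    All (p₁′ ≢_) (r₁′ ∷ r₂′ ∷ []) → All (p₂′ ≢_) (r₁′ ∷ r₂′ ∷ []) → o ≢ p → o ≢ q → (p <ᵇ q) ≡ true →
    ∃ (ChainColors (# 0) (# 1) (# 2) (# 3) p₁′ p₂′ r₁′ r₂′ o p q)
  chainNormal p₁′ p₂′ r₁′ r₂′ o p q <p <r <pr pr₁ pr₂ op oq <q =
    verify-sound (chainColors? (# 0) (# 1) (# 2) (# 3) p₁′ p₂′ r₁′ r₂′ o p q) (chainSearch (# 0) (# 1) (# 2) (# 3) p₁′ p₂′ r₁′ r₂′ o p q)
      (sidesᵇ-sound (chainTest p₁′ p₂′ r₁′ r₂′)
        (guard-sound {avoids p₂′ (r₁′ ∷ r₂′ ∷ [])} (guard-sound {avoids p₁′ (r₁′ ∷ r₂′ ∷ [])} (guard-sound {p₁′ <ᵇ r₁′}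
          (pairsᵇ-sound (chainTests p₁′ p₂′) (pairsᵇ-sound (λ p q → pairsᵇ (chainTests p q)) refl p₁′ p₂′ <p) r₁′ r₂′ <r) <pr)
          (avoids-complete pr₁)) (avoids-complete pr₂))
        o p q op oq <q)

swap-member : ∀ {k p q : Color} → k ∈ (p ∷ q ∷ []) → k ∈ (q ∷ p ∷ [])
swap-member (here e) = there (here e)
swap-member (there (here e)) = here e

chainColors : ∀ {p₁ p₂ r₁ r₂ p₁′ p₂′ r₁′ r₂′ o p q} → Distinct (p₁ ∷ p₂ ∷ r₁ ∷ r₂ ∷ []) → Distinct (p₁′ ∷ p₂′ ∷ r₁′ ∷ r₂′ ∷ []) → Distinct (o ∷ p ∷ q ∷ []) →
  ∃ (ChainColors p₁ p₂ r₁ r₂ p₁′ p₂′ r₁′ r₂′ o p q)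
chainColors d d′ dₒ with relabel d
... | record { to = σ ; injective = inj ; onto = onto ; to-0 = refl ; to-1 = refl ; to-2 = refl ; to-3 = refl } =
  go (onto _) (onto _) (onto _) (onto _) (onto _) (onto _) (onto _) d′ dₒ
  where
    Goal = λ p₁ p₂ r₁ r₂ o p q → ∃ (ChainColors (σ (# 0)) (σ (# 1)) (σ (# 2)) (σ (# 3)) p₁ p₂ r₁ r₂ o p q)
    swapP : ∀ {p₁ p₂ r₁ r₂ o p q} → Goal p₁ p₂ r₁ r₂ o p q → Goal p₂ p₁ r₁ r₂ o p q
    swapP (s , l , offer a b (inj₁ m) n , h) = s , l , offer (swap-member a) b (inj₁ (swap-member m)) n , h
    swapP (s , l , offer a b (inj₂ m) n , h) = s , l , offer (swap-member a) b (inj₂ m) n , h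
    swapR : ∀ {p₁ p₂ r₁ r₂ o p q} → Goal p₁ p₂ r₁ r₂ o p q → Goal p₁ p₂ r₂ r₁ o p q
    swapR (s , l , offer a b (inj₁ m) n , h) = s , l , offer a (swap-member b) (inj₁ m) n , h
    swapR (s , l , offer a b (inj₂ m) n , h) = s , l , offer a (swap-member b) (inj₂ (swap-member m)) n , h
    swapO : ∀ {p₁ p₂ r₁ r₂ o p q} → Goal p₁ p₂ r₁ r₂ o p q → Goal p₁ p₂ r₁ r₂ o q p
    swapO (s , l , r , d , X , Y , Z , (xp ∷ xq ∷ []) , (yp ∷ yq ∷ [])) = s , l , r , d , X , Y , Z , (xq ∷ xp ∷ []) , (yq ∷ yp ∷ [])
    offer-map : ∀ {p₁ p₂ r₁ r₂ t₁ t₂ f} → Offer p₁ p₂ r₁ r₂ t₁ t₂ f → Offer (σ p₁) (σ p₂) (σ r₁) (σ r₂) (σ t₁) (σ t₂) (σ f)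
    offer-map (offer a b m n) = offer (∈-map⁺ σ a) (∈-map⁺ σ b) ([ inj₁ ∘ ∈-map⁺ σ , inj₂ ∘ ∈-map⁺ σ ]′ m) (avoids-map {σ} inj n)
    sorted : ∀ {p₁ p₂ r₁ r₂ o p q} → All (p₁ ≢_) (r₁ ∷ r₂ ∷ []) → All (p₂ ≢_) (r₁ ∷ r₂ ∷ []) → o ≢ p → o ≢ q →
      (p₁ <ᵇ p₂) ≡ true → (r₁ <ᵇ r₂) ≡ true → (p₁ <ᵇ r₁) ≡ true → (p <ᵇ q) ≡ true → Goal (σ p₁) (σ p₂) (σ r₁) (σ r₂) (σ o) (σ p) (σ q)
    sorted pr₁ pr₂ op oq <p <r <pr <q with chainNormal _ _ _ _ _ _ _ <p <r <pr pr₁ pr₂ op oq <q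
    ... | (t₁ , t₂ , f , t₁′ , t₂′ , f′ , x , y , z) , l , r , d , X , Y , Z , X′ , Y′ =
      (σ t₁ , σ t₂ , σ f , σ t₁′ , σ t₂′ , σ f′ , σ x , σ y , σ z) , offer-map l , offer-map r , distinct-map {σ} inj d ,
      avoids-map {σ} inj X , avoids-map {σ} inj Y , avoids-map {σ} inj Z , avoids-map {σ} inj X′ , avoids-map {σ} inj Y′
    swapPR : ∀ {p₁ p₂ r₁ r₂ o p q} → Goal r₁ r₂ p₁ p₂ o p q → Goal p₁ p₂ r₁ r₂ o p q
    swapPR ((t₁ , t₂ , f , t₁′ , t₂′ , f′ , x , y , z) , l , offer a b m (n₁ ∷ n₂ ∷ []) , d , X , (y₁ ∷ y₂ ∷ []) , (z₁ ∷ z₂ ∷ z₃ ∷ z₄ ∷ []) , h) =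
      (t₁ , t₂ , f , t₂′ , t₁′ , f′ , x , y , z) , l , offer b a (swap m) (n₂ ∷ n₁ ∷ []) , d , X , (y₂ ∷ y₁ ∷ []) , (z₁ ∷ z₂ ∷ z₄ ∷ z₃ ∷ []) , h
    sortPR : ∀ {p₁ p₂ r₁ r₂ o p q} → All (p₁ ≢_) (r₁ ∷ r₂ ∷ []) → All (p₂ ≢_) (r₁ ∷ r₂ ∷ []) → o ≢ p → o ≢ q →
      (p₁ <ᵇ p₂) ≡ true → (r₁ <ᵇ r₂) ≡ true → (p <ᵇ q) ≡ true → Goal (σ p₁) (σ p₂) (σ r₁) (σ r₂) (σ o) (σ p) (σ q)
    sortPR pr₁@(a ∷ b ∷ []) pr₂@(c ∷ d ∷ []) op oq <p <r <q =
      [ (λ <pr → sorted pr₁ pr₂ op oq <p <r <pr <q) ,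
        (λ <rp → swapPR (sorted (≢-sym a ∷ ≢-sym c ∷ []) (≢-sym b ∷ ≢-sym d ∷ []) op oq <r <p <rp <q)) ]′ (<ᵇ-total a)
    sortO : ∀ {p₁ p₂ r₁ r₂ o p q} → All (p₁ ≢_) (r₁ ∷ r₂ ∷ []) → All (p₂ ≢_) (r₁ ∷ r₂ ∷ []) → o ≢ p → o ≢ q → p ≢ q →
      (p₁ <ᵇ p₂) ≡ true → (r₁ <ᵇ r₂) ≡ true → Goal (σ p₁) (σ p₂) (σ r₁) (σ r₂) (σ o) (σ p) (σ q)
    sortO pr₁ pr₂ op oq pq <p <r = [ sortPR pr₁ pr₂ op oq <p <r , swapO ∘ sortPR pr₁ pr₂ oq op <p <r ]′ (<ᵇ-total pq)
    sortR : ∀ {p₁ p₂ r₁ r₂ o p q} → All (p₁ ≢_) (r₁ ∷ r₂ ∷ []) → All (p₂ ≢_) (r₁ ∷ r₂ ∷ []) → r₁ ≢ r₂ → o ≢ p → o ≢ q → p ≢ q →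
      (p₁ <ᵇ p₂) ≡ true → Goal (σ p₁) (σ p₂) (σ r₁) (σ r₂) (σ o) (σ p) (σ q)
    sortR pr₁@(a ∷ b ∷ []) pr₂@(c ∷ d ∷ []) rr op oq pq <p =
      [ sortO pr₁ pr₂ op oq pq <p , swapR ∘ sortO (b ∷ a ∷ []) (d ∷ c ∷ []) op oq pq <p ]′ (<ᵇ-total rr)
    go : ∀ {p₁ p₂ r₁ r₂ o p q} → (∃ λ i → σ i ≡ p₁) → (∃ λ i → σ i ≡ p₂) → (∃ λ i → σ i ≡ r₁) → (∃ λ i → σ i ≡ r₂) →
      (∃ λ i → σ i ≡ o) → (∃ λ i → σ i ≡ p) → (∃ λ i → σ i ≡ q) →
      Distinct (p₁ ∷ p₂ ∷ r₁ ∷ r₂ ∷ []) → Distinct (o ∷ p ∷ q ∷ []) → Goal p₁ p₂ r₁ r₂ o p q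
    go (_ , refl) (_ , refl) (_ , refl) (_ , refl) (_ , refl) (_ , refl) (_ , refl)
      ((pp ∷ pr₁₁ ∷ pr₁₂ ∷ []) ∷ (pr₂₁ ∷ pr₂₂ ∷ []) ∷ (rr ∷ []) ∷ _) ((op ∷ oq ∷ []) ∷ (pq ∷ []) ∷ _) =
      [ sortR from₁ from₂ (rr ∘ cong σ) (op ∘ cong σ) (oq ∘ cong σ) (pq ∘ cong σ) ,
        swapP ∘ sortR from₂ from₁ (rr ∘ cong σ) (op ∘ cong σ) (oq ∘ cong σ) (pq ∘ cong σ) ]′ (<ᵇ-total (pp ∘ cong σ))
      where
        from₁ = (pr₁₁ ∘ cong σ) ∷ (pr₁₂ ∘ cong σ) ∷ []
        from₂ = (pr₂₁ ∘ cong σ) ∷ (pr₂₂ ∘ cong σ) ∷ []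

-- Doubly linked triangles

module _ {n : ℕ} where

  private
    V = Fin n

  -- p and q bound the colours at v apart from that of the edge to a; absent edges leave them arbitrary.
  side-colors : ∀ {G K : Graph n} → Good G → K ⊑ G → ∀ {c a v} → Strong K c → K ∋ v ∼ a →
    ∃ λ p → ∃ λ q → Distinct (c a v ∷ p ∷ q ∷ []) × (∀ {k} → k ≢ c a v → All (k ≢_) (p ∷ q ∷ []) → Unused K c v k)
  side-colors {G} {K} g K⊑G {c} {a} {v} s va with nbrs₁ (subcubic g) (sub K⊑G va)
  ... | e , f , hv = decide (_∼?_ K v e ×-dec ¬? (e ≟ a)) (_∼?_ K v f ×-dec ¬? (f ≟ a) ×-dec ¬? (f ≟ e))
    where
      o = c a v
      Real : V → Set
      Real w = K ∋ v ∼ w × w ≢ a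
      apart : ∀ {w} → Real w → o ≢ c v w
      apart (vw , w≢a) eq = incident s va vw (≢-sym w≢a) (trans (symm s v a) eq)
      bound : ∀ {p q} → (∀ {w} → Real w → w ≡ e → c v w ≡ p) → (∀ {w} → Real w → w ≢ e → w ≡ f → c v w ≡ q) →
        ∀ {k} → k ≢ o → All (k ≢_) (p ∷ q ∷ []) → Unused K c v k
      bound atE atF k≢o (k≢p ∷ k≢q ∷ []) {w} vw eq with w ≟ a | w ≟ e | hv (sub K⊑G vw)
      ... | yes refl | _ | _ = k≢o (trans (≡-sym eq) (symm s v a))
      ... | no w≢a | yes w≡e | _ = k≢p (trans (≡-sym eq) (atE (vw , w≢a) w≡e))
      ... | no w≢a | no _ | inj₁ w≡a = w≢a w≡a
      ... | no _ | no w≢e | inj₂ (inj₁ w≡e) = w≢e w≡e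
      ... | no w≢a | no w≢e | inj₂ (inj₂ w≡f) = k≢q (trans (≡-sym eq) (atF (vw , w≢a) w≢e w≡f))
      decide : Dec (Real e) → Dec (K ∋ v ∼ f × f ≢ a × f ≢ e) →
        ∃ λ p → ∃ λ q → Distinct (o ∷ p ∷ q ∷ []) × (∀ {k} → k ≢ o → All (k ≢_) (p ∷ q ∷ []) → Unused K c v k)
      decide (yes re) (yes (vf , f≢a , f≢e)) = c v e , c v f ,
        ((apart re ∷ apart (vf , f≢a) ∷ []) ∷ (incident s (proj₁ re) vf (≢-sym f≢e) ∷ []) ∷ [] ∷ []) ,
        bound (λ where _ refl → refl) (λ where _ _ refl → refl)
      decide (yes re) (no ¬f) with fresh (o ∷ c v e ∷ [])
      ... | q , qo ∷ qp ∷ [] = c v e , q , ((apart re ∷ ≢-sym qo ∷ []) ∷ (≢-sym qp ∷ []) ∷ [] ∷ []) ,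
        bound (λ where _ refl → refl) (λ where (vf , f≢a) f≢e refl → contradiction (vf , f≢a , f≢e) ¬f)
      decide (no ¬e) (yes (vf , f≢a , f≢e)) with fresh (o ∷ c v f ∷ [])
      ... | p , po ∷ pq ∷ [] = p , c v f , ((≢-sym po ∷ apart (vf , f≢a) ∷ []) ∷ (pq ∷ []) ∷ [] ∷ []) ,
        bound (λ where re refl → contradiction re ¬e) (λ where _ _ refl → refl)
      decide (no ¬e) (no ¬f) with fresh (o ∷ [])
      ... | p , po ∷ [] with fresh (p ∷ o ∷ [])
      ... | q , qp ∷ qo ∷ [] = p , q , ((≢-sym po ∷ ≢-sym qo ∷ []) ∷ (≢-sym qp ∷ []) ∷ [] ∷ []) ,
        bound (λ where re refl → contradiction re ¬e) (λ where (vf , f≢a) f≢e refl → contradiction (vf , f≢a , f≢e) ¬f)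

  module _ {G : Graph n} (g : Good G) (below : Below G) {a₁ b₁ c₁ a₂ b₂ c₂ v₁ v₂ : V}
    (dl : DoubleLink G a₁ b₁ c₁ a₂ b₂ c₂)
    (a₁v₁ : G ∋ a₁ ∼ v₁) (v₁≢b₁ : v₁ ≢ b₁) (v₁≢c₁ : v₁ ≢ c₁) (nbA₁ : ∀ {w} → G ∋ a₁ ∼ w → w ≡ b₁ ⊎ w ≡ c₁ ⊎ w ≡ v₁)
    (a₂v₂ : G ∋ a₂ ∼ v₂) (v₂≢b₂ : v₂ ≢ b₂) (v₂≢c₂ : v₂ ≢ c₂) (nbA₂ : ∀ {w} → G ∋ a₂ ∼ w → w ≡ b₂ ⊎ w ≡ c₂ ⊎ w ≡ v₂) where

    private
      ab₁ = proj₁ (proj₁ dl)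
      ac₁ = proj₁ (proj₂ (proj₁ dl))
      bc₁ = proj₂ (proj₂ (proj₁ dl))
      ab₂ = proj₁ (proj₁ (proj₂ dl))
      ac₂ = proj₁ (proj₂ (proj₁ (proj₂ dl)))
      bc₂ = proj₂ (proj₂ (proj₁ (proj₂ dl)))
      bb = proj₁ (proj₂ (proj₂ dl))
      cc = proj₁ (proj₂ (proj₂ (proj₂ dl)))
      G₁ = del² G c₂ b₂
      K = del² G₁ c₁ b₁
      K⊑G : K ⊑ G
      K⊑G = ⊑-trans (⊑-trans (del-⊑ (del G₁ c₁) b₁) (del-⊑ G₁ c₁)) (⊑-trans (del-⊑ (del G c₂) b₂) (del-⊑ G c₂))

    -- Only `b₁`, `c₁`, `b₂`, `c₂` are removed, so `a₁` and `a₂` keep their pendant edges. Excluding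
    -- the prism is what makes these two different edges. The triangles then go in one after the
    -- other.
    doubleLinked : Disjoint (a₁ ∷ b₁ ∷ c₁ ∷ []) (a₂ ∷ b₂ ∷ c₂ ∷ []) → Colorable G
    doubleLinked ((aa ∷ a₁b₂ ∷ a₁c₂ ∷ []) ∷ (b₁a₂ ∷ b₁b₂ ∷ b₁c₂ ∷ []) ∷ (c₁a₂ ∷ c₁b₂ ∷ c₁c₂ ∷ []) ∷ []) =
      go (below (Good-del (Good-del (Good-del (Good-del g c₂) b₂) c₁) b₁) (⊑⇒⊏ K⊑G (∼-sym G ac₂) λ ((((_ , c₂≢c₂ , _) , _) , _) , _) → c₂≢c₂ refl))
      where
        nbB₁ = nbrs₃ (subcubic g) (∼-sym G ab₁) bc₁ bb (∼⇒≢ G ac₁) a₁b₂ c₁b₂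
        nbC₁ = nbrs₃ (subcubic g) (∼-sym G ac₁) (∼-sym G bc₁) cc (∼⇒≢ G ab₁) a₁c₂ b₁c₂
        nbB₂ = nbrs₃ (subcubic g) (∼-sym G ab₂) bc₂ (∼-sym G bb) (∼⇒≢ G ac₂) (≢-sym b₁a₂) (≢-sym b₁c₂)
        nbC₂ = nbrs₃ (subcubic g) (∼-sym G ac₂) (∼-sym G bc₂) (∼-sym G cc) (∼⇒≢ G ab₂) (≢-sym c₁a₂) (≢-sym c₁b₂)
        ¬a₁a₂ : ¬ G ∋ a₁ ∼ a₂
        ¬a₁a₂ = noPrism g dl
        v₁≢b₂ : v₁ ≢ b₂
        v₁≢b₂ refl = [ aa , [ a₁c₂ , ∼⇒≢ G ab₁ ]′ ]′ (nbB₂ (∼-sym G a₁v₁))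
        v₁≢c₂ : v₁ ≢ c₂
        v₁≢c₂ refl = [ aa , [ a₁b₂ , ∼⇒≢ G ac₁ ]′ ]′ (nbC₂ (∼-sym G a₁v₁))
        v₂≢b₁ : v₂ ≢ b₁
        v₂≢b₁ refl = [ ≢-sym aa , [ ≢-sym c₁a₂ , ∼⇒≢ G ab₂ ]′ ]′ (nbB₁ (∼-sym G a₂v₂))
        v₂≢c₁ : v₂ ≢ c₁
        v₂≢c₁ refl = [ ≢-sym aa , [ ≢-sym b₁a₂ , ∼⇒≢ G ac₂ ]′ ]′ (nbC₁ (∼-sym G a₂v₂))
        v₂≢a₁ : v₂ ≢ a₁
        v₂≢a₁ refl = ¬a₁a₂ (∼-sym G a₂v₂)
        va₁ : K ∋ v₁ ∼ a₁
        va₁ = (((∼-sym G a₁v₁ , v₁≢c₂ , a₁c₂) , v₁≢b₂ , a₁b₂) , v₁≢c₁ , ∼⇒≢ G ac₁) , v₁≢b₁ , ∼⇒≢ G ab₁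
        va₂ : K ∋ v₂ ∼ a₂
        va₂ = (((∼-sym G a₂v₂ , v₂≢c₂ , ∼⇒≢ G ac₂) , v₂≢b₂ , ∼⇒≢ G ab₂) , v₂≢c₁ , ≢-sym c₁a₂) , v₂≢b₁ , ≢-sym b₁a₂
        in₁ : ∀ {u w} → G ∋ u ∼ w → u ≢ c₂ → u ≢ b₂ → w ≢ c₂ → w ≢ b₂ → G₁ ∋ u ∼ w
        in₁ uw u≢c₂ u≢b₂ w≢c₂ w≢b₂ = (uw , u≢c₂ , w≢c₂) , u≢b₂ , w≢b₂

        go : Colorable K → Colorable G
        go (c , s) = fill (side-colors g K⊑G s va₁) (side-colors g K⊑G s va₂)
          where
            Side : V → V → Set
            Side a v = ∃ λ p → ∃ λ q → Distinct (c a v ∷ p ∷ q ∷ []) × (∀ {k} → k ≢ c a v → All (k ≢_) (p ∷ q ∷ []) → Unused K c v k)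
            fill : Side a₁ v₁ → Side a₂ v₂ → Colorable G
            fill (p₁ , q₁ , d₁ , un₁) (p₂ , q₂ , d₂ , un₂) = build (doubleLinkColors d₁ d₂)
              where
                build : ∃ (DoubleLinkColors (c a₁ v₁) p₁ q₁ (c a₂ v₂) p₂ q₂) → Colorable G
                build ((x , y , z , x′ , y′ , z′ , f , h) ,
                  dis@((_ ∷ _ ∷ x≢o ∷ x≢f ∷ x≢h ∷ []) ∷ (_ ∷ y≢o ∷ y≢f ∷ y≢h ∷ []) ∷ (_ ∷ z≢f ∷ z≢h ∷ []) ∷ (o≢f ∷ o≢h ∷ []) ∷ (f≢h ∷ []) ∷ _) ,
                  dis′@((_ ∷ _ ∷ x′≢o ∷ x′≢f ∷ x′≢h ∷ []) ∷ (_ ∷ y′≢o ∷ y′≢f ∷ y′≢h ∷ []) ∷ (_ ∷ z′≢f ∷ z′≢h ∷ []) ∷ _) ,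
                  (x≢p ∷ x≢q ∷ x≢x′ ∷ x≢z′ ∷ []) , (y≢p ∷ y≢q ∷ y≢y′ ∷ y≢z′ ∷ []) , (z≢x′ ∷ z≢y′ ∷ z≢z′ ∷ []) , X′ , Y′) =
                  _ , AddPair.strong R₂
                  where
                    R₁ : AddPair G₁ a₁ b₁ c₁ c x y z (c a₁ v₁) f h
                    -- The links to the second triangle are still missing, so `f` and `h` are only
                    -- reserved at `b₁` and `c₁`.
                    R₁ = addPair G₁ (in₁ ab₁ a₁c₂ a₁b₂ b₁c₂ b₁b₂) (in₁ ac₁ a₁c₂ a₁b₂ c₁c₂ c₁b₂) (in₁ bc₁ b₁c₂ b₁b₂ c₁c₂ c₁b₂) s b₂ c₂ dis nbA nbB nbC
                      where
                        nbA : ∀ {w} → K ∋ a₁ ∼ w → c a₁ w ≡ c a₁ v₁ × Unused K c w x × Unused K c w y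
                        nbA ((((aw , _) , _) , _ , w≢c₁) , _ , w≢b₁) with nbA₁ aw
                        ... | inj₁ e = contradiction e w≢b₁
                        ... | inj₂ (inj₁ e) = contradiction e w≢c₁
                        ... | inj₂ (inj₂ refl) = refl , un₁ x≢o (x≢p ∷ x≢q ∷ []) , un₁ y≢o (y≢p ∷ y≢q ∷ [])
                        nbB : ∀ {w} → G₁ ∋ b₁ ∼ w → w ≡ a₁ ⊎ w ≡ c₁ ⊎ (w ≡ b₂ × Addable K c w f x z)
                        nbB ((bw , _) , _ , w≢b₂) with nbB₁ bw
                        ... | inj₁ e = inj₁ e
                        ... | inj₂ (inj₁ e) = inj₂ (inj₁ e)
                        ... | inj₂ (inj₂ e) = contradiction e w≢b₂
                        nbC : ∀ {w} → G₁ ∋ c₁ ∼ w → w ≡ a₁ ⊎ w ≡ b₁ ⊎ (w ≡ c₂ × Addable K c w h y z)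
                        nbC ((cw , _ , w≢c₂) , _) with nbC₁ cw
                        ... | inj₁ e = inj₁ e
                        ... | inj₂ (inj₁ e) = inj₂ (inj₁ e)
                        ... | inj₂ (inj₂ e) = contradiction e w≢c₂
                    c′ = AddPair.coloring R₁
                    up : ∀ {k} → k ≢ f → k ≢ h → k ≢ c a₂ v₂ → All (k ≢_) (p₂ ∷ q₂ ∷ []) → Unused G₁ c′ v₂ k
                    up k≢f k≢h k≢o ks = AddPair.at-old R₁ v₂≢a₁ v₂≢b₁ v₂≢c₁ (un₂ k≢o ks) (λ _ → k≢f) (λ _ → k≢h)
                    R₂ : AddPair G a₂ b₂ c₂ c′ x′ y′ z′ (c a₂ v₂) f h
                    R₂ = addPair G ab₂ ac₂ bc₂ (AddPair.strong R₁) b₁ c₁ dis′ nbA nbB nbC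
                      where
                        nbA : ∀ {w} → G₁ ∋ a₂ ∼ w → c′ a₂ w ≡ c a₂ v₂ × Unused G₁ c′ w x′ × Unused G₁ c′ w y′
                        nbA ((aw , _ , w≢c₂) , _ , w≢b₂) with nbA₂ aw
                        ... | inj₁ e = contradiction e w≢b₂
                        ... | inj₂ (inj₁ e) = contradiction e w≢c₂
                        ... | inj₂ (inj₂ refl) = AddPair.keeps R₁ (≢-sym b₁a₂) (≢-sym c₁a₂) v₂≢b₁ v₂≢c₁ , up x′≢f x′≢h x′≢o X′ , up y′≢f y′≢h y′≢o Y′
                        nbB : ∀ {w} → G ∋ b₂ ∼ w → w ≡ a₂ ⊎ w ≡ c₂ ⊎ (w ≡ b₁ × Addable G₁ c′ w f x′ z′)
                        nbB bw with nbB₂ bw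
                        ... | inj₁ e = inj₁ e
                        ... | inj₂ (inj₁ e) = inj₂ (inj₁ e)
                        ... | inj₂ (inj₂ refl) = inj₂ (inj₂ (refl , addable free
                                (AddPair.at-b R₁ x′≢f (≢-sym x≢x′) (≢-sym z≢x′)) (AddPair.at-b R₁ z′≢f (≢-sym x≢z′) (≢-sym z≢z′))))
                          where
                            free : Free G₁ c′ b₁ f
                            free ((bw , _) , _ , w≢b₂) with nbB₁ bw
                            ... | inj₁ refl = AddPair.at-a R₁ (≢-sym o≢f) (≢-sym x≢f) (≢-sym y≢f)
                            ... | inj₂ (inj₁ refl) = AddPair.at-d R₁ f≢h (≢-sym y≢f) (≢-sym z≢f)
                            ... | inj₂ (inj₂ e) = contradiction e w≢b₂
                        nbC : ∀ {w} → G ∋ c₂ ∼ w → w ≡ a₂ ⊎ w ≡ b₂ ⊎ (w ≡ c₁ × Addable G₁ c′ w h y′ z′)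
                        nbC cw with nbC₂ cw
                        ... | inj₁ e = inj₁ e
                        ... | inj₂ (inj₁ e) = inj₂ (inj₁ e)
                        ... | inj₂ (inj₂ refl) = inj₂ (inj₂ (refl , addable free
                                (AddPair.at-d R₁ y′≢h (≢-sym y≢y′) (≢-sym z≢y′)) (AddPair.at-d R₁ z′≢h (≢-sym y≢z′) (≢-sym z≢z′))))
                          where
                            free : Free G₁ c′ c₁ h
                            free ((cw , _ , w≢c₂) , _) with nbC₁ cw
                            ... | inj₁ refl = AddPair.at-a R₁ (≢-sym o≢h) (≢-sym x≢h) (≢-sym y≢h)
                            ... | inj₂ (inj₁ refl) = AddPair.at-b R₁ (≢-sym f≢h) (≢-sym x≢h) (≢-sym z≢h)
                            ... | inj₂ (inj₂ e) = contradiction e w≢c₂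

-- Triply linked triangles

record Six (x y z o f g : Color) : Set where
  field
    xo : x ≢ o
    xf : x ≢ f
    xg : x ≢ g
    yo : y ≢ o
    yf : y ≢ f
    yg : y ≢ g
    zf : z ≢ f
    zg : z ≢ g
    of : o ≢ f
    og : o ≢ g
    fg : f ≢ g

six : ∀ {x y z o f g} → Distinct (x ∷ y ∷ z ∷ o ∷ f ∷ g ∷ []) → Six x y z o f g
six ((_ ∷ _ ∷ xo ∷ xf ∷ xg ∷ []) ∷ (_ ∷ yo ∷ yf ∷ yg ∷ []) ∷ (_ ∷ zf ∷ zg ∷ []) ∷ (of ∷ og ∷ []) ∷ (fg ∷ []) ∷ _) =
  record { xo = xo ; xf = xf ; xg = xg ; yo = yo ; yf = yf ; yg = yg ; zf = zf ; zg = zg ; of = of ; og = og ; fg = fg }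

module _ {n : ℕ} where

  private
    V = Fin n

  TripleLink : Graph n → (a₁ b₁ c₁ a₂ b₂ c₂ a₃ b₃ c₃ : V) → Set
  TripleLink G a₁ b₁ c₁ a₂ b₂ c₂ a₃ b₃ c₃ =
    (Triangle G a₁ b₁ c₁ × Triangle G a₂ b₂ c₂ × Triangle G a₃ b₃ c₃) ×
    (G ∋ b₁ ∼ b₂ × G ∋ c₁ ∼ b₃ × G ∋ c₂ ∼ c₃) ×
    Disjoint (a₁ ∷ b₁ ∷ c₁ ∷ []) (a₂ ∷ b₂ ∷ c₂ ∷ []) ×
    Disjoint (a₁ ∷ b₁ ∷ c₁ ∷ []) (a₃ ∷ b₃ ∷ c₃ ∷ []) ×
    Disjoint (a₂ ∷ b₂ ∷ c₂ ∷ []) (a₃ ∷ b₃ ∷ c₃ ∷ [])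

  Outer : Graph n → V → V → V → V → Set
  Outer G a b c v = G ∋ a ∼ v × v ≢ b × v ≢ c × (∀ {w} → G ∋ a ∼ w → w ≡ b ⊎ w ≡ c ⊎ w ≡ v)

  record Apart (a b c a′ b′ c′ : V) : Set where
    field
      aa : a ≢ a′
      ab : a ≢ b′
      ac : a ≢ c′
      ba : b ≢ a′
      bb : b ≢ b′
      bc : b ≢ c′
      ca : c ≢ a′
      cb : c ≢ b′
      cc : c ≢ c′

  toApart : ∀ {a b c a′ b′ c′} → Disjoint (a ∷ b ∷ c ∷ []) (a′ ∷ b′ ∷ c′ ∷ []) → Apart a b c a′ b′ c′
  toApart ((aa ∷ ab ∷ ac ∷ []) ∷ (ba ∷ bb ∷ bc ∷ []) ∷ (ca ∷ cb ∷ cc ∷ []) ∷ []) =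
    record { aa = aa ; ab = ab ; ac = ac ; ba = ba ; bb = bb ; bc = bc ; ca = ca ; cb = cb ; cc = cc }

  private
    flip : ∀ {x y z x′ y′ z′ : V} → Disjoint (x ∷ y ∷ z ∷ []) (x′ ∷ y′ ∷ z′ ∷ []) → Disjoint (z ∷ y ∷ x ∷ []) (z′ ∷ y′ ∷ x′ ∷ [])
    flip ((a ∷ b ∷ c ∷ []) ∷ (d ∷ e ∷ f ∷ []) ∷ (g ∷ h ∷ i ∷ []) ∷ []) = (i ∷ h ∷ g ∷ []) ∷ (f ∷ e ∷ d ∷ []) ∷ (c ∷ b ∷ a ∷ []) ∷ []
    flip′ : ∀ {x y z x′ y′ z′ : V} → Disjoint (x ∷ y ∷ z ∷ []) (x′ ∷ y′ ∷ z′ ∷ []) → Disjoint (y ∷ z ∷ x ∷ []) (z′ ∷ y′ ∷ x′ ∷ [])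
    flip′ ((a ∷ b ∷ c ∷ []) ∷ (d ∷ e ∷ f ∷ []) ∷ (g ∷ h ∷ i ∷ []) ∷ []) = (f ∷ e ∷ d ∷ []) ∷ (i ∷ h ∷ g ∷ []) ∷ (c ∷ b ∷ a ∷ []) ∷ []
    flip″ : ∀ {x y z x′ y′ z′ : V} → Disjoint (x ∷ y ∷ z ∷ []) (x′ ∷ y′ ∷ z′ ∷ []) → Disjoint (y ∷ z ∷ x ∷ []) (y′ ∷ z′ ∷ x′ ∷ [])
    flip″ ((a ∷ b ∷ c ∷ []) ∷ (d ∷ e ∷ f ∷ []) ∷ (g ∷ h ∷ i ∷ []) ∷ []) = (e ∷ f ∷ d ∷ []) ∷ (h ∷ i ∷ g ∷ []) ∷ (b ∷ c ∷ a ∷ []) ∷ []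

  module _ {G : Graph n} (g : Good G) (below : Below G) (noDL : NoDoubleLink G) {a₁ b₁ c₁ a₂ b₂ c₂ a₃ b₃ c₃ v₁ v₂ v₃ : V}
    (T : TripleLink G a₁ b₁ c₁ a₂ b₂ c₂ a₃ b₃ c₃) (O₁ : Outer G a₁ b₁ c₁ v₁) (O₂ : Outer G a₂ b₂ c₂ v₂) (O₃ : Outer G a₃ b₃ c₃ v₃) where

    private
      K₂ = del² G c₃ b₃
      K₁ = del² K₂ c₂ b₂
      K₀ = del² K₁ c₁ b₁
      del²⊑ : ∀ (H : Graph n) x y → del² H x y ⊑ H
      del²⊑ H x y = ⊑-trans (del-⊑ (del H x) y) (del-⊑ H x)

      abstract
        ab₁ : G ∋ a₁ ∼ b₁
        ab₁ = proj₁ (proj₁ (proj₁ T))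
        ac₁ : G ∋ a₁ ∼ c₁
        ac₁ = proj₁ (proj₂ (proj₁ (proj₁ T)))
        bc₁ : G ∋ b₁ ∼ c₁
        bc₁ = proj₂ (proj₂ (proj₁ (proj₁ T)))
        ab₂ : G ∋ a₂ ∼ b₂
        ab₂ = proj₁ (proj₁ (proj₂ (proj₁ T)))
        ac₂ : G ∋ a₂ ∼ c₂
        ac₂ = proj₁ (proj₂ (proj₁ (proj₂ (proj₁ T))))
        bc₂ : G ∋ b₂ ∼ c₂
        bc₂ = proj₂ (proj₂ (proj₁ (proj₂ (proj₁ T))))
        ab₃ : G ∋ a₃ ∼ b₃
        ab₃ = proj₁ (proj₂ (proj₂ (proj₁ T)))
        ac₃ : G ∋ a₃ ∼ c₃
        ac₃ = proj₁ (proj₂ (proj₂ (proj₂ (proj₁ T))))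
        bc₃ : G ∋ b₃ ∼ c₃
        bc₃ = proj₂ (proj₂ (proj₂ (proj₂ (proj₁ T))))
        l₁₂ : G ∋ b₁ ∼ b₂
        l₁₂ = proj₁ (proj₁ (proj₂ T))
        l₁₃ : G ∋ c₁ ∼ b₃
        l₁₃ = proj₁ (proj₂ (proj₁ (proj₂ T)))
        l₂₃ : G ∋ c₂ ∼ c₃
        l₂₃ = proj₂ (proj₂ (proj₁ (proj₂ T)))
        a₁v₁ : G ∋ a₁ ∼ v₁
        a₁v₁ = proj₁ O₁
        v₁≢b₁ : v₁ ≢ b₁
        v₁≢b₁ = proj₁ (proj₂ O₁)
        v₁≢c₁ : v₁ ≢ c₁
        v₁≢c₁ = proj₁ (proj₂ (proj₂ O₁))
        nbA₁ : ∀ {w} → G ∋ a₁ ∼ w → w ≡ b₁ ⊎ w ≡ c₁ ⊎ w ≡ v₁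
        nbA₁ = proj₂ (proj₂ (proj₂ O₁))
        a₂v₂ : G ∋ a₂ ∼ v₂
        a₂v₂ = proj₁ O₂
        v₂≢b₂ : v₂ ≢ b₂
        v₂≢b₂ = proj₁ (proj₂ O₂)
        v₂≢c₂ : v₂ ≢ c₂
        v₂≢c₂ = proj₁ (proj₂ (proj₂ O₂))
        nbA₂ : ∀ {w} → G ∋ a₂ ∼ w → w ≡ b₂ ⊎ w ≡ c₂ ⊎ w ≡ v₂
        nbA₂ = proj₂ (proj₂ (proj₂ O₂))
        a₃v₃ : G ∋ a₃ ∼ v₃
        a₃v₃ = proj₁ O₃
        v₃≢b₃ : v₃ ≢ b₃
        v₃≢b₃ = proj₁ (proj₂ O₃)
        v₃≢c₃ : v₃ ≢ c₃
        v₃≢c₃ = proj₁ (proj₂ (proj₂ O₃))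
        nbA₃ : ∀ {w} → G ∋ a₃ ∼ w → w ≡ b₃ ⊎ w ≡ c₃ ⊎ w ≡ v₃
        nbA₃ = proj₂ (proj₂ (proj₂ O₃))
        D₁₂ : Apart a₁ b₁ c₁ a₂ b₂ c₂
        D₁₂ = toApart (proj₁ (proj₂ (proj₂ T)))
        D₁₃ : Apart a₁ b₁ c₁ a₃ b₃ c₃
        D₁₃ = toApart (proj₁ (proj₂ (proj₂ (proj₂ T))))
        D₂₃ : Apart a₂ b₂ c₂ a₃ b₃ c₃
        D₂₃ = toApart (proj₂ (proj₂ (proj₂ (proj₂ T))))
      module D₁₂ = Apart D₁₂
      module D₁₃ = Apart D₁₃
      module D₂₃ = Apart D₂₃

      abstract
        K₀⊑G : K₀ ⊑ G
        K₀⊑G = ⊑-trans (del²⊑ K₁ c₁ b₁) (⊑-trans (del²⊑ K₂ c₂ b₂) (del²⊑ G c₃ b₃))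
        a₁≢b₁ : a₁ ≢ b₁
        a₁≢b₁ = ∼⇒≢ G ab₁
        a₁≢c₁ : a₁ ≢ c₁
        a₁≢c₁ = ∼⇒≢ G ac₁
        a₂≢b₂ : a₂ ≢ b₂
        a₂≢b₂ = ∼⇒≢ G ab₂
        a₂≢c₂ : a₂ ≢ c₂
        a₂≢c₂ = ∼⇒≢ G ac₂
        a₃≢b₃ : a₃ ≢ b₃
        a₃≢b₃ = ∼⇒≢ G ab₃
        a₃≢c₃ : a₃ ≢ c₃
        a₃≢c₃ = ∼⇒≢ G ac₃
        nbB₁ : ∀ {w} → G ∋ b₁ ∼ w → w ≡ a₁ ⊎ w ≡ c₁ ⊎ w ≡ b₂
        nbB₁ = nbrs₃ (subcubic g) (∼-sym G ab₁) bc₁ l₁₂ a₁≢c₁ D₁₂.ab D₁₂.cb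
        nbC₁ : ∀ {w} → G ∋ c₁ ∼ w → w ≡ a₁ ⊎ w ≡ b₁ ⊎ w ≡ b₃
        nbC₁ = nbrs₃ (subcubic g) (∼-sym G ac₁) (∼-sym G bc₁) l₁₃ a₁≢b₁ D₁₃.ab D₁₃.bb
        nbB₂ : ∀ {w} → G ∋ b₂ ∼ w → w ≡ a₂ ⊎ w ≡ c₂ ⊎ w ≡ b₁
        nbB₂ = nbrs₃ (subcubic g) (∼-sym G ab₂) bc₂ (∼-sym G l₁₂) a₂≢c₂ (≢-sym D₁₂.ba) (≢-sym D₁₂.bc)
        nbC₂ : ∀ {w} → G ∋ c₂ ∼ w → w ≡ a₂ ⊎ w ≡ b₂ ⊎ w ≡ c₃
        nbC₂ = nbrs₃ (subcubic g) (∼-sym G ac₂) (∼-sym G bc₂) l₂₃ a₂≢b₂ D₂₃.ac D₂₃.bc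
        nbB₃ : ∀ {w} → G ∋ b₃ ∼ w → w ≡ a₃ ⊎ w ≡ c₃ ⊎ w ≡ c₁
        nbB₃ = nbrs₃ (subcubic g) (∼-sym G ab₃) bc₃ (∼-sym G l₁₃) a₃≢c₃ (≢-sym D₁₃.ca) (≢-sym D₁₃.cc)
        nbC₃ : ∀ {w} → G ∋ c₃ ∼ w → w ≡ a₃ ⊎ w ≡ b₃ ⊎ w ≡ c₂
        nbC₃ = nbrs₃ (subcubic g) (∼-sym G ac₃) (∼-sym G bc₃) (∼-sym G l₂₃) a₃≢b₃ (≢-sym D₂₃.ca) (≢-sym D₂₃.cb)
        -- An edge between two of the vertices `a₁`, `a₂`, `a₃` would be a second link between their
        -- triangles; hence the three pendant edges are different.
        a₁≁a₂ : ¬ G ∋ a₁ ∼ a₂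
        a₁≁a₂ aa = noDL ((∼-sym G bc₁ , ∼-sym G ac₁ , ∼-sym G ab₁) , (∼-sym G bc₂ , ∼-sym G ac₂ , ∼-sym G ab₂) , l₁₂ , aa , flip (proj₁ (proj₂ (proj₂ T))))
        a₁≁a₃ : ¬ G ∋ a₁ ∼ a₃
        a₁≁a₃ aa = noDL ((bc₁ , ∼-sym G ab₁ , ∼-sym G ac₁) , (∼-sym G bc₃ , ∼-sym G ac₃ , ∼-sym G ab₃) , l₁₃ , aa , flip′ (proj₁ (proj₂ (proj₂ (proj₂ T)))))
        a₂≁a₃ : ¬ G ∋ a₂ ∼ a₃
        a₂≁a₃ aa = noDL ((bc₂ , ∼-sym G ab₂ , ∼-sym G ac₂) , (bc₃ , ∼-sym G ab₃ , ∼-sym G ac₃) , l₂₃ , aa , flip″ (proj₂ (proj₂ (proj₂ (proj₂ T)))))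
        v₁≢b₂ : v₁ ≢ b₂
        v₁≢b₂ refl = [ D₁₂.aa , [ D₁₂.ac , a₁≢b₁ ]′ ]′ (nbB₂ (∼-sym G a₁v₁))
        v₁≢c₂ : v₁ ≢ c₂
        v₁≢c₂ refl = [ D₁₂.aa , [ D₁₂.ab , D₁₃.ac ]′ ]′ (nbC₂ (∼-sym G a₁v₁))
        v₁≢b₃ : v₁ ≢ b₃
        v₁≢b₃ refl = [ D₁₃.aa , [ D₁₃.ac , a₁≢c₁ ]′ ]′ (nbB₃ (∼-sym G a₁v₁))
        v₁≢c₃ : v₁ ≢ c₃
        v₁≢c₃ refl = [ D₁₃.aa , [ D₁₃.ab , D₁₂.ac ]′ ]′ (nbC₃ (∼-sym G a₁v₁))
        v₂≢b₁ : v₂ ≢ b₁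
        v₂≢b₁ refl = [ ≢-sym D₁₂.aa , [ ≢-sym D₁₂.ca , a₂≢b₂ ]′ ]′ (nbB₁ (∼-sym G a₂v₂))
        v₂≢c₁ : v₂ ≢ c₁
        v₂≢c₁ refl = [ ≢-sym D₁₂.aa , [ ≢-sym D₁₂.ba , D₂₃.ab ]′ ]′ (nbC₁ (∼-sym G a₂v₂))
        v₂≢b₃ : v₂ ≢ b₃
        v₂≢b₃ refl = [ D₂₃.aa , [ D₂₃.ac , ≢-sym D₁₂.ca ]′ ]′ (nbB₃ (∼-sym G a₂v₂))
        v₂≢c₃ : v₂ ≢ c₃
        v₂≢c₃ refl = [ D₂₃.aa , [ D₂₃.ab , a₂≢c₂ ]′ ]′ (nbC₃ (∼-sym G a₂v₂))
        v₃≢b₁ : v₃ ≢ b₁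
        v₃≢b₁ refl = [ ≢-sym D₁₃.aa , [ ≢-sym D₁₃.ca , ≢-sym D₂₃.ba ]′ ]′ (nbB₁ (∼-sym G a₃v₃))
        v₃≢c₁ : v₃ ≢ c₁
        v₃≢c₁ refl = [ ≢-sym D₁₃.aa , [ ≢-sym D₁₃.ba , a₃≢b₃ ]′ ]′ (nbC₁ (∼-sym G a₃v₃))
        v₃≢b₂ : v₃ ≢ b₂
        v₃≢b₂ refl = [ ≢-sym D₂₃.aa , [ ≢-sym D₂₃.ca , ≢-sym D₁₃.ba ]′ ]′ (nbB₂ (∼-sym G a₃v₃))
        v₃≢c₂ : v₃ ≢ c₂
        v₃≢c₂ refl = [ ≢-sym D₂₃.aa , [ ≢-sym D₂₃.ba , a₃≢c₃ ]′ ]′ (nbC₂ (∼-sym G a₃v₃))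
        v₂≢a₁ : v₂ ≢ a₁
        v₂≢a₁ refl = a₁≁a₂ (∼-sym G a₂v₂)
        v₃≢a₁ : v₃ ≢ a₁
        v₃≢a₁ refl = a₁≁a₃ (∼-sym G a₃v₃)
        v₃≢a₂ : v₃ ≢ a₂
        v₃≢a₂ refl = a₂≁a₃ (∼-sym G a₃v₃)
        c₁≁v₂ : ¬ K₁ ∋ c₁ ∼ v₂
        c₁≁v₂ ((((cv , _) , _) , _) , _) = [ v₂≢a₁ , [ v₂≢b₁ , v₂≢b₃ ]′ ]′ (nbC₁ cv)
        b₁≁v₃ : ¬ K₁ ∋ b₁ ∼ v₃
        b₁≁v₃ ((((bv , _) , _) , _) , _) = [ v₃≢a₁ , [ v₃≢c₁ , v₃≢b₂ ]′ ]′ (nbB₁ bv)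
        b₂≁v₃ : ¬ K₂ ∋ b₂ ∼ v₃
        b₂≁v₃ ((bv , _) , _) = [ v₃≢a₂ , [ v₃≢c₂ , v₃≢b₁ ]′ ]′ (nbB₂ bv)
        b₂≁c₁ : ¬ K₂ ∋ b₂ ∼ c₁
        b₂≁c₁ ((bc , _) , _) = [ D₁₂.ca , [ D₁₂.cc , ≢-sym (∼⇒≢ G bc₁) ]′ ]′ (nbB₂ bc)
        in₂ : ∀ {u w} → G ∋ u ∼ w → u ≢ c₃ → w ≢ c₃ → u ≢ b₃ → w ≢ b₃ → K₂ ∋ u ∼ w
        in₂ uw a b c d = (uw , a , b) , c , d
        in₁ : ∀ {u w} → K₂ ∋ u ∼ w → u ≢ c₂ → w ≢ c₂ → u ≢ b₂ → w ≢ b₂ → K₁ ∋ u ∼ w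
        in₁ uw a b c d = (uw , a , b) , c , d
        in₀ : ∀ {u w} → K₁ ∋ u ∼ w → u ≢ c₁ → w ≢ c₁ → u ≢ b₁ → w ≢ b₁ → K₀ ∋ u ∼ w
        in₀ uw a b c d = (uw , a , b) , c , d
        va₁ : K₀ ∋ v₁ ∼ a₁
        va₁ = in₀ (in₁ (in₂ (∼-sym G a₁v₁) v₁≢c₃ D₁₃.ac v₁≢b₃ D₁₃.ab) v₁≢c₂ D₁₂.ac v₁≢b₂ D₁₂.ab) v₁≢c₁ a₁≢c₁ v₁≢b₁ a₁≢b₁
        va₂ : K₀ ∋ v₂ ∼ a₂
        va₂ = in₀ (in₁ (in₂ (∼-sym G a₂v₂) v₂≢c₃ D₂₃.ac v₂≢b₃ D₂₃.ab) v₂≢c₂ a₂≢c₂ v₂≢b₂ a₂≢b₂) v₂≢c₁ (≢-sym D₁₂.ca) v₂≢b₁ (≢-sym D₁₂.ba)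
        va₃ : K₀ ∋ v₃ ∼ a₃
        va₃ = in₀ (in₁ (in₂ (∼-sym G a₃v₃) v₃≢c₃ a₃≢c₃ v₃≢b₃ a₃≢b₃) v₃≢c₂ (≢-sym D₂₃.ca) v₃≢b₂ (≢-sym D₂₃.ba)) v₃≢c₁ (≢-sym D₁₃.ca) v₃≢b₁ (≢-sym D₁₃.ba)

      Side : (V → V → Color) → V → V → Color → Color → Set
      Side c a v p q = ∀ {k} → k ≢ c a v → All (k ≢_) (p ∷ q ∷ []) → Unused K₀ c v k

      module Fill {c : V → V → Color} (s : Strong K₀ c) {p₁ q₁ p₂ q₂ p₃ q₃ : Color}
        (un₁ : Side c a₁ v₁ p₁ q₁) (un₂ : Side c a₂ v₂ p₂ q₂) (un₃ : Side c a₃ v₃ p₃ q₃)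
        {e₁₂ e₁₃ z₁ e₂₁ e₂₃ z₂ e₃₁ e₃₂ z₃ f₁₂ f₁₃ f₂₃ : Color}
        (dis₁ : Distinct (e₁₂ ∷ e₁₃ ∷ z₁ ∷ c a₁ v₁ ∷ f₁₂ ∷ f₁₃ ∷ []))
        (dis₂ : Distinct (e₂₁ ∷ e₂₃ ∷ z₂ ∷ c a₂ v₂ ∷ f₁₂ ∷ f₂₃ ∷ []))
        (dis₃ : Distinct (e₃₁ ∷ e₃₂ ∷ z₃ ∷ c a₃ v₃ ∷ f₁₃ ∷ f₂₃ ∷ []))
        (e₁₂≢e₂₁ : e₁₂ ≢ e₂₁) (e₁₂≢z₂ : e₁₂ ≢ z₂) (e₁₃≢e₃₁ : e₁₃ ≢ e₃₁) (e₁₃≢z₃ : e₁₃ ≢ z₃) (e₂₃≢e₃₂ : e₂₃ ≢ e₃₂) (e₂₃≢z₃ : e₂₃ ≢ z₃)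
        (z₁≢e₂₁ : z₁ ≢ e₂₁) (z₁≢z₂ : z₁ ≢ z₂) (z₁≢e₃₁ : z₁ ≢ e₃₁) (z₁≢z₃ : z₁ ≢ z₃) (z₂≢e₃₂ : z₂ ≢ e₃₂) (z₂≢z₃ : z₂ ≢ z₃)
        (E₁₂ : All (e₁₂ ≢_) (p₁ ∷ q₁ ∷ [])) (E₁₃ : All (e₁₃ ≢_) (p₁ ∷ q₁ ∷ []))
        (E₂₁ : All (e₂₁ ≢_) (p₂ ∷ q₂ ∷ [])) (E₂₃ : All (e₂₃ ≢_) (p₂ ∷ q₂ ∷ []))
        (E₃₁ : All (e₃₁ ≢_) (p₃ ∷ q₃ ∷ [])) (E₃₂ : All (e₃₂ ≢_) (p₃ ∷ q₃ ∷ [])) where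

        module S₁ = Six (six dis₁)
        module S₂ = Six (six dis₂)
        module S₃ = Six (six dis₃)

        -- A link is coloured together with the later of its two triangles; until then its colour is
        -- only reserved. So no link is coloured here, `f₁₂` is placed by `step₂`, and `f₁₃`, `f₂₃`
        -- by `step₃`.
        step₁ : AddPair K₁ a₁ b₁ c₁ c e₁₂ e₁₃ z₁ (c a₁ v₁) f₁₂ f₁₃
        step₁ = addPair K₁ (in₁ (in₂ ab₁ D₁₃.ac D₁₃.bc D₁₃.ab D₁₃.bb) D₁₂.ac D₁₂.bc D₁₂.ab D₁₂.bb)
          (in₁ (in₂ ac₁ D₁₃.ac D₁₃.cc D₁₃.ab D₁₃.cb) D₁₂.ac D₁₂.cc D₁₂.ab D₁₂.cb) (in₁ (in₂ bc₁ D₁₃.bc D₁₃.cc D₁₃.bb D₁₃.cb) D₁₂.bc D₁₂.cc D₁₂.bb D₁₂.cb)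
          s b₂ b₃ dis₁ nbA nbB nbC
          where
            nbA : ∀ {w} → K₀ ∋ a₁ ∼ w → c a₁ w ≡ (c a₁ v₁) × Unused K₀ c w e₁₂ × Unused K₀ c w e₁₃
            nbA aw@((_ , _ , w≢c₁) , _ , w≢b₁) with nbA₁ (sub K₀⊑G aw)
            ... | inj₁ e = contradiction e w≢b₁
            ... | inj₂ (inj₁ e) = contradiction e w≢c₁
            ... | inj₂ (inj₂ refl) = refl , un₁ S₁.xo E₁₂ , un₁ S₁.yo E₁₃
            nbB : ∀ {w} → K₁ ∋ b₁ ∼ w → w ≡ a₁ ⊎ w ≡ c₁ ⊎ (w ≡ b₂ × Addable K₀ c w f₁₂ e₁₂ z₁)
            nbB ((((bw , _) , _) , _) , _ , w≢b₂) with nbB₁ bw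
            ... | inj₁ e = inj₁ e
            ... | inj₂ (inj₁ e) = inj₂ (inj₁ e)
            ... | inj₂ (inj₂ e) = contradiction e w≢b₂
            nbC : ∀ {w} → K₁ ∋ c₁ ∼ w → w ≡ a₁ ⊎ w ≡ b₁ ⊎ (w ≡ b₃ × Addable K₀ c w f₁₃ e₁₃ z₁)
            nbC ((((cw , _) , _ , w≢b₃) , _) , _) with nbC₁ cw
            ... | inj₁ e = inj₁ e
            ... | inj₂ (inj₁ e) = inj₂ (inj₁ e)
            ... | inj₂ (inj₂ e) = contradiction e w≢b₃

        step₂ : (R₁ : AddPair K₁ a₁ b₁ c₁ c e₁₂ e₁₃ z₁ (c a₁ v₁) f₁₂ f₁₃) → AddPair K₂ a₂ b₂ c₂ (AddPair.coloring R₁) e₂₁ e₂₃ z₂ (c a₂ v₂) f₁₂ f₂₃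
        step₂ R₁ = addPair K₂ (in₂ ab₂ D₂₃.ac D₂₃.bc D₂₃.ab D₂₃.bb) (in₂ ac₂ D₂₃.ac D₂₃.cc D₂₃.ab D₂₃.cb) (in₂ bc₂ D₂₃.bc D₂₃.cc D₂₃.bb D₂₃.cb)
          (AddPair.strong R₁) b₁ c₃ dis₂ nbA nbB nbC
          where
            k₁ = AddPair.coloring R₁
            up : ∀ {k} → k ≢ (c a₂ v₂) → All (k ≢_) (p₂ ∷ q₂ ∷ []) → k ≢ f₁₂ → Unused K₁ k₁ v₂ k
            up k≢o ks k≢f = AddPair.at-old R₁ v₂≢a₁ v₂≢b₁ v₂≢c₁ (un₂ k≢o ks) (λ _ → k≢f)
              (λ cv → ⊥-elim (c₁≁v₂ cv))
            nbA : ∀ {w} → K₁ ∋ a₂ ∼ w → k₁ a₂ w ≡ (c a₂ v₂) × Unused K₁ k₁ w e₂₁ × Unused K₁ k₁ w e₂₃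
            nbA ((((aw , _) , _) , _ , w≢c₂) , _ , w≢b₂) with nbA₂ aw
            ... | inj₁ e = contradiction e w≢b₂
            ... | inj₂ (inj₁ e) = contradiction e w≢c₂
            ... | inj₂ (inj₂ refl) = AddPair.keeps R₁ (≢-sym D₁₂.ba) (≢-sym D₁₂.ca) v₂≢b₁ v₂≢c₁ , up S₂.xo E₂₁ S₂.xf , up S₂.yo E₂₃ S₂.yf
            nbB : ∀ {w} → K₂ ∋ b₂ ∼ w → w ≡ a₂ ⊎ w ≡ c₂ ⊎ (w ≡ b₁ × Addable K₁ k₁ w f₁₂ e₂₁ z₂)
            nbB ((bw , _) , _) with nbB₂ bw
            ... | inj₁ e = inj₁ e
            ... | inj₂ (inj₁ e) = inj₂ (inj₁ e)
            ... | inj₂ (inj₂ refl) = inj₂ (inj₂ (refl , addable free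
                    (AddPair.at-b R₁ S₂.xf (≢-sym e₁₂≢e₂₁) (≢-sym z₁≢e₂₁)) (AddPair.at-b R₁ S₂.zf (≢-sym e₁₂≢z₂) (≢-sym z₁≢z₂))))
              where
                free : Free K₁ k₁ b₁ f₁₂
                free ((((bw , _) , _) , _) , _ , w≢b₂) with nbB₁ bw
                ... | inj₁ refl = AddPair.at-a R₁ (≢-sym S₁.of) (≢-sym S₁.xf) (≢-sym S₁.yf)
                ... | inj₂ (inj₁ refl) = AddPair.at-d R₁ S₁.fg (≢-sym S₁.yf) (≢-sym S₁.zf)
                ... | inj₂ (inj₂ e) = contradiction e w≢b₂
            nbC : ∀ {w} → K₂ ∋ c₂ ∼ w → w ≡ a₂ ⊎ w ≡ b₂ ⊎ (w ≡ c₃ × Addable K₁ k₁ w f₂₃ e₂₃ z₂)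
            nbC ((cw , _ , w≢c₃) , _) with nbC₂ cw
            ... | inj₁ e = inj₁ e
            ... | inj₂ (inj₁ e) = inj₂ (inj₁ e)
            ... | inj₂ (inj₂ e) = contradiction e w≢c₃

        step₃ : (R₁ : AddPair K₁ a₁ b₁ c₁ c e₁₂ e₁₃ z₁ (c a₁ v₁) f₁₂ f₁₃) (R₂ : AddPair K₂ a₂ b₂ c₂ (AddPair.coloring R₁) e₂₁ e₂₃ z₂ (c a₂ v₂) f₁₂ f₂₃) →
          AddPair G a₃ b₃ c₃ (AddPair.coloring R₂) e₃₁ e₃₂ z₃ (c a₃ v₃) f₁₃ f₂₃
        step₃ R₁ R₂ = addPair G ab₃ ac₃ bc₃ (AddPair.strong R₂) c₁ c₂ dis₃ nbA nbB nbC
          where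
            k₂ = AddPair.coloring R₂
            up : ∀ {k} → k ≢ (c a₃ v₃) → All (k ≢_) (p₃ ∷ q₃ ∷ []) → k ≢ f₁₃ → k ≢ f₂₃ → Unused K₂ k₂ v₃ k
            up k≢o ks k≢f k≢f′ = AddPair.at-old R₂ v₃≢a₂ v₃≢b₂ v₃≢c₂
              (AddPair.at-old R₁ v₃≢a₁ v₃≢b₁ v₃≢c₁ (un₃ k≢o ks)
                (λ bv → ⊥-elim (b₁≁v₃ bv)) (λ _ → k≢f))
              (λ bv → ⊥-elim (b₂≁v₃ bv)) (λ _ → k≢f′)
            nbA : ∀ {w} → K₂ ∋ a₃ ∼ w → k₂ a₃ w ≡ (c a₃ v₃) × Unused K₂ k₂ w e₃₁ × Unused K₂ k₂ w e₃₂
            nbA ((aw , _ , w≢c₃) , _ , w≢b₃) with nbA₃ aw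
            ... | inj₁ e = contradiction e w≢b₃
            ... | inj₂ (inj₁ e) = contradiction e w≢c₃
            ... | inj₂ (inj₂ refl) =
              trans (AddPair.keeps R₂ (≢-sym D₂₃.ba) (≢-sym D₂₃.ca) v₃≢b₂ v₃≢c₂) (AddPair.keeps R₁ (≢-sym D₁₃.ba) (≢-sym D₁₃.ca) v₃≢b₁ v₃≢c₁) ,
              up S₃.xo E₃₁ S₃.xf S₃.xg , up S₃.yo E₃₂ S₃.yf S₃.yg
            nbB : ∀ {w} → G ∋ b₃ ∼ w → w ≡ a₃ ⊎ w ≡ c₃ ⊎ (w ≡ c₁ × Addable K₂ k₂ w f₁₃ e₃₁ z₃)
            nbB bw with nbB₃ bw
            ... | inj₁ e = inj₁ e
            ... | inj₂ (inj₁ e) = inj₂ (inj₁ e)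
            ... | inj₂ (inj₂ refl) = inj₂ (inj₂ (refl , addable free
                    (at-c₁ S₃.xf (≢-sym e₁₃≢e₃₁) (≢-sym z₁≢e₃₁) S₃.xg) (at-c₁ S₃.zf (≢-sym e₁₃≢z₃) (≢-sym z₁≢z₃) S₃.zg)))
              where
                at-c₁ : ∀ {k} → k ≢ f₁₃ → k ≢ e₁₃ → k ≢ z₁ → k ≢ f₂₃ → Unused K₂ k₂ c₁ k
                at-c₁ k≢f k≢e k≢z k≢f′ = AddPair.at-old R₂ D₁₂.ca D₁₂.cb D₁₂.cc (AddPair.at-d R₁ k≢f k≢e k≢z)
                  (λ bc → ⊥-elim (b₂≁c₁ bc)) (λ _ → k≢f′)
                free : Free K₂ k₂ c₁ f₁₃
                free ((cw , _) , _ , w≢b₃) with nbC₁ cw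
                ... | inj₁ refl = AddPair.at-old R₂ D₁₂.aa D₁₂.ab D₁₂.ac (AddPair.at-a R₁ (≢-sym S₁.og) (≢-sym S₁.xg) (≢-sym S₁.yg))
                      (λ _ → ≢-sym S₁.fg) (λ _ → S₃.fg)
                ... | inj₂ (inj₁ refl) = AddPair.at-old R₂ D₁₂.ba D₁₂.bb D₁₂.bc (AddPair.at-b R₁ (≢-sym S₁.fg) (≢-sym S₁.xg) (≢-sym S₁.zg))
                      (λ _ → ≢-sym S₁.fg) (λ _ → S₃.fg)
                ... | inj₂ (inj₂ e) = contradiction e w≢b₃
            nbC : ∀ {w} → G ∋ c₃ ∼ w → w ≡ a₃ ⊎ w ≡ b₃ ⊎ (w ≡ c₂ × Addable K₂ k₂ w f₂₃ e₃₂ z₃)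
            nbC cw with nbC₃ cw
            ... | inj₁ e = inj₁ e
            ... | inj₂ (inj₁ e) = inj₂ (inj₁ e)
            ... | inj₂ (inj₂ refl) = inj₂ (inj₂ (refl , addable free
                    (AddPair.at-d R₂ S₃.yg (≢-sym e₂₃≢e₃₂) (≢-sym z₂≢e₃₂)) (AddPair.at-d R₂ S₃.zg (≢-sym e₂₃≢z₃) (≢-sym z₂≢z₃))))
              where
                free : Free K₂ k₂ c₂ f₂₃
                free ((cw , _ , w≢c₃) , _) with nbC₂ cw
                ... | inj₁ refl = AddPair.at-a R₂ (≢-sym S₂.og) (≢-sym S₂.xg) (≢-sym S₂.yg)
                ... | inj₂ (inj₁ refl) = AddPair.at-b R₂ (≢-sym S₂.fg) (≢-sym S₂.xg) (≢-sym S₂.zg)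
                ... | inj₂ (inj₂ e) = contradiction e w≢c₃

    tripleLinked : Colorable G
    tripleLinked =
      go (below (Good-del (Good-del (Good-del (Good-del (Good-del (Good-del g c₃) b₃) c₂) b₂) c₁) b₁)
           (⊑⇒⊏ K₀⊑G (∼-sym G ac₃) λ ((((((_ , c₃≢c₃ , _) , _) , _) , _) , _) , _) → c₃≢c₃ refl))
      where
        go : Colorable K₀ → Colorable G
        go (c , s) = fill (side-colors g K₀⊑G s va₁) (side-colors g K₀⊑G s va₂) (side-colors g K₀⊑G s va₃)
          where
            Sides : V → V → Set
            Sides a v = ∃ λ p → ∃ λ q → Distinct (c a v ∷ p ∷ q ∷ []) × Side c a v p q
            fill : Sides a₁ v₁ → Sides a₂ v₂ → Sides a₃ v₃ → Colorable G
            fill (_ , _ , d₁ , un₁) (_ , _ , d₂ , un₂) (_ , _ , d₃ , un₃) with tripleLinkColors d₁ d₂ d₃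
            ... | _ , dis₁ , dis₂ , dis₃ , ((x₁ ∷ x₂ ∷ []) , (x₃ ∷ x₄ ∷ []) , (x₅ ∷ x₆ ∷ []) , (x₇ ∷ x₈ ∷ x₉ ∷ x₁₀ ∷ []) , (x₁₁ ∷ x₁₂ ∷ [])) ,
                  (E₁₂ , E₁₃) , (E₂₁ , E₂₃) , (E₃₁ , E₃₂) = _ , AddPair.strong (step₃ step₁ (step₂ step₁))
              where open Fill s un₁ un₂ un₃ dis₁ dis₂ dis₃ x₁ x₂ x₃ x₄ x₅ x₆ x₇ x₈ x₉ x₁₀ x₁₁ x₁₂ E₁₂ E₁₃ E₂₁ E₂₃ E₃₁ E₃₂

-- Cutting and joining

module _ {n : ℕ} where

  private
    V = Fin n

  delAll : Graph n → List V → Graph n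
  delAll G xs = record
    { _∼_   = λ u v → G ∋ u ∼ v × All (u ≢_) xs × All (v ≢_) xs
    ; ∼-sym = λ (uv , u∉ , v∉) → ∼-sym G uv , v∉ , u∉
    ; ∼-irr = λ (vv , _) → ∼-irr G vv
    ; _∼?_  = λ u v → _∼?_ G u v ×-dec all? (λ x → ¬? (u ≟ x)) xs ×-dec all? (λ x → ¬? (v ≟ x)) xs
    }

  delAll-⊑ : ∀ G xs → delAll G xs ⊑ G
  delAll-⊑ G xs = incl proj₁

  Good-delAll : ∀ {G} → Good G → ∀ xs → Good (delAll G xs)
  Good-delAll {G} g xs = record
    { clawFree = λ { (cx , _ , x∉) (cy , _ , y∉) (cz , _ , z∉) xy xz yz → [ (λ e → inj₁ (e , x∉ , y∉)) , (λ r → inj₂ ([ (λ e → inj₁ (e , x∉ , z∉)) , (λ e → inj₂ (e , y∉ , z∉)) ]′ r)) ]′ (clawFree g cx cy cz xy xz yz) }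
    ; subcubic = cover-by λ v → let (a , b , c , h) = cover (subcubic g) v in a , b , c , λ (vw , _) → h vw
    ; noPrism = λ dl (aa , _) → noPrism g (DoubleLink-⊑ (delAll-⊑ G xs) dl) aa
    }

  Pair : V → V → V → V → Set
  Pair p q u v = (u ≡ p × v ≡ q) ⊎ (u ≡ q × v ≡ p)

  pair-sym : ∀ {p q u v} → Pair p q u v → Pair p q v u
  pair-sym (inj₁ (a , b)) = inj₂ (b , a)
  pair-sym (inj₂ (a , b)) = inj₁ (b , a)

  cut : Graph n → V → V → Graph n
  cut G p q = record
    { _∼_   = λ u v → G ∋ u ∼ v × ¬ Pair p q u v
    ; ∼-sym = λ (uv , ¬p) → ∼-sym G uv , λ e → ¬p (pair-sym e)
    ; ∼-irr = λ (vv , _) → ∼-irr G vv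
    ; _∼?_  = λ u v → _∼?_ G u v ×-dec ¬? (((u ≟ p) ×-dec (v ≟ q)) ⊎-dec ((u ≟ q) ×-dec (v ≟ p)))
    }

  cut-⊑ : ∀ G p q → cut G p q ⊑ G
  cut-⊑ G p q = incl proj₁

  -- A homomorphism that is injective on each neighbourhood maps distinct incident edges to distinct
  -- incident edges, and a path of three edges to edges that still satisfy the hypotheses of
  -- `joined`.
  Strong-pullback : ∀ {H G c} (φ : V → V) → (∀ {u v} → H ∋ u ∼ v → G ∋ φ u ∼ φ v) →
    (∀ {u a b} → H ∋ u ∼ a → H ∋ u ∼ b → φ a ≡ φ b → a ≡ b) → Strong G c → Strong H (λ u v → c (φ u) (φ v))
  Strong-pullback {H} φ hom inj s = record
    { symm = λ u v → symm s (φ u) (φ v)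
    ; incident = λ ua ub a≢b → incident s (hom ua) (hom ub) (a≢b ∘ inj ua ub)
    ; joined = λ uv ua vb a≢v b≢u → joined s (hom uv) (hom ua) (hom vb) (a≢v ∘ inj ua uv) (b≢u ∘ inj vb (∼-sym H uv))
    }

  -- M replaces the joining edge v₁v₂ by pendant edges u₁v₁ and u₂v₂, both inheriting its colour.
  unjoin : ∀ {L M : Graph n} {v₁ v₂ u₁ u₂ c} (v₁≢v₂ : v₁ ≢ v₂) → ¬ L ∋ v₁ ∼ v₂ → (∀ {w} → ¬ L ∋ u₁ ∼ w) → (∀ {w} → ¬ L ∋ u₂ ∼ w) →
    u₁ ≢ u₂ → All (u₁ ≢_) (v₁ ∷ v₂ ∷ []) → All (u₂ ≢_) (v₁ ∷ v₂ ∷ []) →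
    (∀ {x y} → M ∋ x ∼ y → L ∋ x ∼ y ⊎ Pair u₁ v₁ x y ⊎ Pair u₂ v₂ x y) → Strong (join L v₁ v₂ v₁≢v₂) c →
    ∃ λ k → Strong M k × k u₁ v₁ ≡ c v₁ v₂ × k u₂ v₂ ≡ c v₁ v₂ × (∀ {x y} → x ≢ u₁ → x ≢ u₂ → y ≢ u₁ → y ≢ u₂ → k x y ≡ c x y)
  unjoin {L} {M} {v₁} {v₂} {u₁} {u₂} {c} v₁≢v₂ ¬L iso₁ iso₂ u₁≢u₂ (u₁≢v₁ ∷ u₁≢v₂ ∷ []) (u₂≢v₁ ∷ u₂≢v₂ ∷ []) edges s =
    (λ x y → c (φ x) (φ y)) , Strong-pullback {M} {J} φ hom inj s ,
    trans (cong₂ c φu₁ (φ-else (≢-sym u₁≢v₁) (≢-sym u₂≢v₁))) (symm s v₂ v₁) , cong₂ c φu₂ (φ-else (≢-sym u₁≢v₂) (≢-sym u₂≢v₂)) ,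
    λ a b d e → cong₂ c (φ-else a b) (φ-else d e)
    where
      J = join L v₁ v₂ v₁≢v₂
      -- The leaf `u₁` is folded onto `v₂` and `u₂` onto `v₁`, so both pendant edges land on the
      -- joining edge. Injectivity at `v₁` and `v₂` holds because `v₁ v₂` is not an edge of `L`.
      φ : V → V
      φ x with x ≟ u₁ | x ≟ u₂
      ... | yes _ | _     = v₂
      ... | no _  | yes _ = v₁
      ... | no _  | no _  = x
      φu₁ : φ u₁ ≡ v₂
      φu₁ with u₁ ≟ u₁
      ... | yes _ = refl
      ... | no ne = contradiction refl ne
      φu₂ : φ u₂ ≡ v₁
      φu₂ with u₂ ≟ u₁ | u₂ ≟ u₂
      ... | yes e | _ = contradiction (≡-sym e) u₁≢u₂
      ... | no _ | yes _ = refl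
      ... | no _ | no ne = contradiction refl ne
      φ-else : ∀ {x} → x ≢ u₁ → x ≢ u₂ → φ x ≡ x
      φ-else {x} x≢u₁ x≢u₂ with x ≟ u₁ | x ≟ u₂
      ... | yes e | _ = contradiction e x≢u₁
      ... | no _ | yes e = contradiction e x≢u₂
      ... | no _ | no _ = refl
      φv₁ = φ-else (≢-sym u₁≢v₁) (≢-sym u₂≢v₁)
      φv₂ = φ-else (≢-sym u₁≢v₂) (≢-sym u₂≢v₂)
      φL : ∀ {x y} → L ∋ x ∼ y → φ x ≡ x
      φL xy = φ-else (λ where refl → iso₁ xy) (λ where refl → iso₂ xy)
      hom : ∀ {x y} → M ∋ x ∼ y → J ∋ φ x ∼ φ y
      hom {x} {y} xy with edges xy
      ... | inj₁ e rewrite φL e | φL (∼-sym L e) = inj₁ e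
      ... | inj₂ (inj₁ (inj₁ (refl , refl))) = inj₂ (inj₂ (φu₁ , φv₁))
      ... | inj₂ (inj₁ (inj₂ (refl , refl))) = inj₂ (inj₁ (φv₁ , φu₁))
      ... | inj₂ (inj₂ (inj₁ (refl , refl))) = inj₂ (inj₁ (φu₂ , φv₂))
      ... | inj₂ (inj₂ (inj₂ (refl , refl))) = inj₂ (inj₂ (φv₂ , φu₂))
      inj : ∀ {x a b} → M ∋ x ∼ a → M ∋ x ∼ b → φ a ≡ φ b → a ≡ b
      inj xa xb e with edges xa | edges xb
      ... | inj₁ p | inj₁ q = trans (≡-sym (φL (∼-sym L p))) (trans e (φL (∼-sym L q)))
      ... | inj₁ p | inj₂ (inj₁ (inj₁ (refl , _))) = contradiction p iso₁
      ... | inj₁ p | inj₂ (inj₁ (inj₂ (refl , refl))) = contradiction (subst (λ z → L ∋ v₁ ∼ z) (trans (≡-sym (φL (∼-sym L p))) (trans e φu₁)) p) ¬L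
      ... | inj₁ p | inj₂ (inj₂ (inj₁ (refl , _))) = contradiction p iso₂
      ... | inj₁ p | inj₂ (inj₂ (inj₂ (refl , refl))) = contradiction (∼-sym L (subst (λ z → L ∋ v₂ ∼ z) (trans (≡-sym (φL (∼-sym L p))) (trans e φu₂)) p)) ¬L
      ... | inj₂ (inj₁ (inj₁ (refl , _))) | inj₁ q = contradiction q iso₁
      ... | inj₂ (inj₁ (inj₂ (refl , refl))) | inj₁ q = contradiction (subst (λ z → L ∋ v₁ ∼ z) (trans (≡-sym (φL (∼-sym L q))) (trans (≡-sym e) φu₁)) q) ¬L
      ... | inj₂ (inj₂ (inj₁ (refl , _))) | inj₁ q = contradiction q iso₂
      ... | inj₂ (inj₂ (inj₂ (refl , refl))) | inj₁ q = contradiction (∼-sym L (subst (λ z → L ∋ v₂ ∼ z) (trans (≡-sym (φL (∼-sym L q))) (trans (≡-sym e) φu₂)) q)) ¬L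
      ... | inj₂ (inj₁ (inj₁ (refl , refl))) | inj₂ (inj₁ (inj₁ (_ , refl))) = refl
      ... | inj₂ (inj₁ (inj₁ (refl , refl))) | inj₂ (inj₁ (inj₂ (f , _))) = contradiction f u₁≢v₁
      ... | inj₂ (inj₁ (inj₂ (refl , refl))) | inj₂ (inj₁ (inj₁ (f , _))) = contradiction (≡-sym f) u₁≢v₁
      ... | inj₂ (inj₁ (inj₂ (refl , refl))) | inj₂ (inj₁ (inj₂ (_ , refl))) = refl
      ... | inj₂ (inj₂ (inj₁ (refl , refl))) | inj₂ (inj₂ (inj₁ (_ , refl))) = refl
      ... | inj₂ (inj₂ (inj₁ (refl , refl))) | inj₂ (inj₂ (inj₂ (f , _))) = contradiction f u₂≢v₂
      ... | inj₂ (inj₂ (inj₂ (refl , refl))) | inj₂ (inj₂ (inj₁ (f , _))) = contradiction (≡-sym f) u₂≢v₂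
      ... | inj₂ (inj₂ (inj₂ (refl , refl))) | inj₂ (inj₂ (inj₂ (_ , refl))) = refl
      ... | inj₂ (inj₁ (inj₁ (refl , _))) | inj₂ (inj₂ (inj₁ (f , _))) = contradiction f u₁≢u₂
      ... | inj₂ (inj₁ (inj₁ (refl , _))) | inj₂ (inj₂ (inj₂ (f , _))) = contradiction f u₁≢v₂
      ... | inj₂ (inj₁ (inj₂ (refl , _))) | inj₂ (inj₂ (inj₁ (f , _))) = contradiction (≡-sym f) u₂≢v₁
      ... | inj₂ (inj₁ (inj₂ (refl , _))) | inj₂ (inj₂ (inj₂ (f , _))) = contradiction f v₁≢v₂
      ... | inj₂ (inj₂ (inj₁ (refl , _))) | inj₂ (inj₁ (inj₁ (f , _))) = contradiction (≡-sym f) u₁≢u₂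
      ... | inj₂ (inj₂ (inj₁ (refl , _))) | inj₂ (inj₁ (inj₂ (f , _))) = contradiction f u₂≢v₁
      ... | inj₂ (inj₂ (inj₂ (refl , _))) | inj₂ (inj₁ (inj₁ (f , _))) = contradiction (≡-sym f) u₁≢v₂
      ... | inj₂ (inj₂ (inj₂ (refl , _))) | inj₂ (inj₁ (inj₂ (f , _))) = contradiction (≡-sym f) v₁≢v₂

  -- Without a common neighbour of `p` and `q` the new edge lies in no triangle, so in a new double
  -- link it must be one of the two links. The other link and the two triangles are then old, which
  -- the last hypothesis forbids.
  NoDoubleLink-join : ∀ {L : Graph n} {p q} (p≢q : p ≢ q) → NoDoubleLink L → (∀ {w} → L ∋ p ∼ w → ¬ L ∋ q ∼ w) →
    (∀ {a c a′ c′} → Triangle L p c a → Triangle L q c′ a′ → L ∋ c ∼ c′ → ¬ Disjoint (p ∷ c ∷ a ∷ []) (q ∷ c′ ∷ a′ ∷ [])) →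
    NoDoubleLink (join L p q p≢q)
  NoDoubleLink-join {L} {p} {q} p≢q noDL apart noTriple {a₁} {b₁} {c₁} {a₂} {b₂} {c₂}
    (t₁ , t₂ , bb , cc , dis@((aa ∷ ab ∷ ac ∷ []) ∷ (ba ∷ bb′ ∷ bc ∷ []) ∷ (ca ∷ cb ∷ cc′ ∷ []) ∷ [])) = links (inside t₁) (inside t₂) bb cc
    where
      J = join L p q p≢q
      third-edge : ∀ {u v w} → Pair p q u v → w ≢ u → w ≢ v → ∀ {x} → J ∋ w ∼ x → L ∋ w ∼ x
      third-edge pr w≢u w≢v (inj₁ e) = e
      third-edge (inj₁ (refl , refl)) w≢u w≢v (inj₂ (inj₁ (e , _))) = contradiction e w≢u
      third-edge (inj₁ (refl , refl)) w≢u w≢v (inj₂ (inj₂ (e , _))) = contradiction e w≢v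
      third-edge (inj₂ (refl , refl)) w≢u w≢v (inj₂ (inj₁ (e , _))) = contradiction e w≢v
      third-edge (inj₂ (refl , refl)) w≢u w≢v (inj₂ (inj₂ (e , _))) = contradiction e w≢u
      inner : ∀ {u v w} → J ∋ u ∼ v → J ∋ w ∼ u → J ∋ w ∼ v → L ∋ u ∼ v
      inner (inj₁ e) _ _ = e
      inner (inj₂ pr) wu wv with third-edge pr (∼⇒≢ J wu) (∼⇒≢ J wv) wu | third-edge pr (∼⇒≢ J wu) (∼⇒≢ J wv) wv | pr
      ... | x | y | inj₁ (refl , refl) = contradiction (∼-sym L y) (apart (∼-sym L x))
      ... | x | y | inj₂ (refl , refl) = contradiction (∼-sym L x) (apart (∼-sym L y))
      inside : ∀ {a b c} → Triangle J a b c → Triangle L a b c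
      inside (ab , ac , bc) = inner ab (∼-sym J ac) (∼-sym J bc) , inner ac (∼-sym J ab) bc , inner bc ab ac
      turn : ∀ {a b c a′ b′ c′} → Pair p q b b′ → Triangle L a b c → Triangle L a′ b′ c′ → L ∋ c ∼ c′ →
        a ≢ a′ → a ≢ b′ → a ≢ c′ → b ≢ a′ → b ≢ b′ → b ≢ c′ → c ≢ a′ → c ≢ b′ → c ≢ c′ → ⊥
      turn (inj₁ (refl , refl)) (ab , ac , bc) (ab′ , ac′ , bc′) cc x₁ x₂ x₃ x₄ x₅ x₆ x₇ x₈ x₉ =
        noTriple (bc , ∼-sym L ab , ∼-sym L ac) (bc′ , ∼-sym L ab′ , ∼-sym L ac′) cc ((x₅ ∷ x₆ ∷ x₄ ∷ []) ∷ (x₈ ∷ x₉ ∷ x₇ ∷ []) ∷ (x₂ ∷ x₃ ∷ x₁ ∷ []) ∷ [])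
      turn (inj₂ (refl , refl)) (ab , ac , bc) (ab′ , ac′ , bc′) cc x₁ x₂ x₃ x₄ x₅ x₆ x₇ x₈ x₉ =
        noTriple (bc′ , ∼-sym L ab′ , ∼-sym L ac′) (bc , ∼-sym L ab , ∼-sym L ac) (∼-sym L cc)
          ((≢-sym x₅ ∷ ≢-sym x₈ ∷ ≢-sym x₂ ∷ []) ∷ (≢-sym x₆ ∷ ≢-sym x₉ ∷ ≢-sym x₃ ∷ []) ∷ (≢-sym x₄ ∷ ≢-sym x₇ ∷ ≢-sym x₁ ∷ []) ∷ [])
      links : Triangle L a₁ b₁ c₁ → Triangle L a₂ b₂ c₂ → J ∋ b₁ ∼ b₂ → J ∋ c₁ ∼ c₂ → ⊥
      links t₁ t₂ (inj₁ bb) (inj₁ cc) = noDL (t₁ , t₂ , bb , cc , dis)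
      links t₁@(_ , _ , bc₁) t₂@(_ , _ , _) (inj₂ pr) cc =
        turn pr t₁ t₂ (third-edge pr (≢-sym (∼⇒≢ L bc₁)) cb cc) aa ab ac ba bb′ bc ca cb cc′
      links t₁@(ab₁ , ac₁ , bc₁) t₂@(ab₂ , ac₂ , bc₂) bb (inj₂ pr) =
        turn pr (ac₁ , ab₁ , ∼-sym L bc₁) (ac₂ , ab₂ , ∼-sym L bc₂) (third-edge pr (∼⇒≢ L bc₁) bc bb) aa ac ab ca cc′ cb ba bc bb′

  -- For an edge `u v` this says that it lies in no triangle, that is, it is a link.
  NoCommon : Graph n → V → V → Set
  NoCommon G u v = ∀ {s} → G ∋ u ∼ s → ¬ G ∋ v ∼ s

  -- Any coincidence between the two triangles would produce a common neighbour of `a` and `a′`.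
  link-disjoint : ∀ (G : Graph n) {a y z a′ y′ z′} → Triangle G a y z → Triangle G a′ y′ z′ → G ∋ a ∼ a′ → NoCommon G a a′ →
    Disjoint (a ∷ y ∷ z ∷ []) (a′ ∷ y′ ∷ z′ ∷ [])
  link-disjoint G (ay , az , yz) (ay′ , az′ , yz′) aa′ none =
    (∼⇒≢ G aa′ ∷ (λ where refl → none yz′ az′) ∷ (λ where refl → none (∼-sym G yz′) ay′) ∷ []) ∷
    ((λ where refl → none az yz) ∷ (λ where refl → none ay ay′) ∷ (λ where refl → none ay az′) ∷ []) ∷
    ((λ where refl → none ay (∼-sym G yz)) ∷ (λ where refl → none az ay′) ∷ (λ where refl → none az az′) ∷ []) ∷ []

  module _ {G : Graph n} (g : Good G) (noLeaf : NoLeaf G) (noPath : ∀ {v x y} → ¬ Only₂ G v x y) (noDiamond : NoDiamond G) where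

    other-nbrs : ∀ {v u} → G ∋ v ∼ u → ∃ λ s → ∃ λ t → G ∋ v ∼ s × G ∋ v ∼ t × s ≢ u × t ≢ u × s ≢ t
    other-nbrs {v} {u} vu with rest g (del-⊑ G u) vu (λ (_ , _ , u≢u) → u≢u refl)
    ... | two vs vt s≢u t≢u s≢t _ = _ , _ , vs , vt , s≢u , t≢u , s≢t
    ... | one r h = ⊥-elim (impossible (_∼?_ G v r ×-dec ¬? (r ≟ u)))
      where
        nb : ∀ {x} → G ∋ v ∼ x → x ≢ u → x ≡ r
        nb vx x≢u = h (vx , ∼⇒≢ G vu , x≢u)
        impossible : Dec (G ∋ v ∼ r × r ≢ u) → ⊥
        impossible (yes (vr , r≢u)) = noPath (vu , vr , ≢-sym r≢u , split)
          where
            split : ∀ x → G ∋ v ∼ x → x ≡ u ⊎ x ≡ r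
            split x vx with x ≟ u
            ... | yes e = inj₁ e
            ... | no x≢u = inj₂ (nb vx x≢u)
        impossible (no ¬r) = noLeaf (vu , only)
          where
            only : ∀ x → G ∋ v ∼ x → x ≡ u
            only x vx with x ≟ u
            ... | yes e = e
            ... | no x≢u = contradiction (subst (λ z → G ∋ v ∼ z) (nb vx x≢u) vx , λ e → x≢u (trans (nb vx x≢u) e)) ¬r

    beyond-link : ∀ {v u} → G ∋ v ∼ u → NoCommon G u v → ∃ λ s → ∃ λ t → Triangle G v s t × s ≢ u × t ≢ u × (∀ {w} → G ∋ v ∼ w → w ≡ u ⊎ w ≡ s ⊎ w ≡ t)
    beyond-link vu none with other-nbrs vu
    ... | s , t , vs , vt , s≢u , t≢u , s≢t = s , t ,
      (vs , vt , others-adjacent g vu vs vt (≢-sym s≢u) (≢-sym t≢u) s≢t (λ us → none us vs) (λ ut → none ut vt)) ,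
      s≢u , t≢u , nbrs₃ (subcubic g) vu vs vt (≢-sym s≢u) (≢-sym t≢u) s≢t

    -- Besides one link, the other two edges at `v` span a triangle, so neither of them is a link.
    link-unique : ∀ {v u u′} → G ∋ v ∼ u → G ∋ v ∼ u′ → NoCommon G u v → NoCommon G u′ v → u ≡ u′
    link-unique vu vu′ none none′ with beyond-link vu none
    ... | s , t , (vs , vt , st) , _ , _ , h with h vu′
    ... | inj₁ e = ≡-sym e
    ... | inj₂ (inj₁ refl) = contradiction vt (none′ st)
    ... | inj₂ (inj₂ refl) = contradiction vs (none′ (∼-sym G st))

    triangle-at : ∀ {v u} → G ∋ v ∼ u → ∃ λ s → ∃ λ t → Triangle G v s t
    triangle-at vu with other-nbrs vu
    ... | s , t , vs , vt , s≢u , t≢u , s≢t with clawFree g vu vs vt (≢-sym s≢u) (≢-sym t≢u) s≢t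
    ... | inj₁ us = _ , _ , vu , vs , us
    ... | inj₂ (inj₁ ut) = _ , _ , vu , vt , ut
    ... | inj₂ (inj₂ st) = _ , _ , vs , vt , st

    -- If the third edge at `v` lay in a triangle too, that triangle would share a side with `v s t`
    -- and form a diamond.
    triangle-link : ∀ {v s t} → Triangle G v s t → ∃ λ x → G ∋ v ∼ x × NoCommon G v x × x ≢ s × x ≢ t × (∀ {w} → G ∋ v ∼ w → w ≡ s ⊎ w ≡ t ⊎ w ≡ x)
    triangle-link {v} {s} {t} (vs , vt , st) with third g (λ o _ → noPath o) vs vt st
    ... | x , vx , x≢s , x≢t , h = x , vx , none , x≢s , x≢t , h
      where
        none : NoCommon G v x
        none vr xr with h vr
        ... | inj₁ refl = noDiamond ((vs , ∼-sym G vt , ∼-sym G st) , ∼-sym G vx , xr , ≢-sym x≢t)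
        ... | inj₂ (inj₁ refl) = noDiamond ((vt , ∼-sym G vs , st) , ∼-sym G vx , xr , ≢-sym x≢s)
        ... | inj₂ (inj₂ refl) = ∼-irr G xr

-- Chains of three triangles

module _ {n : ℕ} where

  private
    V = Fin n

  -- An outer triangle `u₃ u₁ u₂`, attached by the link `b u₃` to the corner `b` of the middle
  -- triangle; its other two links lead to `v₁` and `v₂`.
  record Arm (G : Graph n) (b u₃ u₁ u₂ v₁ v₂ : V) : Set where
    field
      link   : G ∋ b ∼ u₃
      apart  : NoCommon G b u₃
      tri    : Triangle G u₃ u₁ u₂
      nb₃    : ∀ {w} → G ∋ u₃ ∼ w → w ≡ b ⊎ w ≡ u₁ ⊎ w ≡ u₂
      link₁  : G ∋ u₁ ∼ v₁
      apart₁ : NoCommon G u₁ v₁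
      v₁≢u₂  : v₁ ≢ u₂
      v₁≢u₃  : v₁ ≢ u₃
      nb₁    : ∀ {w} → G ∋ u₁ ∼ w → w ≡ u₂ ⊎ w ≡ u₃ ⊎ w ≡ v₁
      link₂  : G ∋ u₂ ∼ v₂
      apart₂ : NoCommon G u₂ v₂
      v₂≢u₁  : v₂ ≢ u₁
      v₂≢u₃  : v₂ ≢ u₃
      nb₂    : ∀ {w} → G ∋ u₂ ∼ w → w ≡ u₁ ⊎ w ≡ u₃ ⊎ w ≡ v₂

  -- With `turned` below, this reduces each fact about the positions of the three triangles to one
  -- of its symmetric cases.
  mirror : ∀ {G : Graph n} {b u₃ u₁ u₂ v₁ v₂} → Arm G b u₃ u₁ u₂ v₁ v₂ → Arm G b u₃ u₂ u₁ v₂ v₁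
  mirror {G} A = record
    { link = link ; apart = apart ; tri = proj₁ (proj₂ tri) , proj₁ tri , ∼-sym G (proj₂ (proj₂ tri))
    ; nb₃ = λ uw → [ inj₁ , inj₂ ∘ [ inj₂ , inj₁ ]′ ]′ (nb₃ uw)
    ; link₁ = link₂ ; apart₁ = apart₂ ; v₁≢u₂ = v₂≢u₁ ; v₁≢u₃ = v₂≢u₃ ; nb₁ = nb₂
    ; link₂ = link₁ ; apart₂ = apart₁ ; v₂≢u₁ = v₁≢u₂ ; v₂≢u₃ = v₁≢u₃ ; nb₂ = nb₁ }
    where open Arm A

  record Centre (G : Graph n) (b c a u₃ w₃ v₅ : V) : Set where
    field
      tri : Triangle G b c a
      nbB : ∀ {w} → G ∋ b ∼ w → w ≡ c ⊎ w ≡ a ⊎ w ≡ u₃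
      nbC : ∀ {w} → G ∋ c ∼ w → w ≡ b ⊎ w ≡ a ⊎ w ≡ w₃
      nbA : ∀ {w} → G ∋ a ∼ w → w ≡ b ⊎ w ≡ c ⊎ w ≡ v₅
      link  : G ∋ a ∼ v₅
      apart : NoCommon G a v₅
      v₅≢b  : v₅ ≢ b
      v₅≢c  : v₅ ≢ c

  turned : ∀ {G : Graph n} {b c a u₃ w₃ v₅} → Centre G b c a u₃ w₃ v₅ → Centre G c b a w₃ u₃ v₅
  turned {G} C = record
    { tri = ∼-sym G (proj₁ tri) , proj₂ (proj₂ tri) , proj₁ (proj₂ tri) ; nbB = nbC ; nbC = nbB
    ; nbA = λ aw → [ inj₂ ∘ inj₁ , [ inj₁ , inj₂ ∘ inj₂ ]′ ]′ (nbA aw)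
    ; link = link ; apart = apart ; v₅≢b = v₅≢c ; v₅≢c = v₅≢b }
    where open Centre C

  NoTripleLink : Graph n → Set
  NoTripleLink G = ∀ {a₁ b₁ c₁ a₂ b₂ c₂ a₃ b₃ c₃} → ¬ TripleLink G a₁ b₁ c₁ a₂ b₂ c₂ a₃ b₃ c₃

  module _ {G : Graph n} (g : Good G) (noLeaf : NoLeaf G) (noPath : ∀ {v x y} → ¬ Only₂ G v x y) (noDiamond : NoDiamond G)
    (noDL : NoDoubleLink G) (noTL : NoTripleLink G) where

    private
      _≈_ : V → V → Set
      u ≈ v = G ∋ u ∼ v
      sy : ∀ {u v} → u ≈ v → v ≈ u
      sy = ∼-sym G

    arm : ∀ {b u₃} → b ≈ u₃ → NoCommon G b u₃ → ∃ λ u₁ → ∃ λ u₂ → ∃ λ v₁ → ∃ λ v₂ → Arm G b u₃ u₁ u₂ v₁ v₂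
    arm bu₃ none with beyond-link g noLeaf noPath noDiamond (sy bu₃) none
    ... | u₁ , u₂ , (x , y , z) , _ , _ , nb with triangle-link g noLeaf noPath noDiamond (z , sy x , sy y) | triangle-link g noLeaf noPath noDiamond (sy z , sy y , sy x)
    ... | v₁ , uv₁ , none₁ , e₁ , f₁ , nb₁ | v₂ , uv₂ , none₂ , e₂ , f₂ , nb₂ = u₁ , u₂ , v₁ , v₂ , record
      { link = bu₃ ; apart = none ; tri = x , y , z ; nb₃ = nb
      ; link₁ = uv₁ ; apart₁ = none₁ ; v₁≢u₂ = e₁ ; v₁≢u₃ = f₁ ; nb₁ = nb₁
      ; link₂ = uv₂ ; apart₂ = none₂ ; v₂≢u₁ = e₂ ; v₂≢u₃ = f₂ ; nb₂ = nb₂ }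

    module _ {b c a u₃ w₃ v₅ u₁ u₂ v₁ v₂} (C : Centre G b c a u₃ w₃ v₅) (A : Arm G b u₃ u₁ u₂ v₁ v₂) where
      private
        module A = Arm A
        module C = Centre C
        bc = proj₁ C.tri
        ba = proj₁ (proj₂ C.tri)
        ca = proj₂ (proj₂ C.tri)
        x = proj₁ A.tri
        y = proj₁ (proj₂ A.tri)
        z = proj₂ (proj₂ A.tri)

      centre-arm : Disjoint (b ∷ c ∷ a ∷ []) (u₃ ∷ u₁ ∷ u₂ ∷ [])
      centre-arm = link-disjoint G C.tri A.tri A.link A.apart

      no-second-link : ¬ c ≈ u₁
      no-second-link cu₁ with centre-arm
      ... | (p₁ ∷ p₂ ∷ p₃ ∷ []) ∷ (q₁ ∷ q₂ ∷ q₃ ∷ []) ∷ (r₁ ∷ r₂ ∷ r₃ ∷ []) ∷ [] =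
        noDL ((sy ba , sy ca , bc) , (sy y , sy z , x) , A.link , cu₁ , (r₃ ∷ r₁ ∷ r₂ ∷ []) ∷ (p₃ ∷ p₁ ∷ p₂ ∷ []) ∷ (q₃ ∷ q₁ ∷ q₂ ∷ []) ∷ [])

      no-top-link : ¬ a ≈ u₁
      no-top-link au₁ with centre-arm
      ... | (p₁ ∷ p₂ ∷ p₃ ∷ []) ∷ (q₁ ∷ q₂ ∷ q₃ ∷ []) ∷ (r₁ ∷ r₂ ∷ r₃ ∷ []) ∷ [] =
        noDL ((sy bc , ca , ba) , (sy y , sy z , x) , A.link , au₁ , (q₃ ∷ q₁ ∷ q₂ ∷ []) ∷ (p₃ ∷ p₁ ∷ p₂ ∷ []) ∷ (r₃ ∷ r₁ ∷ r₂ ∷ []) ∷ [])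

    module _ {b c a u₃ w₃ v₅ u₁ u₂ v₁ v₂ w₁ w₂ v₃ v₄} (C : Centre G b c a u₃ w₃ v₅) (A : Arm G b u₃ u₁ u₂ v₁ v₂) (B : Arm G c w₃ w₁ w₂ v₃ v₄) where
      private
        module A = Arm A
        module B = Arm B
        module C = Centre C

      base-outside : All (w₃ ≢_) (u₃ ∷ u₁ ∷ u₂ ∷ [])
      base-outside = (λ where refl → A.apart (proj₁ C.tri) (sy B.link)) ∷ (λ where refl → no-second-link C A B.link) ∷
        (λ where refl → no-second-link C (mirror A) B.link) ∷ []

      tip-outside : u₁ ≢ w₁
      tip-outside refl with base-outside
      ... | h₃ ∷ _ ∷ h₂ ∷ [] = [ h₂ , [ h₃ , (λ where refl → A.apart₁ (proj₂ (proj₂ B.tri)) (proj₁ (proj₂ B.tri))) ]′ ]′ (A.nb₁ (sy (proj₁ B.tri)))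

    module _ {b c a u₃ w₃ v₅ u₁ u₂ v₁ v₂ w₁ w₂ v₃ v₄} (C : Centre G b c a u₃ w₃ v₅) (A : Arm G b u₃ u₁ u₂ v₁ v₂) (B : Arm G c w₃ w₁ w₂ v₃ v₄) where
      private
        module A = Arm A
        module B = Arm B
        module C = Centre C

      arms-disjoint : Disjoint (u₃ ∷ u₁ ∷ u₂ ∷ []) (w₃ ∷ w₁ ∷ w₂ ∷ [])
      arms-disjoint with base-outside C A B | base-outside (turned {G} C) B A
      ... | w₃≢u₃ ∷ w₃≢u₁ ∷ w₃≢u₂ ∷ [] | _ ∷ u₃≢w₁ ∷ u₃≢w₂ ∷ [] =
        (≢-sym w₃≢u₃ ∷ u₃≢w₁ ∷ u₃≢w₂ ∷ []) ∷
        (≢-sym w₃≢u₁ ∷ tip-outside C A B ∷ tip-outside C A (mirror B) ∷ []) ∷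
        (≢-sym w₃≢u₂ ∷ tip-outside C (mirror A) B ∷ tip-outside C (mirror A) (mirror B) ∷ []) ∷ []

    module _ {b c a u₃ w₃ v₅ u₁ u₂ v₁ v₂ w₁ w₂ v₃ v₄} (C : Centre G b c a u₃ w₃ v₅) (A : Arm G b u₃ u₁ u₂ v₁ v₂) (B : Arm G c w₃ w₁ w₂ v₃ v₄) where
      private
        module A = Arm A
        module B = Arm B
        module C = Centre C
        bc = proj₁ C.tri
        ba = proj₁ (proj₂ C.tri)
        ca = proj₂ (proj₂ C.tri)
        x = proj₁ A.tri
        y = proj₁ (proj₂ A.tri)
        z = proj₂ (proj₂ A.tri)
        x′ = proj₁ B.tri
        y′ = proj₁ (proj₂ B.tri)
        z′ = proj₂ (proj₂ B.tri)

      -- Both outer triangles are linked to the middle one, so this edge would complete a triple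
      -- link.
      no-cross-link : ¬ u₁ ≈ w₁
      no-cross-link uw with centre-arm C A | centre-arm (turned {G} C) B | arms-disjoint C A B
      ... | (p₁ ∷ p₂ ∷ p₃ ∷ []) ∷ (q₁ ∷ q₂ ∷ q₃ ∷ []) ∷ (r₁ ∷ r₂ ∷ r₃ ∷ []) ∷ []
          | (q₁′ ∷ q₂′ ∷ q₃′ ∷ []) ∷ (p₁′ ∷ p₂′ ∷ p₃′ ∷ []) ∷ (r₁′ ∷ r₂′ ∷ r₃′ ∷ []) ∷ []
          | (d₁ ∷ d₂ ∷ d₃ ∷ []) ∷ (e₁ ∷ e₂ ∷ e₃ ∷ []) ∷ (f₁ ∷ f₂ ∷ f₃ ∷ []) ∷ [] =
        noTL (((sy ba , sy ca , bc) , (sy y , sy z , x) , (sy y′ , sy z′ , x′)) , (A.link , B.link , uw) ,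
          (r₃ ∷ r₁ ∷ r₂ ∷ []) ∷ (p₃ ∷ p₁ ∷ p₂ ∷ []) ∷ (q₃ ∷ q₁ ∷ q₂ ∷ []) ∷ [] ,
          (r₃′ ∷ r₁′ ∷ r₂′ ∷ []) ∷ (p₃′ ∷ p₁′ ∷ p₂′ ∷ []) ∷ (q₃′ ∷ q₁′ ∷ q₂′ ∷ []) ∷ [] ,
          (f₃ ∷ f₁ ∷ f₂ ∷ []) ∷ (d₃ ∷ d₁ ∷ d₂ ∷ []) ∷ (e₃ ∷ e₁ ∷ e₂ ∷ []) ∷ [])

    module _ {b c a u₃ w₃ v₅ u₁ u₂ v₁ v₂ w₁ w₂ v₃ v₄} (C : Centre G b c a u₃ w₃ v₅) (A : Arm G b u₃ u₁ u₂ v₁ v₂) (B : Arm G c w₃ w₁ w₂ v₃ v₄) where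
      private
        module A = Arm A
        module B = Arm B
        module C = Centre C

      outside : All (v₁ ≢_) (b ∷ c ∷ u₃ ∷ u₁ ∷ u₂ ∷ w₃ ∷ w₁ ∷ w₂ ∷ a ∷ [])
      outside with centre-arm C A | arms-disjoint C A B
      ... | (_ ∷ bu₁ ∷ _) ∷ (_ ∷ cu₁ ∷ _) ∷ (_ ∷ au₁ ∷ _) ∷ [] | _ ∷ (u₁w₃ ∷ u₁w₁ ∷ u₁w₂ ∷ []) ∷ _ =
        (λ where refl → [ (λ e → cu₁ (≡-sym e)) , [ (λ e → au₁ (≡-sym e)) , (λ e → ∼⇒≢ G (proj₁ A.tri) (≡-sym e)) ]′ ]′ (C.nbB (sy A.link₁))) ∷
        (λ where refl → no-second-link C A (sy A.link₁)) ∷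
        A.v₁≢u₃ ∷ (λ e → ∼⇒≢ G A.link₁ (≡-sym e)) ∷ A.v₁≢u₂ ∷
        (λ where refl → [ (λ e → cu₁ (≡-sym e)) , [ u₁w₁ , u₁w₂ ]′ ]′ (B.nb₃ (sy A.link₁))) ∷
        (λ where refl → no-cross-link C A B A.link₁) ∷ (λ where refl → no-cross-link C A (mirror B) A.link₁) ∷
        (λ where refl → no-top-link C A (sy A.link₁)) ∷ []

      ends-differ : v₁ ≢ v₃
      ends-differ refl with arms-disjoint C A B
      ... | _ ∷ (_ ∷ u₁w₁ ∷ _) ∷ _ = u₁w₁ (link-unique g noLeaf noPath noDiamond (sy A.link₁) (sy B.link₁) A.apart₁ B.apart₁)

      top-apart : v₁ ≢ v₅
      top-apart refl with centre-arm C A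
      ... | _ ∷ _ ∷ (_ ∷ au₁ ∷ _) ∷ [] = au₁ (link-unique g noLeaf noPath noDiamond (sy C.link) (sy A.link₁) C.apart A.apart₁)

      top-outside : All (v₅ ≢_) (u₃ ∷ u₁ ∷ u₂ ∷ [])
      top-outside with centre-arm C A
      ... | (_ ∷ _ ∷ _ ∷ []) ∷ _ ∷ (au₃ ∷ au₁ ∷ au₂ ∷ []) ∷ [] =
        (λ where refl → [ (λ e → ∼⇒≢ G (proj₁ (proj₂ C.tri)) (≡-sym e)) , [ au₁ , au₂ ]′ ]′ (A.nb₃ (sy C.link))) ∷
        (λ where refl → no-top-link C A C.link) ∷ (λ where refl → no-top-link C (mirror A) C.link) ∷ []

    module _ {b u₃ u₁ u₂ v₁ v₂} (A : Arm G b u₃ u₁ u₂ v₁ v₂) where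
      private
        module A = Arm A
        x = proj₁ A.tri
        y = proj₁ (proj₂ A.tri)
        z = proj₂ (proj₂ A.tri)

      ends-distinct : v₁ ≢ v₂
      ends-distinct refl = A.apart₁ z (sy A.link₂)

      -- The only link at `v₁` leads to `u₁`, so an edge `v₁ v₂` would lie in a triangle, and that
      -- triangle would be doubly linked to `u₁ u₂ u₃`.
      ends-not-adjacent : ¬ v₁ ≈ v₂
      ends-not-adjacent vv with beyond-link g noLeaf noPath noDiamond (sy A.link₁) A.apart₁
      ... | s , t , (vs , vt , st) , _ , _ , h with h vv
      ... | inj₁ e = A.v₂≢u₁ e
      ... | inj₂ (inj₁ refl) = adjacent vt st
        where
          adjacent : ∀ {r} → v₁ ≈ r → v₂ ≈ r → ⊥
          adjacent v₁r v₂r with link-disjoint G (z , sy x , sy y) (vv , v₁r , v₂r) A.link₁ A.apart₁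
          ... | (p₁ ∷ p₂ ∷ p₃ ∷ []) ∷ (q₁ ∷ q₂ ∷ q₃ ∷ []) ∷ (r₁ ∷ r₂ ∷ r₃ ∷ []) ∷ [] =
            noDL ((x , y , z) , (sy v₁r , sy v₂r , vv) , A.link₁ , A.link₂ , (r₃ ∷ r₁ ∷ r₂ ∷ []) ∷ (p₃ ∷ p₁ ∷ p₂ ∷ []) ∷ (q₃ ∷ q₁ ∷ q₂ ∷ []) ∷ [])
      ... | inj₂ (inj₂ refl) = adjacent vs (sy st)
        where
          adjacent : ∀ {r} → v₁ ≈ r → v₂ ≈ r → ⊥
          adjacent v₁r v₂r with link-disjoint G (z , sy x , sy y) (vv , v₁r , v₂r) A.link₁ A.apart₁
          ... | (p₁ ∷ p₂ ∷ p₃ ∷ []) ∷ (q₁ ∷ q₂ ∷ q₃ ∷ []) ∷ (r₁ ∷ r₂ ∷ r₃ ∷ []) ∷ [] =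
            noDL ((x , y , z) , (sy v₁r , sy v₂r , vv) , A.link₁ , A.link₂ , (r₃ ∷ r₁ ∷ r₂ ∷ []) ∷ (p₃ ∷ p₁ ∷ p₂ ∷ []) ∷ (q₃ ∷ q₁ ∷ q₂ ∷ []) ∷ [])

      -- The edges from a common neighbour `w` to `v₁` and `v₂` both lie in triangles. If the third
      -- vertices of these coincide there is a diamond, and if not, `w` has four neighbours.
      ends-no-common : ∀ {w} → w ≢ u₁ → w ≢ u₂ → v₁ ≈ w → ¬ v₂ ≈ w
      ends-no-common {w} w≢u₁ w≢u₂ v₁w v₂w with mate A.apart₁ A.link₁ v₁w w≢u₁ | mate A.apart₂ A.link₂ v₂w w≢u₂
        where
          mate : ∀ {u v} → NoCommon G u v → u ≈ v → v ≈ w → w ≢ u → ∃ λ t → v ≈ t × w ≈ t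
          mate none uv vw w≢u with beyond-link g noLeaf noPath noDiamond (sy uv) none
          ... | s , t , (vs , vt , st) , _ , _ , h with h vw
          ... | inj₁ e = contradiction e w≢u
          ... | inj₂ (inj₁ refl) = t , vt , st
          ... | inj₂ (inj₂ refl) = s , vs , sy st
      ... | t , v₁t , wt | t′ , v₂t′ , wt′ with t ≟ t′
      ... | yes refl = noDiamond ((wt , v₁w , v₁t) , v₂w , v₂t′ , ends-distinct)
      ... | no t≢t′ = noFour (subcubic g) (sy v₁w) (sy v₂w) wt wt′ ends-distinct (∼⇒≢ G v₁t) (λ where refl → ends-not-adjacent (sy v₂t′))
                        (λ where refl → ends-not-adjacent v₁t) (∼⇒≢ G v₂t′) t≢t′

      -- Together with the outer triangle these two would be triply linked. This is the last
      -- hypothesis of `NoDoubleLink-join`.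
      no-triple-beyond : ∀ {p s q t} → Triangle G v₁ p s → Triangle G v₂ q t → p ≈ q → ¬ Disjoint (v₁ ∷ p ∷ s ∷ []) (v₂ ∷ q ∷ t ∷ [])
      no-triple-beyond (v₁p , v₁s , ps) (v₂q , v₂t , qt) pq ((d₁ ∷ d₂ ∷ d₃ ∷ []) ∷ (e₁ ∷ e₂ ∷ e₃ ∷ []) ∷ (f₁ ∷ f₂ ∷ f₃ ∷ []) ∷ [])
        with link-disjoint G (z , sy x , sy y) (v₁p , v₁s , ps) A.link₁ A.apart₁ | link-disjoint G (sy z , sy y , sy x) (v₂q , v₂t , qt) A.link₂ A.apart₂
      ... | (p₁ ∷ p₂ ∷ p₃ ∷ []) ∷ (q₁ ∷ q₂ ∷ q₃ ∷ []) ∷ (r₁ ∷ r₂ ∷ r₃ ∷ []) ∷ []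
          | (q₁′ ∷ q₂′ ∷ q₃′ ∷ []) ∷ (p₁′ ∷ p₂′ ∷ p₃′ ∷ []) ∷ (r₁′ ∷ r₂′ ∷ r₃′ ∷ []) ∷ [] =
        noTL (((x , y , z) , (sy v₁s , sy ps , v₁p) , (sy v₂t , sy qt , v₂q)) , (A.link₁ , A.link₂ , pq) ,
          (r₃ ∷ r₁ ∷ r₂ ∷ []) ∷ (p₃ ∷ p₁ ∷ p₂ ∷ []) ∷ (q₃ ∷ q₁ ∷ q₂ ∷ []) ∷ [] ,
          (r₃′ ∷ r₁′ ∷ r₂′ ∷ []) ∷ (p₃′ ∷ p₁′ ∷ p₂′ ∷ []) ∷ (q₃′ ∷ q₁′ ∷ q₂′ ∷ []) ∷ [] ,
          (f₃ ∷ f₁ ∷ f₂ ∷ []) ∷ (d₃ ∷ d₁ ∷ d₂ ∷ []) ∷ (e₃ ∷ e₁ ∷ e₂ ∷ []) ∷ [])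

record Quad (e₁ e₂ x₁ x₂ y₁ y₂ : Color) : Set where
  field
    p₁ p₂ r₁ r₂ s : Color
    distinct : Distinct (p₁ ∷ p₂ ∷ r₁ ∷ r₂ ∷ s ∷ e₁ ∷ e₂ ∷ [])
    coverX   : ∀ {k} → k ≢ e₂ → k ≢ p₁ → k ≢ p₂ → k ≢ x₁ × k ≢ x₂
    coverY   : ∀ {k} → k ≢ r₁ → k ≢ r₂ → k ≢ y₁ × k ≢ y₂

quad : ∀ {e₁ e₂ x₁ x₂ y₁ y₂} → e₁ ≢ e₂ → All (e₁ ≢_) (x₁ ∷ x₂ ∷ y₁ ∷ y₂ ∷ []) → All (e₂ ≢_) (y₁ ∷ y₂ ∷ []) →
  x₁ ≢ x₂ → y₁ ≢ y₂ → All (x₁ ≢_) (y₁ ∷ y₂ ∷ []) → All (x₂ ≢_) (y₁ ∷ y₂ ∷ []) → Quad e₁ e₂ x₁ x₂ y₁ y₂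
quad {e₁} {e₂} {x₁} {x₂} {y₁} {y₂} ee (ex₁ ∷ ex₂ ∷ ey₁ ∷ ey₂ ∷ []) (fy₁ ∷ fy₂ ∷ []) xx yy (xy₁₁ ∷ xy₁₂ ∷ []) (xy₂₁ ∷ xy₂₂ ∷ []) with x₁ ≟ e₂ | x₂ ≟ e₂
... | yes refl | yes refl = contradiction refl xx
... | no x₁≢e₂ | no x₂≢e₂ with fresh (e₁ ∷ e₂ ∷ x₁ ∷ x₂ ∷ y₁ ∷ y₂ ∷ [])
...   | s , se₁ ∷ se₂ ∷ sx₁ ∷ sx₂ ∷ sy₁ ∷ sy₂ ∷ [] = record
  { distinct = (xx ∷ xy₁₁ ∷ xy₁₂ ∷ ≢-sym sx₁ ∷ ≢-sym ex₁ ∷ x₁≢e₂ ∷ []) ∷ (xy₂₁ ∷ xy₂₂ ∷ ≢-sym sx₂ ∷ ≢-sym ex₂ ∷ x₂≢e₂ ∷ []) ∷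
      (yy ∷ ≢-sym sy₁ ∷ ≢-sym ey₁ ∷ ≢-sym fy₁ ∷ []) ∷ (≢-sym sy₂ ∷ ≢-sym ey₂ ∷ ≢-sym fy₂ ∷ []) ∷ (se₁ ∷ se₂ ∷ []) ∷ (ee ∷ []) ∷ [] ∷ []
  ; coverX = λ _ a b → a , b ; coverY = λ a b → a , b }
quad {e₁} {e₂} {x₁} {x₂} {y₁} {y₂} ee (ex₁ ∷ ex₂ ∷ ey₁ ∷ ey₂ ∷ []) (fy₁ ∷ fy₂ ∷ []) xx yy (xy₁₁ ∷ xy₁₂ ∷ []) (xy₂₁ ∷ xy₂₂ ∷ []) | yes refl | no x₂≢e₂ with fresh (e₁ ∷ e₂ ∷ x₂ ∷ y₁ ∷ y₂ ∷ [])
... | p , pe₁ ∷ pe₂ ∷ px₂ ∷ py₁ ∷ py₂ ∷ [] with fresh (p ∷ e₁ ∷ e₂ ∷ x₂ ∷ y₁ ∷ y₂ ∷ [])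
...   | s , sp ∷ se₁ ∷ se₂ ∷ sx₂ ∷ sy₁ ∷ sy₂ ∷ [] = record
  { distinct = (px₂ ∷ py₁ ∷ py₂ ∷ ≢-sym sp ∷ pe₁ ∷ pe₂ ∷ []) ∷ (xy₂₁ ∷ xy₂₂ ∷ ≢-sym sx₂ ∷ ≢-sym ex₂ ∷ x₂≢e₂ ∷ []) ∷
      (yy ∷ ≢-sym sy₁ ∷ ≢-sym ey₁ ∷ ≢-sym fy₁ ∷ []) ∷ (≢-sym sy₂ ∷ ≢-sym ey₂ ∷ ≢-sym fy₂ ∷ []) ∷ (se₁ ∷ se₂ ∷ []) ∷ (ee ∷ []) ∷ [] ∷ []
  ; coverX = λ e _ b → e , b ; coverY = λ a b → a , b }
quad {e₁} {e₂} {x₁} {x₂} {y₁} {y₂} ee (ex₁ ∷ ex₂ ∷ ey₁ ∷ ey₂ ∷ []) (fy₁ ∷ fy₂ ∷ []) xx yy (xy₁₁ ∷ xy₁₂ ∷ []) (xy₂₁ ∷ xy₂₂ ∷ []) | no x₁≢e₂ | yes refl with fresh (e₁ ∷ e₂ ∷ x₁ ∷ y₁ ∷ y₂ ∷ [])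
... | p , pe₁ ∷ pe₂ ∷ px₁ ∷ py₁ ∷ py₂ ∷ [] with fresh (p ∷ e₁ ∷ e₂ ∷ x₁ ∷ y₁ ∷ y₂ ∷ [])
...   | s , sp ∷ se₁ ∷ se₂ ∷ sx₁ ∷ sy₁ ∷ sy₂ ∷ [] = record
  { distinct = (px₁ ∷ py₁ ∷ py₂ ∷ ≢-sym sp ∷ pe₁ ∷ pe₂ ∷ []) ∷ (xy₁₁ ∷ xy₁₂ ∷ ≢-sym sx₁ ∷ ≢-sym ex₁ ∷ x₁≢e₂ ∷ []) ∷
      (yy ∷ ≢-sym sy₁ ∷ ≢-sym ey₁ ∷ ≢-sym fy₁ ∷ []) ∷ (≢-sym sy₂ ∷ ≢-sym ey₂ ∷ ≢-sym fy₂ ∷ []) ∷ (se₁ ∷ se₂ ∷ []) ∷ (ee ∷ []) ∷ [] ∷ []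
  ; coverX = λ e _ b → b , e ; coverY = λ a b → a , b }

offer-distinct : ∀ {p₁ p₂ r₁ r₂ s e₁ e₂ t₁ t₂ f} → Distinct (p₁ ∷ p₂ ∷ r₁ ∷ r₂ ∷ s ∷ e₁ ∷ e₂ ∷ []) → Offer p₁ p₂ r₁ r₂ t₁ t₂ f →
  Distinct (s ∷ t₂ ∷ t₁ ∷ e₁ ∷ e₂ ∷ f ∷ []) × All (t₂ ≢_) (p₁ ∷ p₂ ∷ []) × All (t₁ ≢_) (r₁ ∷ r₂ ∷ [])
offer-distinct {p₁} {p₂} {r₁} {r₂} {s} {e₁} {e₂} {t₁} {t₂} {f}
  ((_ ∷ p₁r₁ ∷ p₁r₂ ∷ p₁s ∷ p₁e₁ ∷ p₁e₂ ∷ []) ∷ (p₂r₁ ∷ p₂r₂ ∷ p₂s ∷ p₂e₁ ∷ p₂e₂ ∷ []) ∷ (_ ∷ r₁s ∷ r₁e₁ ∷ r₁e₂ ∷ []) ∷ (r₂s ∷ r₂e₁ ∷ r₂e₂ ∷ []) ∷ (se₁ ∷ se₂ ∷ []) ∷ (ee ∷ []) ∷ _)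
  (offer t₁∈ t₂∈ f∈ (ft₁ ∷ ft₂ ∷ [])) = build (inP t₁∈) (inR t₂∈) ([ (λ m → drop (inP m)) , (λ m → drop (inR m)) ]′ f∈)
  where
    inP : ∀ {k} → k ∈ (p₁ ∷ p₂ ∷ []) → All (k ≢_) (s ∷ e₁ ∷ e₂ ∷ r₁ ∷ r₂ ∷ [])
    inP (here refl) = p₁s ∷ p₁e₁ ∷ p₁e₂ ∷ p₁r₁ ∷ p₁r₂ ∷ []
    inP (there (here refl)) = p₂s ∷ p₂e₁ ∷ p₂e₂ ∷ p₂r₁ ∷ p₂r₂ ∷ []
    inR : ∀ {k} → k ∈ (r₁ ∷ r₂ ∷ []) → All (k ≢_) (s ∷ e₁ ∷ e₂ ∷ p₁ ∷ p₂ ∷ [])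
    inR (here refl) = r₁s ∷ r₁e₁ ∷ r₁e₂ ∷ ≢-sym p₁r₁ ∷ ≢-sym p₂r₁ ∷ []
    inR (there (here refl)) = r₂s ∷ r₂e₁ ∷ r₂e₂ ∷ ≢-sym p₁r₂ ∷ ≢-sym p₂r₂ ∷ []
    drop : ∀ {k x y} → All (k ≢_) (s ∷ e₁ ∷ e₂ ∷ x ∷ y ∷ []) → All (k ≢_) (s ∷ e₁ ∷ e₂ ∷ [])
    drop (a ∷ b ∷ c ∷ _) = a ∷ b ∷ c ∷ []
    build : All (t₁ ≢_) (s ∷ e₁ ∷ e₂ ∷ r₁ ∷ r₂ ∷ []) → All (t₂ ≢_) (s ∷ e₁ ∷ e₂ ∷ p₁ ∷ p₂ ∷ []) → All (f ≢_) (s ∷ e₁ ∷ e₂ ∷ []) →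
      Distinct (s ∷ t₂ ∷ t₁ ∷ e₁ ∷ e₂ ∷ f ∷ []) × All (t₂ ≢_) (p₁ ∷ p₂ ∷ []) × All (t₁ ≢_) (r₁ ∷ r₂ ∷ [])
    build (t₁s ∷ t₁e₁ ∷ t₁e₂ ∷ t₁rs@(t₁r₁ ∷ t₁r₂ ∷ [])) (t₂s ∷ t₂e₁ ∷ t₂e₂ ∷ t₂ps) (fs ∷ fe₁ ∷ fe₂ ∷ []) =
      ((≢-sym t₂s ∷ ≢-sym t₁s ∷ se₁ ∷ se₂ ∷ ≢-sym fs ∷ []) ∷ (≢-sym (apart t₂∈) ∷ t₂e₁ ∷ t₂e₂ ∷ ≢-sym ft₂ ∷ []) ∷
       (t₁e₁ ∷ t₁e₂ ∷ ≢-sym ft₁ ∷ []) ∷ (ee ∷ ≢-sym fe₁ ∷ []) ∷ (≢-sym fe₂ ∷ []) ∷ [] ∷ []) , t₂ps , t₁rs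
      where
        apart : ∀ {k} → k ∈ (r₁ ∷ r₂ ∷ []) → t₁ ≢ k
        apart (here refl) = t₁r₁
        apart (there (here refl)) = t₁r₂

module _ {n : ℕ} where

  private
    V = Fin n

  -- The colours cross over: `u₁ u₃`, seen from `v₁`, takes a colour `t₂` from the pair of `v₂`, and
  -- `u₂ u₃` takes `t₁` from the pair of `v₁`. The side `u₁ u₂` is seen from both ends and takes the
  -- colour `s`.
  fillArm : ∀ (B : Graph n) {u₁ u₂ u₃ v₁ v₂ k e₁ e₂ x₁ x₂ y₁ y₂ t₁ t₂ f} → Triangle B u₃ u₁ u₂ → Strong (del² B u₃ u₂) k →
    (∀ {w} → B ∋ u₁ ∼ w → w ≡ u₂ ⊎ w ≡ u₃ ⊎ w ≡ v₁) → (∀ {w} → B ∋ u₂ ∼ w → w ≡ u₁ ⊎ w ≡ u₃ ⊎ w ≡ v₂) → (∀ {w} → B ∋ u₃ ∼ w → w ≡ u₁ ⊎ w ≡ u₂) →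
    k u₁ v₁ ≡ e₁ → (∀ {j} → All (j ≢_) (e₁ ∷ x₁ ∷ x₂ ∷ []) → Unused (del² B u₃ u₂) k v₁ j) →
    (∀ {j} → All (j ≢_) (y₁ ∷ y₂ ∷ []) → Unused (del² B u₃ u₂) k v₂ j) → Free (del² B u₃ u₂) k v₂ e₂ →
    (q : Quad e₁ e₂ x₁ x₂ y₁ y₂) → let open Quad q in Offer p₁ p₂ r₁ r₂ t₁ t₂ f → AddPair B u₁ u₂ u₃ k s t₂ t₁ e₁ e₂ f
  fillArm B {u₁} {u₂} {u₃} {v₁} {v₂} {k} {e₁} {e₂} {x₁} {x₂} {y₁} {y₂} {t₁} {t₂} {f} (u₃u₁ , u₃u₂ , u₁u₂) st nb₁ nb₂ nb₃ leg un₁ un₂ free q off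
    with Quad.distinct q | offer-distinct (Quad.distinct q) off
  ... | (_ ∷ _ ∷ _ ∷ p₁s ∷ _) ∷ (_ ∷ _ ∷ p₂s ∷ _) ∷ (_ ∷ r₁s ∷ _) ∷ (r₂s ∷ _) ∷ _
      | dis@((st₂ ∷ st₁ ∷ se₁ ∷ se₂ ∷ _) ∷ (_ ∷ t₂e₁ ∷ t₂e₂ ∷ _) ∷ _) , (t₂p₁ ∷ t₂p₂ ∷ []) , (t₁r₁ ∷ t₁r₂ ∷ []) =
    -- In `B` the corner `u₃` has no third edge: the second `v₂` is a dummy, and `f` is reserved for
    -- the link to the middle triangle.
    addPair B u₁u₂ (∼-sym B u₃u₁) (∼-sym B u₃u₂) st v₂ v₂ dis at₁ at₂ at₃
    where
      open Quad q
      K = del² B u₃ u₂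
      free₁ : ∀ {j} → j ≢ e₁ → j ≢ e₂ → j ≢ p₁ → j ≢ p₂ → Unused K k v₁ j
      free₁ je₁ je₂ jp₁ jp₂ = let (a , b) = coverX je₂ jp₁ jp₂ in un₁ (je₁ ∷ a ∷ b ∷ [])
      free₂ : ∀ {j} → j ≢ r₁ → j ≢ r₂ → Unused K k v₂ j
      free₂ jr₁ jr₂ = let (a , b) = coverY jr₁ jr₂ in un₂ (a ∷ b ∷ [])
      at₁ : ∀ {w} → K ∋ u₁ ∼ w → k u₁ w ≡ e₁ × Unused K k w s × Unused K k w t₂
      at₁ ((uw , _ , w≢u₃) , _ , w≢u₂) with nb₁ uw
      ... | inj₁ e = contradiction e w≢u₂
      ... | inj₂ (inj₁ e) = contradiction e w≢u₃
      ... | inj₂ (inj₂ refl) = leg , free₁ se₁ se₂ (≢-sym p₁s) (≢-sym p₂s) , free₁ t₂e₁ t₂e₂ t₂p₁ t₂p₂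
      at₂ : ∀ {w} → B ∋ u₂ ∼ w → w ≡ u₁ ⊎ w ≡ u₃ ⊎ (w ≡ v₂ × Addable K k w e₂ s t₁)
      at₂ uw with nb₂ uw
      ... | inj₁ e = inj₁ e
      ... | inj₂ (inj₁ e) = inj₂ (inj₁ e)
      ... | inj₂ (inj₂ refl) = inj₂ (inj₂ (refl , addable free (free₂ (≢-sym r₁s) (≢-sym r₂s)) (free₂ t₁r₁ t₁r₂)))
      at₃ : ∀ {w} → B ∋ u₃ ∼ w → w ≡ u₁ ⊎ w ≡ u₂ ⊎ (w ≡ v₂ × Addable K k w f t₂ t₁)
      at₃ uw = [ inj₁ , inj₂ ∘ inj₁ ]′ (nb₃ uw)

-- Cutting out and rebuilding a chain of three triangles

module Chain {n : ℕ} {G : Graph n} (g : Good G) (below : Below G) (noLeaf : NoLeaf G) (noPath : ∀ {v x y} → ¬ Only₂ G v x y) (noDiamond : NoDiamond G)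
  (noDL : NoDoubleLink G) (noTL : NoTripleLink G) {b c a u₃ w₃ v₅ u₁ u₂ v₁ v₂ w₁ w₂ v₃ v₄ : Fin n}
  (C : Centre G b c a u₃ w₃ v₅) (A : Arm G b u₃ u₁ u₂ v₁ v₂) (B : Arm G c w₃ w₁ w₂ v₃ v₄) where

  private
    V = Fin n
    module A = Arm A
    module B = Arm B
    module C = Centre C
    module A′ = Arm (mirror {n} {G} A)
    C′ = turned {n} {G} C
    sy : ∀ {u v} → G ∋ u ∼ v → G ∋ v ∼ u
    sy = ∼-sym G

  nine eight : List V
  nine = b ∷ c ∷ u₃ ∷ u₁ ∷ u₂ ∷ w₃ ∷ w₁ ∷ w₂ ∷ a ∷ []
  eight = b ∷ c ∷ u₃ ∷ u₁ ∷ u₂ ∷ w₃ ∷ w₁ ∷ w₂ ∷ []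

  abstract
    out₁ : All (v₁ ≢_) nine
    out₁ = outside g noLeaf noPath noDiamond noDL noTL C A B
    out₂ : All (v₂ ≢_) nine
    out₂ with outside g noLeaf noPath noDiamond noDL noTL C (mirror {n} {G} A) B
    ... | p₁ ∷ p₂ ∷ p₃ ∷ p₄ ∷ p₅ ∷ ps = p₁ ∷ p₂ ∷ p₃ ∷ p₅ ∷ p₄ ∷ ps
    out₃ : All (v₃ ≢_) nine
    out₃ with outside g noLeaf noPath noDiamond noDL noTL C′ B A
    ... | p₁ ∷ p₂ ∷ p₃ ∷ p₄ ∷ p₅ ∷ q₁ ∷ q₂ ∷ q₃ ∷ ps = p₂ ∷ p₁ ∷ q₁ ∷ q₂ ∷ q₃ ∷ p₃ ∷ p₄ ∷ p₅ ∷ ps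
    out₄ : All (v₄ ≢_) nine
    out₄ with outside g noLeaf noPath noDiamond noDL noTL C′ (mirror {n} {G} B) A
    ... | p₁ ∷ p₂ ∷ p₃ ∷ p₄ ∷ p₅ ∷ q₁ ∷ q₂ ∷ q₃ ∷ ps = p₂ ∷ p₁ ∷ q₁ ∷ q₂ ∷ q₃ ∷ p₃ ∷ p₅ ∷ p₄ ∷ ps
    out₅ : All (v₅ ≢_) nine
    out₅ with top-outside g noLeaf noPath noDiamond noDL noTL C A B | top-outside g noLeaf noPath noDiamond noDL noTL C′ B A
    ... | p₁ ∷ p₂ ∷ p₃ ∷ [] | q₁ ∷ q₂ ∷ q₃ ∷ [] = C.v₅≢b ∷ C.v₅≢c ∷ p₁ ∷ p₂ ∷ p₃ ∷ q₁ ∷ q₂ ∷ q₃ ∷ (λ e → ∼⇒≢ G C.link (≡-sym e)) ∷ []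

    v₁≢v₂ : v₁ ≢ v₂
    v₁≢v₂ = ends-distinct g noLeaf noPath noDiamond noDL noTL A
    v₃≢v₄ : v₃ ≢ v₄
    v₃≢v₄ = ends-distinct g noLeaf noPath noDiamond noDL noTL B
    v₁≢v₃ : v₁ ≢ v₃
    v₁≢v₃ = ends-differ g noLeaf noPath noDiamond noDL noTL C A B
    v₁≢v₄ : v₁ ≢ v₄
    v₁≢v₄ = ends-differ g noLeaf noPath noDiamond noDL noTL C A (mirror {n} {G} B)
    v₂≢v₃ : v₂ ≢ v₃
    v₂≢v₃ = ends-differ g noLeaf noPath noDiamond noDL noTL C (mirror {n} {G} A) B
    v₂≢v₄ : v₂ ≢ v₄
    v₂≢v₄ = ends-differ g noLeaf noPath noDiamond noDL noTL C (mirror {n} {G} A) (mirror {n} {G} B)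
    v₂≢v₅ : v₂ ≢ v₅
    v₂≢v₅ = top-apart g noLeaf noPath noDiamond noDL noTL C (mirror {n} {G} A) B
    v₄≢v₅ : v₄ ≢ v₅
    v₄≢v₅ = top-apart g noLeaf noPath noDiamond noDL noTL C′ (mirror {n} {G} B) A
    v₁≁v₂ : ¬ G ∋ v₁ ∼ v₂
    v₁≁v₂ = ends-not-adjacent g noLeaf noPath noDiamond noDL noTL A
    v₃≁v₄ : ¬ G ∋ v₃ ∼ v₄
    v₃≁v₄ = ends-not-adjacent g noLeaf noPath noDiamond noDL noTL B

  private
    CA = centre-arm g noLeaf noPath noDiamond noDL noTL C A
    CB = centre-arm g noLeaf noPath noDiamond noDL noTL C′ B
    AB = arms-disjoint g noLeaf noPath noDiamond noDL noTL C A B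

  corners : List V
  corners = b ∷ c ∷ u₃ ∷ w₃ ∷ a ∷ []
  abstract
    tip₁ : All (u₁ ≢_) corners × All (u₁ ≢_) (u₂ ∷ w₁ ∷ w₂ ∷ [])
    tip₁ with CA | AB
    ... | (_ ∷ p ∷ _) ∷ (_ ∷ q ∷ _) ∷ (_ ∷ r ∷ _) ∷ [] | _ ∷ (x ∷ y ∷ z ∷ []) ∷ _ =
      (≢-sym p ∷ ≢-sym q ∷ ≢-sym (∼⇒≢ G (proj₁ A.tri)) ∷ x ∷ ≢-sym r ∷ []) , (∼⇒≢ G (proj₂ (proj₂ A.tri)) ∷ y ∷ z ∷ [])
    tip₂ : All (u₂ ≢_) corners × All (u₂ ≢_) (u₁ ∷ w₁ ∷ w₂ ∷ [])
    tip₂ with CA | AB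
    ... | (_ ∷ _ ∷ p ∷ []) ∷ (_ ∷ _ ∷ q ∷ []) ∷ (_ ∷ _ ∷ r ∷ []) ∷ [] | _ ∷ _ ∷ (x ∷ y ∷ z ∷ []) ∷ [] =
      (≢-sym p ∷ ≢-sym q ∷ ≢-sym (∼⇒≢ G (proj₁ (proj₂ A.tri))) ∷ x ∷ ≢-sym r ∷ []) , (≢-sym (∼⇒≢ G (proj₂ (proj₂ A.tri))) ∷ y ∷ z ∷ [])
    tip₃ : All (w₁ ≢_) corners × All (w₁ ≢_) (w₂ ∷ u₁ ∷ u₂ ∷ [])
    tip₃ with CB | AB
    ... | (_ ∷ q ∷ _) ∷ (_ ∷ p ∷ _) ∷ (_ ∷ r ∷ _) ∷ [] | (_ ∷ x ∷ _) ∷ (_ ∷ y ∷ _) ∷ (_ ∷ z ∷ _) ∷ [] =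
      (≢-sym p ∷ ≢-sym q ∷ ≢-sym x ∷ ≢-sym (∼⇒≢ G (proj₁ B.tri)) ∷ ≢-sym r ∷ []) , (∼⇒≢ G (proj₂ (proj₂ B.tri)) ∷ ≢-sym y ∷ ≢-sym z ∷ [])
    tip₄ : All (w₂ ≢_) corners × All (w₂ ≢_) (w₁ ∷ u₁ ∷ u₂ ∷ [])
    tip₄ with CB | AB
    ... | (_ ∷ _ ∷ q ∷ []) ∷ (_ ∷ _ ∷ p ∷ []) ∷ (_ ∷ _ ∷ r ∷ []) ∷ [] | (_ ∷ _ ∷ x ∷ []) ∷ (_ ∷ _ ∷ y ∷ []) ∷ (_ ∷ _ ∷ z ∷ []) ∷ [] =
      (≢-sym p ∷ ≢-sym q ∷ ≢-sym x ∷ ≢-sym (∼⇒≢ G (proj₁ (proj₂ B.tri))) ∷ ≢-sym r ∷ []) , (≢-sym (∼⇒≢ G (proj₂ (proj₂ B.tri))) ∷ ≢-sym y ∷ ≢-sym z ∷ [])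
    top-corner : All (a ≢_) eight
    top-corner with CA | CB
    ... | _ ∷ _ ∷ (p ∷ q ∷ r ∷ []) ∷ [] | _ ∷ _ ∷ (x ∷ y ∷ z ∷ []) ∷ [] =
      ≢-sym (∼⇒≢ G (proj₁ (proj₂ C.tri))) ∷ ≢-sym (∼⇒≢ G (proj₂ (proj₂ C.tri))) ∷ p ∷ q ∷ r ∷ x ∷ y ∷ z ∷ []

  not-tip₁ : ∀ {v s} → All (v ≢_) nine → v ≢ v₁ → G ∋ v ∼ s → s ≢ u₁
  not-tip₁ (_ ∷ _ ∷ u₃ ∷ _ ∷ u₂ ∷ _) v≢ vs refl = [ u₂ , [ u₃ , v≢ ]′ ]′ (A.nb₁ (sy vs))
  not-tip₂ : ∀ {v s} → All (v ≢_) nine → v ≢ v₂ → G ∋ v ∼ s → s ≢ u₂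
  not-tip₂ (_ ∷ _ ∷ u₃ ∷ u₁ ∷ _) v≢ vs refl = [ u₁ , [ u₃ , v≢ ]′ ]′ (A.nb₂ (sy vs))
  not-tip₃ : ∀ {v s} → All (v ≢_) nine → v ≢ v₃ → G ∋ v ∼ s → s ≢ w₁
  not-tip₃ (_ ∷ _ ∷ _ ∷ _ ∷ _ ∷ w₃ ∷ _ ∷ w₂ ∷ _) v≢ vs refl = [ w₂ , [ w₃ , v≢ ]′ ]′ (B.nb₁ (sy vs))
  not-tip₄ : ∀ {v s} → All (v ≢_) nine → v ≢ v₄ → G ∋ v ∼ s → s ≢ w₂
  not-tip₄ (_ ∷ _ ∷ _ ∷ _ ∷ _ ∷ w₃ ∷ w₁ ∷ _) v≢ vs refl = [ w₁ , [ w₃ , v≢ ]′ ]′ (B.nb₂ (sy vs))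

  clear : ∀ {v s} → All (v ≢_) nine → G ∋ v ∼ s → s ≢ u₁ → s ≢ u₂ → s ≢ w₁ → s ≢ w₂ → All (s ≢_) eight
  clear (vb ∷ vc ∷ vu₃ ∷ vu₁ ∷ vu₂ ∷ vw₃ ∷ vw₁ ∷ vw₂ ∷ va ∷ []) vs s≢u₁ s≢u₂ s≢w₁ s≢w₂ =
    (λ where refl → [ vc , [ va , vu₃ ]′ ]′ (C.nbB (sy vs))) ∷ (λ where refl → [ vb , [ va , vw₃ ]′ ]′ (C.nbC (sy vs))) ∷
    (λ where refl → [ vb , [ vu₁ , vu₂ ]′ ]′ (A.nb₃ (sy vs))) ∷ s≢u₁ ∷ s≢u₂ ∷
    (λ where refl → [ vc , [ vw₁ , vw₂ ]′ ]′ (B.nb₃ (sy vs))) ∷ s≢w₁ ∷ s≢w₂ ∷ []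

  to-eight : ∀ {v} → All (v ≢_) nine → All (v ≢_) eight
  to-eight (x₁ ∷ x₂ ∷ x₃ ∷ x₄ ∷ x₅ ∷ x₆ ∷ x₇ ∷ x₈ ∷ _) = x₁ ∷ x₂ ∷ x₃ ∷ x₄ ∷ x₅ ∷ x₆ ∷ x₇ ∷ x₈ ∷ []

  -- The induction colours `J`; the rebuilding passes through `Q`, `B₁`, `B₂` and `G`, adding one
  -- arm, the other arm, and the middle triangle. In `Q` the sides `u₁ u₂` and `w₁ w₂` are cut but
  -- their ends are kept, so that all four links already have colours in a strong colouring before
  -- an arm goes in.
  L = delAll G eight
  B₂ = del² G c b
  B₁ = cut (del B₂ w₃) w₁ w₂
  Q = cut (del B₁ u₃) u₁ u₂
  Lⱼ = join L v₃ v₄ v₃≢v₄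
  J = join Lⱼ v₁ v₂ v₁≢v₂

  L⊑G : L ⊑ G
  L⊑G = delAll-⊑ G eight
  B₂⊑G : B₂ ⊑ G
  B₂⊑G = ⊑-trans (del-⊑ (del G c) b) (del-⊑ G c)
  B₁⊑B₂ : B₁ ⊑ B₂
  B₁⊑B₂ = ⊑-trans (cut-⊑ (del B₂ w₃) w₁ w₂) (del-⊑ B₂ w₃)
  Q⊑B₁ : Q ⊑ B₁
  Q⊑B₁ = ⊑-trans (cut-⊑ (del B₁ u₃) u₁ u₂) (del-⊑ B₁ u₃)
  Q⊑G : Q ⊑ G
  Q⊑G = ⊑-trans Q⊑B₁ (⊑-trans B₁⊑B₂ B₂⊑G)

  mkQ : ∀ {x y} → G ∋ x ∼ y → All (x ≢_) (b ∷ c ∷ u₃ ∷ w₃ ∷ []) → All (y ≢_) (b ∷ c ∷ u₃ ∷ w₃ ∷ []) → ¬ Pair w₁ w₂ x y → ¬ Pair u₁ u₂ x y → Q ∋ x ∼ y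
  mkQ xy (x₁ ∷ x₂ ∷ x₃ ∷ x₄ ∷ []) (y₁ ∷ y₂ ∷ y₃ ∷ y₄ ∷ []) ¬w ¬u = (((((((xy , x₂ , y₂) , x₁ , y₁)) , x₄ , y₄) , ¬w) , x₃ , y₃) , ¬u)

  private
    four : ∀ {x} → All (x ≢_) eight → All (x ≢_) (b ∷ c ∷ u₃ ∷ w₃ ∷ [])
    four (x₁ ∷ x₂ ∷ x₃ ∷ _ ∷ _ ∷ x₆ ∷ _) = x₁ ∷ x₂ ∷ x₃ ∷ x₆ ∷ []
    four′ : ∀ {x} → All (x ≢_) corners → All (x ≢_) (b ∷ c ∷ u₃ ∷ w₃ ∷ [])
    four′ (x₁ ∷ x₂ ∷ x₃ ∷ x₄ ∷ _) = x₁ ∷ x₂ ∷ x₃ ∷ x₄ ∷ []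

  outQ : ∀ {x y} → All (x ≢_) eight → G ∋ x ∼ y → All (y ≢_) (b ∷ c ∷ u₃ ∷ w₃ ∷ []) → Q ∋ x ∼ y
  outQ o@(_ ∷ _ ∷ _ ∷ xu₁ ∷ xu₂ ∷ _ ∷ xw₁ ∷ xw₂ ∷ []) xy ys =
    mkQ xy (four o) ys [ (λ (e , _) → xw₁ e) , (λ (e , _) → xw₂ e) ]′ [ (λ (e , _) → xu₁ e) , (λ (e , _) → xu₂ e) ]′

  L⊑Q : L ⊑ Q
  L⊑Q = incl λ (xy , xs , ys) → outQ xs xy (four ys)

  abstract
    vu₁ : Q ∋ v₁ ∼ u₁
    vu₁ = outQ (to-eight out₁) (sy A.link₁) (four′ (proj₁ tip₁))
    vu₂ : Q ∋ v₂ ∼ u₂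
    vu₂ = outQ (to-eight out₂) (sy A.link₂) (four′ (proj₁ tip₂))
    vw₁ : Q ∋ v₃ ∼ w₁
    vw₁ = outQ (to-eight out₃) (sy B.link₁) (four′ (proj₁ tip₃))
    vw₂ : Q ∋ v₄ ∼ w₂
    vw₂ = outQ (to-eight out₄) (sy B.link₂) (four′ (proj₁ tip₄))
    va : Q ∋ v₅ ∼ a
    va = outQ (to-eight out₅) (sy C.link) (four top-corner)

  nbQ₁ : ∀ {w} → Q ∋ u₁ ∼ w → w ≡ v₁
  nbQ₁ (((((((uw , _) , _) , _) , _) , _ , w≢u₃) , ¬p)) with A.nb₁ uw
  ... | inj₁ e = contradiction (inj₁ (refl , e)) ¬p
  ... | inj₂ (inj₁ e) = contradiction e w≢u₃
  ... | inj₂ (inj₂ e) = e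
  nbQ₂ : ∀ {w} → Q ∋ u₂ ∼ w → w ≡ v₂
  nbQ₂ (((((((uw , _) , _) , _) , _) , _ , w≢u₃) , ¬p)) with A.nb₂ uw
  ... | inj₁ e = contradiction (inj₂ (refl , e)) ¬p
  ... | inj₂ (inj₁ e) = contradiction e w≢u₃
  ... | inj₂ (inj₂ e) = e
  nbQ₃ : ∀ {w} → Q ∋ w₁ ∼ w → w ≡ v₃
  nbQ₃ (((((((uw , _) , _) , _ , w≢w₃) , ¬p) , _) , _)) with B.nb₁ uw
  ... | inj₁ e = contradiction (inj₁ (refl , e)) ¬p
  ... | inj₂ (inj₁ e) = contradiction e w≢w₃
  ... | inj₂ (inj₂ e) = e
  nbQ₄ : ∀ {w} → Q ∋ w₂ ∼ w → w ≡ v₄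
  nbQ₄ (((((((uw , _) , _) , _ , w≢w₃) , ¬p) , _) , _)) with B.nb₂ uw
  ... | inj₁ e = contradiction (inj₂ (refl , e)) ¬p
  ... | inj₂ (inj₁ e) = contradiction e w≢w₃
  ... | inj₂ (inj₂ e) = e

  -- The second application of `Good-join` needs `Lⱼ` to be free of double links, not only `L`. For
  -- this `v₃` and `v₄` must have no common neighbour and must not continue into a triple link.
  Good-J : Good J
  Good-J = Good-join v₁≢v₂ Good-Lⱼ noDL-Lⱼ
      (cliqueⱼ v₁≢v₃ v₁≢v₄ (clique (sy A.link₁) A.apart₁ no-u₁)) (cliqueⱼ v₂≢v₃ v₂≢v₄ (clique (sy A.link₂) A.apart₂ no-u₂))
      (twoⱼ v₁≢v₃ v₁≢v₄ (two-beyond g L⊑G (sy A.link₁) (λ e → no-u₁ e refl))) (twoⱼ v₂≢v₃ v₂≢v₄ (two-beyond g L⊑G (sy A.link₂) (λ e → no-u₂ e refl)))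
    where
      no-u₁ : ∀ {v s} → L ∋ v ∼ s → s ≢ u₁
      no-u₁ (_ , _ , _ ∷ _ ∷ _ ∷ x ∷ _) = x
      no-u₂ : ∀ {v s} → L ∋ v ∼ s → s ≢ u₂
      no-u₂ (_ , _ , _ ∷ _ ∷ _ ∷ _ ∷ x ∷ _) = x
      no-w₁ : ∀ {v s} → L ∋ v ∼ s → s ≢ w₁
      no-w₁ (_ , _ , _ ∷ _ ∷ _ ∷ _ ∷ _ ∷ _ ∷ x ∷ _) = x
      no-w₂ : ∀ {v s} → L ∋ v ∼ s → s ≢ w₂
      no-w₂ (_ , _ , _ ∷ _ ∷ _ ∷ _ ∷ _ ∷ _ ∷ _ ∷ x ∷ _) = x
      clique : ∀ {v u} → G ∋ v ∼ u → NoCommon G u v → (∀ {v s} → L ∋ v ∼ s → s ≢ u) → Clique L v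
      clique vu none not-u = clique-beyond g L⊑G vu (λ vw → not-u vw , λ uw → none uw (proj₁ vw)) (λ (_ , _ , ss) (_ , _ , ts) st → st , ss , ts)
      cliqueⱼ : ∀ {v} → v ≢ v₃ → v ≢ v₄ → Clique L v → Clique Lⱼ v
      cliqueⱼ v≢v₃ v≢v₄ cl (inj₁ vs) (inj₁ vt) s≢t = inj₁ (cl vs vt s≢t)
      cliqueⱼ v≢v₃ v≢v₄ cl (inj₂ (inj₁ (e , _))) _ _ = contradiction e v≢v₃
      cliqueⱼ v≢v₃ v≢v₄ cl (inj₂ (inj₂ (e , _))) _ _ = contradiction e v≢v₄
      cliqueⱼ v≢v₃ v≢v₄ cl _ (inj₂ (inj₁ (e , _))) _ = contradiction e v≢v₃
      cliqueⱼ v≢v₃ v≢v₄ cl _ (inj₂ (inj₂ (e , _))) _ = contradiction e v≢v₄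
      twoⱼ : ∀ {v} → v ≢ v₃ → v ≢ v₄ → AtMostTwo L v → AtMostTwo Lⱼ v
      twoⱼ v≢v₃ v≢v₄ (s , t , h) = s , t , λ where
        (inj₁ vw) → h vw
        (inj₂ (inj₁ (e , _))) → contradiction e v≢v₃
        (inj₂ (inj₂ (e , _))) → contradiction e v≢v₄
      Good-Lⱼ : Good Lⱼ
      Good-Lⱼ = Good-join v₃≢v₄ (Good-delAll g eight) (NoDoubleLink-⊑ L⊑G noDL) (clique (sy B.link₁) B.apart₁ no-w₁) (clique (sy B.link₂) B.apart₂ no-w₂)
        (two-beyond g L⊑G (sy B.link₁) (λ e → no-w₁ e refl)) (two-beyond g L⊑G (sy B.link₂) (λ e → no-w₂ e refl))
      noDL-Lⱼ : NoDoubleLink Lⱼ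
      noDL-Lⱼ = NoDoubleLink-join {L = L} v₃≢v₄ (NoDoubleLink-⊑ {H = L} L⊑G noDL)
        (λ v₃w v₄w → ends-no-common g noLeaf noPath noDiamond noDL noTL B (no-w₁ v₃w) (no-w₂ v₃w) (proj₁ v₃w) (proj₁ v₄w))
        (λ ((a , _) , (b , _) , (c , _)) ((a′ , _) , (b′ , _) , (c′ , _)) (pq , _) dis →
          no-triple-beyond g noLeaf noPath noDiamond noDL noTL B (a , b , c) (a′ , b′ , c′) pq dis)

  coloured : Colorable J
  coloured = below Good-J (record { alive = alive ; edge-of = proj₁ C.tri ; dead = λ {y} → dead {y} })
    where
      alive : ∀ {x y} → J ∋ x ∼ y → ∃ λ w → G ∋ x ∼ w
      alive {y = y} (inj₁ (inj₁ xy)) = y , proj₁ xy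
      alive (inj₁ (inj₂ (inj₁ (refl , _)))) = _ , sy B.link₁
      alive (inj₁ (inj₂ (inj₂ (refl , _)))) = _ , sy B.link₂
      alive (inj₂ (inj₁ (refl , _))) = _ , sy A.link₁
      alive (inj₂ (inj₂ (refl , _))) = _ , sy A.link₂
      dead : ∀ {y} → ¬ J ∋ b ∼ y
      dead (inj₁ (inj₁ (_ , x ∷ _ , _))) = x refl
      dead (inj₁ (inj₂ (inj₁ (e , _)))) = All.head out₃ (≡-sym e)
      dead (inj₁ (inj₂ (inj₂ (e , _)))) = All.head out₄ (≡-sym e)
      dead (inj₂ (inj₁ (e , _))) = All.head out₁ (≡-sym e)
      dead (inj₂ (inj₂ (e , _))) = All.head out₂ (≡-sym e)

  tips : List V
  tips = u₁ ∷ u₂ ∷ w₁ ∷ w₂ ∷ []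

  -- A colouring of the graph in which both arms are reduced to pendant edges at v₁, v₂, v₃, v₄.
  record Pendant (κ : V → V → Color) : Set where
    field
      k      : V → V → Color
      strong : Strong Q k
      same   : ∀ {x y} → All (x ≢_) tips → All (y ≢_) tips → k x y ≡ κ x y
      leg₁   : k u₁ v₁ ≡ κ v₁ v₂
      leg₃   : k w₁ v₃ ≡ κ v₃ v₄
      legs₁₂ : k u₁ v₁ ≢ k u₂ v₂
      legs₃₄ : k w₁ v₃ ≢ k w₂ v₄

  private
    split : ∀ {x y} → Q ∋ x ∼ y → L ∋ x ∼ y ⊎ Pair u₁ v₁ x y ⊎ Pair u₂ v₂ x y ⊎ Pair w₁ v₃ x y ⊎ Pair w₂ v₄ x y
    split {x} {y} xy = go (x ≟ u₁) (x ≟ u₂) (x ≟ w₁) (x ≟ w₂) (y ≟ u₁) (y ≟ u₂) (y ≟ w₁) (y ≟ w₂)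
      where
        yx : Q ∋ y ∼ x
        yx = ∼-sym Q xy
        go : Dec (x ≡ u₁) → Dec (x ≡ u₂) → Dec (x ≡ w₁) → Dec (x ≡ w₂) → Dec (y ≡ u₁) → Dec (y ≡ u₂) → Dec (y ≡ w₁) → Dec (y ≡ w₂) →
          L ∋ x ∼ y ⊎ Pair u₁ v₁ x y ⊎ Pair u₂ v₂ x y ⊎ Pair w₁ v₃ x y ⊎ Pair w₂ v₄ x y
        go (yes refl) _ _ _ _ _ _ _ = inj₂ (inj₁ (inj₁ (refl , nbQ₁ xy)))
        go _ (yes refl) _ _ _ _ _ _ = inj₂ (inj₂ (inj₁ (inj₁ (refl , nbQ₂ xy))))
        go _ _ (yes refl) _ _ _ _ _ = inj₂ (inj₂ (inj₂ (inj₁ (inj₁ (refl , nbQ₃ xy)))))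
        go _ _ _ (yes refl) _ _ _ _ = inj₂ (inj₂ (inj₂ (inj₂ (inj₁ (refl , nbQ₄ xy)))))
        go _ _ _ _ (yes refl) _ _ _ = inj₂ (inj₁ (inj₂ (nbQ₁ yx , refl)))
        go _ _ _ _ _ (yes refl) _ _ = inj₂ (inj₂ (inj₁ (inj₂ (nbQ₂ yx , refl))))
        go _ _ _ _ _ _ (yes refl) _ = inj₂ (inj₂ (inj₂ (inj₁ (inj₂ (nbQ₃ yx , refl)))))
        go _ _ _ _ _ _ _ (yes refl) = inj₂ (inj₂ (inj₂ (inj₂ (inj₂ (nbQ₄ yx , refl)))))
        go (no x₁) (no x₂) (no x₃) (no x₄) (no y₁) (no y₂) (no y₃) (no y₄) = inj₁ (plain xy (x₁ ∷ x₂ ∷ x₃ ∷ x₄ ∷ []) (y₁ ∷ y₂ ∷ y₃ ∷ y₄ ∷ []))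
          where
            plain : Q ∋ x ∼ y → All (x ≢_) tips → All (y ≢_) tips → L ∋ x ∼ y
            plain ((((((e , xc , yc) , xb , yb) , xw₃ , yw₃) , _) , xu₃ , yu₃) , _) (x₁ ∷ x₂ ∷ x₃ ∷ x₄ ∷ []) (y₁ ∷ y₂ ∷ y₃ ∷ y₄ ∷ []) =
              e , (xb ∷ xc ∷ xu₃ ∷ x₁ ∷ x₂ ∷ xw₃ ∷ x₃ ∷ x₄ ∷ []) , (yb ∷ yc ∷ yu₃ ∷ y₁ ∷ y₂ ∷ yw₃ ∷ y₃ ∷ y₄ ∷ [])

  module _ {κ : V → V → Color} (sJ : Strong J κ) where

    private
      L′ = del² Q w₁ w₂
      -- The halfway graph: `v₁ v₂` is already replaced by two pendant edges, while `v₃` and `v₄`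
      -- are still joined.
      M = join L′ v₃ v₄ v₃≢v₄
      ≢nine : ∀ {v} → All (v ≢_) nine → u₁ ≢ v × u₂ ≢ v × w₁ ≢ v × w₂ ≢ v
      ≢nine (_ ∷ _ ∷ _ ∷ p ∷ q ∷ _ ∷ r ∷ s ∷ _) = ≢-sym p , ≢-sym q , ≢-sym r , ≢-sym s

      abstract
        first : ∃ λ k → Strong M k × k u₁ v₁ ≡ κ v₁ v₂ × k u₂ v₂ ≡ κ v₁ v₂ × (∀ {x y} → x ≢ u₁ → x ≢ u₂ → y ≢ u₁ → y ≢ u₂ → k x y ≡ κ x y)
        first = unjoin {L = Lⱼ} {M} v₁≢v₂ not-adjacent iso₁ iso₂ (All.head (proj₂ tip₁))
          (proj₁ (≢nine out₁) ∷ proj₁ (≢nine out₂) ∷ []) (proj₁ (proj₂ (≢nine out₁)) ∷ proj₁ (proj₂ (≢nine out₂)) ∷ []) edges sJ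
          where
            not-adjacent : ¬ Lⱼ ∋ v₁ ∼ v₂
            not-adjacent (inj₁ e) = v₁≁v₂ (proj₁ e)
            not-adjacent (inj₂ (inj₁ (e , _))) = v₁≢v₃ e
            not-adjacent (inj₂ (inj₂ (e , _))) = v₁≢v₄ e
            iso₁ : ∀ {w} → ¬ Lⱼ ∋ u₁ ∼ w
            iso₁ (inj₁ (_ , (_ ∷ _ ∷ _ ∷ x ∷ _) , _)) = x refl
            iso₁ (inj₂ (inj₁ (e , _))) = proj₁ (≢nine out₃) e
            iso₁ (inj₂ (inj₂ (e , _))) = proj₁ (≢nine out₄) e
            iso₂ : ∀ {w} → ¬ Lⱼ ∋ u₂ ∼ w
            iso₂ (inj₁ (_ , (_ ∷ _ ∷ _ ∷ _ ∷ x ∷ _) , _)) = x refl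
            iso₂ (inj₂ (inj₁ (e , _))) = proj₁ (proj₂ (≢nine out₃)) e
            iso₂ (inj₂ (inj₂ (e , _))) = proj₁ (proj₂ (≢nine out₄)) e
            edges : ∀ {x y} → M ∋ x ∼ y → Lⱼ ∋ x ∼ y ⊎ Pair u₁ v₁ x y ⊎ Pair u₂ v₂ x y
            edges (inj₂ p) = inj₁ (inj₂ p)
            edges (inj₁ ((xy , x≢w₁ , y≢w₁) , x≢w₂ , y≢w₂)) with split xy
            ... | inj₁ l = inj₁ (inj₁ l)
            ... | inj₂ (inj₁ p) = inj₂ (inj₁ p)
            ... | inj₂ (inj₂ (inj₁ p)) = inj₂ (inj₂ p)
            ... | inj₂ (inj₂ (inj₂ (inj₁ p))) = ⊥-elim ([ (λ (e , _) → x≢w₁ e) , (λ (_ , e) → y≢w₁ e) ]′ p)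
            ... | inj₂ (inj₂ (inj₂ (inj₂ p))) = ⊥-elim ([ (λ (e , _) → x≢w₂ e) , (λ (_ , e) → y≢w₂ e) ]′ p)

        second : ∀ {k} → Strong M k → ∃ λ k′ → Strong Q k′ × k′ w₁ v₃ ≡ k v₃ v₄ × k′ w₂ v₄ ≡ k v₃ v₄ × (∀ {x y} → x ≢ w₁ → x ≢ w₂ → y ≢ w₁ → y ≢ w₂ → k′ x y ≡ k x y)
        second s = unjoin {L = L′} {Q} v₃≢v₄ (λ ((e , _) , _) → v₃≁v₄ (sub Q⊑G e)) (λ ((_ , x , _) , _) → x refl) (λ (_ , x , _) → x refl) (All.head (proj₂ tip₃))
          (proj₁ (proj₂ (proj₂ (≢nine out₃))) ∷ proj₁ (proj₂ (proj₂ (≢nine out₄))) ∷ [])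
          (proj₂ (proj₂ (proj₂ (≢nine out₃))) ∷ proj₂ (proj₂ (proj₂ (≢nine out₄))) ∷ []) edges s
          where
            edges : ∀ {x y} → Q ∋ x ∼ y → L′ ∋ x ∼ y ⊎ Pair w₁ v₃ x y ⊎ Pair w₂ v₄ x y
            edges {x} {y} xy = go (x ≟ w₁) (x ≟ w₂) (y ≟ w₁) (y ≟ w₂)
              where
                go : Dec (x ≡ w₁) → Dec (x ≡ w₂) → Dec (y ≡ w₁) → Dec (y ≡ w₂) → L′ ∋ x ∼ y ⊎ Pair w₁ v₃ x y ⊎ Pair w₂ v₄ x y
                go (yes refl) _ _ _ = inj₂ (inj₁ (inj₁ (refl , nbQ₃ xy)))
                go _ (yes refl) _ _ = inj₂ (inj₂ (inj₁ (refl , nbQ₄ xy)))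
                go _ _ (yes refl) _ = inj₂ (inj₁ (inj₂ (nbQ₃ (∼-sym Q xy) , refl)))
                go _ _ _ (yes refl) = inj₂ (inj₂ (inj₂ (nbQ₄ (∼-sym Q xy) , refl)))
                go (no p) (no q) (no r) (no s) = inj₁ ((xy , p , r) , q , s)

        -- After `unjoin` both links of an arm have the same colour, although in `G` they are at
        -- distance 2. One of them is coloured anew: beyond it at most five colours are forbidden,
        -- and `e`, that of the other link, is the sixth.
        recolor : ∀ {k u v} e → Strong Q k → (∀ {w} → Q ∋ u ∼ w → w ≡ v) → G ∋ v ∼ u → NoCommon G u v →
          ∃ λ d → Strong Q (extend u (λ _ → d) k) × e ≢ d
        recolor {k} {u} {v} e s nb vu none with legColors g {K = del Q u} {c = k} (⊑-trans (del-⊑ Q u) Q⊑G) (symm s) vu (λ (_ , _ , x) → x refl) (λ vs us → none us vs)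
        ... | k₁ , k₂ , k₃ , k₄ , k₅ , free with fresh (e ∷ k₁ ∷ k₂ ∷ k₃ ∷ k₄ ∷ k₅ ∷ [])
        ... | d , d≢e ∷ avoids = d , addPendant Q nb (Strong-⊑ (del-⊑ Q u) s) (free avoids) , ≢-sym d≢e

    private
     module _ {k k′ : V → V → Color} {d d′ : Color} (l₁ : k u₁ v₁ ≡ κ v₁ v₂) (same : ∀ {x y} → x ≢ u₁ → x ≢ u₂ → y ≢ u₁ → y ≢ u₂ → k x y ≡ κ x y)
       (l₃ : k′ w₁ v₃ ≡ k v₃ v₄) (same′ : ∀ {x y} → x ≢ w₁ → x ≢ w₂ → y ≢ w₁ → y ≢ w₂ → k′ x y ≡ k x y)
       (d≢ : k′ u₁ v₁ ≢ d) (sQ₄ : Strong Q (extend w₂ (λ _ → d′) (extend u₂ (λ _ → d) k′))) (d′≢ : k′ w₁ v₃ ≢ d′) where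
        K = extend w₂ (λ _ → d′) (extend u₂ (λ _ → d) k′)
        keep : ∀ {x y} → x ≢ u₂ → x ≢ w₂ → y ≢ u₂ → y ≢ w₂ → K x y ≡ k′ x y
        keep xu xw yu yw = trans (extend-old w₂ _ _ xw yw) (extend-old u₂ _ _ xu yu)
        finish : u₁ ≢ v₁ × u₂ ≢ v₁ × w₁ ≢ v₁ × w₂ ≢ v₁ → u₁ ≢ v₂ × u₂ ≢ v₂ × w₁ ≢ v₂ × w₂ ≢ v₂ → u₁ ≢ v₃ × u₂ ≢ v₃ × w₁ ≢ v₃ × w₂ ≢ v₃ → u₁ ≢ v₄ × u₂ ≢ v₄ × w₁ ≢ v₄ × w₂ ≢ v₄ →
          All (u₁ ≢_) (u₂ ∷ w₁ ∷ w₂ ∷ []) → All (u₂ ≢_) (u₁ ∷ w₁ ∷ w₂ ∷ []) → All (w₁ ≢_) (w₂ ∷ u₁ ∷ u₂ ∷ []) → Pendant κ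
        finish (_ , u₂v₁ , w₁v₁ , w₂v₁) (_ , _ , _ , w₂v₂) (u₁v₃ , u₂v₃ , _ , w₂v₃) (u₁v₄ , u₂v₄ , _ , _) (u₁u₂ ∷ u₁w₁ ∷ u₁w₂ ∷ []) (_ ∷ u₂w₁ ∷ u₂w₂ ∷ []) (w₁w₂ ∷ _) = record
          { k = K ; strong = sQ₄
          ; same = λ { (x₁ ∷ x₂ ∷ x₃ ∷ x₄ ∷ []) (y₁ ∷ y₂ ∷ y₃ ∷ y₄ ∷ []) → trans (keep x₂ x₄ y₂ y₄) (trans (same′ x₃ x₄ y₃ y₄) (same x₁ x₂ y₁ y₂)) }
          ; leg₁ = trans keep₁ (trans (same′ u₁w₁ u₁w₂ (≢-sym w₁v₁) (≢-sym w₂v₁)) l₁)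
          ; leg₃ = trans keep₃ (trans l₃ (same (≢-sym u₁v₃) (≢-sym u₂v₃) (≢-sym u₁v₄) (≢-sym u₂v₄)))
          ; legs₁₂ = λ e → d≢ (trans (≡-sym keep₁) (trans e (trans (extend-old w₂ _ _ u₂w₂ (≢-sym w₂v₂)) (extend-new u₂ _ _ _))))
          ; legs₃₄ = λ e → d′≢ (trans (≡-sym keep₃) (trans e (extend-new w₂ _ _ _)))
          }
          where
            keep₁ : K u₁ v₁ ≡ k′ u₁ v₁
            keep₁ = keep u₁u₂ u₁w₂ (≢-sym u₂v₁) (≢-sym w₂v₁)
            keep₃ : K w₁ v₃ ≡ k′ w₁ v₃
            keep₃ = keep (≢-sym u₂w₁) w₁w₂ (≢-sym u₂v₃) (≢-sym w₂v₃)

    pendant : Pendant κ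
    pendant = from-first first
      where
        from-first : (∃ λ k → Strong M k × k u₁ v₁ ≡ κ v₁ v₂ × k u₂ v₂ ≡ κ v₁ v₂ × (∀ {x y} → x ≢ u₁ → x ≢ u₂ → y ≢ u₁ → y ≢ u₂ → k x y ≡ κ x y)) → Pendant κ
        from-first (k , sM , l₁ , l₂ , same) = from-second (second sM)
          where
            from-second : (∃ λ k′ → Strong Q k′ × k′ w₁ v₃ ≡ k v₃ v₄ × k′ w₂ v₄ ≡ k v₃ v₄ × (∀ {x y} → x ≢ w₁ → x ≢ w₂ → y ≢ w₁ → y ≢ w₂ → k′ x y ≡ k x y)) → Pendant κ
            from-second (k′ , sQ , l₃ , _ , same′) = from-third (recolor (k′ u₁ v₁) sQ nbQ₂ (sy A.link₂) A.apart₂)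
              where
                from-third : (∃ λ d → Strong Q (extend u₂ (λ _ → d) k′) × k′ u₁ v₁ ≢ d) → Pendant κ
                from-third (d , sQ₂ , d≢) = let (d′ , sQ₄ , d′≢) = recolor (k′ w₁ v₃) sQ₂ nbQ₄ (sy B.link₂) B.apart₂ in
                  finish l₁ same l₃ same′ d≢ sQ₄ d′≢ (≢nine out₁) (≢nine out₂) (≢nine out₃) (≢nine out₄) (proj₂ tip₁) (proj₂ tip₂) (proj₂ tip₃)

  record End (v u : V) : Set where
    field
      {s t} : V
      vs    : L ∋ v ∼ s
      vt    : L ∋ v ∼ t
      s≢t   : s ≢ t
      cov   : ∀ {w} → G ∋ v ∼ w → w ≡ u ⊎ w ≡ s ⊎ w ≡ t

  private
    end : ∀ {v u} → All (v ≢_) nine → G ∋ v ∼ u → NoCommon G u v →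
      (∀ {s} → G ∋ v ∼ s → s ≢ u → s ≢ u₁ × s ≢ u₂ × s ≢ w₁ × s ≢ w₂) → End v u
    end out vu none tips with beyond-link g noLeaf noPath noDiamond vu none
    ... | s , t , (vs , vt , st) , s≢u , t≢u , h = record { vs = inL vs s≢u ; vt = inL vt t≢u ; s≢t = ∼⇒≢ G st ; cov = h }
      where
        inL : ∀ {s} → G ∋ _ ∼ s → s ≢ _ → L ∋ _ ∼ s
        inL vs s≢u = let (p , q , r , t) = tips vs s≢u in vs , to-eight out , clear out vs p q r t

  abstract
    end₁ : End v₁ u₁
    end₁ = end out₁ (sy A.link₁) A.apart₁ λ vs s≢ → s≢ , not-tip₂ out₁ v₁≢v₂ vs , not-tip₃ out₁ v₁≢v₃ vs , not-tip₄ out₁ v₁≢v₄ vs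
    end₂ : End v₂ u₂
    end₂ = end out₂ (sy A.link₂) A.apart₂ λ vs s≢ → not-tip₁ out₂ (≢-sym v₁≢v₂) vs , s≢ , not-tip₃ out₂ v₂≢v₃ vs , not-tip₄ out₂ v₂≢v₄ vs
    end₃ : End v₃ w₁
    end₃ = end out₃ (sy B.link₁) B.apart₁ λ vs s≢ → not-tip₁ out₃ (≢-sym v₁≢v₃) vs , not-tip₂ out₃ (≢-sym v₂≢v₃) vs , s≢ , not-tip₄ out₃ v₃≢v₄ vs
    end₄ : End v₄ w₂
    end₄ = end out₄ (sy B.link₂) B.apart₂ λ vs s≢ → not-tip₁ out₄ (≢-sym v₁≢v₄) vs , not-tip₂ out₄ (≢-sym v₂≢v₄) vs , not-tip₃ out₄ (≢-sym v₃≢v₄) vs , s≢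

  unused-end : ∀ {K} κ {v u j} (E : End v u) → K ⊑ G → (K ∋ v ∼ u → j ≢ κ v u) → j ≢ κ v (End.s E) → j ≢ κ v (End.t E) → Unused K κ v j
  unused-end κ E h ju js jt vw e with End.cov E (sub h vw)
  ... | inj₁ refl = ju vw (≡-sym e)
  ... | inj₂ (inj₁ refl) = js (≡-sym e)
  ... | inj₂ (inj₂ refl) = jt (≡-sym e)

  private
    of-L : ∀ {x y} → L ∋ x ∼ y → All (x ≢_) tips × All (y ≢_) tips
    of-L (_ , xs , ys) = f xs , f ys
      where
        f : ∀ {x} → All (x ≢_) eight → All (x ≢_) tips
        f (_ ∷ _ ∷ _ ∷ x₁ ∷ x₂ ∷ _ ∷ x₃ ∷ x₄ ∷ []) = x₁ ∷ x₂ ∷ x₃ ∷ x₄ ∷ []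

  module _ {κ : V → V → Color} (sJ : Strong J κ) (P : Pendant κ) where
    open Pendant P

    -- In `J` the joining edge has a colour different from all others at both of its ends, and it
    -- separates the two colours at `v` from the two at `v′`. The link `u v` still has that colour,
    -- whereas the recoloured `u′ v′` is compared only with `u v` and with the colours at `v′`.
    quad-at : ∀ {v v′ u u′} → J ∋ v ∼ v′ → ¬ G ∋ v ∼ v′ → Q ∋ v ∼ u → Q ∋ v′ ∼ u′ → u ∈ tips → u′ ∈ tips → k u v ≡ κ v v′ → k u v ≢ k u′ v′ →
      (E : End v u) (F : End v′ u′) → Quad (k u v) (k u′ v′) (k v (End.s E)) (k v (End.t E)) (k v′ (End.s F)) (k v′ (End.t F))
    quad-at {v} {v′} {u} {u′} jj ¬vv vu vu′ u∈ u′∈ leg legs E F =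
      quad legs (e≢x E.vs ∷ e≢x E.vt ∷ e≢y F.vs ∷ e≢y F.vt ∷ []) (e′≢y F.vs ∷ e′≢y F.vt ∷ []) (inc E.vs E.vt E.s≢t) (inc F.vs F.vt F.s≢t)
        (sep E.vs F.vs ∷ sep E.vs F.vt ∷ []) (sep E.vt F.vs ∷ sep E.vt F.vt ∷ [])
      where
        module E = End E
        module F = End F
        inc : ∀ {x s t} → L ∋ x ∼ s → L ∋ x ∼ t → s ≢ t → k x s ≢ k x t
        inc xs xt = incident strong (sub L⊑Q xs) (sub L⊑Q xt)
        same-L : ∀ {x y} → L ∋ x ∼ y → k x y ≡ κ x y
        same-L xy = same (proj₁ (of-L xy)) (proj₂ (of-L xy))
        e≢x : ∀ {s} → L ∋ v ∼ s → k u v ≢ k v s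
        e≢x vs e = incident strong vu (sub L⊑Q vs) (λ where refl → All.lookup (proj₂ (of-L vs)) u∈ refl) (trans (symm strong v u) e)
        e′≢y : ∀ {s} → L ∋ v′ ∼ s → k u′ v′ ≢ k v′ s
        e′≢y vs e = incident strong vu′ (sub L⊑Q vs) (λ where refl → All.lookup (proj₂ (of-L vs)) u′∈ refl) (trans (symm strong v′ u′) e)
        e≢y : ∀ {s} → L ∋ v′ ∼ s → k u v ≢ k v′ s
        e≢y vs e = incident sJ (∼-sym J jj) (inj₁ (inj₁ vs)) (λ where refl → ¬vv (sy (proj₁ vs)))
          (trans (symm sJ v′ v) (trans (≡-sym leg) (trans e (same-L vs))))
        sep : ∀ {s t} → L ∋ v ∼ s → L ∋ v′ ∼ t → k v s ≢ k v′ t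
        sep vs vt e = joined sJ jj (inj₁ (inj₁ vs)) (inj₁ (inj₁ vt)) (λ where refl → ¬vv (proj₁ vs)) (λ where refl → ¬vv (sy (proj₁ vt)))
          (trans (≡-sym (same-L vs)) (trans e (same-L vt)))

    abstract
      q₁ : Quad (k u₁ v₁) (k u₂ v₂) (k v₁ (End.s end₁)) (k v₁ (End.t end₁)) (k v₂ (End.s end₂)) (k v₂ (End.t end₂))
      q₁ = quad-at (inj₂ (inj₁ (refl , refl))) v₁≁v₂ vu₁ vu₂ (here refl) (there (here refl)) leg₁ legs₁₂ end₁ end₂
      q₃ : Quad (k w₁ v₃) (k w₂ v₄) (k v₃ (End.s end₃)) (k v₃ (End.t end₃)) (k v₄ (End.s end₄)) (k v₄ (End.t end₄))
      q₃ = quad-at (inj₁ (inj₂ (inj₁ (refl , refl)))) v₃≁v₄ vw₁ vw₂ (there (there (here refl))) (there (there (there (here refl)))) leg₃ legs₃₄ end₃ end₄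

    module Q₁ = Quad q₁
    module Q₃ = Quad q₃

    private
      base₁ : All (u₃ ≢_) (b ∷ c ∷ w₃ ∷ w₁ ∷ w₂ ∷ [])
      base₁ with CA | AB
      ... | (p ∷ _) ∷ (q ∷ _) ∷ _ | (x ∷ y ∷ z ∷ []) ∷ _ = ≢-sym p ∷ ≢-sym q ∷ x ∷ y ∷ z ∷ []
      base₃ : All (w₃ ≢_) (b ∷ c ∷ u₃ ∷ u₁ ∷ u₂ ∷ [])
      base₃ with CB | AB
      ... | (q ∷ _) ∷ (p ∷ _) ∷ _ | (x ∷ _) ∷ (y ∷ _) ∷ (z ∷ _) ∷ [] = ≢-sym p ∷ ≢-sym q ∷ ≢-sym x ∷ ≢-sym y ∷ ≢-sym z ∷ []

      K₁ = del² B₁ u₃ u₂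
      K₃ = del² B₂ w₃ w₂
      K₁⊑Q : K₁ ⊑ Q
      K₁⊑Q = incl λ ((xy , h) , x≢u₂ , y≢u₂) → (xy , h) , [ (λ (_ , e) → y≢u₂ e) , (λ (e , _) → x≢u₂ e) ]′
      K₃⊑B₁ : K₃ ⊑ B₁
      K₃⊑B₁ = incl λ ((xy , h) , x≢w₂ , y≢w₂) → (xy , h) , [ (λ (_ , e) → y≢w₂ e) , (λ (e , _) → x≢w₂ e) ]′
      B₁⊑G : B₁ ⊑ G
      B₁⊑G = ⊑-trans B₁⊑B₂ B₂⊑G

      mkB₂ : ∀ {x y} → G ∋ x ∼ y → x ≢ b → x ≢ c → y ≢ b → y ≢ c → B₂ ∋ x ∼ y
      mkB₂ xy xb xc yb yc = (xy , xc , yc) , xb , yb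
      mkB₁ : ∀ {x y} → G ∋ x ∼ y → All (x ≢_) (b ∷ c ∷ w₃ ∷ w₁ ∷ w₂ ∷ []) → y ≢ b → y ≢ c → y ≢ w₃ → B₁ ∋ x ∼ y
      mkB₁ xy (xb ∷ xc ∷ xw₃ ∷ xw₁ ∷ xw₂ ∷ []) yb yc yw₃ = (mkB₂ xy xb xc yb yc , xw₃ , yw₃) , [ (λ (e , _) → xw₁ e) , (λ (e , _) → xw₂ e) ]′

      triA : Triangle B₁ u₃ u₁ u₂
      triA with tip₁ | tip₂
      ... | (p₁ ∷ p₂ ∷ _ ∷ p₃ ∷ _) , (_ ∷ p₄ ∷ p₅ ∷ []) | (q₁ ∷ q₂ ∷ _ ∷ q₃ ∷ _) , _ =
        mkB₁ (proj₁ A.tri) base₁ p₁ p₂ p₃ , mkB₁ (proj₁ (proj₂ A.tri)) base₁ q₁ q₂ q₃ , mkB₁ (proj₂ (proj₂ A.tri)) (p₁ ∷ p₂ ∷ p₃ ∷ p₄ ∷ p₅ ∷ []) q₁ q₂ q₃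
      triB : Triangle B₂ w₃ w₁ w₂
      triB with base₃ | tip₃ | tip₄
      ... | r₁ ∷ r₂ ∷ _ | (p₁ ∷ p₂ ∷ _) , _ | (q₁ ∷ q₂ ∷ _) , _ =
        mkB₂ (proj₁ B.tri) r₁ r₂ p₁ p₂ , mkB₂ (proj₁ (proj₂ B.tri)) r₁ r₂ q₁ q₂ , mkB₂ (proj₂ (proj₂ B.tri)) p₁ p₂ q₁ q₂

      stepA : ∀ {t₁ t₂ f} → Offer Q₁.p₁ Q₁.p₂ Q₁.r₁ Q₁.r₂ t₁ t₂ f → AddPair B₁ u₁ u₂ u₃ k Q₁.s t₂ t₁ (k u₁ v₁) (k u₂ v₂) f
      stepA = fillArm B₁ triA (Strong-⊑ K₁⊑Q strong) (λ uw → A.nb₁ (sub B₁⊑G uw)) (λ uw → A.nb₂ (sub B₁⊑G uw))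
          (λ uw → [ (λ e → contradiction e (not-b uw)) , id ]′ (A.nb₃ (sub B₁⊑G uw))) refl
          (λ { (j₁ ∷ j₂ ∷ j₃ ∷ []) → unused-end k end₁ (⊑-trans K₁⊑Q Q⊑G) (λ _ e → j₁ (trans e (symm strong _ _))) j₂ j₃ })
          (λ { (j₂ ∷ j₃ ∷ []) → unused-end k end₂ (⊑-trans K₁⊑Q Q⊑G) (λ vu → contradiction refl (proj₂ (proj₂ vu))) j₂ j₃ })
          -- The link `v₂ u₂` is present in `Q`; after its removal its colour is free at `v₂` and is
          -- given to it again.
          (subst (Free K₁ k v₂) (symm strong v₂ u₂) (edge-free K₁⊑Q strong vu₂ (λ vu → proj₂ (proj₂ vu) refl))) q₁
        where
          not-b : ∀ {w} → B₁ ∋ u₃ ∼ w → w ≢ b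
          not-b (((_ , _ , x) , _) , _) = x

      module _ {s t₁ t₂ e₁ e₂ f} (R : AddPair B₁ u₁ u₂ u₃ k s t₂ t₁ e₁ e₂ f) where
        module R = AddPair R
        from-end : ∀ {v u} (E : End v u) → All (v ≢_) nine → (R.coloring v (End.s E) ≡ k v (End.s E)) × (R.coloring v (End.t E) ≡ k v (End.t E))
        from-end E (_ ∷ _ ∷ v₃ ∷ _ ∷ v₂ ∷ _) with End.vs E | End.vt E
        ... | _ , _ , (_ ∷ _ ∷ s₃ ∷ _ ∷ s₂ ∷ _) | _ , _ , (_ ∷ _ ∷ t₃ ∷ _ ∷ t₂ ∷ _) = R.keeps v₂ v₃ s₂ s₃ , R.keeps v₂ v₃ t₂ t₃
        leg-kept : ∀ {v u} → All (v ≢_) nine → u ≢ u₂ → u ≢ u₃ → R.coloring u v ≡ k u v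
        leg-kept (_ ∷ _ ∷ v₃ ∷ _ ∷ v₂ ∷ _) uu₂ uu₃ = R.keeps uu₂ uu₃ v₂ v₃

        stepB : ∀ {t₁′ t₂′ f′} → Offer Q₃.p₁ Q₃.p₂ Q₃.r₁ Q₃.r₂ t₁′ t₂′ f′ → AddPair B₂ w₁ w₂ w₃ R.coloring Q₃.s t₂′ t₁′ (k w₁ v₃) (k w₂ v₄) f′
        stepB = fillArm B₂ triB (Strong-⊑ K₃⊑B₁ R.strong) (λ ww → B.nb₁ (sub B₂⊑G ww)) (λ ww → B.nb₂ (sub B₂⊑G ww))
            (λ ww → [ (λ e → contradiction e (not-c ww)) , id ]′ (B.nb₃ (sub B₂⊑G ww))) kept₃
            (λ { (j₁ ∷ j₂ ∷ j₃ ∷ []) → unused-end R.coloring end₃ (⊑-trans K₃⊑B₁ B₁⊑G) (λ _ e → j₁ (trans e (trans (symm R.strong _ _) kept₃)))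
                (λ e → j₂ (trans e (proj₁ (from-end end₃ out₃)))) (λ e → j₃ (trans e (proj₂ (from-end end₃ out₃)))) })
            (λ { (j₂ ∷ j₃ ∷ []) → unused-end R.coloring end₄ (⊑-trans K₃⊑B₁ B₁⊑G) (λ vw → contradiction refl (proj₂ (proj₂ vw)))
                (λ e → j₂ (trans e (proj₁ (from-end end₄ out₄)))) (λ e → j₃ (trans e (proj₂ (from-end end₄ out₄)))) })
            (subst (Free K₃ R.coloring v₄) (trans (symm R.strong v₄ w₂) kept₄) (edge-free K₃⊑B₁ R.strong (sub Q⊑B₁ vw₂) (λ vw → proj₂ (proj₂ vw) refl))) q₃
          where
            not-c : ∀ {w} → B₂ ∋ w₃ ∼ w → w ≢ c
            not-c ((_ , _ , x) , _) = x
            kept₃ : R.coloring w₁ v₃ ≡ k w₁ v₃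
            kept₃ with tip₃
            ... | (_ ∷ _ ∷ p ∷ _) , (_ ∷ _ ∷ q ∷ []) = leg-kept out₃ q p
            kept₄ : R.coloring w₂ v₄ ≡ k w₂ v₄
            kept₄ with tip₄
            ... | (_ ∷ _ ∷ p ∷ _) , (_ ∷ _ ∷ q ∷ []) = leg-kept out₄ q p

        module _ {s′ t₁′ t₂′ e₃ e₄ f′ x y z} (S : AddPair B₂ w₁ w₂ w₃ R.coloring s′ t₂′ t₁′ e₃ e₄ f′)
          (dR : Distinct (s ∷ t₂ ∷ t₁ ∷ e₁ ∷ e₂ ∷ f ∷ [])) (dS : Distinct (s′ ∷ t₂′ ∷ t₁′ ∷ e₃ ∷ e₄ ∷ f′ ∷ []))
          (dC : Distinct (x ∷ y ∷ z ∷ k a v₅ ∷ f ∷ f′ ∷ []))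
          (X : All (x ≢_) (t₁ ∷ t₂ ∷ [])) (Y : All (y ≢_) (t₁′ ∷ t₂′ ∷ [])) (Z : All (z ≢_) (t₁ ∷ t₂ ∷ t₁′ ∷ t₂′ ∷ []))
          (unX : Unused Q k v₅ x) (unY : Unused Q k v₅ y) where
          module S = AddPair S

          -- Inserting the second arm adds edges only at `w₁`, `w₂`, `w₃` and `v₄`, so at other
          -- vertices no colour becomes used.
          below-S : ∀ {w j} → All (w ≢_) (c ∷ w₃ ∷ w₁ ∷ w₂ ∷ v₄ ∷ []) → Unused B₁ R.coloring w j → Unused B₂ S.coloring w j
          below-S (wc ∷ w-w₃ ∷ w-w₁ ∷ w-w₂ ∷ w-v₄ ∷ []) un = S.at-old w-w₁ w-w₂ w-w₃ (λ wb → un (sub K₃⊑B₁ wb))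
            (λ e → ⊥-elim ([ w-w₁ , [ w-w₃ , w-v₄ ]′ ]′ (B.nb₂ (sub B₂⊑G e)))) (λ e → ⊥-elim ([ wc , [ w-w₁ , w-w₂ ]′ ]′ (B.nb₃ (sub B₂⊑G e))))

          at-v₅ : ∀ {j} → Unused Q k v₅ j → Unused B₂ S.coloring v₅ j
          at-v₅ un with out₅
          ... | o₁ ∷ o₂ ∷ o₃ ∷ o₄ ∷ o₅ ∷ o₆ ∷ o₇ ∷ o₈ ∷ _ = below-S (o₂ ∷ o₆ ∷ o₇ ∷ o₈ ∷ ≢-sym v₄≢v₅ ∷ [])
            (R.at-old o₄ o₅ o₃ (λ vb → un (sub K₁⊑Q vb))
              (λ e → ⊥-elim ([ o₄ , [ o₃ , ≢-sym v₂≢v₅ ]′ ]′ (A.nb₂ (sub B₁⊑G e)))) (λ e → ⊥-elim ([ o₁ , [ o₄ , o₅ ]′ ]′ (A.nb₃ (sub B₁⊑G e)))))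

          far₁ : All (u₁ ≢_) (c ∷ w₃ ∷ w₁ ∷ w₂ ∷ v₄ ∷ [])
          far₁ with tip₁
          ... | (_ ∷ p ∷ _ ∷ q ∷ _) , (_ ∷ r ∷ s ∷ []) = p ∷ q ∷ r ∷ s ∷ proj₁ (≢nine′ out₄) ∷ []
            where
              ≢nine′ : ∀ {v} → All (v ≢_) nine → u₁ ≢ v × u₂ ≢ v
              ≢nine′ (_ ∷ _ ∷ _ ∷ p ∷ q ∷ _) = ≢-sym p , ≢-sym q
          far₂ : All (u₂ ≢_) (c ∷ w₃ ∷ w₁ ∷ w₂ ∷ v₄ ∷ [])
          far₂ with tip₂ | out₄
          ... | (_ ∷ p ∷ _ ∷ q ∷ _) , (_ ∷ r ∷ s ∷ []) | _ ∷ _ ∷ _ ∷ _ ∷ t ∷ _ = p ∷ q ∷ r ∷ s ∷ ≢-sym t ∷ []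
          far₃ : All (u₃ ≢_) (c ∷ w₃ ∷ w₁ ∷ w₂ ∷ v₄ ∷ [])
          far₃ with base₁ | out₄
          ... | _ ∷ p ∷ q ∷ r ∷ s ∷ [] | _ ∷ _ ∷ t ∷ _ = p ∷ q ∷ r ∷ s ∷ ≢-sym t ∷ []

          centre : Colorable G
          centre = go dR dS dC X Y Z
           where
            go : Distinct (s ∷ t₂ ∷ t₁ ∷ e₁ ∷ e₂ ∷ f ∷ []) → Distinct (s′ ∷ t₂′ ∷ t₁′ ∷ e₃ ∷ e₄ ∷ f′ ∷ []) → Distinct (x ∷ y ∷ z ∷ k a v₅ ∷ f ∷ f′ ∷ []) →
              All (x ≢_) (t₁ ∷ t₂ ∷ []) → All (y ≢_) (t₁′ ∷ t₂′ ∷ []) → All (z ≢_) (t₁ ∷ t₂ ∷ t₁′ ∷ t₂′ ∷ []) → Colorable G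
            go ((_ ∷ _ ∷ _ ∷ _ ∷ sf ∷ []) ∷ (_ ∷ _ ∷ _ ∷ t₂f ∷ []) ∷ (_ ∷ _ ∷ t₁f ∷ []) ∷ (_ ∷ e₁f ∷ []) ∷ (e₂f ∷ []) ∷ _)
              ((_ ∷ _ ∷ _ ∷ _ ∷ sf′ ∷ []) ∷ (_ ∷ _ ∷ _ ∷ t₂f′ ∷ []) ∷ (_ ∷ _ ∷ t₁f′ ∷ []) ∷ (_ ∷ e₃f′ ∷ []) ∷ (e₄f′ ∷ []) ∷ _)
              ((_ ∷ _ ∷ _ ∷ xf ∷ _ ∷ []) ∷ (_ ∷ _ ∷ _ ∷ yf′ ∷ []) ∷ (_ ∷ zf ∷ zf′ ∷ []) ∷ _)
              (xt₁ ∷ xt₂ ∷ []) (yt₁ ∷ yt₂ ∷ []) (zt₁ ∷ zt₂ ∷ zt₁′ ∷ zt₂′ ∷ []) =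
             -- The middle triangle is inserted at the pendant edge `a v₅`; its legs are the links
             -- to `u₃` and `w₃`, in the colours `f` and `f′` reserved there.
             _ , AddPair.strong (addPair G (sy (proj₁ (proj₂ C.tri))) (sy (proj₂ (proj₂ C.tri))) (proj₁ C.tri) S.strong u₃ w₃ dC nbA nbB nbC)
              where
                nbA : ∀ {w} → B₂ ∋ a ∼ w → S.coloring a w ≡ k a v₅ × Unused B₂ S.coloring w x × Unused B₂ S.coloring w y
                nbA ((aw , _ , w≢c) , _ , w≢b) with C.nbA aw
                ... | inj₁ e = contradiction e w≢b
                ... | inj₂ (inj₁ e) = contradiction e w≢c
                ... | inj₂ (inj₂ refl) = kept top-corner out₅ , at-v₅ unX , at-v₅ unY
                  where
                    kept : All (a ≢_) eight → All (v₅ ≢_) nine → S.coloring a v₅ ≡ k a v₅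
                    kept (_ ∷ _ ∷ p₃ ∷ _ ∷ p₂ ∷ q₃ ∷ _ ∷ q₂ ∷ []) (_ ∷ _ ∷ r₃ ∷ _ ∷ r₂ ∷ s₃ ∷ _ ∷ s₂ ∷ _) = trans (S.keeps q₂ q₃ s₂ s₃) (R.keeps p₂ p₃ r₂ r₃)
                nbB : ∀ {w} → G ∋ b ∼ w → w ≡ a ⊎ w ≡ c ⊎ (w ≡ u₃ × Addable B₂ S.coloring w f x z)
                nbB bw with C.nbB bw
                ... | inj₁ e = inj₂ (inj₁ e)
                ... | inj₂ (inj₁ e) = inj₁ e
                ... | inj₂ (inj₂ refl) = inj₂ (inj₂ (refl , addable free (below-S far₃ (R.at-d xf xt₂ xt₁)) (below-S far₃ (R.at-d zf zt₂ zt₁))))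
                  where
                    free : Free B₂ S.coloring u₃ f
                    free ((uw , _) , _ , w≢b) with A.nb₃ uw
                    ... | inj₁ e = contradiction e w≢b
                    ... | inj₂ (inj₁ refl) = below-S far₁ (R.at-a (≢-sym e₁f) (≢-sym sf) (≢-sym t₂f))
                    ... | inj₂ (inj₂ refl) = below-S far₂ (R.at-b (≢-sym e₂f) (≢-sym sf) (≢-sym t₁f))
                nbC : ∀ {w} → G ∋ c ∼ w → w ≡ a ⊎ w ≡ b ⊎ (w ≡ w₃ × Addable B₂ S.coloring w f′ y z)
                nbC cw with C.nbC cw
                ... | inj₁ e = inj₂ (inj₁ e)
                ... | inj₂ (inj₁ e) = inj₁ e
                ... | inj₂ (inj₂ refl) = inj₂ (inj₂ (refl , addable free (S.at-d yf′ yt₂ yt₁) (S.at-d zf′ zt₂′ zt₁′)))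
                  where
                    free : Free B₂ S.coloring w₃ f′
                    free ((ww , _ , w≢c) , _) with B.nb₃ ww
                    ... | inj₁ e = contradiction e w≢c
                    ... | inj₂ (inj₁ refl) = S.at-a (≢-sym e₃f′) (≢-sym sf′) (≢-sym t₂f′)
                    ... | inj₂ (inj₂ refl) = S.at-b (≢-sym e₄f′) (≢-sym sf′) (≢-sym t₁f′)

    assemble : Colorable G
    assemble = from-side (side-colors g Q⊑G strong va)
      where
        take₄ : ∀ {p₁ p₂ r₁ r₂ s e₁ e₂ : Color} → Distinct (p₁ ∷ p₂ ∷ r₁ ∷ r₂ ∷ s ∷ e₁ ∷ e₂ ∷ []) → Distinct (p₁ ∷ p₂ ∷ r₁ ∷ r₂ ∷ [])
        take₄ ((a ∷ b ∷ c ∷ _) ∷ (d ∷ e ∷ _) ∷ (f ∷ _) ∷ _) = (a ∷ b ∷ c ∷ []) ∷ (d ∷ e ∷ []) ∷ (f ∷ []) ∷ [] ∷ []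
        from-side : (∃ λ p → ∃ λ q → Distinct (k a v₅ ∷ p ∷ q ∷ []) × (∀ {j} → j ≢ k a v₅ → All (j ≢_) (p ∷ q ∷ []) → Unused Q k v₅ j)) → Colorable G
        from-side (p , q , d , un) = from-colors (chainColors (take₄ Q₁.distinct) (take₄ Q₃.distinct) d)
          where
            from-colors : ∃ (ChainColors Q₁.p₁ Q₁.p₂ Q₁.r₁ Q₁.r₂ Q₃.p₁ Q₃.p₂ Q₃.r₁ Q₃.r₂ (k a v₅) p q) → Colorable G
            from-colors ((t₁ , t₂ , f , t₁′ , t₂′ , f′ , x , y , z) , off , off′ , dC@((_ ∷ _ ∷ xo ∷ _) ∷ (_ ∷ yo ∷ _) ∷ _) , X , Y , Z , Xs , Ys) = from-A (stepA off)
              where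
                from-A : AddPair B₁ u₁ u₂ u₃ k Q₁.s t₂ t₁ (k u₁ v₁) (k u₂ v₂) f → Colorable G
                from-A R = centre R (stepB R off′) (proj₁ (offer-distinct Q₁.distinct off)) (proj₁ (offer-distinct Q₃.distinct off′)) dC X Y Z (un xo Xs) (un yo Ys)

  chain : Colorable G
  chain = assemble (proj₂ coloured) (pendant (proj₂ coloured))

-- Reduction

module _ {n : ℕ} where

  private
    V = Fin n

  only₁? : ∀ (G : Graph n) v x → Dec (Only₁ G v x)
  only₁? G v x = _∼?_ G v x ×-dec Fin.all? λ w → _∼?_ G v w →-dec (w ≟ x)

  only₂? : ∀ (G : Graph n) v x y → Dec (Only₂ G v x y)
  only₂? G v x y = _∼?_ G v x ×-dec _∼?_ G v y ×-dec ¬? (x ≟ y) ×-dec Fin.all? λ w → _∼?_ G v w →-dec ((w ≟ x) ⊎-dec (w ≟ y))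

  triangle? : ∀ (G : Graph n) a b c → Dec (Triangle G a b c)
  triangle? G a b c = _∼?_ G a b ×-dec _∼?_ G a c ×-dec _∼?_ G b c

  disjoint? : ∀ (xs ys : List V) → Dec (Disjoint xs ys)
  disjoint? xs ys = all? (λ x → all? (λ y → ¬? (x ≟ y)) ys) xs

  private
    Ex₂ : (V → V → Set) → Set
    Ex₂ P = ∃ λ a → ∃ λ b → P a b
    Ex₃ : (V → V → V → Set) → Set
    Ex₃ P = ∃ λ a → Ex₂ (P a)
    Ex₄ : (V → V → V → V → Set) → Set
    Ex₄ P = ∃ λ a → Ex₃ (P a)
    Ex₆ : (V → V → V → V → V → V → Set) → Set
    Ex₆ P = Ex₃ λ a b c → Ex₃ (P a b c)
    Ex₉ : (V → V → V → V → V → V → V → V → V → Set) → Set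
    Ex₉ P = Ex₃ λ a b c → Ex₆ (P a b c)

    ex₂? : ∀ {P : V → V → Set} → (∀ a b → Dec (P a b)) → Dec (Ex₂ P)
    ex₂? P? = Fin.any? λ a → Fin.any? (P? a)
    ex₃? : ∀ {P : V → V → V → Set} → (∀ a b c → Dec (P a b c)) → Dec (Ex₃ P)
    ex₃? P? = Fin.any? λ a → ex₂? (P? a)
    ex₄? : ∀ {P : V → V → V → V → Set} → (∀ a b c d → Dec (P a b c d)) → Dec (Ex₄ P)
    ex₄? P? = Fin.any? λ a → ex₃? (P? a)
    ex₆? : ∀ {P : V → V → V → V → V → V → Set} → (∀ a b c d e f → Dec (P a b c d e f)) → Dec (Ex₆ P)
    ex₆? P? = ex₃? λ a b c → ex₃? (P? a b c)
    ex₉? : ∀ {P : V → V → V → V → V → V → V → V → V → Set} → (∀ a b c d e f g h i → Dec (P a b c d e f g h i)) → Dec (Ex₉ P)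
    ex₉? P? = ex₃? λ a b c → ex₆? (P? a b c)

  doubleLink? : ∀ (G : Graph n) a₁ b₁ c₁ a₂ b₂ c₂ → Dec (DoubleLink G a₁ b₁ c₁ a₂ b₂ c₂)
  doubleLink? G a₁ b₁ c₁ a₂ b₂ c₂ = triangle? G a₁ b₁ c₁ ×-dec triangle? G a₂ b₂ c₂ ×-dec _∼?_ G b₁ b₂ ×-dec _∼?_ G c₁ c₂ ×-dec disjoint? _ _

  diamond? : ∀ (G : Graph n) a b p q → Dec (Diamond G a b p q)
  diamond? G a b p q = (_∼?_ G p q ×-dec _∼?_ G a p ×-dec _∼?_ G a q) ×-dec _∼?_ G b p ×-dec _∼?_ G b q ×-dec ¬? (a ≟ b)

  tripleLink? : ∀ (G : Graph n) a₁ b₁ c₁ a₂ b₂ c₂ a₃ b₃ c₃ → Dec (TripleLink G a₁ b₁ c₁ a₂ b₂ c₂ a₃ b₃ c₃)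
  tripleLink? G a₁ b₁ c₁ a₂ b₂ c₂ a₃ b₃ c₃ = (triangle? G a₁ b₁ c₁ ×-dec triangle? G a₂ b₂ c₂ ×-dec triangle? G a₃ b₃ c₃) ×-dec
    (_∼?_ G b₁ b₂ ×-dec _∼?_ G c₁ b₃ ×-dec _∼?_ G c₂ c₃) ×-dec disjoint? _ _ ×-dec disjoint? _ _ ×-dec disjoint? _ _

  module _ {G : Graph n} (g : Good G) (below : Below G) where

    private
      chains : NoLeaf G → (∀ {v x y} → ¬ Only₂ G v x y) → NoDoubleLink G → NoDiamond G → NoTripleLink G → ∀ {b c a} → Triangle G b c a → Colorable G
      chains noLeaf noPath noDL noDiamond noTL t@(bc , ba , ca) =
        from (triangle-link g noLeaf noPath noDiamond t) (triangle-link g noLeaf noPath noDiamond (∼-sym G bc , ca , ba))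
          (triangle-link g noLeaf noPath noDiamond (∼-sym G ba , ∼-sym G ca , bc))
        where
          Link : V → V → V → Set
          Link v s t = ∃ λ x → G ∋ v ∼ x × NoCommon G v x × x ≢ s × x ≢ t × (∀ {w} → G ∋ v ∼ w → w ≡ s ⊎ w ≡ t ⊎ w ≡ x)
          from : Link _ _ _ → Link _ _ _ → Link _ _ _ → Colorable G
          from (u₃ , bu₃ , noneB , _ , _ , nbB) (w₃ , cw₃ , noneC , _ , _ , nbC) (v₅ , av₅ , noneA , v₅≢b , v₅≢c , nbA) =
            let (_ , _ , _ , _ , A) = arm g noLeaf noPath noDiamond noDL noTL bu₃ noneB
                (_ , _ , _ , _ , B) = arm g noLeaf noPath noDiamond noDL noTL cw₃ noneC
            in Chain.chain g below noLeaf noPath noDiamond noDL noTL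
              (record { tri = t ; nbB = nbB ; nbC = nbC ; nbA = nbA ; link = av₅ ; apart = noneA ; v₅≢b = v₅≢b ; v₅≢c = v₅≢c }) A B

      edges : NoLeaf G → (∀ {v x y} → ¬ Only₂ G v x y) → NoDoubleLink G → NoDiamond G → NoTripleLink G → Dec (Ex₂ λ v u → G ∋ v ∼ u) → Colorable G
      edges noLeaf noPath noDL noDiamond noTL (no none) = (λ _ _ → zero) , record
        { symm = λ _ _ → refl ; incident = λ ua → contradiction (_ , _ , ua) none ; joined = λ uv → contradiction (_ , _ , uv) none }
      edges noLeaf noPath noDL noDiamond noTL (yes (_ , _ , bu)) =
        chains noLeaf noPath noDL noDiamond noTL (proj₂ (proj₂ (triangle-at g noLeaf noPath noDiamond bu)))

      tripleLinks : NoLeaf G → NoFlatPath G → (∀ {v x y} → ¬ Only₂ G v x y) → NoDoubleLink G → NoDiamond G → Dec (Ex₉ (TripleLink G)) → Colorable G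
      tripleLinks noLeaf noFlat noPath noDL noDiamond (yes (_ , _ , _ , _ , _ , _ , _ , _ , _ , tl@(((ab₁ , ac₁ , bc₁) , (ab₂ , ac₂ , bc₂) , (ab₃ , ac₃ , bc₃)) , _))) =
        tripleLinked g below noDL tl (proj₂ (third g noFlat ab₁ ac₁ bc₁)) (proj₂ (third g noFlat ab₂ ac₂ bc₂)) (proj₂ (third g noFlat ab₃ ac₃ bc₃))
      tripleLinks noLeaf noFlat noPath noDL noDiamond (no none) =
        edges noLeaf noPath noDL noDiamond (λ tl → none (_ , _ , _ , _ , _ , _ , _ , _ , _ , tl)) (ex₂? (_∼?_ G))

      paths : NoLeaf G → NoFlatPath G → NoAdjacentPaths G → NoDoubleLink G → NoDiamond G → Dec (Ex₃ (Only₂ G)) → Colorable G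
      paths noLeaf noFlat noAdj noDL noDiamond (yes (_ , _ , _ , o)) = pathVertex g below noLeaf noFlat noAdj noDL noDiamond o
      paths noLeaf noFlat noAdj noDL noDiamond (no none) = tripleLinks noLeaf noFlat (λ o → none (_ , _ , _ , o)) noDL noDiamond (ex₉? (tripleLink? G))

      diamonds : NoLeaf G → NoFlatPath G → NoAdjacentPaths G → NoDoubleLink G → Dec (Ex₄ (Diamond G)) → Colorable G
      diamonds noLeaf noFlat noAdj noDL (yes (_ , _ , _ , _ , D)) = diamond g below noFlat noAdj noDL D
      diamonds noLeaf noFlat noAdj noDL (no none) = paths noLeaf noFlat noAdj noDL (λ D → none (_ , _ , _ , _ , D)) (ex₃? (only₂? G))

      doubleLinks : NoLeaf G → NoFlatPath G → NoAdjacentPaths G → Dec (Ex₆ (DoubleLink G)) → Colorable G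
      doubleLinks noLeaf noFlat noAdj (no none) = diamonds noLeaf noFlat noAdj (λ dl → none (_ , _ , _ , _ , _ , _ , dl)) (ex₄? (diamond? G))
      doubleLinks noLeaf noFlat noAdj (yes (_ , _ , _ , _ , _ , _ , dl@((ab₁ , ac₁ , bc₁) , (ab₂ , ac₂ , bc₂) , _ , _ , dis))) =
        let (_ , x₁ , x₂ , x₃ , x₄) = third g noFlat ab₁ ac₁ bc₁
            (_ , y₁ , y₂ , y₃ , y₄) = third g noFlat ab₂ ac₂ bc₂
        in doubleLinked g below dl x₁ x₂ x₃ x₄ y₁ y₂ y₃ y₄ dis

      adjacent : NoLeaf G → NoFlatPath G → Dec (Ex₄ λ v x y z → Only₂ G v x y × Only₂ G x v z) → Colorable G
      adjacent noLeaf noFlat (yes (_ , _ , _ , _ , o , o′)) = adjacentPaths g below o o′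
      adjacent noLeaf noFlat (no none) = doubleLinks noLeaf noFlat (λ o o′ → none (_ , _ , _ , _ , o , o′)) (ex₆? (doubleLink? G))

      flats : NoLeaf G → Dec (Ex₃ λ v x y → Only₂ G v x y × G ∋ x ∼ y) → Colorable G
      flats noLeaf (yes (_ , _ , _ , o , xy)) = flatPath g below o xy
      flats noLeaf (no none) = adjacent noLeaf (λ o xy → none (_ , _ , _ , o , xy)) (ex₄? λ v x y z → only₂? G v x y ×-dec only₂? G x v z)

      leaves : Dec (Ex₂ (Only₁ G)) → Colorable G
      leaves (yes (_ , _ , o)) = leaf g below o
      leaves (no none) = flats (λ o → none (_ , _ , o)) (ex₃? λ v x y → only₂? G v x y ×-dec _∼?_ G x y)

    -- Each test may assume that the earlier ones failed. Double links are handled before diamonds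
    -- and vertices of degree 2, because these reductions join vertices and `Good-join` needs a
    -- graph without double links, whereas the reduction of a double link only deletes.
    reduce : Colorable G
    reduce = leaves (ex₂? (only₁? G))

-- Simple graphs and the prism

lookup-injective : ∀ {A : Set} {xs : List A} → AllPairs _≢_ xs → ∀ i j → lookup xs i ≡ lookup xs j → i ≡ j
lookup-injective (_ ∷ _)  zero    zero    _ = refl
lookup-injective (h ∷ _)  zero    (suc j) e = contradiction e (All.lookup h (∈-lookup j))
lookup-injective (h ∷ _)  (suc i) zero    e = contradiction (≡-sym e) (All.lookup h (∈-lookup i))
lookup-injective (_ ∷ hs) (suc i) (suc j) e = cong suc (lookup-injective hs i j e)

-- In each row the last entry is the partner in the other triangle.
prismNbrs : Fin 6 → Fin 6 × Fin 6 × Fin 6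
prismNbrs = lookup ((# 1 , # 2 , # 3) ∷ (# 0 , # 2 , # 4) ∷ (# 0 , # 1 , # 5) ∷ (# 4 , # 5 , # 0) ∷ (# 3 , # 5 , # 1) ∷ (# 3 , # 4 , # 2) ∷ [])

prismNbrs-distinct : ∀ i → let (x , y , z) = prismNbrs i in x ≢ y × x ≢ z × y ≢ z
prismNbrs-distinct = toWitness {a? = Fin.all? λ i → let (x , y , z) = prismNbrs i in ¬? (x ≟ y) ×-dec ¬? (x ≟ z) ×-dec ¬? (y ≟ z)} _

Listed : Fin 6 → Fin 6 → Set
Listed i j = let (x , y , z) = prismNbrs i in j ≡ x ⊎ j ≡ y ⊎ j ≡ z

prismAdj⇔Listed : ∀ i j → (prismAdj i j ≡ true → Listed i j) × (Listed i j → prismAdj i j ≡ true)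
prismAdj⇔Listed = toWitness {a? = Fin.all? λ i → Fin.all? λ j → (adj? i j →-dec listed? i j) ×-dec (listed? i j →-dec adj? i j)} _
  where
    adj? : ∀ i j → Dec (prismAdj i j ≡ true)
    adj? i j = Bool._≟_ (prismAdj i j) true
    listed? : ∀ i j → Dec (Listed i j)
    listed? i j = let (x , y , z) = prismNbrs i in (j ≟ x) ⊎-dec (j ≟ y) ⊎-dec (j ≟ z)

module _ {n : ℕ} (S : SimpleGraph n) where

  private
    V = Fin n

  graph : Graph n
  graph = record
    { _∼_ = Adj S
    ; ∼-sym = λ {u} {v} uv → trans (SimpleGraph.sym S v u) uv
    ; ∼-irr = λ {v} vv → contradiction (trans (≡-sym vv) (irrefl S v)) λ ()
    ; _∼?_ = λ u v → Bool._≟_ (adj S u v) true }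

  private
    G = graph

  members : ∀ {m} (p : Fin m → Bool) → ∃ λ xs → length xs ≡ sumFin m (λ i → if p i then 1 else 0) × (∀ i → p i ≡ true → i ∈ xs)
  members {zero} p = [] , refl , λ ()
  members {suc m} p with members (p ∘ suc) | p zero in eq
  ... | xs , len , all | true = zero ∷ map suc xs , cong suc (trans (length-map suc xs) len) , λ where
        zero _ → here refl
        (suc i) h → there (∈-map⁺ suc (all i h))
  ... | xs , len , all | false = map suc xs , trans (length-map suc xs) len , λ where
        zero h → contradiction (trans (≡-sym eq) h) λ ()
        (suc i) h → ∈-map⁺ suc (all i h)

  module _ (deg : Subcubic S) where

    private
      subcubic′ : Subcubic′ G
      subcubic′ = cover-by λ v → let (xs , len , all) = members (adj S v) in three v xs (subst (_≤ 3) (≡-sym len) (deg v)) (all _)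
        where
          three : ∀ v xs → length xs ≤ 3 → (∀ {w} → Adj S v w → w ∈ xs) → ∃ λ x → ∃ λ y → ∃ λ z → ∀ {w} → Adj S v w → w ≡ x ⊎ w ≡ y ⊎ w ≡ z
          three v [] _ all = v , v , v , λ vw → contradiction (all vw) λ ()
          three v (x ∷ []) _ all = x , x , x , λ vw → case (all vw)
            where
              case : ∀ {w} → w ∈ (x ∷ []) → w ≡ x ⊎ w ≡ x ⊎ w ≡ x
              case (here e) = inj₁ e
          three v (x ∷ y ∷ []) _ all = x , y , y , λ vw → case (all vw)
            where
              case : ∀ {w} → w ∈ (x ∷ y ∷ []) → w ≡ x ⊎ w ≡ y ⊎ w ≡ y
              case (here e) = inj₁ e
              case (there (here e)) = inj₂ (inj₁ e)
          three v (x ∷ y ∷ z ∷ []) _ all = x , y , z , λ vw → case (all vw)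
            where
              case : ∀ {w} → w ∈ (x ∷ y ∷ z ∷ []) → w ≡ x ⊎ w ≡ y ⊎ w ≡ z
              case (here e) = inj₁ e
              case (there (here e)) = inj₂ (inj₁ e)
              case (there (there (here e))) = inj₂ (inj₂ e)
          three v (_ ∷ _ ∷ _ ∷ _ ∷ _) (s≤s (s≤s (s≤s ())))

    -- Each of the six vertices has three neighbours among the others. By the degree bound there are
    -- no more, so nothing else is reachable and no further pair is adjacent.
    prism-component : ∀ {a₁ b₁ c₁ a₂ b₂ c₂} → DoubleLink G a₁ b₁ c₁ a₂ b₂ c₂ → Adj S a₁ a₂ → ComponentIsPrism S a₁
    prism-component {a₁} {b₁} {c₁} {a₂} {b₂} {c₂} ((ab , ac , bc) , (ab′ , ac′ , bc′) , bb , cc ,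
      ((d00 ∷ d01 ∷ d02 ∷ []) ∷ (d10 ∷ d11 ∷ d12 ∷ []) ∷ (d20 ∷ d21 ∷ d22 ∷ []) ∷ [])) aa =
      f , lookup-injective distinct , closed , reach , edges
      where
        f : Fin 6 → V
        f = lookup (a₁ ∷ b₁ ∷ c₁ ∷ a₂ ∷ b₂ ∷ c₂ ∷ [])
        sy : ∀ {u v} → Adj S u v → Adj S v u
        sy = ∼-sym G
        distinct : AllPairs _≢_ (a₁ ∷ b₁ ∷ c₁ ∷ a₂ ∷ b₂ ∷ c₂ ∷ [])
        distinct = (∼⇒≢ G ab ∷ ∼⇒≢ G ac ∷ d00 ∷ d01 ∷ d02 ∷ []) ∷ (∼⇒≢ G bc ∷ d10 ∷ d11 ∷ d12 ∷ []) ∷ (d20 ∷ d21 ∷ d22 ∷ []) ∷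
          (∼⇒≢ G ab′ ∷ ∼⇒≢ G ac′ ∷ []) ∷ (∼⇒≢ G bc′ ∷ []) ∷ [] ∷ []
        inj : ∀ {i j} → f i ≡ f j → i ≡ j
        inj = lookup-injective distinct _ _
        link : ∀ i → let (x , y , z) = prismNbrs i in Adj S (f i) (f x) × Adj S (f i) (f y) × Adj S (f i) (f z)
        link zero                                = ab , ac , aa
        link (suc zero)                          = sy ab , bc , bb
        link (suc (suc zero))                    = sy ac , sy bc , cc
        link (suc (suc (suc zero)))              = ab′ , ac′ , sy aa
        link (suc (suc (suc (suc zero))))        = sy ab′ , bc′ , sy bb
        link (suc (suc (suc (suc (suc zero)))))  = sy ac′ , sy bc′ , sy cc
        nbrs : ∀ i {w} → Adj S (f i) w → let (x , y , z) = prismNbrs i in w ≡ f x ⊎ w ≡ f y ⊎ w ≡ f z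
        nbrs i = let (l₁ , l₂ , l₃) = link i ; (xy , xz , yz) = prismNbrs-distinct i in
          nbrs₃ subcubic′ l₁ l₂ l₃ (xy ∘ inj) (xz ∘ inj) (yz ∘ inj)
        closed : ∀ w → Reach S a₁ w → ∃ λ i → f i ≡ w
        closed _ here = zero , refl
        closed _ (step r wx) with closed _ r
        ... | i , refl with nbrs i wx
        ...   | inj₁ e = proj₁ (prismNbrs i) , ≡-sym e
        ...   | inj₂ (inj₁ e) = proj₁ (proj₂ (prismNbrs i)) , ≡-sym e
        ...   | inj₂ (inj₂ e) = proj₂ (proj₂ (prismNbrs i)) , ≡-sym e
        reach : ∀ i → Reach S a₁ (f i)
        reach zero = here
        reach (suc zero) = step here ab
        reach (suc (suc zero)) = step here ac
        reach (suc (suc (suc zero))) = step here aa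
        reach (suc (suc (suc (suc zero)))) = step (step here ab) bb
        reach (suc (suc (suc (suc (suc zero))))) = step (step here ac) cc
        listed : ∀ i j → Listed i j → Adj S (f i) (f j)
        listed i _ (inj₁ refl) = proj₁ (link i)
        listed i _ (inj₂ (inj₁ refl)) = proj₁ (proj₂ (link i))
        listed i _ (inj₂ (inj₂ refl)) = proj₂ (proj₂ (link i))
        edges : ∀ i j → adj S (f i) (f j) ≡ prismAdj i j
        edges i j with prismAdj i j in eq
        ... | true  = listed i j (proj₁ (prismAdj⇔Listed i j) eq)
        ... | false = ¬-not λ e → contradiction (trans (≡-sym eq) (proj₂ (prismAdj⇔Listed i j)
                        ([ inj₁ ∘ inj , [ inj₂ ∘ inj₁ ∘ inj , inj₂ ∘ inj₂ ∘ inj ]′ ]′ (nbrs i e)))) λ ()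

    good : ClawFree S → (∀ v → ¬ ComponentIsPrism S v) → Good G
    good claw prism = record
      { clawFree = clawFree′ ; subcubic = subcubic′ ; noPrism = λ dl aa → prism _ (prism-component dl aa) }
      where
        clawFree′ : ∀ {c x y z} → G ∋ c ∼ x → G ∋ c ∼ y → G ∋ c ∼ z → x ≢ y → x ≢ z → y ≢ z → G ∋ x ∼ y ⊎ G ∋ x ∼ z ⊎ G ∋ y ∼ z
        clawFree′ {c} {x} {y} {z} cx cy cz xy xz yz with _∼?_ G x y | _∼?_ G x z | _∼?_ G y z
        ... | yes e | _ | _ = inj₁ e
        ... | no _ | yes e | _ = inj₂ (inj₁ e)
        ... | no _ | no _ | yes e = inj₂ (inj₂ e)
        ... | no p | no q | no r = contradiction (cx , cy , cz , xy , xz , yz , p , q , r) (claw c x y z)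

  -- From colourings of vertex pairs to edge colourings

  module _ {κ : V → V → Color} (s : Strong G κ) where

    private
      φ : Edge S → Color
      φ e = κ (Edge.u e) (Edge.v e)

      record Rest′ (w : V) (e : Edge S) : Set where
        field
          o     : V
          wo    : Adj S w o
          color : φ e ≡ κ w o
          at-o  : Incident o e
          only  : ∀ {z} → Incident z e → z ≡ w ⊎ z ≡ o

      other : ∀ {w} (e : Edge S) → Incident w e → Rest′ w e
      other e (inj₁ refl) = record { o = Edge.v e ; wo = Edge.uv e ; color = refl ; at-o = inj₂ refl ; only = id }
      other e (inj₂ refl) = record { o = Edge.u e ; wo = ∼-sym G (Edge.uv e) ; color = symm s _ _ ; at-o = inj₁ refl ; only = [ inj₂ , inj₁ ]′ }

      -- An edge is stored with its smaller end in front, so two edges with the same ends cannot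
      -- list them in opposite orders.
      same-edge : ∀ {w o} (e e′ : Edge S) → w ≢ o → Incident w e → Incident o e → Incident w e′ → Incident o e′ → Edge.u e ≡ Edge.u e′ × Edge.v e ≡ Edge.v e′
      same-edge e e′ w≢o (inj₁ p) (inj₁ q) _ _ = contradiction (trans p (≡-sym q)) w≢o
      same-edge e e′ w≢o (inj₂ p) (inj₂ q) _ _ = contradiction (trans p (≡-sym q)) w≢o
      same-edge e e′ w≢o _ _ (inj₁ p) (inj₁ q) = contradiction (trans p (≡-sym q)) w≢o
      same-edge e e′ w≢o _ _ (inj₂ p) (inj₂ q) = contradiction (trans p (≡-sym q)) w≢o
      same-edge e e′ w≢o (inj₁ refl) (inj₂ refl) (inj₁ p) (inj₂ q) = p , q
      same-edge e e′ w≢o (inj₂ refl) (inj₁ refl) (inj₂ p) (inj₁ q) = q , p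
      same-edge e e′ w≢o (inj₁ refl) (inj₂ refl) (inj₂ p) (inj₁ q) = contradiction (Edge.u<v e) (ℕ.<-asym (subst₂ (λ a b → toℕ a < toℕ b) (≡-sym q) (≡-sym p) (Edge.u<v e′)))
      same-edge e e′ w≢o (inj₂ refl) (inj₁ refl) (inj₁ p) (inj₂ q) = contradiction (Edge.u<v e) (ℕ.<-asym (subst₂ (λ a b → toℕ a < toℕ b) (≡-sym p) (≡-sym q) (Edge.u<v e′)))

    strongEdgeColoring : StrongEdgeColoring S 7 φ
    strongEdgeColoring e e′ (inj₁ (distinct , w , we , we′)) eq =
      incident s E.wo F.wo (λ o≡o′ → distinct (same-edge e e′ (∼⇒≢ G E.wo) we E.at-o we′ (subst (λ z → Incident z e′) (≡-sym o≡o′) F.at-o)))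
        (trans (≡-sym E.color) (trans eq F.color))
      where
        module E = Rest′ (other e we)
        module F = Rest′ (other e′ we′)
    strongEdgeColoring e e′ (inj₂ (_ , apart , f , (_ , w , we , wf) , (_ , w′ , we′ , wf′))) eq =
      joined s ww′ E.wo F.wo (λ where refl → apart (w′ , E.at-o , we′)) (λ where refl → apart (w , we , F.at-o))
        (trans (≡-sym E.color) (trans eq F.color))
      where
        module E = Rest′ (other e we)
        module F = Rest′ (other e′ we′)
        module M = Rest′ (other f wf)
        ww′ : Adj S w w′
        ww′ with M.only wf′
        ... | inj₁ refl = contradiction (w , we , we′) apart
        ... | inj₂ refl = M.wo

theorem2 : (n : ℕ) (G : SimpleGraph n) → ClawFree G → Subcubic G →
    (∀ (v : Fin n) → ¬ ComponentIsPrism G v) →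
    StrongChromaticIndexAtMost G 7
theorem2 n G claw deg prism = _ , strongEdgeColoring G (proj₂ (colorable reduce (good G deg claw prism)))
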